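{- For every integer $k\ge 2$, \[ \min\{k,3\}\le \operatorname{bs}(k)\le g(k)+2. \]
   Context: All hypergraphs are finite. For a $k$-uniform hypergraph $G$ on $n$ vertices, its density is $p=e(G)/\binom{n}{k}$. For $k$-uniform hypergraphs $G,H$ on $n$ vertices with densities $p,q$, their relative discrepancy is \[ \operatorname{disc}(G,H)=\max\Big||E(G')\cap E(H')|-pq\binom{n}{k}\Big|, \] the maximum ranging over all pairs $G',H'$ with $G'\cong G$, $H'\cong H$ and $V(G')=V(H')$. For $k\ge 2$, $\operatorname{bs}(k)$ is the smallest integer $m\ge 2$ with the following property: for every $\gamma\in(0,1/2)$ there exist $c>0$ and $n_0$ such that for all $n\ge n_0$, any collection $G_1,\ldots,G_m$ of $k$-uniform hypergraphs on $n$ vertices, each with density in $(\gamma,1-\gamma)$, contains a pair $i\neq j$ with $\operatorname{disc}(G_i,G_j)\ge c\, n^{(k+1)/2}$. For an integer $k\ge 2$, $g(k)$ is the smallest integer $g\ge 0$ such that for each integer $m\in[2,k]$, the system of linear equations \[ \sum_{0\le i\le r}(-1)^i\binom{r}{i}\alpha_i=0\quad\text{for } r=m-g,\ldots,m, \] in the unknown vector $\vec\alpha=(\alpha_0,\ldots,\alpha_m)\in\{0,1\}^{m+1}$, has only the two solutions $(0,\ldots,0)$ and $(1,\ldots,1)$. -}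

module Defs where

open import Algebra.Properties.CommutativeMonoid.Sum using (sum)
open import Data.Bool using (Bool; true; _∧_)
open import Data.Fin using (Fin; toℕ; inject≤)
open import Data.Fin.Patterns using (0F; 1F)
open import Data.Fin.Permutation using (Permutation′; _⟨$⟩ˡ_)
open import Data.Fin.Subset using (Subset; ∣_∣; inside; outside)
open import Data.Integer using (ℤ; +_; 0ℤ; -1ℤ)
import Data.Integer as ℤ
import Data.Integer.Properties as ℤ
open import Data.List using (List; []; _∷_; [_]; _++_; map; length; filterᵇ)
open import Data.Nat using (ℕ; zero; suc; _+_; _^_; _≤_; s≤s)
open import Data.Nat.Combinatorics using (_C_)
open import Data.Product using (Σ-syntax; ∃-syntax; _×_)
open import Data.Rational using (ℚ; 0ℚ; ½; 1ℚ; _/_)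
import Data.Rational as ℚ
open import Data.Sum using (_⊎_)
open import Data.Vec using ([]; _∷_; lookup; tabulate)
open import Data.Vec.Functional using (Vector)
open import Relation.Binary.PropositionalEquality using (_≡_; _≢_)

IsLeast : (ℕ → Set) → ℕ → Set
IsLeast P m = P m × (∀ n → P n → m ≤ n)

ℕ→ℚ : ℕ → ℚ
ℕ→ℚ n = + n / 1

-- The vertex set is always Fin n; a subset is a hyperedge iff `edge` maps it
-- to true.
record Hypergraph (n k : ℕ) : Set where
  field
    edge    : Subset n → Bool
    uniform : ∀ e → edge e ≡ true → ∣ e ∣ ≡ k

open Hypergraph public

subsets : ∀ n → List (Subset n)
subsets zero    = [ [] ]
subsets (suc n) = map (outside ∷_) (subsets n) ++ map (inside ∷_) (subsets n)

module _ {n k : ℕ} where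

  edgeCount : Hypergraph n k → ℕ
  edgeCount G = length (filterᵇ (edge G) (subsets n))

  commonEdges : Hypergraph n k → Hypergraph n k → ℕ
  commonEdges G H = length (filterᵇ (λ e → edge G e ∧ edge H e) (subsets n))

  -- For n < k there are no k-subsets and the density is set to 0. This value
  -- never matters for bs(k), where n is taken sufficiently large.
  density : Hypergraph n k → ℚ
  density G with n C k
  ... | zero    = 0ℚ
  ... | N@(suc _) = + edgeCount G / N

  -- { π x ∣ x ∈ e }: a vertex y belongs to it iff π⁻¹ y belongs to e.
  image : Permutation′ n → Subset n → Subset n
  image π e = tabulate (λ y → lookup e (π ⟨$⟩ˡ y))

  _≅_ : Hypergraph n k → Hypergraph n k → Set
  G ≅ H = Σ[ π ∈ Permutation′ n ] ∀ e → edge H (image π e) ≡ edge G e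

  -- IsDisc G H d says that d = disc(G,H), i.e. that d is the maximum of
  -- ∣ ∣E(G′) ∩ E(H′)∣ − p q (n C k) ∣ over copies G′ of G and H′ of H on a
  -- common vertex set, which may be taken to be Fin n.
  IsDisc : Hypergraph n k → Hypergraph n k → ℚ → Set
  IsDisc G H d =
      (∃[ G′ ] ∃[ H′ ] G′ ≅ G × H′ ≅ H × d ≡ deviation G′ H′)
    × (∀ G′ H′ → G′ ≅ G → H′ ≅ H → deviation G′ H′ ℚ.≤ d)
    where
    deviation : Hypergraph n k → Hypergraph n k → ℚ
    deviation G′ H′ =
      ℚ.∣ ℕ→ℚ (commonEdges G′ H′)
          ℚ.- density G ℚ.* density H ℚ.* ℕ→ℚ (n C k) ∣

-- Letting γ and c range over ℚ rather than ℝ changes nothing: the statement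
-- for γ follows from that for any smaller positive γ, and c may be decreased.
-- As d ≥ 0, the inequality d ≥ c n^((k+1)/2) is expressed by squaring both
-- sides, n^((k+1)/2) being irrational in general.
HasDiscrepantPair : (k m : ℕ) → Set
HasDiscrepantPair k m =
  ∀ γ → 0ℚ ℚ.< γ → γ ℚ.< ½ →
  ∃[ c ] 0ℚ ℚ.< c × ∃[ n₀ ] ∀ n → n₀ ≤ n →
  (G : Fin m → Hypergraph n k) →
  (∀ i → γ ℚ.< density (G i) × density (G i) ℚ.< 1ℚ ℚ.- γ) →
  ∃[ i ] ∃[ j ] i ≢ j × ∃[ d ] IsDisc (G i) (G j) d
    × c ℚ.* c ℚ.* ℕ→ℚ (n ^ (k + 1)) ℚ.≤ d ℚ.* d

-- IsBs k b says that b = bs(k).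
IsBs : ℕ → ℕ → Set
IsBs k = IsLeast (λ m → 2 ≤ m × HasDiscrepantPair k m)

-- ∑_{0 ≤ i ≤ r} (-1)^i (r C i) αᵢ
alternatingSum : ∀ {m} → Vector (Fin 2) (suc m) → ∀ r → r ≤ m → ℤ
alternatingSum α r r≤m = sum ℤ.+-0-commutativeMonoid {suc r} λ i →
  -1ℤ ℤ.^ toℕ i ℤ.* + (r C toℕ i) ℤ.* + toℕ (α (inject≤ i (s≤s r≤m)))

-- The hypothesis m ≤ r + g is r ≥ m - g without truncated subtraction; when
-- m < g, the equations with r < 0 are empty sums and impose nothing.
-- "Only the two solutions" is read as "no solution besides these two": if
-- g ≥ m, the equation for r = 0 is α₀ = 0, which excludes (1,…,1) itself.
OnlyConstantSolutions : (k g : ℕ) → Set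
OnlyConstantSolutions k g =
  ∀ m → 2 ≤ m → m ≤ k → (α : Vector (Fin 2) (suc m)) →
  (∀ r → m ≤ r + g → (r≤m : r ≤ m) → alternatingSum α r r≤m ≡ 0ℤ) →
  (∀ i → α i ≡ 0F) ⊎ (∀ i → α i ≡ 1F)

-- IsG k g says that g = g(k).
IsG : ℕ → ℕ → Set
IsG k = IsLeast (OnlyConstantSolutions k)

{-# OPTIONS --safe #-}
module Submission where

-- Upper bound.  Apply alternating signs over r disjoint pairs of vertices to the
-- indicator of a hypergraph and average over the other k - r vertices; the mean
-- absolute value is its bias of order r.  If all biases of orders k - g, …, k were
-- tiny, all differences of order k - g would vanish on a random sample that is
-- complete on k of its parts and empty on k others.  By Ramsey's theorem membership
-- may be assumed to depend only on the numbers of vertices in the parts, and the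
-- definition of g(k) then forces it to be constant, a contradiction.  Hence two of
-- g + 2 hypergraphs have a large bias of the same order r.  Swapping the vertices of
-- each of r blocks of m disjoint pairs at random turns the intersection of two
-- random copies into a polynomial in signs.  A fixed signed measure extracts its
-- part linear in every block, whose coefficients are bounded below in mean square by
-- the biases, and Khinchine's inequality yields a discrepancy of order
-- n^(k-r) m^((r+1)/2), where m is of order n.
--
-- Lower bound.  Colour the vertices with k - 1 colours and let G consist of the
-- k-sets meeting every colour.  Exactly two vertices of such a set can be removed
-- without losing a colour, so G has degree k - 1 as a polynomial.  Pair up the
-- vertices.  On the sets without a pair, H is given by a product of signs, which is
-- orthogonal to all polynomials of degree k - 1.  On the O(n^(k-1)) sets with a pair,
-- signs are chosen that are nearly balanced against all (k-1)^n colourings, so that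
-- the discrepancy of G and H is O(n^(k/2)).

open import Axiom.ExcludedMiddle using (ExcludedMiddle)
open import Data.Bool as Bool using (Bool; true; false)
import Data.Bool.Properties as Bool
open import Data.Empty using (⊥; ⊥-elim)
open import Data.Fin as Fin using (Fin; zero; suc; toℕ; fromℕ<; _↑ˡ_; _↑ʳ_; combine)
open import Data.Fin.Permutation as Perm using (Permutation′; _⟨$⟩ʳ_; _⟨$⟩ˡ_; _∘ₚ_)
import Data.Fin.Properties as Fin
open import Data.Fin.Subset using (Subset)
import Data.Integer.Properties as ℤ
open import Data.Nat as ℕ using (ℕ; zero; suc; z≤n; s≤s)
import Data.Nat.Properties as ℕ
open import Data.Product using (Σ-syntax; _×_; _,_; ∃-syntax; proj₁; proj₂)
open import Data.Rational as ℚ using (ℚ; 0ℚ; 1ℚ; ½)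
import Data.Rational.Properties as ℚ
import Data.Rational.Unnormalised as ℚᵘ
import Data.Rational.Unnormalised.Properties as ℚᵘ
open import Data.Sum using (_⊎_; inj₁; inj₂)
open import Data.Unit using (⊤; tt)
open import Data.Vec as Vec using (Vec; []; _∷_)
import Data.Vec.Properties as Vec
open import Level using (0ℓ)
open import Relation.Binary.PropositionalEquality
open import Relation.Nullary using (¬_; Dec; yes; no; does)
open import Relation.Nullary.Decidable using (dec-true; dec-false)
open import Tactic.RingSolver using (solve-∀)

-- The exponent arises as follows. After division by n^k, the multilinear part attached to order r
-- has m^r coefficients of mean square at least a constant times n^(-2r). Greedy signs in one block
-- and random signs in the other r - 1 give it the size m · m^((r-1)/2) · n^(-r). For m of order n
-- the worst case is r = k, which meets n^((k+1)/2) exactly. Both hypergraphs must be biased in the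
-- same order because a coefficient is only bounded below by a product of two biases of that order;
-- hence one hypergraph more than there are orders k - g, ..., k. In the lower bound, twice the
-- indicator of G counts the vertices whose removal leaves a set meeting every colour, so double
-- counting yields the orthogonality. The free signs face exponentially many tests, and √(n^(k-1) ·
-- n) = n^(k/2) falls short of n^((k+1)/2) by √n. Random k-sets are replaced by k independent
-- vertices, which makes the measures products; repetitions cost O(1/n). All measures are finite
-- weighted lists over ℚ, so roots are avoided by squaring and by taking m to be a square, and
-- exponentials by polynomial inequalities.

-- Rational arithmetic, powers, and the natural numbers inside ℚ.

module Rationals where

 open import Defs using (ℕ→ℚ)
 open import Data.Integer as ℤ using (ℤ; +_; -[1+_])
 open import Data.Maybe using (Maybe; just; nothing)
 open import Data.Rational using (mkℚ; _+_; _*_; _-_; -_; _≤_; _<_; ∣_∣; _/_; toℚᵘ; nonNegative; positive; *≤*; *<*)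
 import Tactic.RingSolver.Core.AlmostCommutativeRing as ACR

 ringℚ : ACR.AlmostCommutativeRing 0ℓ 0ℓ
 ringℚ = ACR.fromCommutativeRing ℚ.+-*-commutativeRing isZero
   where
   isZero : ∀ x → Maybe (0ℚ ≡ x)
   isZero x with 0ℚ ℚ.≟ x
   ... | yes p = just p
   ... | no _ = nothing

 -- Most polynomial inequalities below go through this: the difference of the two sides is exhibited
 -- as a visibly nonnegative `e`, and the identity is left to the ring solver.
 ≤-by : ∀ {p q} e → 0ℚ ≤ e → q ≡ p + e → p ≤ q
 ≤-by {p} {q} e 0≤e eq =
   subst₂ _≤_ (ℚ.+-identityʳ p) (sym eq) (ℚ.+-monoʳ-≤ p 0≤e)

 0≤q-p : ∀ {p q} → p ≤ q → 0ℚ ≤ q - p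
 0≤q-p {p} {q} p≤q = subst (_≤ q - p) (ℚ.+-inverseʳ p) (ℚ.+-monoˡ-≤ (- p) p≤q)

 0<q-p : ∀ {p q} → p < q → 0ℚ < q - p
 0<q-p {p} {q} p<q = subst (_< q - p) (ℚ.+-inverseʳ p) (ℚ.+-monoˡ-< (- p) p<q)

 +-nonneg : ∀ {p q} → 0ℚ ≤ p → 0ℚ ≤ q → 0ℚ ≤ p + q
 +-nonneg = ℚ.+-mono-≤

 *-nonneg : ∀ {p q} → 0ℚ ≤ p → 0ℚ ≤ q → 0ℚ ≤ p * q
 *-nonneg {p} {q} 0≤p 0≤q = subst (_≤ p * q) (ℚ.*-zeroʳ p)
   (ℚ.*-monoˡ-≤-nonNeg p {{nonNegative 0≤p}} 0≤q)

 *-pos : ∀ {p q} → 0ℚ < p → 0ℚ < q → 0ℚ < p * q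
 *-pos {p} {q} 0<p 0<q = subst (_< p * q) (ℚ.*-zeroʳ p)
   (ℚ.*-monoʳ-<-pos p {{positive 0<p}} 0<q)

 *-monoˡ : ∀ r {p q} → 0ℚ ≤ r → p ≤ q → r * p ≤ r * q
 *-monoˡ r 0≤r = ℚ.*-monoˡ-≤-nonNeg r {{nonNegative 0≤r}}

 *-monoʳ : ∀ r {p q} → 0ℚ ≤ r → p ≤ q → p * r ≤ q * r
 *-monoʳ r 0≤r = ℚ.*-monoʳ-≤-nonNeg r {{nonNegative 0≤r}}

 *-mono : ∀ {p q r s} → 0ℚ ≤ r → 0ℚ ≤ q → p ≤ q → r ≤ s → p * r ≤ q * s
 *-mono 0≤r 0≤q p≤q r≤s = ℚ.≤-trans (*-monoʳ _ 0≤r p≤q) (*-monoˡ _ 0≤q r≤s)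

 *-cancelˡ : ∀ r {p q} → 0ℚ < r → r * p ≤ r * q → p ≤ q
 *-cancelˡ r 0<r = ℚ.*-cancelˡ-≤-pos r {{positive 0<r}}

 neg-mono : ∀ {p q} → p ≤ q → - q ≤ - p
 neg-mono = ℚ.neg-antimono-≤

 neg-neg : ∀ p → - (- p) ≡ p
 neg-neg = solve-∀ ringℚ

 square-nonneg : ∀ p → 0ℚ ≤ p * p
 square-nonneg p with ℚ.≤-total 0ℚ p
 ... | inj₁ 0≤p = *-nonneg 0≤p 0≤p
 ... | inj₂ p≤0 = subst (0ℚ ≤_) (neg*neg p) (*-nonneg (neg-mono p≤0) (neg-mono p≤0))
   where
   neg*neg : ∀ p → (- p) * (- p) ≡ p * p
   neg*neg = solve-∀ ringℚ

 p≤∣p∣ : ∀ p → p ≤ ∣ p ∣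
 p≤∣p∣ p with ℚ.≤-total 0ℚ p
 ... | inj₁ 0≤p = ℚ.≤-reflexive (sym (ℚ.0≤p⇒∣p∣≡p 0≤p))
 ... | inj₂ p≤0 = ℚ.≤-trans p≤0 (ℚ.0≤∣p∣ p)

 -p≤∣p∣ : ∀ p → - p ≤ ∣ p ∣
 -p≤∣p∣ p = subst (- p ≤_) (ℚ.∣-p∣≡∣p∣ p) (p≤∣p∣ (- p))

 ∣p∣≤ : ∀ {p q} → p ≤ q → - p ≤ q → ∣ p ∣ ≤ q
 ∣p∣≤ {p} p≤q -p≤q with ℚ.∣p∣≡p∨∣p∣≡-p p
 ... | inj₁ eq = subst (_≤ _) (sym eq) p≤q
 ... | inj₂ eq = subst (_≤ _) (sym eq) -p≤q

 ∣p∣²≡p² : ∀ p → ∣ p ∣ * ∣ p ∣ ≡ p * p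
 ∣p∣²≡p² p with ℚ.∣p∣≡p∨∣p∣≡-p p
 ... | inj₁ eq = cong₂ _*_ eq eq
 ... | inj₂ eq = trans (cong₂ _*_ eq eq) (lem p)
   where
   lem : ∀ p → (- p) * (- p) ≡ p * p
   lem = solve-∀ ringℚ

 ∣∣-mono-triangle : ∀ p q → ∣ p ∣ ≤ ∣ q ∣ + ∣ p - q ∣
 ∣∣-mono-triangle p q =
   subst (λ z → ∣ z ∣ ≤ ∣ q ∣ + ∣ p - q ∣) (lem p q) (ℚ.∣p+q∣≤∣p∣+∣q∣ q (p - q))
   where
   lem : ∀ p q → q + (p - q) ≡ p
   lem = solve-∀ ringℚ

 infixr 8 _^_
 _^_ : ℚ → ℕ → ℚ
 p ^ zero  = 1ℚ
 p ^ suc n = p * p ^ n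

 0≤1 : 0ℚ ≤ 1ℚ
 0≤1 = *≤* (ℤ.+≤+ ℕ.z≤n)

 0<1 : 0ℚ < 1ℚ
 0<1 = *<* (ℤ.+<+ (ℕ.s≤s ℕ.z≤n))

 ^-nonneg : ∀ {p} n → 0ℚ ≤ p → 0ℚ ≤ p ^ n
 ^-nonneg zero    0≤p = 0≤1
 ^-nonneg (suc n) 0≤p = *-nonneg 0≤p (^-nonneg n 0≤p)

 ^-pos : ∀ {p} n → 0ℚ < p → 0ℚ < p ^ n
 ^-pos zero    0<p = 0<1
 ^-pos (suc n) 0<p = *-pos 0<p (^-pos n 0<p)

 ^-mono : ∀ {p q} n → 0ℚ ≤ p → p ≤ q → p ^ n ≤ q ^ n
 ^-mono zero    0≤p p≤q = ℚ.≤-refl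
 ^-mono (suc n) 0≤p p≤q =
   *-mono (^-nonneg n 0≤p) (ℚ.≤-trans 0≤p p≤q) p≤q (^-mono n 0≤p p≤q)

 ^-≤1 : ∀ {p} n → 0ℚ ≤ p → p ≤ 1ℚ → p ^ n ≤ 1ℚ
 ^-≤1 zero    0≤p p≤1 = ℚ.≤-refl
 ^-≤1 (suc n) 0≤p p≤1 =
   ℚ.≤-trans (*-mono (^-nonneg n 0≤p) 0≤1 p≤1 (^-≤1 n 0≤p p≤1)) (ℚ.≤-reflexive (ℚ.*-identityˡ 1ℚ))

 ^-≥1 : ∀ {p} n → 1ℚ ≤ p → 1ℚ ≤ p ^ n
 ^-≥1 zero    1≤p = ℚ.≤-refl
 ^-≥1 {p} (suc n) 1≤p =
   subst (_≤ p * p ^ n) (ℚ.*-identityˡ 1ℚ) (*-mono 0≤1 (ℚ.≤-trans 0≤1 1≤p) 1≤p (^-≥1 n 1≤p))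

 ^-+ : ∀ p m n → p ^ (m ℕ.+ n) ≡ p ^ m * p ^ n
 ^-+ p zero    n = sym (ℚ.*-identityˡ _)
 ^-+ p (suc m) n = trans (cong (p *_) (^-+ p m n)) (sym (ℚ.*-assoc p _ _))

 ^-distrib-* : ∀ p q n → (p * q) ^ n ≡ p ^ n * q ^ n
 ^-distrib-* p q zero    = refl
 ^-distrib-* p q (suc n) = trans (cong (p * q *_) (^-distrib-* p q n)) (lem p q (p ^ n) (q ^ n))
   where
   lem : ∀ a b c d → a * b * (c * d) ≡ a * c * (b * d)
   lem = solve-∀ ringℚ

 ^-^ : ∀ p m n → (p ^ m) ^ n ≡ p ^ (n ℕ.* m)
 ^-^ p m zero    = refl
 ^-^ p m (suc n) = trans (cong (p ^ m *_) (^-^ p m n)) (sym (^-+ p m (n ℕ.* m)))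

 1^ : ∀ n → 1ℚ ^ n ≡ 1ℚ
 1^ zero    = refl
 1^ (suc n) = trans (ℚ.*-identityˡ _) (1^ n)

 -- Keeping ι opaque lets unification recover n from ι n.
 opaque
   ι : ℕ → ℚ
   ι = ℕ→ℚ

   ι≡ : ∀ n → ι n ≡ ℕ→ℚ n
   ι≡ n = refl

   ι-0 : ι 0 ≡ 0ℚ
   ι-0 = refl

   ι-1 : ι 1 ≡ 1ℚ
   ι-1 = refl

   toℚᵘ-ι : ∀ n → toℚᵘ (ι n) ℚᵘ.≃ ℚᵘ.mkℚᵘ (+ n) 0
   toℚᵘ-ι n = ℚ.toℚᵘ-fromℚᵘ (ℚᵘ.mkℚᵘ (+ n) 0)

   inv : ℕ → ℚ
   -- A default value, chosen so that `inv` is nonnegative everywhere.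
   inv zero    = 0ℚ
   inv (suc n) = + 1 / suc n

   inv-pos : ∀ n → 0ℚ < inv (suc n)
   inv-pos n = ℚ.positive⁻¹ _ {{ℚ.normalize-pos 1 (suc n)}}

   inv-nonneg : ∀ n → 0ℚ ≤ inv n
   inv-nonneg zero    = ℚ.≤-refl
   inv-nonneg (suc n) = ℚ.<⇒≤ (inv-pos n)

   ι*inv : ∀ n → ι (suc n) * inv (suc n) ≡ 1ℚ
   ι*inv n = ℚ.toℚᵘ-injective (ℚᵘ.≃-trans (ℚ.toℚᵘ-homo-* (ι (suc n)) (inv (suc n)))
     (ℚᵘ.≃-trans (ℚᵘ.*-cong (toℚᵘ-ι (suc n)) (ℚ.toℚᵘ-fromℚᵘ (ℚᵘ.mkℚᵘ (+ 1) n)))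
     (ℚᵘ.*≡* (trans (ℤ.*-identityʳ _) (trans (ℤ.*-identityʳ _) (sym
       (trans (ℤ.*-identityˡ _) (cong +_ (ℕ.+-identityʳ (suc n))))))))))

 ι-+ : ∀ m n → ι (m ℕ.+ n) ≡ ι m + ι n
 ι-+ m n = ℚ.toℚᵘ-injective (ℚᵘ.≃-trans (toℚᵘ-ι (m ℕ.+ n)) (ℚᵘ.≃-sym
   (ℚᵘ.≃-trans (ℚ.toℚᵘ-homo-+ (ι m) (ι n))
   (ℚᵘ.≃-trans (ℚᵘ.+-cong (toℚᵘ-ι m) (toℚᵘ-ι n))
   (ℚᵘ.*≡* (cong (ℤ._* ℤ.1ℤ) (cong₂ ℤ._+_ (ℤ.*-identityʳ (+ m)) (ℤ.*-identityʳ (+ n)))))))))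

 ι-* : ∀ m n → ι (m ℕ.* n) ≡ ι m * ι n
 ι-* m n = ℚ.toℚᵘ-injective (ℚᵘ.≃-trans (toℚᵘ-ι (m ℕ.* n)) (ℚᵘ.≃-sym
   (ℚᵘ.≃-trans (ℚ.toℚᵘ-homo-* (ι m) (ι n))
   (ℚᵘ.≃-trans (ℚᵘ.*-cong (toℚᵘ-ι m) (toℚᵘ-ι n))
   (ℚᵘ.*≡* (cong (ℤ._* ℤ.1ℤ) (sym (ℤ.pos-* m n))))))))

 ι-suc : ∀ n → ι (suc n) ≡ 1ℚ + ι n
 ι-suc n = trans (ι-+ 1 n) (cong (_+ ι n) ι-1)

 ι-^ : ∀ m n → ι (m ℕ.^ n) ≡ ι m ^ n
 ι-^ m zero    = ι-1
 ι-^ m (suc n) = trans (ι-* m (m ℕ.^ n)) (cong (ι m *_) (ι-^ m n))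

 ι-nonneg : ∀ n → 0ℚ ≤ ι n
 ι-nonneg zero    = ℚ.≤-reflexive (sym ι-0)
 ι-nonneg (suc n) = subst (0ℚ ≤_) (sym (ι-suc n)) (+-nonneg 0≤1 (ι-nonneg n))

 ι-mono : ∀ {m n} → m ℕ.≤ n → ι m ≤ ι n
 ι-mono {m} {n} m≤n = ≤-by (ι (n ℕ.∸ m)) (ι-nonneg _)
   (trans (cong ι (sym (ℕ.m+[n∸m]≡n m≤n))) (ι-+ m (n ℕ.∸ m)))

 ι-pos : ∀ n → 0ℚ < ι (suc n)
 ι-pos n = ℚ.<-≤-trans 0<1 (subst (_≤ ι (suc n)) ι-1 (ι-mono (ℕ.s≤s ℕ.z≤n)))

 ι-cancel-≤ : ∀ {m n} → ι m ≤ ι n → m ℕ.≤ n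
 ι-cancel-≤ {m} {n} h with m ℕ.≤? n
 ... | yes m≤n = m≤n
 ... | no m≰n = ⊥-elim (ℚ.<-irrefl refl (ℚ.<-≤-trans (ℚ.<-≤-trans step (ι-mono (ℕ.≰⇒> m≰n))) h))
   where
   step : ι n < ι (suc n)
   step = subst₂ _<_ (ℚ.+-identityˡ (ι n)) (sym (ι-suc n)) (ℚ.+-monoˡ-< (ι n) 0<1)

 archimedean : ∀ q → ∃[ n ] q ≤ ι n
 archimedean q@(mkℚ (+ m) d _) = m , ℚ.toℚᵘ-cancel-≤ (ℚᵘ.≤-respʳ-≃ (ℚᵘ.≃-sym (toℚᵘ-ι m))
   (ℚᵘ.*≤* (subst₂ ℤ._≤_ (ℤ.pos-* m 1) (ℤ.pos-* m (suc d))
     (ℤ.+≤+ (ℕ.*-monoʳ-≤ m (ℕ.s≤s ℕ.z≤n))))))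
 archimedean q@(mkℚ (-[1+ m ]) d _) = 0 , subst (q ≤_) (sym ι-0) (ℚ.<⇒≤ (ℚ.negative⁻¹ q))

 archimedean-inv : ∀ {q} → 0ℚ < q → ∃[ n ] inv (suc n) ≤ q
 archimedean-inv {q} 0<q with archimedean ((ℚ.1/ q) {{ℚ.>-nonZero 0<q}})
 ... | n , h = n , *-cancelˡ (ι (suc n)) (ι-pos n) (subst (_≤ ι (suc n) * q) (sym (ι*inv n))
     (subst (_≤ ι (suc n) * q) (ℚ.*-inverseˡ q {{ℚ.>-nonZero 0<q}})
       (*-monoʳ q (ℚ.<⇒≤ 0<q) (ℚ.≤-trans h (ι-mono (ℕ.n≤1+n n))))))

 -- The value 0 at 0 makes `sgn` odd, which is needed when a permutation changes the sign of a mean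
 -- difference that may vanish.
 sgn : ℚ → ℚ
 sgn p with ℚ.≤-total 0ℚ p
 ... | inj₁ _ with p ℚ.≟ 0ℚ
 ...   | yes _ = 0ℚ
 ...   | no _  = 1ℚ
 sgn p | inj₂ _ with p ℚ.≟ 0ℚ
 ...   | yes _ = 0ℚ
 ...   | no _  = - 1ℚ

 sgn-* : ∀ p → sgn p * p ≡ ∣ p ∣
 sgn-* p with ℚ.≤-total 0ℚ p
 ... | inj₁ 0≤p with p ℚ.≟ 0ℚ
 ...   | yes refl = refl
 ...   | no _  = trans (ℚ.*-identityˡ p) (sym (ℚ.0≤p⇒∣p∣≡p 0≤p))
 sgn-* p | inj₂ p≤0 with p ℚ.≟ 0ℚ
 ...   | yes refl = refl
 ...   | no _  = trans (lem p) (trans (sym (ℚ.0≤p⇒∣p∣≡p (neg-mono p≤0))) (ℚ.∣-p∣≡∣p∣ p))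
   where
   lem : ∀ p → (- 1ℚ) * p ≡ - p
   lem = solve-∀ ringℚ

 sgn²≤1 : ∀ p → sgn p * sgn p ≤ 1ℚ
 sgn²≤1 p with ℚ.≤-total 0ℚ p
 ... | inj₁ _ with p ℚ.≟ 0ℚ
 ...   | yes _ = 0≤1
 ...   | no _  = ℚ.≤-refl
 sgn²≤1 p | inj₂ _ with p ℚ.≟ 0ℚ
 ...   | yes _ = 0≤1
 ...   | no _  = ℚ.≤-refl

 sgn-neg : ∀ p → sgn (- p) ≡ - sgn p
 sgn-neg p with ℚ.≤-total 0ℚ p | ℚ.≤-total 0ℚ (- p)
 ... | inj₁ 0≤p | inj₁ 0≤-p with p ℚ.≟ 0ℚ | (- p) ℚ.≟ 0ℚ
 ...   | yes _ | yes _ = refl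
 ...   | yes refl | no ne = ⊥-elim (ne refl)
 ...   | no ne | _ = ⊥-elim (ne (ℚ.≤-antisym (subst (_≤ 0ℚ) (neg-neg p) (neg-mono 0≤-p)) 0≤p))
 sgn-neg p | inj₁ 0≤p | inj₂ -p≤0 with p ℚ.≟ 0ℚ | (- p) ℚ.≟ 0ℚ
 ...   | yes _ | yes _ = refl
 ...   | no _  | no _  = refl
 ...   | yes refl | no ne = ⊥-elim (ne refl)
 ...   | no ne | yes e = ⊥-elim (ne (trans (sym (neg-neg p)) (cong -_ e)))
 sgn-neg p | inj₂ p≤0 | inj₁ 0≤-p with p ℚ.≟ 0ℚ | (- p) ℚ.≟ 0ℚ
 ...   | yes _ | yes _ = refl
 ...   | no _  | no _  = refl
 ...   | yes refl | no ne = ⊥-elim (ne refl)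
 ...   | no ne | yes e = ⊥-elim (ne (trans (sym (neg-neg p)) (cong -_ e)))
 sgn-neg p | inj₂ p≤0 | inj₂ -p≤0 with p ℚ.≟ 0ℚ | (- p) ℚ.≟ 0ℚ
 ...   | yes _ | yes _ = refl
 ...   | yes refl | no ne = ⊥-elim (ne refl)
 ...   | no ne | _ = ⊥-elim (ne (ℚ.≤-antisym p≤0 (subst (0ℚ ≤_) (neg-neg p) (neg-mono -p≤0))))

-- Finitely supported signed measures, probabilities and product measures.

module Measures where

 open Rationals
 open import Data.List using (List; []; _∷_; _++_; map)
 open import Data.Rational using (_+_; _*_; _-_; -_; _≤_; ∣_∣)
 open import Algebra.Properties.CommutativeMonoid.Sum ℚ.+-0-commutativeMonoid using () renaming (sum to Σᶠ; sum-permute to Σᶠ-permute)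
 open import Data.Vec using (_[_]≔_)

 private
   variable
     A B : Set

 -- A finitely supported signed measure, as a list of weighted atoms.
 Measure : Set → Set
 Measure A = List (ℚ × A)

 ∫ : Measure A → (A → ℚ) → ℚ
 ∫ []            F = 0ℚ
 ∫ ((w , a) ∷ L) F = w * F a + ∫ L F

 dirac : A → Measure A
 dirac a = (1ℚ , a) ∷ []

 scale : ℚ → Measure A → Measure A
 scale c = map (λ (w , a) → c * w , a)

 push : (A → B) → Measure A → Measure B
 push f = map (λ (w , a) → w , f a)

 infixl 1 _⟫=_
 _⟫=_ : Measure A → (A → Measure B) → Measure B
 []            ⟫= f = []
 ((w , a) ∷ L) ⟫= f = scale w (f a) ++ (L ⟫= f)

 ∫-cong : ∀ (L : Measure A) {F G} → (∀ a → F a ≡ G a) → ∫ L F ≡ ∫ L G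
 ∫-cong []            h = refl
 ∫-cong ((w , a) ∷ L) h = cong₂ _+_ (cong (w *_) (h a)) (∫-cong L h)

 ∫-+ : ∀ (L : Measure A) F G → ∫ L (λ a → F a + G a) ≡ ∫ L F + ∫ L G
 ∫-+ []            F G = refl
 ∫-+ ((w , a) ∷ L) F G = trans (cong (w * (F a + G a) +_) (∫-+ L F G)) (lem w (F a) (G a) _ _)
   where
   lem : ∀ w f g x y → w * (f + g) + (x + y) ≡ w * f + x + (w * g + y)
   lem = solve-∀ ringℚ

 ∫-*ˡ : ∀ (L : Measure A) c F → ∫ L (λ a → c * F a) ≡ c * ∫ L F
 ∫-*ˡ []            c F = sym (ℚ.*-zeroʳ c)
 ∫-*ˡ ((w , a) ∷ L) c F = trans (cong (w * (c * F a) +_) (∫-*ˡ L c F)) (lem w c (F a) _)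
   where
   lem : ∀ w c f x → w * (c * f) + c * x ≡ c * (w * f + x)
   lem = solve-∀ ringℚ

 ∫-*ʳ : ∀ (L : Measure A) c F → ∫ L (λ a → F a * c) ≡ ∫ L F * c
 ∫-*ʳ L c F = trans (∫-cong L (λ a → ℚ.*-comm (F a) c)) (trans (∫-*ˡ L c F) (ℚ.*-comm c _))

 ∫-0 : ∀ (L : Measure A) → ∫ L (λ _ → 0ℚ) ≡ 0ℚ
 ∫-0 L = trans (∫-*ˡ L 0ℚ (λ _ → 0ℚ)) (ℚ.*-zeroˡ (∫ L (λ _ → 0ℚ)))

 ∫-≡0 : ∀ (L : Measure A) {F} → (∀ a → F a ≡ 0ℚ) → ∫ L F ≡ 0ℚ
 ∫-≡0 L h = trans (∫-cong L h) (∫-0 L)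

 ∫-neg : ∀ (L : Measure A) F → ∫ L (λ a → - F a) ≡ - ∫ L F
 ∫-neg L F = trans (∫-cong L (λ a → lem (F a))) (trans (∫-*ˡ L (- 1ℚ) F) (sym (lem (∫ L F))))
   where
   lem : ∀ x → - x ≡ (- 1ℚ) * x
   lem = solve-∀ ringℚ

 ∫-- : ∀ (L : Measure A) F G → ∫ L (λ a → F a - G a) ≡ ∫ L F - ∫ L G
 ∫-- L F G = trans (∫-+ L F (λ a → - G a)) (cong (∫ L F +_) (∫-neg L G))

 ∫-swap : ∀ (L : Measure A) (M : Measure B) (F : A → B → ℚ) →
   ∫ L (λ a → ∫ M (λ b → F a b)) ≡ ∫ M (λ b → ∫ L (λ a → F a b))
 ∫-swap []            M F = sym (∫-0 M)
 ∫-swap ((w , a) ∷ L) M F = trans (cong (w * ∫ M (F a) +_) (∫-swap L M F))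
   (trans (cong (_+ _) (sym (∫-*ˡ M w (F a)))) (sym (∫-+ M (λ b → w * F a b) (λ b → ∫ L (λ a → F a b)))))

 ∫-++ : ∀ (L M : Measure A) F → ∫ (L ++ M) F ≡ ∫ L F + ∫ M F
 ∫-++ []            M F = sym (ℚ.+-identityˡ _)
 ∫-++ ((w , a) ∷ L) M F = trans (cong (w * F a +_) (∫-++ L M F)) (sym (ℚ.+-assoc (w * F a) _ _))

 ∫-scale : ∀ c (L : Measure A) F → ∫ (scale c L) F ≡ c * ∫ L F
 ∫-scale c []            F = sym (ℚ.*-zeroʳ c)
 ∫-scale c ((w , a) ∷ L) F = trans (cong (c * w * F a +_) (∫-scale c L F)) (lem c w (F a) _)
   where
   lem : ∀ c w f x → c * w * f + c * x ≡ c * (w * f + x)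
   lem = solve-∀ ringℚ

 ∫-push : ∀ (f : A → B) L F → ∫ (push f L) F ≡ ∫ L (λ a → F (f a))
 ∫-push f []            F = refl
 ∫-push f ((w , a) ∷ L) F = cong (w * F (f a) +_) (∫-push f L F)

 ∫-bind : ∀ (L : Measure A) (f : A → Measure B) F → ∫ (L ⟫= f) F ≡ ∫ L (λ a → ∫ (f a) F)
 ∫-bind []            f F = refl
 ∫-bind ((w , a) ∷ L) f F = trans (∫-++ (scale w (f a)) (L ⟫= f) F)
   (cong₂ _+_ (∫-scale w (f a) F) (∫-bind L f F))

 ∫-dirac : ∀ (a : A) F → ∫ (dirac a) F ≡ F a
 ∫-dirac a F = trans (ℚ.+-identityʳ _) (ℚ.*-identityˡ _)

 norm : Measure A → ℚ
 norm []            = 0ℚ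
 norm ((w , a) ∷ L) = ∣ w ∣ + norm L

 ∫-bounded : ∀ (L : Measure A) F D → (∀ a → ∣ F a ∣ ≤ D) → ∣ ∫ L F ∣ ≤ norm L * D
 ∫-bounded []            F D h = ℚ.≤-reflexive (sym (ℚ.*-zeroˡ D))
 ∫-bounded ((w , a) ∷ L) F D h = begin
   ∣ w * F a + ∫ L F ∣        ≤⟨ ℚ.∣p+q∣≤∣p∣+∣q∣ (w * F a) (∫ L F) ⟩
   ∣ w * F a ∣ + ∣ ∫ L F ∣    ≡⟨ cong (_+ _) (ℚ.∣p*q∣≡∣p∣*∣q∣ w (F a)) ⟩
   ∣ w ∣ * ∣ F a ∣ + ∣ ∫ L F ∣ ≤⟨ ℚ.+-mono-≤ (*-monoˡ ∣ w ∣ (ℚ.0≤∣p∣ w) (h a)) (∫-bounded L F D h) ⟩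
   ∣ w ∣ * D + norm L * D     ≡⟨ sym (ℚ.*-distribʳ-+ D ∣ w ∣ (norm L)) ⟩
   (∣ w ∣ + norm L) * D       ∎
   where open ℚ.≤-Reasoning

 -- Positivity is recorded as monotonicity of the integral, not as a condition on the weights, so
 -- that it passes through `push`, `⟫=` and `power` without inspecting the list.
 record Probability (L : Measure A) : Set where
   field
     mono  : ∀ F G → (∀ a → F a ≤ G a) → ∫ L F ≤ ∫ L G
     total : ∫ L (λ _ → 1ℚ) ≡ 1ℚ

   const : ∀ c → ∫ L (λ _ → c) ≡ c
   const c = trans (∫-cong L (λ _ → sym (ℚ.*-identityʳ c)))
     (trans (∫-*ˡ L c (λ _ → 1ℚ)) (trans (cong (c *_) total) (ℚ.*-identityʳ c)))

   +-const : ∀ F c → ∫ L (λ a → F a + c) ≡ ∫ L F + c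
   +-const F c = trans (∫-+ L F (λ _ → c)) (cong (∫ L F +_) (const c))

   const-+ : ∀ c F → ∫ L (λ a → c + F a) ≡ c + ∫ L F
   const-+ c F = trans (∫-+ L (λ _ → c) F) (cong (_+ ∫ L F) (const c))

   nonneg : ∀ F → (∀ a → 0ℚ ≤ F a) → 0ℚ ≤ ∫ L F
   nonneg F h = subst (_≤ ∫ L F) (∫-0 L) (mono (λ _ → 0ℚ) F h)

   ≤-const : ∀ {F} c → (∀ a → F a ≤ c) → ∫ L F ≤ c
   ≤-const {F} c h = subst (∫ L F ≤_) (const c) (mono F (λ _ → c) h)

   const-≤ : ∀ {F} c → (∀ a → c ≤ F a) → c ≤ ∫ L F
   const-≤ {F} c h = subst (_≤ ∫ L F) (const c) (mono (λ _ → c) F h)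

   ∣∣-≤ : ∀ F → ∣ ∫ L F ∣ ≤ ∫ L (λ a → ∣ F a ∣)
   ∣∣-≤ F = ∣p∣≤ (mono _ _ (λ a → p≤∣p∣ (F a)))
     (subst (_≤ ∫ L (λ a → ∣ F a ∣)) (∫-neg L F) (mono _ _ (λ a → -p≤∣p∣ (F a))))

   -- Jensen's inequality for t ↦ tᵘ, from the tangent line at the mean.
   jensen : ∀ F → (∀ a → 0ℚ ≤ F a) → ∀ u → ∫ L F ^ u ≤ ∫ L (λ a → F a ^ u)
   jensen F F≥0 zero    = ℚ.≤-reflexive (sym total)
   jensen F F≥0 (suc u) = subst (_≤ ∫ L (λ a → F a ^ suc u)) integral
       (mono _ _ (λ a → tangent u (F a) (F≥0 a)))
     where
     m = ∫ L F
     m≥0 = nonneg F F≥0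
     tangent : ∀ u x → 0ℚ ≤ x → m ^ suc u + ι (suc u) * m ^ u * (x - m) ≤ x ^ suc u
     tangent zero x x≥0 = ℚ.≤-reflexive
       (trans (cong (λ z → m * 1ℚ + z * 1ℚ * (x - m)) ι-1) (lem m x))
       where
       lem : ∀ m x → m * 1ℚ + 1ℚ * 1ℚ * (x - m) ≡ x * 1ℚ
       lem = solve-∀ ringℚ
     -- The previous inequality is multiplied by x; what remains is a nonnegative multiple of (x -
     -- m)².
     tangent (suc u) x x≥0 = ℚ.≤-trans
       (≤-by (ι (suc u) * m ^ u * ((x - m) * (x - m)))
         (*-nonneg (*-nonneg (ι-nonneg (suc u)) (^-nonneg u m≥0)) (square-nonneg (x - m)))
         (trans (lem m (m ^ u) (ι (suc u)) x)
           (cong (λ z → m * (m * m ^ u) + z * (m * m ^ u) * (x - m) + ι (suc u) * m ^ u * ((x - m) * (x - m))) (sym (ι-suc (suc u))))))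
       (*-monoˡ x x≥0 (tangent u x x≥0))
       where
       lem : ∀ m p c x → x * (m * p + c * p * (x - m)) ≡
         m * (m * p) + (1ℚ + c) * (m * p) * (x - m) + c * p * ((x - m) * (x - m))
       lem = solve-∀ ringℚ
     integral : ∫ L (λ a → m ^ suc u + ι (suc u) * m ^ u * (F a - m)) ≡ m ^ suc u
     integral = trans (∫-+ L _ _) (trans (cong₂ _+_ (const (m ^ suc u))
       (trans (∫-*ˡ L (ι (suc u) * m ^ u) _) (cong (ι (suc u) * m ^ u *_)
         (trans (∫-- L F (λ _ → m)) (trans (cong (λ z → m - z) (const m)) (ℚ.+-inverseʳ m))))))
       (lem (m ^ suc u) (ι (suc u) * m ^ u)))
       where
       lem : ∀ a b → a + b * 0ℚ ≡ a
       lem = solve-∀ ringℚ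

 open Probability

 dirac-prob : ∀ (a : A) → Probability (dirac a)
 dirac-prob a .mono F G h = subst₂ _≤_ (sym (∫-dirac a F)) (sym (∫-dirac a G)) (h a)
 dirac-prob a .total      = ∫-dirac a (λ _ → 1ℚ)

 push-prob : ∀ (f : A → B) {L} → Probability L → Probability (push f L)
 push-prob f {L} P .mono F G h =
   subst₂ _≤_ (sym (∫-push f L F)) (sym (∫-push f L G)) (mono P _ _ (λ a → h (f a)))
 push-prob f {L} P .total = trans (∫-push f L _) (total P)

 bind-prob : ∀ {L : Measure A} {f : A → Measure B} →
   Probability L → (∀ a → Probability (f a)) → Probability (L ⟫= f)
 bind-prob {L = L} {f} P Q .mono F G h =
   subst₂ _≤_ (sym (∫-bind L f F)) (sym (∫-bind L f G)) (mono P _ _ (λ a → mono (Q a) F G h))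
 bind-prob {L = L} {f} P Q .total =
   trans (∫-bind L f _) (trans (∫-cong L (λ a → total (Q a))) (total P))

 sum : ∀ {n} → (Fin n → ℚ) → ℚ
 sum {zero}  F = 0ℚ
 sum {suc n} F = F zero + sum (λ i → F (suc i))

 sum≡Σᶠ : ∀ {n} (F : Fin n → ℚ) → sum F ≡ Σᶠ F
 sum≡Σᶠ {zero}  F = refl
 sum≡Σᶠ {suc n} F = cong (F zero +_) (sum≡Σᶠ (λ i → F (suc i)))

 sum-permute : ∀ {n} (F : Fin n → ℚ) (π : Permutation′ n) → sum F ≡ sum (λ i → F (π ⟨$⟩ʳ i))
 sum-permute F π = trans (sum≡Σᶠ F) (trans (Σᶠ-permute F π) (sym (sum≡Σᶠ (λ i → F (π ⟨$⟩ʳ i)))))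

 weighted : ℚ → ∀ n → Measure (Fin n)
 weighted w zero    = []
 weighted w (suc n) = (w , zero) ∷ push suc (weighted w n)

 ∫-weighted : ∀ w n F → ∫ (weighted w n) F ≡ w * sum F
 ∫-weighted w zero    F = sym (ℚ.*-zeroʳ w)
 ∫-weighted w (suc n) F = trans (cong (w * F zero +_)
   (trans (∫-push suc (weighted w n) F) (∫-weighted w n (λ i → F (suc i)))))
   (sym (ℚ.*-distribˡ-+ w (F zero) _))

 sum-mono : ∀ {n} (F G : Fin n → ℚ) → (∀ i → F i ≤ G i) → sum F ≤ sum G
 sum-mono {zero}  F G h = ℚ.≤-refl
 sum-mono {suc n} F G h = ℚ.+-mono-≤ (h zero) (sum-mono _ _ (λ i → h (suc i)))

 sum-nonneg : ∀ {n} (F : Fin n → ℚ) → (∀ i → 0ℚ ≤ F i) → 0ℚ ≤ sum F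
 sum-nonneg {zero}  F h = ℚ.≤-refl
 sum-nonneg {suc n} F h = +-nonneg (h zero) (sum-nonneg _ (λ i → h (suc i)))

 sum-point : ∀ {n} (F : Fin n → ℚ) → (∀ i → 0ℚ ≤ F i) → ∀ i → F i ≤ sum F
 sum-point {suc n} F h zero    = ≤-by _ (sum-nonneg (λ i → F (suc i)) (λ i → h (suc i))) refl
 sum-point {suc n} F h (suc i) = ℚ.≤-trans (sum-point (λ i → F (suc i)) (λ i → h (suc i)) i)
   (≤-by (F zero) (h zero) (ℚ.+-comm (F zero) _))

 sum-1 : ∀ n → sum {n} (λ _ → 1ℚ) ≡ ι n
 sum-1 zero    = sym ι-0
 sum-1 (suc n) = trans (cong (1ℚ +_) (sum-1 n)) (sym (ι-suc n))

 sum-const : ∀ n c → sum {n} (λ _ → c) ≡ ι n * c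
 sum-const zero    c = sym (trans (cong (_* c) ι-0) (ℚ.*-zeroˡ c))
 sum-const (suc n) c = trans (cong (c +_) (sum-const n c))
   (trans (lem c (ι n)) (cong (_* c) (sym (ι-suc n))))
   where
   lem : ∀ c x → c + x * c ≡ (1ℚ + x) * c
   lem = solve-∀ ringℚ

 sum-cong : ∀ {n} {F G : Fin n → ℚ} → (∀ i → F i ≡ G i) → sum F ≡ sum G
 sum-cong {zero}  h = refl
 sum-cong {suc n} h = cong₂ _+_ (h zero) (sum-cong (λ i → h (suc i)))

 ∫-sum : ∀ (L : Measure A) {n} (F : Fin n → A → ℚ) →
   ∫ L (λ a → sum (λ i → F i a)) ≡ sum (λ i → ∫ L (F i))
 ∫-sum L {zero}  F = ∫-0 L
 ∫-sum L {suc n} F = trans (∫-+ L (F zero) _) (cong (∫ L (F zero) +_) (∫-sum L (λ i → F (suc i))))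

 sum-*ˡ : ∀ {n} c (F : Fin n → ℚ) → sum (λ i → c * F i) ≡ c * sum F
 sum-*ˡ {zero}  c F = sym (ℚ.*-zeroʳ c)
 sum-*ˡ {suc n} c F = trans (cong (c * F zero +_) (sum-*ˡ c (λ i → F (suc i))))
   (sym (ℚ.*-distribˡ-+ c (F zero) _))

 opaque
   unif : ∀ n → Measure (Fin n)
   unif n = weighted (inv n) n

   ∫-unif : ∀ n F → ∫ (unif n) F ≡ inv n * sum F
   ∫-unif n F = ∫-weighted (inv n) n F

 unif-prob : ∀ n → Probability (unif (suc n))
 unif-prob n .mono F G h = subst₂ _≤_ (sym (∫-unif (suc n) F)) (sym (∫-unif (suc n) G))
   (*-monoˡ (inv (suc n)) (inv-nonneg (suc n)) (sum-mono F G h))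
 unif-prob n .total = trans (∫-unif (suc n) (λ _ → 1ℚ))
   (trans (cong (inv (suc n) *_) (sum-1 (suc n))) (trans (ℚ.*-comm (inv (suc n)) _) (ι*inv n)))

 unif-permute : ∀ {n} (π : Permutation′ n) F → ∫ (unif n) (λ i → F (π ⟨$⟩ʳ i)) ≡ ∫ (unif n) F
 unif-permute {n} π F = trans (∫-unif n _)
   (trans (cong (inv n *_) (sym (sum-permute F π))) (sym (∫-unif n F)))

 unif-point : ∀ n F → (∀ i → 0ℚ ≤ F i) → ∀ i → inv n * F i ≤ ∫ (unif n) F
 unif-point n F h i = subst (inv n * F i ≤_) (sym (∫-unif n F))
   (*-monoˡ (inv n) (inv-nonneg n) (sum-point F h i))

 opaque
   power : Measure A → ∀ l → Measure (Vec A l)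
   power L zero    = dirac []
   power L (suc l) = L ⟫= λ v → push (v ∷_) (power L l)

   ∫-power-[] : ∀ (L : Measure A) F → ∫ (power L zero) F ≡ F []
   ∫-power-[] L F = ∫-dirac [] F

   ∫-power : ∀ (L : Measure A) l F →
     ∫ (power L (suc l)) F ≡ ∫ L (λ v → ∫ (power L l) (λ xs → F (v ∷ xs)))
   ∫-power L l F = trans (∫-bind L _ F) (∫-cong L (λ v → ∫-push (v ∷_) (power L l) F))

   power-prob : ∀ {L : Measure A} → Probability L → ∀ l → Probability (power L l)
   power-prob P zero    = dirac-prob []
   power-prob P (suc l) = bind-prob P (λ v → push-prob (v ∷_) (power-prob P l))

 ∫-power-++ : ∀ (L : Measure A) l m F →
   ∫ (power L (l ℕ.+ m)) F ≡ ∫ (power L l) (λ xs → ∫ (power L m) (λ ys → F (xs Vec.++ ys)))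
 ∫-power-++ L zero    m F = sym (∫-power-[] L _)
 ∫-power-++ L (suc l) m F = trans (∫-power L (l ℕ.+ m) F) (trans
   (∫-cong L (λ v → ∫-power-++ L l m (λ xs → F (v ∷ xs)))) (sym (∫-power L l _)))

 ∫-power-map : ∀ (L : Measure A) (g : A → A) → (∀ F → ∫ L (λ a → F (g a)) ≡ ∫ L F) →
   ∀ l F → ∫ (power L l) (λ xs → F (Vec.map g xs)) ≡ ∫ (power L l) F
 ∫-power-map L g h zero    F = trans (∫-power-[] L _) (sym (∫-power-[] L F))
 ∫-power-map L g h (suc l) F = trans (∫-power L l _) (trans
   (∫-cong L (λ v → ∫-power-map L g h l (λ xs → F (g v ∷ xs))))
   (trans (h (λ v → ∫ (power L l) (λ xs → F (v ∷ xs)))) (sym (∫-power L l F))))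

 -- Redrawing one independent coordinate does not change the law. `marginal` uses this to integrate
 -- out the coordinates of a sample one at a time.
 ∫-power-resample : ∀ {L : Measure A} → Probability L → ∀ {l} (i : Fin l) F →
   ∫ (power L l) F ≡ ∫ (power L l) (λ xs → ∫ L (λ v → F (xs [ i ]≔ v)))
 ∫-power-resample {L = L} P {suc l} zero F = begin
   ∫ (power L (suc l)) F
     ≡⟨ ∫-power L l F ⟩
   ∫ L (λ v → ∫ (power L l) (λ xs → F (v ∷ xs)))
     ≡⟨ ∫-swap L (power L l) _ ⟩
   ∫ (power L l) (λ xs → ∫ L (λ v → F (v ∷ xs)))
     ≡⟨ const P _ ⟨
   ∫ L (λ _ → ∫ (power L l) (λ xs → ∫ L (λ v → F (v ∷ xs))))
     ≡⟨ ∫-power L l _ ⟨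
   ∫ (power L (suc l)) (λ xs → ∫ L (λ v → F (xs [ zero ]≔ v)))
     ≡⟨⟩
   ∫ (power L (suc l)) (λ xs → ∫ L (λ v → F (xs [ zero ]≔ v))) ∎
   where open ≡-Reasoning
 ∫-power-resample {L = L} P {suc l} (suc i) F = trans (∫-power L l F) (trans
   (∫-cong L (λ v → ∫-power-resample P i (λ xs → F (v ∷ xs)))) (sym (∫-power L l _)))

 -- All atoms but one are dropped from the mean of a nonnegative function. For uniform tuples δ is
 -- `inv n` and a factor n^l is lost; this is harmless where n is a constant, and it is the true
 -- order in `correlation`.
 ∫-power-point : ∀ {L : Measure A} → Probability L → ∀ {δ} → 0ℚ ≤ δ →
   (∀ F → (∀ a → 0ℚ ≤ F a) → ∀ a → δ * F a ≤ ∫ L F) →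
   ∀ {l} F → (∀ xs → 0ℚ ≤ F xs) → ∀ xs → δ ^ l * F xs ≤ ∫ (power L l) F
 ∫-power-point {L = L} P δ≥0 h F F≥0 [] =
   ℚ.≤-reflexive (trans (ℚ.*-identityˡ _) (sym (∫-power-[] L F)))
 ∫-power-point {L = L} P {δ} δ≥0 h {suc l} F F≥0 (x ∷ xs) = begin
   δ * δ ^ l * F (x ∷ xs)     ≡⟨ ℚ.*-assoc δ (δ ^ l) _ ⟩
   δ * (δ ^ l * F (x ∷ xs))   ≤⟨ *-monoˡ δ δ≥0 (∫-power-point P δ≥0 h (λ ys → F (x ∷ ys)) (λ ys → F≥0 (x ∷ ys)) xs) ⟩
   δ * ∫ (power L l) (λ ys → F (x ∷ ys))
     ≤⟨ h (λ v → ∫ (power L l) (λ ys → F (v ∷ ys))) (λ v → nonneg (power-prob P l) _ (λ ys → F≥0 (v ∷ ys))) x ⟩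
   ∫ L (λ v → ∫ (power L l) (λ ys → F (v ∷ ys)))
     ≡⟨ ∫-power L l F ⟨
   ∫ (power L (suc l)) F      ∎
   where open ℚ.≤-Reasoning

-- Subsets as bit vectors, their images, and counting them by tuples.

module Subsets where

 open import Defs using (subsets)
 open Measures
 open Rationals
 open import Data.Bool using (not)
 open import Data.Fin.Permutation using (inverseʳ; inverseˡ; flip)
 open import Data.Fin.Subset using (∣_∣)
 open import Data.List as List using ([]; _∷_; _++_; map; length; filterᵇ)
 open import Data.Nat.Combinatorics using (_C_; nCk+nC[k+1]≡[n+1]C[k+1])
 open import Data.Rational using (_+_; _*_; _≤_; _<_)
 open import Data.Vec using (lookup; tabulate)

 𝟙 : Bool → ℚ
 𝟙 true  = 1ℚ
 𝟙 false = 0ℚ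

 𝟙-nonneg : ∀ b → 0ℚ ≤ 𝟙 b
 𝟙-nonneg true  = 0≤1
 𝟙-nonneg false = ℚ.≤-refl

 𝟙-≤1 : ∀ b → 𝟙 b ≤ 1ℚ
 𝟙-≤1 true  = ℚ.≤-refl
 𝟙-≤1 false = 0≤1

 true≢false : ∀ {b} → b ≡ true → ¬ b ≡ false
 true≢false refl ()

 lookup-ext : ∀ {A : Set} {n} {xs ys : Vec A n} → (∀ i → lookup xs i ≡ lookup ys i) → xs ≡ ys
 lookup-ext {xs = xs} {ys} h =
   trans (sym (Vec.tabulate∘lookup xs)) (trans (Vec.tabulate-cong h) (Vec.tabulate∘lookup ys))

 private
   variable
     n : ℕ

 ins : Fin n → Subset n → Subset n
 ins zero    (_ ∷ A) = true ∷ A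
 ins (suc i) (x ∷ A) = x ∷ ins i A

 del : Fin n → Subset n → Subset n
 del zero    (_ ∷ A) = false ∷ A
 del (suc i) (x ∷ A) = x ∷ del i A

 ∅ : Subset n
 ∅ = Vec.replicate _ false

 toSet : ∀ {l} → Vec (Fin n) l → Subset n
 toSet []       = ∅
 toSet (x ∷ xs) = ins x (toSet xs)

 lookup-ins : ∀ (a : Fin n) A → lookup (ins a A) a ≡ true
 lookup-ins zero    (x ∷ A) = refl
 lookup-ins (suc a) (x ∷ A) = lookup-ins a A

 lookup-ins-≢ : ∀ {a i : Fin n} A → ¬ a ≡ i → lookup (ins a A) i ≡ lookup A i
 lookup-ins-≢ {a = zero}  {zero}  (x ∷ A) ne = ⊥-elim (ne refl)
 lookup-ins-≢ {a = zero}  {suc i} (x ∷ A) ne = refl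
 lookup-ins-≢ {a = suc a} {zero}  (x ∷ A) ne = refl
 lookup-ins-≢ {a = suc a} {suc i} (x ∷ A) ne = lookup-ins-≢ A (λ e → ne (cong suc e))

 lookup-ins-mono : ∀ (a : Fin n) A i → lookup A i ≡ true → lookup (ins a A) i ≡ true
 lookup-ins-mono a A i h with a Fin.≟ i
 ... | yes refl = lookup-ins a A
 ... | no ne    = trans (lookup-ins-≢ A ne) h

 ins-comm : ∀ (a b : Fin n) A → ins a (ins b A) ≡ ins b (ins a A)
 ins-comm zero    zero    (x ∷ A) = refl
 ins-comm zero    (suc b) (x ∷ A) = refl
 ins-comm (suc a) zero    (x ∷ A) = refl
 ins-comm (suc a) (suc b) (x ∷ A) = cong (x ∷_) (ins-comm a b A)

 ins-absorb : ∀ (a : Fin n) A → lookup A a ≡ true → ins a A ≡ A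
 ins-absorb zero    (x ∷ A) h = cong (_∷ A) (sym h)
 ins-absorb (suc a) (x ∷ A) h = cong (x ∷_) (ins-absorb a A h)

 ins-del : ∀ (a : Fin n) A → lookup A a ≡ true → ins a (del a A) ≡ A
 ins-del zero    (x ∷ A) h = cong (_∷ A) (sym h)
 ins-del (suc a) (x ∷ A) h = cong (x ∷_) (ins-del a A h)

 lookup-del : ∀ (a : Fin n) A → lookup (del a A) a ≡ false
 lookup-del zero    (x ∷ A) = refl
 lookup-del (suc a) (x ∷ A) = lookup-del a A

 lookup-del-≢ : ∀ {a i : Fin n} A → ¬ a ≡ i → lookup (del a A) i ≡ lookup A i
 lookup-del-≢ {a = zero}  {zero}  (x ∷ A) ne = ⊥-elim (ne refl)
 lookup-del-≢ {a = zero}  {suc i} (x ∷ A) ne = refl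
 lookup-del-≢ {a = suc a} {zero}  (x ∷ A) ne = refl
 lookup-del-≢ {a = suc a} {suc i} (x ∷ A) ne = lookup-del-≢ A (λ e → ne (cong suc e))

 ∣ins∣ : ∀ (a : Fin n) A → lookup A a ≡ false → ∣ ins a A ∣ ≡ suc ∣ A ∣
 ∣ins∣ zero    (false ∷ A) h = refl
 ∣ins∣ (suc a) (false ∷ A) h = ∣ins∣ a A h
 ∣ins∣ (suc a) (true ∷ A)  h = cong suc (∣ins∣ a A h)

 ∣del∣ : ∀ (a : Fin n) A → lookup A a ≡ true → ∣ A ∣ ≡ suc ∣ del a A ∣
 ∣del∣ a A h = trans (cong ∣_∣ (sym (ins-del a A h))) (∣ins∣ a (del a A) (lookup-del a A))

 ∣ins∣≤ : ∀ (a : Fin n) A → ∣ ins a A ∣ ℕ.≤ suc ∣ A ∣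
 ∣ins∣≤ a A with lookup A a in eq
 ... | true  = subst (λ B → ∣ B ∣ ℕ.≤ suc ∣ A ∣) (sym (ins-absorb a A eq)) (ℕ.n≤1+n _)
 ... | false = ℕ.≤-reflexive (∣ins∣ a A eq)

 ∣∅∣ : ∀ n → ∣ ∅ {n} ∣ ≡ 0
 ∣∅∣ zero    = refl
 ∣∅∣ (suc n) = ∣∅∣ n

 lookup-∅ : ∀ (i : Fin n) → lookup ∅ i ≡ false
 lookup-∅ i = Vec.lookup-replicate i false

 ∣toSet∣≤ : ∀ {n l} (xs : Vec (Fin n) l) → ∣ toSet xs ∣ ℕ.≤ l
 ∣toSet∣≤ {n} []   = ℕ.≤-reflexive (∣∅∣ n)
 ∣toSet∣≤ (x ∷ xs) = ℕ.≤-trans (∣ins∣≤ x (toSet xs)) (ℕ.s≤s (∣toSet∣≤ xs))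

 image : Permutation′ n → Subset n → Subset n
 image π e = tabulate (λ y → lookup e (π ⟨$⟩ˡ y))

 lookup-image : ∀ (π : Permutation′ n) A i → lookup (image π A) i ≡ lookup A (π ⟨$⟩ˡ i)
 lookup-image π A i = Vec.lookup∘tabulate _ i

 image-ins : ∀ (π : Permutation′ n) a A → image π (ins a A) ≡ ins (π ⟨$⟩ʳ a) (image π A)
 image-ins π a A = lookup-ext pointwise
   where
   pointwise : ∀ i → lookup (image π (ins a A)) i ≡ lookup (ins (π ⟨$⟩ʳ a) (image π A)) i
   pointwise i with (π ⟨$⟩ʳ a) Fin.≟ i
   ... | yes refl = trans (lookup-image π (ins a A) i) (trans
         (cong (lookup (ins a A)) (inverseˡ π)) (trans (lookup-ins a A) (sym (lookup-ins (π ⟨$⟩ʳ a) (image π A)))))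
   ... | no ne = trans (lookup-image π (ins a A) i) (trans
         (lookup-ins-≢ A (λ e → ne (trans (cong (π ⟨$⟩ʳ_) e) (inverseʳ π))))
         (trans (sym (lookup-image π A i)) (sym (lookup-ins-≢ (image π A) ne))))

 image-∅ : ∀ (π : Permutation′ n) → image π ∅ ≡ ∅
 image-∅ π = lookup-ext (λ i → trans (lookup-image π ∅ i) (trans (lookup-∅ (π ⟨$⟩ˡ i)) (sym (lookup-∅ i))))

 image-toSet : ∀ (π : Permutation′ n) {l} (xs : Vec (Fin n) l) →
   image π (toSet xs) ≡ toSet (Vec.map (π ⟨$⟩ʳ_) xs)
 image-toSet π []       = image-∅ π
 image-toSet π (x ∷ xs) = trans (image-ins π x (toSet xs)) (cong (ins _) (image-toSet π xs))

 ι∣∣ : ∀ {n} (A : Subset n) → ι ∣ A ∣ ≡ sum (λ i → 𝟙 (lookup A i))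
 ι∣∣ []          = ι-0
 ι∣∣ (true ∷ A)  = trans (ι-suc ∣ A ∣) (cong (1ℚ +_) (ι∣∣ A))
 ι∣∣ (false ∷ A) = trans (ι∣∣ A) (sym (ℚ.+-identityˡ _))

 ∣image∣ : ∀ (π : Permutation′ n) A → ∣ image π A ∣ ≡ ∣ A ∣
 ∣image∣ π A = ℕ.≤-antisym (ι-cancel-≤ (ℚ.≤-reflexive eq)) (ι-cancel-≤ (ℚ.≤-reflexive (sym eq)))
   where
   eq : ι ∣ image π A ∣ ≡ ι ∣ A ∣
   eq = trans (ι∣∣ (image π A)) (trans (sum-cong (λ i → cong 𝟙 (lookup-image π A i)))
     (trans (sym (sum-permute (λ i → 𝟙 (lookup A i)) (flip π))) (sym (ι∣∣ A))))

 opaque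
   counting : ∀ n → Measure (Subset n)
   counting zero    = dirac []
   counting (suc n) = push (false ∷_) (counting n) ++ push (true ∷_) (counting n)

   ∫-counting-[] : ∀ F → ∫ (counting 0) F ≡ F []
   ∫-counting-[] F = ∫-dirac [] F

   ∫-counting : ∀ n F → ∫ (counting (suc n)) F ≡
     ∫ (counting n) (λ e → F (false ∷ e)) + ∫ (counting n) (λ e → F (true ∷ e))
   ∫-counting n F = trans (∫-++ (push (false ∷_) (counting n)) (push (true ∷_) (counting n)) F)
     (cong₂ _+_ (∫-push _ (counting n) F) (∫-push _ (counting n) F))

 counting-mono : ∀ n F G → (∀ e → F e ≤ G e) → ∫ (counting n) F ≤ ∫ (counting n) G
 counting-mono zero    F G h = subst₂ _≤_ (sym (∫-counting-[] F)) (sym (∫-counting-[] G)) (h [])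
 counting-mono (suc n) F G h = subst₂ _≤_ (sym (∫-counting n F)) (sym (∫-counting n G))
   (ℚ.+-mono-≤ (counting-mono n _ _ (λ e → h (false ∷ e))) (counting-mono n _ _ (λ e → h (true ∷ e))))

 length-filterᵇ : ∀ n (p : Subset n → Bool) →
   ι (length (filterᵇ p (subsets n))) ≡ ∫ (counting n) (λ e → 𝟙 (p e))
 length-filterᵇ zero p with p [] in eq
 ... | true  = trans ι-1 (sym (trans (∫-counting-[] _) (cong 𝟙 eq)))
 ... | false = trans ι-0 (sym (trans (∫-counting-[] _) (cong 𝟙 eq)))
 length-filterᵇ (suc n) p = begin
   ι (length (filterᵇ p (map (false ∷_) S ++ map (true ∷_) S)))
     ≡⟨ cong ι (filter-++ (map (false ∷_) S) (map (true ∷_) S)) ⟩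
   ι (length (filterᵇ p (map (false ∷_) S)) ℕ.+ length (filterᵇ p (map (true ∷_) S)))
     ≡⟨ cong ι (cong₂ ℕ._+_ (filter-map (false ∷_) S) (filter-map (true ∷_) S)) ⟩
   ι (length (filterᵇ (λ e → p (false ∷ e)) S) ℕ.+ length (filterᵇ (λ e → p (true ∷ e)) S))
     ≡⟨ ι-+ (length (filterᵇ (λ e → p (false ∷ e)) S)) _ ⟩
   ι (length (filterᵇ (λ e → p (false ∷ e)) S)) + ι (length (filterᵇ (λ e → p (true ∷ e)) S))
     ≡⟨ cong₂ _+_ (length-filterᵇ n _) (length-filterᵇ n _) ⟩
   ∫ (counting n) (λ e → 𝟙 (p (false ∷ e))) + ∫ (counting n) (λ e → 𝟙 (p (true ∷ e)))
     ≡⟨ ∫-counting n _ ⟨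
   ∫ (counting (suc n)) (λ e → 𝟙 (p e)) ∎
   where
   open ≡-Reasoning
   S = subsets n
   filter-++ : ∀ xs ys → length (filterᵇ p (xs ++ ys)) ≡ length (filterᵇ p xs) ℕ.+ length (filterᵇ p ys)
   filter-++ []       ys = refl
   filter-++ (x ∷ xs) ys with p x
   ... | true  = cong suc (filter-++ xs ys)
   ... | false = filter-++ xs ys
   filter-map : ∀ (f : Subset n → Subset (suc n)) xs →
     length (filterᵇ p (map f xs)) ≡ length (filterᵇ (λ e → p (f e)) xs)
   filter-map f []       = refl
   filter-map f (x ∷ xs) with p (f x)
   ... | true  = cong suc (filter-map f xs)
   ... | false = filter-map f xs

 -- Both sides run over the incidences e = T ∪ {v} with v outside T, grouped on the left by e and on
 -- the right by T.
 double-count : ∀ n (Ω : Subset n → Subset n → ℚ) →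
   ∫ (counting n) (λ e → sum (λ v → 𝟙 (lookup e v) * Ω e (del v e))) ≡
   ∫ (counting n) (λ T → sum (λ v → 𝟙 (not (lookup T v)) * Ω (ins v T) T))
 double-count zero    Ω = refl
 double-count (suc n) Ω = begin
   ∫ (counting (suc n)) (λ e → sum (λ v → 𝟙 (lookup e v) * Ω e (del v e)))
     ≡⟨ ∫-counting n _ ⟩
   ∫ M (λ e → 0ℚ * Ω (false ∷ e) (false ∷ e) + sum (λ v → 𝟙 (lookup e v) * Ω (false ∷ e) (false ∷ del v e))) +
   ∫ M (λ e → 1ℚ * Ω (true ∷ e) (false ∷ e) + sum (λ v → 𝟙 (lookup e v) * Ω (true ∷ e) (true ∷ del v e)))
     ≡⟨ cong₂ _+_ (trans (∫-+ M _ _) (cong₂ _+_ (∫-≡0 M (λ e → ℚ.*-zeroˡ (Ω (false ∷ e) (false ∷ e)))) (double-count n (λ e T → Ω (false ∷ e) (false ∷ T)))))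
          (trans (∫-+ M (λ e → 1ℚ * Ω (true ∷ e) (false ∷ e)) _) (cong (Y +_) (double-count n (λ e T → Ω (true ∷ e) (true ∷ T))))) ⟩
   0ℚ + X + (Y + Z)
     ≡⟨ lem X Y Z ⟩
   Y + X + (0ℚ + Z)
     ≡⟨ cong₂ _+_ (∫-+ M _ _) (trans (∫-+ M _ _) (cong (_+ Z) (∫-≡0 M (λ e → ℚ.*-zeroˡ (Ω (true ∷ e) (true ∷ e)))))) ⟨
   ∫ M (λ T → 1ℚ * Ω (true ∷ T) (false ∷ T) + sum (λ v → 𝟙 (not (lookup T v)) * Ω (false ∷ ins v T) (false ∷ T))) +
   ∫ M (λ T → 0ℚ * Ω (true ∷ T) (true ∷ T) + sum (λ v → 𝟙 (not (lookup T v)) * Ω (true ∷ ins v T) (true ∷ T)))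
     ≡⟨ ∫-counting n _ ⟨
   ∫ (counting (suc n)) (λ T → sum (λ v → 𝟙 (not (lookup T v)) * Ω (ins v T) T)) ∎
   where
   open ≡-Reasoning
   M = counting n
   X = ∫ M (λ T → sum (λ v → 𝟙 (not (lookup T v)) * Ω (false ∷ ins v T) (false ∷ T)))
   Y = ∫ M (λ e → 1ℚ * Ω (true ∷ e) (false ∷ e))
   Z = ∫ M (λ T → sum (λ v → 𝟙 (not (lookup T v)) * Ω (true ∷ ins v T) (true ∷ T)))
   lem : ∀ x y z → 0ℚ + x + (y + z) ≡ y + x + (0ℚ + z)
   lem = solve-∀ ringℚ

 infix 5 _!ℚ
 _!ℚ : ℕ → ℚ
 zero !ℚ  = 1ℚ
 suc k !ℚ = ι (suc k) * (k !ℚ)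

 !ℚ-pos : ∀ k → 0ℚ < k !ℚ
 !ℚ-pos zero    = 0<1
 !ℚ-pos (suc k) = *-pos (ι-pos k) (!ℚ-pos k)

 Uniform : ℕ → (Subset n → ℚ) → Set
 Uniform k Φ = ∀ e → ¬ ∣ e ∣ ≡ k → Φ e ≡ 0ℚ

 ∣e∣≡0 : ∀ {n} (e : Subset n) → ∣ e ∣ ≡ 0 → e ≡ ∅
 ∣e∣≡0 []          h = refl
 ∣e∣≡0 (false ∷ e) h = cong (false ∷_) (∣e∣≡0 e h)

 ∫-counting-∅ : ∀ n (Φ : Subset n → ℚ) → Uniform 0 Φ → ∫ (counting n) Φ ≡ Φ ∅
 ∫-counting-∅ zero    Φ U = ∫-counting-[] Φ
 ∫-counting-∅ (suc n) Φ U = trans (∫-counting n Φ) (trans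
   (cong₂ _+_ (∫-counting-∅ n (λ e → Φ (false ∷ e)) (λ e → U (false ∷ e)))
     (∫-≡0 (counting n) (λ e → U (true ∷ e) (λ ()))))
   (ℚ.+-identityʳ _))

 -- Every k-set is enumerated by k! injective k-tuples, and Φ kills the tuples
 -- with repetitions.
 ∫-tuples : ∀ n k (Φ : Subset (suc n) → ℚ) → Uniform k Φ →
   ι (suc n) ^ k * ∫ (power (unif (suc n)) k) (λ xs → Φ (toSet xs)) ≡ (k !ℚ) * ∫ (counting (suc n)) Φ
 ∫-tuples n zero    Φ U = cong (1ℚ *_) (trans (∫-power-[] _ _) (sym (∫-counting-∅ (suc n) Φ U)))
 ∫-tuples n (suc k) Φ U = begin
   N * N ^ k * ∫ (power (unif (suc n)) (suc k)) (λ xs → Φ (toSet xs))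
     ≡⟨ cong (N * N ^ k *_) (trans (∫-power _ k _) (∫-swap (unif (suc n)) P _)) ⟩
   N * N ^ k * ∫ P (λ xs → ∫ (unif (suc n)) (λ v → Φ (ins v (toSet xs))))
     ≡⟨ lem N (N ^ k) _ ⟩
   N ^ k * (N * ∫ P (λ xs → ∫ (unif (suc n)) (λ v → Φ (ins v (toSet xs)))))
     ≡⟨ cong (N ^ k *_) (trans (sym (∫-*ˡ P N _)) (∫-cong P step)) ⟩
   -- `Ψ` sums `Φ` over the one-vertex extensions of a k-set; double counting sends it back to
   -- (k+1)-sets, each of which is reached k + 1 times.
   N ^ k * ∫ P (λ xs → Ψ (toSet xs))
     ≡⟨ ∫-tuples n k Ψ U′ ⟩
   (k !ℚ) * ∫ M Ψ
     ≡⟨ cong ((k !ℚ) *_) (sym (double-count (suc n) (λ e _ → Φ e))) ⟩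
   (k !ℚ) * ∫ M (λ e → sum (λ v → 𝟙 (lookup e v) * Φ e))
     ≡⟨ cong ((k !ℚ) *_) (trans (∫-cong M count) (∫-*ˡ M (ι (suc k)) Φ)) ⟩
   (k !ℚ) * (ι (suc k) * ∫ M Φ)
     ≡⟨ lem₂ (k !ℚ) (ι (suc k)) _ ⟩
   ι (suc k) * (k !ℚ) * ∫ M Φ ∎
   where
   open ≡-Reasoning
   N = ι (suc n)
   P = power (unif (suc n)) k
   M = counting (suc n)
   Ψ : Subset (suc n) → ℚ
   Ψ e = sum (λ v → 𝟙 (not (lookup e v)) * Φ (ins v e))
   lem : ∀ a b c → a * b * c ≡ b * (a * c)
   lem = solve-∀ ringℚ
   lem₂ : ∀ a b c → a * (b * c) ≡ b * a * c
   lem₂ = solve-∀ ringℚ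
   U′ : Uniform k Ψ
   U′ e ne = trans (sum-cong term) (trans (sum-const (suc n) 0ℚ) (ℚ.*-zeroʳ (ι (suc n))))
     where
     term : ∀ v → 𝟙 (not (lookup e v)) * Φ (ins v e) ≡ 0ℚ
     term v with lookup e v in eq
     ... | true  = ℚ.*-zeroˡ (Φ (ins v e))
     ... | false = trans (cong (1ℚ *_) (U (ins v e)
       (λ h → ne (ℕ.suc-injective (trans (sym (∣ins∣ v e eq)) h))))) (ℚ.*-zeroʳ 1ℚ)
   step : ∀ xs → N * ∫ (unif (suc n)) (λ v → Φ (ins v (toSet xs))) ≡ Ψ (toSet xs)
   step xs = trans (cong (N *_) (∫-unif (suc n) _)) (trans (sym (ℚ.*-assoc N (inv (suc n)) _))
     (trans (cong (_* sum (λ v → Φ (ins v (toSet xs)))) (ι*inv n)) (trans (ℚ.*-identityˡ _) (sum-cong term))))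
     where
     term : ∀ v → Φ (ins v (toSet xs)) ≡ 𝟙 (not (lookup (toSet xs) v)) * Φ (ins v (toSet xs))
     term v with lookup (toSet xs) v in eq
     ... | true  = trans (U _ (λ h → ℕ.<⇒≢ (ℕ.s≤s (∣toSet∣≤ xs))
                     (trans (cong ∣_∣ (sym (ins-absorb v (toSet xs) eq))) h))) (sym (ℚ.*-zeroˡ (Φ (ins v (toSet xs)))))
     ... | false = sym (ℚ.*-identityˡ (Φ (ins v (toSet xs))))
   count : ∀ e → sum (λ v → 𝟙 (lookup e v) * Φ e) ≡ ι (suc k) * Φ e
   count e = trans (sum-cong (λ v → ℚ.*-comm (𝟙 (lookup e v)) (Φ e)))
     (trans (sum-*ˡ (Φ e) (λ v → 𝟙 (lookup e v))) (trans (ℚ.*-comm (Φ e) _) (trans (cong (_* Φ e) (sym (ι∣∣ e))) size)))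
     where
     size : ι ∣ e ∣ * Φ e ≡ ι (suc k) * Φ e
     size with ∣ e ∣ ℕ.≟ suc k
     ... | yes eq = cong (λ z → ι z * Φ e) eq
     ... | no ne  = trans (cong (ι ∣ e ∣ *_) (U e ne)) (trans (ℚ.*-zeroʳ (ι ∣ e ∣))
                      (sym (trans (cong (ι (suc k) *_) (U e ne)) (ℚ.*-zeroʳ (ι (suc k))))))

 ofSize : ∀ {n} → ℕ → Subset n → Bool
 ofSize k e = ∣ e ∣ ℕ.≡ᵇ k

 ∫-ofSize : ∀ n k → ∫ (counting n) (λ e → 𝟙 (ofSize k e)) ≡ ι (n C k)
 ∫-ofSize zero    zero    = trans (∫-counting-[] _) (sym ι-1)
 ∫-ofSize zero    (suc k) = trans (∫-counting-[] _) (sym ι-0)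
 ∫-ofSize (suc n) zero    = trans (∫-counting n _) (trans (cong₂ _+_ (∫-ofSize n zero) (∫-0 (counting n)))
   (ℚ.+-identityʳ _))
 ∫-ofSize (suc n) (suc k) = trans (∫-counting n _) (trans
   (cong₂ _+_ (∫-ofSize n (suc k)) (∫-ofSize n k))
   (trans (ℚ.+-comm (ι (n C suc k)) _) (trans (sym (ι-+ (n C k) _)) (cong ι (nCk+nC[k+1]≡[n+1]C[k+1] n k)))))

-- Uniformly random permutations and tuples without repetition.

module Permutations where

 open Measures
 open Rationals
 open Subsets
 open Probability
 open import Data.Bool using (not)
 open import Data.Fin using (punchIn)
 open import Data.Fin.Permutation using (_≈_; flip; insert; remove; transpose; inverseʳ; inverseˡ)
 open import Data.Fin.Subset using (∣_∣)
 open import Data.Rational using (_+_; _*_; _≤_)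
 open import Data.Vec using (lookup; map)

 private
   variable
     n l : ℕ

 opaque
   perms : ∀ n → Measure (Permutation′ n)
   perms zero    = dirac Perm.id
   perms (suc n) = unif (suc n) ⟫= λ i → push (insert zero i) (perms n)

   ∫-perms-0 : ∀ F → ∫ (perms 0) F ≡ F Perm.id
   ∫-perms-0 F = ∫-dirac Perm.id F

   ∫-perms : ∀ n F → ∫ (perms (suc n)) F ≡
     ∫ (unif (suc n)) (λ i → ∫ (perms n) (λ π → F (insert zero i π)))
   ∫-perms n F = trans (∫-bind (unif (suc n)) _ F)
     (∫-cong (unif (suc n)) (λ i → ∫-push (insert zero i) (perms n) F))

   perms-prob : ∀ n → Probability (perms n)
   perms-prob zero    = dirac-prob Perm.id
   perms-prob (suc n) = bind-prob (unif-prob n) (λ i → push-prob (insert zero i) (perms-prob n))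

 -- A permutation is a record of functions and proofs, so permutations that agree at every point
 -- need not be propositionally equal. The invariance of the integral is therefore stated for
 -- functions that respect pointwise equality.
 Extensional : (Permutation′ n → ℚ) → Set
 Extensional F = ∀ {π ρ} → π ≈ ρ → F π ≡ F ρ

 insert-cong : ∀ (i : Fin (suc n)) {π ρ : Permutation′ n} → π ≈ ρ → insert zero i π ≈ insert zero i ρ
 insert-cong i h zero = refl
 insert-cong i {π} {ρ} h (suc x) = trans (Perm.insert-punchIn zero i π x)
   (trans (cong (punchIn i) (h x)) (sym (Perm.insert-punchIn zero i ρ x)))

 insert-∘ : ∀ (i : Fin (suc n)) (π : Permutation′ n) (σ : Permutation′ (suc n)) →
   insert zero i π ∘ₚ σ ≈ insert zero (σ ⟨$⟩ʳ i) (π ∘ₚ remove i σ)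
 insert-∘ i π σ zero = refl
 insert-∘ i π σ (suc x) = trans (cong (σ ⟨$⟩ʳ_) (Perm.insert-punchIn zero i π x))
   (trans (Perm.punchIn-permute σ i (π ⟨$⟩ʳ x))
     (sym (Perm.insert-punchIn zero (σ ⟨$⟩ʳ i) (π ∘ₚ remove i σ) x)))

 -- Composition with σ moves the image of 0 from i to σ i and acts on the remaining points by
 -- `remove i σ`: the first change is absorbed by the uniform choice of i, the second by induction.
 ∫-perms-left : ∀ {n} (σ : Permutation′ n) F → Extensional F →
   ∫ (perms n) (λ π → F (π ∘ₚ σ)) ≡ ∫ (perms n) F
 ∫-perms-left {zero} σ F ext =
   trans (∫-perms-0 (λ π → F (π ∘ₚ σ))) (trans (ext (λ ())) (sym (∫-perms-0 F)))
 ∫-perms-left {suc n} σ F ext = begin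
   ∫ (perms (suc n)) (λ π → F (π ∘ₚ σ))
     ≡⟨ ∫-perms n (λ π → F (π ∘ₚ σ)) ⟩
   ∫ U (λ i → ∫ (perms n) (λ π → F (insert zero i π ∘ₚ σ)))
     ≡⟨ ∫-cong U (λ i → ∫-cong (perms n) (λ π → ext (insert-∘ i π σ))) ⟩
   ∫ U (λ i → ∫ (perms n) (λ π → F (insert zero (σ ⟨$⟩ʳ i) (π ∘ₚ remove i σ))))
     ≡⟨ ∫-cong U (λ i → ∫-perms-left (remove i σ) (λ π → F (insert zero (σ ⟨$⟩ʳ i) π))
          (λ {π} {ρ} h → ext (insert-cong (σ ⟨$⟩ʳ i) {π} {ρ} h))) ⟩
   ∫ U (λ i → ∫ (perms n) (λ π → F (insert zero (σ ⟨$⟩ʳ i) π)))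
     ≡⟨ unif-permute σ (λ i → ∫ (perms n) (λ π → F (insert zero i π))) ⟩
   ∫ U (λ i → ∫ (perms n) (λ π → F (insert zero i π)))
     ≡⟨ ∫-perms n F ⟨
   ∫ (perms (suc n)) F ∎
   where
   open ≡-Reasoning
   U = unif (suc n)

 flip-cong : ∀ {π ρ : Permutation′ n} → π ≈ ρ → flip π ≈ flip ρ
 flip-cong {π = π} {ρ} h x = trans (cong (π ⟨$⟩ˡ_) (sym (inverseʳ ρ)))
   (trans (cong (π ⟨$⟩ˡ_) (sym (h (ρ ⟨$⟩ˡ x)))) (inverseˡ π))

 -- Integrating F (τ⁻¹ σ) over both σ and τ compares F with F ∘ flip.
 ∫-perms-flip : ∀ (F : Permutation′ n → ℚ) → Extensional F →
   ∫ (perms n) (λ π → F (flip π)) ≡ ∫ (perms n) F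
 ∫-perms-flip {n} F ext = begin
   ∫ P (λ τ → F (flip τ))
     ≡⟨ const (perms-prob n) _ ⟨
   ∫ P (λ σ → ∫ P (λ τ → F (flip τ)))
     ≡⟨ ∫-cong P (λ σ → ∫-perms-left (flip σ) (λ τ → F (flip τ)) (λ {π} {ρ} h → ext (flip-cong {π = π} {ρ} h))) ⟨
   ∫ P (λ σ → ∫ P (λ τ → F (flip (τ ∘ₚ flip σ))))
     ≡⟨ ∫-cong P (λ σ → ∫-cong P (λ τ → ext (λ x → refl))) ⟩
   ∫ P (λ σ → ∫ P (λ τ → F (σ ∘ₚ flip τ)))
     ≡⟨ ∫-swap P P (λ σ τ → F (σ ∘ₚ flip τ)) ⟩
   ∫ P (λ τ → ∫ P (λ σ → F (σ ∘ₚ flip τ)))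
     ≡⟨ ∫-cong P (λ τ → ∫-perms-left (flip τ) F ext) ⟩
   ∫ P (λ τ → ∫ P F)
     ≡⟨ const (perms-prob n) _ ⟩
   ∫ P F ∎
   where
   open ≡-Reasoning
   P = perms n

 -- Passing to inverses exchanges the two sides of a composition.
 ∫-perms-right : ∀ (σ : Permutation′ n) F → Extensional F →
   ∫ (perms n) (λ π → F (σ ∘ₚ π)) ≡ ∫ (perms n) F
 ∫-perms-right {n} σ F ext = begin
   ∫ P (λ π → F (σ ∘ₚ π))
     ≡⟨ ∫-perms-flip (λ π → F (σ ∘ₚ π)) (λ h → ext (λ x → h (σ ⟨$⟩ʳ x))) ⟨
   ∫ P (λ π → F (σ ∘ₚ flip π))
     ≡⟨ ∫-cong P (λ π → ext (λ x → refl)) ⟩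
   ∫ P (λ π → F (flip (π ∘ₚ flip σ)))
     ≡⟨ ∫-perms-left (flip σ) (λ π → F (flip π)) (λ {π} {ρ} h → ext (flip-cong {π = π} {ρ} h)) ⟩
   ∫ P (λ π → F (flip π))
     ≡⟨ ∫-perms-flip F ext ⟩
   ∫ P F ∎
   where
   open ≡-Reasoning
   P = perms n

 Distinct : Vec (Fin n) l → Set
 Distinct []       = ⊤
 Distinct (x ∷ xs) = lookup (toSet xs) x ≡ false × Distinct xs

 distinct? : (xs : Vec (Fin n) l) → Dec (Distinct xs)
 distinct? []       = yes tt
 distinct? (x ∷ xs) with lookup (toSet xs) x Bool.≟ false | distinct? xs
 ... | no h  | _     = no (λ { (h′ , _) → h h′ })
 ... | yes h | yes d = yes (h , d)
 ... | yes h | no nd = no (λ { (_ , d) → nd d })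

 ∣toSet∣ : ∀ (xs : Vec (Fin n) l) → Distinct xs → ∣ toSet xs ∣ ≡ l
 ∣toSet∣ {n} [] d = ∣∅∣ n
 ∣toSet∣ (x ∷ xs) (h , d) = trans (∣ins∣ x (toSet xs) h) (cong suc (∣toSet∣ xs d))

 ¬distinct⇒∣toSet∣< : ∀ (xs : Vec (Fin n) l) → ¬ Distinct xs → ∣ toSet xs ∣ ℕ.< l
 ¬distinct⇒∣toSet∣< []       nd = ⊥-elim (nd tt)
 ¬distinct⇒∣toSet∣< {l = suc l} (x ∷ xs) nd with lookup (toSet xs) x in eq
 ... | true  = subst (λ A → ∣ A ∣ ℕ.< suc l) (sym (ins-absorb x (toSet xs) eq)) (ℕ.s≤s (∣toSet∣≤ xs))
 ... | false = subst (ℕ._< suc l) (sym (∣ins∣ x (toSet xs) eq))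
   (ℕ.s≤s (¬distinct⇒∣toSet∣< xs (λ d → nd (refl , d))))

 fresh-∷ : ∀ {x y : Fin n} (ys : Vec (Fin n) l) → lookup (toSet (y ∷ ys)) x ≡ false →
   (¬ y ≡ x) × lookup (toSet ys) x ≡ false
 fresh-∷ {x = x} {y} ys h with y Fin.≟ x
 ... | yes refl = ⊥-elim (true≢false (lookup-ins y (toSet ys)) h)
 ... | no ne    = ne , trans (sym (lookup-ins-≢ (toSet ys) ne)) h

 ∷-fresh : ∀ {x y : Fin n} (ys : Vec (Fin n) l) → ¬ y ≡ x → lookup (toSet ys) x ≡ false →
   lookup (toSet (y ∷ ys)) x ≡ false
 ∷-fresh ys ne h = trans (lookup-ins-≢ (toSet ys) ne) h

 transpose-matchˡ : ∀ (i j : Fin n) → transpose i j ⟨$⟩ʳ i ≡ j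
 transpose-matchˡ i j with i Fin.≟ i
 ... | yes _ = refl
 ... | no ne = ⊥-elim (ne refl)

 transpose-mismatch : ∀ {i j k : Fin n} → ¬ i ≡ k → ¬ j ≡ k → transpose i j ⟨$⟩ʳ k ≡ k
 transpose-mismatch {i = i} {j} {k} i≢k j≢k with k Fin.≟ i
 ... | yes refl = ⊥-elim (i≢k refl)
 ... | no _ with k Fin.≟ j
 ...   | yes refl = ⊥-elim (j≢k refl)
 ...   | no _ = refl

 -- The permutation found for the tails is corrected by one transposition, which fixes the images of
 -- the tail because the entries are distinct.
 extend : ∀ (xs ys : Vec (Fin n) l) → Distinct xs → Distinct ys → ∃[ π ] map (π ⟨$⟩ʳ_) xs ≡ ys
 extend []       []       _         _         = Perm.id , refl
 extend (x ∷ xs) (y ∷ ys) (hx , dx) (hy , dy) with extend xs ys dx dy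
 ... | π , refl = π ∘ₚ transpose (π ⟨$⟩ʳ x) y ,
     cong₂ _∷_ (transpose-matchˡ (π ⟨$⟩ʳ x) y) (fixed xs hx hy)
   where
   fixed : ∀ {l} (zs : Vec _ l) → lookup (toSet zs) x ≡ false → lookup (toSet (map (π ⟨$⟩ʳ_) zs)) y ≡ false →
     map ((π ∘ₚ transpose (π ⟨$⟩ʳ x) y) ⟨$⟩ʳ_) zs ≡ map (π ⟨$⟩ʳ_) zs
   fixed []       h₁ h₂ = refl
   fixed (z ∷ zs) h₁ h₂ with fresh-∷ zs h₁ | fresh-∷ (map (π ⟨$⟩ʳ_) zs) h₂
   ... | z≢x , h₁′ | πz≢y , h₂′ = cong₂ _∷_
     (transpose-mismatch (λ e → z≢x (trans (sym (inverseˡ π)) (trans (cong (π ⟨$⟩ˡ_) (sym e)) (inverseˡ π)))) (λ e → πz≢y (sym e)))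
     (fixed zs h₁′ h₂′)

 map-ext : ∀ {π ρ : Permutation′ n} → π ≈ ρ → (xs : Vec (Fin n) l) → map (π ⟨$⟩ʳ_) xs ≡ map (ρ ⟨$⟩ʳ_) xs
 map-ext h xs = Vec.map-cong h xs

 -- Permutations act transitively on tuples without repetition, and the integral is invariant under
 -- composition with the permutation that `extend` provides.
 ∫-perms-tuple : ∀ (F : Vec (Fin n) l → ℚ) (p q : Vec (Fin n) l) → Distinct p → Distinct q →
   ∫ (perms n) (λ π → F (map (π ⟨$⟩ʳ_) p)) ≡ ∫ (perms n) (λ π → F (map (π ⟨$⟩ʳ_) q))
 ∫-perms-tuple {n} F p q dp dq with extend p q dp dq
 ... | σ , refl = trans
   (sym (∫-perms-right σ (λ π → F (map (π ⟨$⟩ʳ_) p)) (λ {π} {ρ} h → cong F (map-ext {π = π} {ρ} h p))))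
   (∫-cong (perms n) (λ π → cong F (Vec.map-∘ (π ⟨$⟩ʳ_) (σ ⟨$⟩ʳ_) p)))

 ∫-unif-lookup : ∀ (A : Subset n) → ∫ (unif n) (λ x → 𝟙 (lookup A x)) ≡ inv n * ι ∣ A ∣
 ∫-unif-lookup {n} A = trans (∫-unif n _) (cong (inv n *_) (sym (ι∣∣ A)))

 repeated : Vec (Fin n) l → Bool
 repeated xs = not (does (distinct? xs))

 -- Union bound: a new entry coincides with one of at most l earlier ones with probability at most l
 -- / n.
 ∫-repeated : ∀ n l → ∫ (power (unif (suc n)) l) (λ xs → 𝟙 (repeated xs)) ≤ ι l * ι l * inv (suc n)
 ∫-repeated n zero = ℚ.≤-reflexive (trans (∫-power-[] (unif (suc n)) (λ xs → 𝟙 (repeated xs)))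
   (sym (trans (cong (λ z → z * z * inv (suc n)) ι-0) (lem (inv (suc n))))))
   where
   lem : ∀ x → 0ℚ * 0ℚ * x ≡ 0ℚ
   lem = solve-∀ ringℚ
 ∫-repeated n (suc l) = begin
   ∫ (power U (suc l)) (λ xs → 𝟙 (repeated xs))
     ≡⟨ trans (∫-power U l _) (∫-swap U P _) ⟩
   ∫ P (λ xs → ∫ U (λ x → 𝟙 (repeated (x ∷ xs))))
     ≤⟨ mono (power-prob (unif-prob n) l) _ _ (λ xs → ℚ.≤-trans
          (mono (unif-prob n) _ _ (λ x → split x xs))
          (ℚ.≤-reflexive (trans (+-const (unif-prob n) (λ x → 𝟙 (lookup (toSet xs) x)) (𝟙 (repeated xs))) (cong (_+ 𝟙 (repeated xs)) (∫-unif-lookup (toSet xs)))))) ⟩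
   ∫ P (λ xs → i * ι ∣ toSet xs ∣ + 𝟙 (repeated xs))
     ≤⟨ mono (power-prob (unif-prob n) l) _ _ (λ xs → ℚ.+-monoˡ-≤ (𝟙 (repeated xs))
          (*-monoˡ i (inv-nonneg (suc n)) (ι-mono (∣toSet∣≤ xs)))) ⟩
   ∫ P (λ xs → i * ι l + 𝟙 (repeated xs))
     ≡⟨ const-+ (power-prob (unif-prob n) l) (i * ι l) (λ xs → 𝟙 (repeated xs)) ⟩
   i * ι l + ∫ P (λ xs → 𝟙 (repeated xs))
     ≤⟨ ℚ.+-monoʳ-≤ (i * ι l) (∫-repeated n l) ⟩
   i * ι l + ι l * ι l * i
     ≤⟨ ≤-by (i * ι l + i) (+-nonneg (*-nonneg (inv-nonneg (suc n)) (ι-nonneg l)) (inv-nonneg (suc n))) (trans (cong (λ z → z * z * i) (ι-suc l)) (lem i (ι l))) ⟩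
   ι (suc l) * ι (suc l) * i ∎
   where
   open ℚ.≤-Reasoning
   U = unif (suc n)
   P = power U l
   i = inv (suc n)
   lem : ∀ i x → (1ℚ + x) * (1ℚ + x) * i ≡ i * x + x * x * i + (i * x + i)
   lem = solve-∀ ringℚ
   lem₂ : ∀ a → a + 0ℚ ≡ 0ℚ + a
   lem₂ = solve-∀ ringℚ
   ¬false⇒true : ∀ {b} → ¬ b ≡ false → b ≡ true
   ¬false⇒true {true}  h = refl
   ¬false⇒true {false} h = ⊥-elim (h refl)
   split : ∀ x (xs : Vec (Fin (suc n)) l) → 𝟙 (repeated (x ∷ xs)) ≤ 𝟙 (lookup (toSet xs) x) + 𝟙 (repeated xs)
   split x xs with lookup (toSet xs) x Bool.≟ false | distinct? xs
   ... | no h | d? = subst (λ b → 1ℚ ≤ 𝟙 b + _) (sym (¬false⇒true h)) (lem₃ d?)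
     where
     lem₃ : ∀ (d? : Dec (Distinct xs)) → 1ℚ ≤ 1ℚ + 𝟙 (not (does d?))
     lem₃ d? = ≤-by (𝟙 (not (does d?))) (𝟙-nonneg (not (does d?))) refl
   ... | yes h | yes _ = ≤-by (𝟙 (lookup (toSet xs) x)) (𝟙-nonneg (lookup (toSet xs) x)) (lem₂ (𝟙 (lookup (toSet xs) x)))
   ... | yes h | no _  = ≤-by (𝟙 (lookup (toSet xs) x)) (𝟙-nonneg (lookup (toSet xs) x)) (ℚ.+-comm (𝟙 (lookup (toSet xs) x)) 1ℚ)

 -- A comparison of sampling with and without replacement. A random tuple is permuted at random; if
 -- it has no repetition, its image has the same law as that of `p`, and otherwise F ≤ 1 is paid for
 -- with the probability of a repetition.
 ∫-perms-≥ : ∀ n (F : Vec (Fin (suc n)) l → ℚ) → (∀ xs → 0ℚ ≤ F xs) → (∀ xs → F xs ≤ 1ℚ) →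
   ∀ p → Distinct p →
   ∫ (power (unif (suc n)) l) F ≤ ∫ (perms (suc n)) (λ π → F (map (π ⟨$⟩ʳ_) p)) + ι l * ι l * inv (suc n)
 ∫-perms-≥ {l} n F F≥0 F≤1 p dp = begin
   ∫ P F
     ≡⟨ const (perms-prob (suc n)) _ ⟨
   ∫ S (λ π → ∫ P F)
     ≡⟨ ∫-cong S (λ π → ∫-power-map (unif (suc n)) (π ⟨$⟩ʳ_) (unif-permute π) l F) ⟨
   ∫ S (λ π → ∫ P (λ q → F (map (π ⟨$⟩ʳ_) q)))
     ≡⟨ ∫-swap S P _ ⟩
   ∫ P (λ q → ∫ S (λ π → F (map (π ⟨$⟩ʳ_) q)))
     ≤⟨ mono (power-prob (unif-prob n) l) _ _ bound ⟩
   ∫ P (λ q → v + 𝟙 (repeated q))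
     ≡⟨ const-+ (power-prob (unif-prob n) l) v (λ q → 𝟙 (repeated q)) ⟩
   v + ∫ P (λ q → 𝟙 (repeated q))
     ≤⟨ ℚ.+-monoʳ-≤ v (∫-repeated n l) ⟩
   v + ι l * ι l * inv (suc n) ∎
   where
   open ℚ.≤-Reasoning
   S = perms (suc n)
   P = power (unif (suc n)) l
   v = ∫ S (λ π → F (map (π ⟨$⟩ʳ_) p))
   bound : ∀ q → ∫ S (λ π → F (map (π ⟨$⟩ʳ_) q)) ≤ v + 𝟙 (repeated q)
   bound q with distinct? q
   ... | yes dq = ℚ.≤-reflexive (trans (∫-perms-tuple F q p dq dp) (sym (ℚ.+-identityʳ v)))
   ... | no _   = ℚ.≤-trans (≤-const (perms-prob (suc n)) 1ℚ (λ π → F≤1 _))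
     (≤-by v (nonneg (perms-prob (suc n)) _ (λ π → F≥0 _)) (ℚ.+-comm v 1ℚ))

-- Fourier analysis on the cube: extracting the part linear in every block.

module Cubes where

 open Measures
 open Rationals
 open Subsets
 open Probability
 open import Data.Bool using (not)
 import Data.Fin.Subset as Sub
 open import Data.List using ([]; _∷_)
 open import Data.List.Relation.Unary.All as All using (All; []; _∷_)
 import Data.List.Relation.Unary.All.Properties as All
 open import Data.Rational using (>-nonZero; _+_; _*_; _-_; -_; _≤_; _<_; ∣_∣)
 open import Data.Vec using (lookup)

 sg : Bool → ℚ
 sg false = 1ℚ
 sg true  = - 1ℚ

 sg² : ∀ b → sg b * sg b ≡ 1ℚ
 sg² false = refl
 sg² true  = refl

 ½-nonneg : 0ℚ ≤ ½
 ½-nonneg = ℚ.nonNegative⁻¹ ½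

 coin : Measure Bool
 coin = (½ , false) ∷ (½ , true) ∷ []

 ∫-coin : ∀ F → ∫ coin F ≡ ½ * (F false + F true)
 ∫-coin F = lem (F false) (F true)
   where
   lem : ∀ x y → ½ * x + (½ * y + 0ℚ) ≡ ½ * (x + y)
   lem = solve-∀ ringℚ

 coin-prob : Probability coin
 coin-prob .mono F G h = subst₂ _≤_ (sym (∫-coin F)) (sym (∫-coin G))
   (*-monoˡ ½ ½-nonneg (ℚ.+-mono-≤ (h false) (h true)))
 coin-prob .total = refl

 cube : ∀ m → Measure (Vec Bool m)
 cube = power coin

 cube-prob : ∀ m → Probability (cube m)
 cube-prob = power-prob coin-prob

 ∫-cube : ∀ m F → ∫ (cube (suc m)) F ≡
   ½ * (∫ (cube m) (λ x → F (false ∷ x)) + ∫ (cube m) (λ x → F (true ∷ x)))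
 ∫-cube m F = trans (∫-power coin m F) (∫-coin (λ b → ∫ (cube m) (λ x → F (b ∷ x))))

 -- The coordinates are independent and the i-th one equals s i with
 -- probability (1 + t) / 2.
 tilt : ℚ → Bool → Measure Bool
 tilt t b = (½ * (1ℚ + t) , b) ∷ (½ * (1ℚ - t) , not b) ∷ []

 opaque
   biased : ∀ {m} → ℚ → Vec Bool m → Measure (Vec Bool m)
   biased t []      = dirac []
   biased t (b ∷ s) = tilt t b ⟫= λ c → push (c ∷_) (biased t s)

   ∫-biased-[] : ∀ t F → ∫ (biased t []) F ≡ F []
   ∫-biased-[] t F = ∫-dirac [] F

   ∫-biased : ∀ {m} t b (s : Vec Bool m) F → ∫ (biased t (b ∷ s)) F ≡
     ∫ (tilt t b) (λ c → ∫ (biased t s) (λ x → F (c ∷ x)))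
   ∫-biased t b s F = trans (∫-bind (tilt t b) (λ c → push (c ∷_) (biased t s)) F)
     (∫-cong (tilt t b) (λ c → ∫-push (c ∷_) (biased t s) F))

   biased-prob : ∀ {m t} → 0ℚ ≤ t → t ≤ 1ℚ → (s : Vec Bool m) → Probability (biased t s)
   biased-prob 0≤t t≤1 []      = dirac-prob []
   biased-prob {t = t} 0≤t t≤1 (b ∷ s) = bind-prob tilt-prob (λ c → push-prob (c ∷_) (biased-prob 0≤t t≤1 s))
     where
     tilt-prob : Probability (tilt t b)
     tilt-prob .mono F G h = ℚ.+-mono-≤
       (*-monoˡ (½ * (1ℚ + t)) (*-nonneg ½-nonneg (+-nonneg 0≤1 0≤t)) (h b))
       (ℚ.+-monoˡ-≤ 0ℚ (*-monoˡ (½ * (1ℚ - t)) (*-nonneg ½-nonneg (0≤q-p t≤1)) (h (not b))))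
     tilt-prob .total = lem t
       where
       lem : ∀ t → ½ * (1ℚ + t) * 1ℚ + (½ * (1ℚ - t) * 1ℚ + 0ℚ) ≡ 1ℚ
       lem = solve-∀ ringℚ

 evenPart oddPart : ∀ {m} → Bool → (Vec Bool (suc m) → ℚ) → Vec Bool m → ℚ
 evenPart b F x = ½ * (F (b ∷ x) + F (not b ∷ x))
 oddPart  b F x = ½ * (F (b ∷ x) - F (not b ∷ x))

 shift : (ℕ → ℚ) → ℕ → ℚ
 shift c zero    = 0ℚ
 shift c (suc j) = c j

 -- The homogeneous part of degree j of (the multilinear extension of) F, at the
 -- sign vector s.
 coef : ∀ {m} → (Vec Bool m → ℚ) → Vec Bool m → ℕ → ℚ
 coef F []      zero    = F []
 coef F []      (suc j) = 0ℚ
 coef F (b ∷ s) j       = coef (evenPart b F) s j + shift (coef (oddPart b F) s) j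

 poly : ℚ → (ℕ → ℚ) → ℕ → ℚ
 poly t c zero    = c zero
 poly t c (suc k) = c zero + t * poly t (λ j → c (suc j)) k

 poly-cong : ∀ t {c d} k → (∀ j → c j ≡ d j) → poly t c k ≡ poly t d k
 poly-cong t zero    h = h zero
 poly-cong t (suc k) h = cong₂ _+_ (h zero) (cong (t *_) (poly-cong t k (λ j → h (suc j))))

 poly-+ : ∀ t c d k → poly t (λ j → c j + d j) k ≡ poly t c k + poly t d k
 poly-+ t c d zero    = refl
 poly-+ t c d (suc k) = trans (cong (λ z → c zero + d zero + t * z) (poly-+ t _ _ k))
   (lem (c zero) (d zero) t (poly t (λ j → c (suc j)) k) (poly t (λ j → d (suc j)) k))
   where
   lem : ∀ a b t x y → a + b + t * (x + y) ≡ a + t * x + (b + t * y)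
   lem = solve-∀ ringℚ

 poly-0 : ∀ t k → poly t (λ _ → 0ℚ) k ≡ 0ℚ
 poly-0 t zero    = refl
 poly-0 t (suc k) = trans (cong (λ z → 0ℚ + t * z) (poly-0 t k)) (lem t)
   where
   lem : ∀ t → 0ℚ + t * 0ℚ ≡ 0ℚ
   lem = solve-∀ ringℚ

 coef-cong : ∀ {m} {F G : Vec Bool m → ℚ} → (∀ x → F x ≡ G x) → ∀ s j → coef F s j ≡ coef G s j
 coef-cong h []      zero    = h []
 coef-cong h []      (suc j) = refl
 coef-cong {F = F} {G} h (b ∷ s) j = cong₂ _+_ (coef-cong (λ x → cong (½ *_) (cong₂ _+_ (h _) (h _))) s j) (tail j)
   where
   tail : ∀ j → shift (coef (oddPart b F) s) j ≡ shift (coef (oddPart b G) s) j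
   tail zero    = refl
   tail (suc j) = coef-cong (λ x → cong (½ *_) (cong₂ _-_ (h (b ∷ x)) (h (not b ∷ x)))) s j

 coef-0 : ∀ {m} (s : Vec Bool m) j → coef (λ _ → 0ℚ) s j ≡ 0ℚ
 coef-0 []      zero    = refl
 coef-0 []      (suc j) = refl
 coef-0 (b ∷ s) zero    = trans (ℚ.+-identityʳ _) (trans (coef-cong (λ x → refl) s zero) (coef-0 s zero))
 coef-0 (b ∷ s) (suc j) = cong₂ _+_ (trans (coef-cong (λ x → refl) s (suc j)) (coef-0 s (suc j)))
   (trans (coef-cong (λ x → refl) s j) (coef-0 s j))

 DependsOn : ∀ {m} → Subset m → (Vec Bool m → ℚ) → Set
 DependsOn J F = ∀ x y → (∀ i → lookup J i ≡ true → lookup x i ≡ lookup y i) → F x ≡ F y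

 dependsOn-∷ : ∀ {m} {J : Subset m} {a F} → DependsOn (a ∷ J) F → ∀ b → DependsOn J (λ x → F (b ∷ x))
 dependsOn-∷ h b x y e = h (b ∷ x) (b ∷ y) (λ { zero _ → refl ; (suc i) j → e i j })

 -- Under `biased t s` the i-th sign has mean t times that of s, so the integral of F is its
 -- multilinear extension at t · s. In t this is a polynomial whose degree is at most the number of
 -- coordinates that F sees.
 ∫-biased-poly : ∀ {m} t (s : Vec Bool m) J F → DependsOn J F → ∀ k → Sub.∣ J ∣ ℕ.≤ k →
   ∫ (biased t s) F ≡ poly t (coef F s) k
 ∫-biased-poly t [] [] F h zero    le = ∫-biased-[] t F
 ∫-biased-poly t [] [] F h (suc k) le = trans (∫-biased-[] t F)
   (sym (trans (cong (λ z → F [] + t * z) (poly-0 t k)) (lem (F []) t)))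
   where
   lem : ∀ a t → a + t * 0ℚ ≡ a
   lem = solve-∀ ringℚ
 ∫-biased-poly {suc m} t (b ∷ s) (a ∷ J) F h k le = begin
   ∫ (biased t (b ∷ s)) F
     ≡⟨ ∫-biased t b s F ⟩
   ½ * (1ℚ + t) * X + (½ * (1ℚ - t) * Y + 0ℚ)
     ≡⟨ lem t X Y ⟩
   ½ * (X + Y) + t * (½ * (X - Y))
     ≡⟨ cong₂ _+_ (trans (cong (½ *_) (sym (∫-+ M _ _))) (sym (∫-*ˡ M ½ _)))
          (cong (t *_) (trans (cong (½ *_) (sym (∫-- M _ _))) (sym (∫-*ˡ M ½ _)))) ⟩
   ∫ M (evenPart b F) + t * ∫ M (oddPart b F)
     ≡⟨ parts a k le h ⟩
   poly t (coef (evenPart b F) s) k + poly t (shift (coef (oddPart b F) s)) k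
     ≡⟨ poly-+ t _ _ k ⟨
   poly t (coef F (b ∷ s)) k ∎
   where
   open ≡-Reasoning
   M = biased t s
   X = ∫ M (λ x → F (b ∷ x))
   Y = ∫ M (λ x → F (not b ∷ x))
   lem : ∀ t x y → ½ * (1ℚ + t) * x + (½ * (1ℚ - t) * y + 0ℚ) ≡ ½ * (x + y) + t * (½ * (x - y))
   lem = solve-∀ ringℚ
   even : ∀ {a} → DependsOn (a ∷ J) F → DependsOn J (evenPart b F)
   even h x y e = cong (½ *_) (cong₂ _+_ (dependsOn-∷ h b x y e) (dependsOn-∷ h (not b) x y e))
   odd : ∀ {a} → DependsOn (a ∷ J) F → DependsOn J (oddPart b F)
   odd h x y e = cong (½ *_) (cong₂ _-_ (dependsOn-∷ h b x y e) (dependsOn-∷ h (not b) x y e))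
   shift-0 : ∀ {c : ℕ → ℚ} → (∀ j → c j ≡ 0ℚ) → ∀ j → shift c j ≡ 0ℚ
   shift-0 h zero    = refl
   shift-0 h (suc j) = h j
   lem₂ : ∀ x y t → x + t * y ≡ x + (0ℚ + t * y)
   lem₂ = solve-∀ ringℚ
   lem₃ : ∀ x t → x + t * 0ℚ ≡ x + 0ℚ
   lem₃ = solve-∀ ringℚ
   half-self : ∀ x → ½ * (x - x) ≡ 0ℚ
   half-self = solve-∀ ringℚ
   -- A coordinate in J raises the degree by one; for a coordinate outside J the odd part vanishes
   -- and the degree is unchanged.
   parts : ∀ a k → Sub.∣ a ∷ J ∣ ℕ.≤ k → DependsOn (a ∷ J) F →
     ∫ M (evenPart b F) + t * ∫ M (oddPart b F) ≡
     poly t (coef (evenPart b F) s) k + poly t (shift (coef (oddPart b F) s)) k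
   parts true (suc k) (ℕ.s≤s le) h = trans
     (cong₂ (λ x y → x + t * y) (∫-biased-poly t s J _ (even h) (suc k) (ℕ.m≤n⇒m≤1+n le))
       (∫-biased-poly t s J _ (odd h) k le))
     (lem₂ (poly t (coef (evenPart b F) s) (suc k)) (poly t (coef (oddPart b F) s) k) t)
   parts false k le h = trans
     (cong₂ (λ x y → x + t * y) (∫-biased-poly t s J _ (even h) k le) (∫-≡0 M zero-odd))
     (trans (lem₃ (poly t (coef (evenPart b F) s) k) t)
       (cong (poly t (coef (evenPart b F) s) k +_)
         (sym (trans (poly-cong t k (shift-0 (λ j → trans (coef-cong zero-odd s j) (coef-0 s j)))) (poly-0 t k)))))
     where
     zero-odd : ∀ x → oddPart b F x ≡ 0ℚ
     zero-odd x = trans (cong (λ z → ½ * (z - F (not b ∷ x)))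
       (h (b ∷ x) (not b ∷ x) (λ { (suc i) _ → refl }))) (half-self (F (not b ∷ x)))

 coef-zero : ∀ {m} (F : Vec Bool m → ℚ) s → coef F s 0 ≡ ∫ (cube m) F
 coef-zero F [] = sym (∫-power-[] coin F)
 coef-zero {suc m} F (b ∷ s) = trans (ℚ.+-identityʳ _) (trans (coef-zero (evenPart b F) s)
   (trans (∫-*ˡ (cube m) ½ _) (trans (cong (½ *_) (∫-+ (cube m) _ _)) (trans (swap b) (sym (∫-cube m F))))))
   where
   swap : ∀ b → ½ * (∫ (cube m) (λ x → F (b ∷ x)) + ∫ (cube m) (λ x → F (not b ∷ x))) ≡
     ½ * (∫ (cube m) (λ x → F (false ∷ x)) + ∫ (cube m) (λ x → F (true ∷ x)))
   swap false = refl
   swap true  = cong (½ *_) (ℚ.+-comm (∫ (cube m) (λ x → F (true ∷ x))) _)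

 dot : ∀ {m} → Vec Bool m → Vec Bool m → ℚ
 dot s x = sum (λ i → sg (lookup s i) * sg (lookup x i))

 -- The linear part at s is the sum of sᵢ times the i-th Fourier coefficient; `dot s` collects these
 -- characters in one integral.
 coef-one : ∀ {m} (F : Vec Bool m → ℚ) s → coef F s 1 ≡ ∫ (cube m) (λ x → dot s x * F x)
 coef-one F [] = sym (trans (∫-power-[] coin _) (ℚ.*-zeroˡ (F [])))
 coef-one {suc m} F (b ∷ s) = begin
   coef (evenPart b F) s 1 + coef (oddPart b F) s 0
     ≡⟨ cong₂ _+_ (coef-one (evenPart b F) s) (coef-zero (oddPart b F) s) ⟩
   ∫ M (λ x → dot s x * evenPart b F x) + ∫ M (oddPart b F)
     ≡⟨ ∫-+ M _ _ ⟨
   ∫ M (λ x → dot s x * evenPart b F x + oddPart b F x)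
     ≡⟨ ∫-cong M (λ x → pointwise b (dot s x) (λ b → F (b ∷ x))) ⟩
   ∫ M (λ x → ½ * (dot (b ∷ s) (false ∷ x) * F (false ∷ x) + dot (b ∷ s) (true ∷ x) * F (true ∷ x)))
     ≡⟨ trans (∫-*ˡ M ½ _) (cong (½ *_) (∫-+ M _ _)) ⟩
   ½ * (∫ M (λ x → dot (b ∷ s) (false ∷ x) * F (false ∷ x)) + ∫ M (λ x → dot (b ∷ s) (true ∷ x) * F (true ∷ x)))
     ≡⟨ ∫-cube m _ ⟨
   ∫ (cube (suc m)) (λ x → dot (b ∷ s) x * F x) ∎
   where
   open ≡-Reasoning
   M = cube m
   lem₁ : ∀ d f g → d * (½ * (f + g)) + ½ * (f - g) ≡ ½ * ((1ℚ * 1ℚ + d) * f + (1ℚ * (- 1ℚ) + d) * g)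
   lem₁ = solve-∀ ringℚ
   lem₂ : ∀ d f g → d * (½ * (g + f)) + ½ * (g - f) ≡ ½ * (((- 1ℚ) * 1ℚ + d) * f + ((- 1ℚ) * (- 1ℚ) + d) * g)
   lem₂ = solve-∀ ringℚ
   pointwise : ∀ b d (f : Bool → ℚ) → d * (½ * (f b + f (not b))) + ½ * (f b - f (not b)) ≡
     ½ * ((sg b * sg false + d) * f false + (sg b * sg true + d) * f true)
   pointwise false d f = lem₁ d (f false) (f true)
   pointwise true  d f = lem₂ d (f false) (f true)

 -- The range of t in which `biased t s` is a probability measure.
 Node : ℚ × ℚ → Set
 Node (_ , t) = 0ℚ ≤ t × t ≤ 1ℚ

 Extractor : ℕ → Measure ℚ → Set
 Extractor k Λ = All Node Λ × (∀ c → ∫ Λ (λ t → poly t c k) ≡ c 1)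

 2^ : ℕ → ℚ
 2^ zero    = 1ℚ
 2^ (suc k) = (1ℚ + 1ℚ) * 2^ k

 2^≥1 : ∀ k → 1ℚ ≤ 2^ k
 2^≥1 zero    = ℚ.≤-refl
 2^≥1 (suc k) = ℚ.≤-trans (2^≥1 k) (≤-by (2^ k) (ℚ.≤-trans 0≤1 (2^≥1 k)) (lem (2^ k)))
   where
   lem : ∀ x → (1ℚ + 1ℚ) * x ≡ x + x
   lem = solve-∀ ringℚ

 scale-nodes : ∀ c {L} → All Node L → All Node (scale c L)
 scale-nodes c []       = []
 scale-nodes c (p ∷ ps) = p ∷ scale-nodes c ps

 halve-nodes : ∀ {L} → All Node L → All Node (push (½ *_) L)
 halve-nodes [] = []
 halve-nodes {(_ , t) ∷ _} ((0≤t , t≤1) ∷ ps) =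
   (*-nonneg ½-nonneg 0≤t , ℚ.≤-trans (*-monoˡ ½ ½-nonneg t≤1) (≤-by ½ ½-nonneg refl)) ∷ halve-nodes ps

 -- Comparing the values of a polynomial at t / 2 and t eliminates its top
 -- coefficient.
 extractor : ∀ k → ∃[ Λ ] Extractor (suc k) Λ
 -- For a polynomial of degree one, p(1) - p(0).
 extractor zero = (1ℚ , 1ℚ) ∷ (- 1ℚ , 0ℚ) ∷ [] ,
   ((0≤1 , ℚ.≤-refl) ∷ (ℚ.≤-refl , 0≤1) ∷ []) , λ c → lem (c 0) (c 1)
   where
   lem : ∀ a b → 1ℚ * (a + 1ℚ * b) + ((- 1ℚ) * (a + 0ℚ * b) + 0ℚ) ≡ b
   lem = solve-∀ ringℚ
 extractor (suc k) with extractor k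
 ... | Λ , nodes , eq = scale a Λ′ , scale-nodes a (All.++⁺ (scale-nodes (2^ (suc (suc k))) (halve-nodes nodes)) (scale-nodes (- 1ℚ) nodes)) , extracts
   where
   open import Data.List using (_++_)
   -- In 2^(k+2) p(t/2) - p(t) the coefficient of t^j is multiplied by 2^(k+2-j) - 1: this is 0 for
   -- j = k + 2 and `d` for j = 1.
   d = 2^ (suc k) - 1ℚ
   0<d : 0ℚ < d
   0<d = ℚ.<-≤-trans 0<1 (≤-by (2^ k - 1ℚ + (2^ k - 1ℚ)) (+-nonneg (0≤q-p (2^≥1 k)) (0≤q-p (2^≥1 k))) (lem (2^ k)))
     where
     lem : ∀ x → (1ℚ + 1ℚ) * x - 1ℚ ≡ 1ℚ + (x - 1ℚ + (x - 1ℚ))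
     lem = solve-∀ ringℚ
   a = (Data.Rational.1/ d) {{>-nonZero 0<d}}
   Λ′ = scale (2^ (suc (suc k))) (push (½ *_) Λ) ++ scale (- 1ℚ) Λ
   damp : (ℕ → ℚ) → ℕ → ℕ → ℚ
   damp c k zero    = (2^ k - 1ℚ) * c 0
   damp c zero    (suc j) = 0ℚ
   damp c (suc k) (suc j) = damp (λ i → c (suc i)) k j
   eliminate : ∀ k c t → 2^ (suc k) * poly (½ * t) c (suc k) - poly t c (suc k) ≡ poly t (damp c (suc k)) k
   eliminate zero c t = lem (c 0) (c 1) t
     where
     lem : ∀ a b t → (1ℚ + 1ℚ) * 1ℚ * (a + ½ * t * b) - (a + t * b) ≡ ((1ℚ + 1ℚ) * 1ℚ - 1ℚ) * a
     lem = solve-∀ ringℚ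
   eliminate (suc k) c t = trans (lem (2^ (suc k)) (c 0) t (poly (½ * t) (λ i → c (suc i)) (suc k)) (poly t (λ i → c (suc i)) (suc k)))
     (cong (λ z → (2^ (suc (suc k)) - 1ℚ) * c 0 + t * z) (eliminate k (λ i → c (suc i)) t))
     where
     lem : ∀ p a t x y → (1ℚ + 1ℚ) * p * (a + ½ * t * x) - (a + t * y) ≡
       ((1ℚ + 1ℚ) * p - 1ℚ) * a + t * (p * x - y)
     lem = solve-∀ ringℚ
   extracts : ∀ c → ∫ (scale a Λ′) (λ t → poly t c (suc (suc k))) ≡ c 1
   extracts c = begin
     ∫ (scale a Λ′) p
       ≡⟨ ∫-scale a Λ′ p ⟩
     a * ∫ Λ′ p
       ≡⟨ cong (a *_) (trans (∫-++ (scale (2^ (suc (suc k))) (push (½ *_) Λ)) (scale (- 1ℚ) Λ) p)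
            (cong₂ _+_ (trans (∫-scale (2^ (suc (suc k))) (push (½ *_) Λ) p) (cong (2^ (suc (suc k)) *_) (∫-push (½ *_) Λ p)))
               (∫-scale (- 1ℚ) Λ p))) ⟩
     a * (2^ (suc (suc k)) * ∫ Λ (λ t → p (½ * t)) + (- 1ℚ) * ∫ Λ p)
       ≡⟨ cong (a *_) (trans (cong₂ _+_ (sym (∫-*ˡ Λ (2^ (suc (suc k))) _)) (lem (∫ Λ p))) (sym (∫-- Λ _ _))) ⟩
     a * ∫ Λ (λ t → 2^ (suc (suc k)) * p (½ * t) - p t)
       ≡⟨ cong (a *_) (trans (∫-cong Λ (eliminate (suc k) c)) (eq (damp c (suc (suc k))))) ⟩
     a * (d * c 1)
       ≡⟨ trans (sym (ℚ.*-assoc a d (c 1))) (trans (cong (_* c 1) (ℚ.*-inverseˡ d {{>-nonZero 0<d}})) (ℚ.*-identityˡ (c 1))) ⟩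
     c 1 ∎
     where
     open ≡-Reasoning
     p = λ t → poly t c (suc (suc k))
     lem : ∀ x → (- 1ℚ) * x ≡ - x
     lem = solve-∀ ringℚ

 ∫-bounded-nodes : ∀ {Λ} → All Node Λ → ∀ F D → (∀ t → 0ℚ ≤ t → t ≤ 1ℚ → ∣ F t ∣ ≤ D) → ∣ ∫ Λ F ∣ ≤ norm Λ * D
 ∫-bounded-nodes [] F D h = ℚ.≤-reflexive (sym (ℚ.*-zeroˡ D))
 ∫-bounded-nodes {(w , t) ∷ Λ} ((0≤t , t≤1) ∷ ps) F D h = begin
   ∣ w * F t + ∫ Λ F ∣         ≤⟨ ℚ.∣p+q∣≤∣p∣+∣q∣ (w * F t) (∫ Λ F) ⟩
   ∣ w * F t ∣ + ∣ ∫ Λ F ∣     ≡⟨ cong (_+ ∣ ∫ Λ F ∣) (ℚ.∣p*q∣≡∣p∣*∣q∣ w (F t)) ⟩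
   ∣ w ∣ * ∣ F t ∣ + ∣ ∫ Λ F ∣ ≤⟨ ℚ.+-mono-≤ (*-monoˡ ∣ w ∣ (ℚ.0≤∣p∣ w) (h t 0≤t t≤1)) (∫-bounded-nodes ps F D h) ⟩
   ∣ w ∣ * D + norm Λ * D      ≡⟨ ℚ.*-distribʳ-+ D ∣ w ∣ (norm Λ) ⟨
   (∣ w ∣ + norm Λ) * D        ∎
   where open ℚ.≤-Reasoning

 module Extraction (Λ : Measure ℚ) (m : ℕ) where

   Key : (Vec Bool m → ℚ) → Set
   Key F = ∀ s → ∫ Λ (λ t → ∫ (biased t s) F) ≡ ∫ (cube m) (λ x → dot s x * F x)

   junta-key : ∀ {k} → Extractor k Λ → ∀ J F → DependsOn J F → Sub.∣ J ∣ ℕ.≤ k → Key F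
   junta-key {k} (_ , eq) J F h le s =
     trans (∫-cong Λ (λ t → ∫-biased-poly t s J F h k le)) (trans (eq (coef F s)) (coef-one F s))

   -- Dependence on few coordinates is lost under averaging, but the identity is linear in F and
   -- survives. The overlap of two hypergraphs is such an average of functions of few signs.
   ∫-key : ∀ {A : Set} (L : Measure A) (F : A → Vec Bool m → ℚ) → (∀ a → Key (F a)) →
     Key (λ x → ∫ L (λ a → F a x))
   ∫-key L F h s = begin
     ∫ Λ (λ t → ∫ (biased t s) (λ x → ∫ L (λ a → F a x)))
       ≡⟨ ∫-cong Λ (λ t → ∫-swap (biased t s) L _) ⟩
     ∫ Λ (λ t → ∫ L (λ a → ∫ (biased t s) (F a)))
       ≡⟨ ∫-swap Λ L _ ⟩
     ∫ L (λ a → ∫ Λ (λ t → ∫ (biased t s) (F a)))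
       ≡⟨ ∫-cong L (λ a → h a s) ⟩
     ∫ L (λ a → ∫ (cube m) (λ x → dot s x * F a x))
       ≡⟨ ∫-swap L (cube m) _ ⟩
     ∫ (cube m) (λ x → ∫ L (λ a → dot s x * F a x))
       ≡⟨ ∫-cong (cube m) (λ x → ∫-*ˡ L (dot s x) (λ a → F a x)) ⟩
     ∫ (cube m) (λ x → dot s x * ∫ L (λ a → F a x)) ∎
     where open ≡-Reasoning

   -- The condition concerns one block at a time with the others frozen, so that `extract` can treat
   -- the blocks successively.
   Good : ∀ {r} → (Vec (Vec Bool m) r → ℚ) → Set
   Good F = ∀ j xs → Key (λ x → F (xs Vec.[ j ]≔ x))

   cubes : ∀ r → Measure (Vec (Vec Bool m) r)
   cubes = power (cube m)

   cubes-prob : ∀ r → Probability (cubes r)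
   cubes-prob = power-prob (cube-prob m)

   kernel : ∀ {r} → Vec (Vec Bool m) r → Vec (Vec Bool m) r → ℚ
   kernel []       []       = 1ℚ
   kernel (s ∷ ss) (x ∷ xs) = dot s x * kernel ss xs

   extract : ∀ {r} → Vec (Vec Bool m) r → (Vec (Vec Bool m) r → ℚ) → ℚ
   extract []       F = F []
   extract (s ∷ ss) F = ∫ Λ (λ t → ∫ (biased t s) (λ x → extract ss (λ xs → F (x ∷ xs))))

   extract-bounded : All Node Λ → ∀ {r} ss (F : Vec (Vec Bool m) r → ℚ) D → (∀ xs → ∣ F xs ∣ ≤ D) →
     ∣ extract ss F ∣ ≤ norm Λ ^ r * D
   extract-bounded nodes []       F D h = ℚ.≤-trans (h []) (ℚ.≤-reflexive (sym (ℚ.*-identityˡ D)))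
   extract-bounded nodes {suc r} (s ∷ ss) F D h = ℚ.≤-trans
     (∫-bounded-nodes nodes _ (norm Λ ^ r * D) (λ t 0≤t t≤1 →
       ℚ.≤-trans (∣∣-≤ (biased-prob 0≤t t≤1 s) _) (≤-const (biased-prob 0≤t t≤1 s) _
         (λ x → extract-bounded nodes ss (λ xs → F (x ∷ xs)) D (λ xs → h (x ∷ xs))))))
     (ℚ.≤-reflexive (sym (ℚ.*-assoc (norm Λ) (norm Λ ^ r) D)))

   extract-kernel : ∀ {r} ss (F : Vec (Vec Bool m) r → ℚ) → Good F →
     extract ss F ≡ ∫ (cubes r) (λ xs → kernel ss xs * F xs)
   extract-kernel []       F G = sym (trans (∫-power-[] (cube m) _) (ℚ.*-identityˡ (F [])))
   extract-kernel {suc r} (s ∷ ss) F G = begin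
     ∫ Λ (λ t → ∫ (biased t s) (λ x → extract ss (λ xs → F (x ∷ xs))))
       ≡⟨ ∫-cong Λ (λ t → ∫-cong (biased t s) (λ x → extract-kernel ss (λ xs → F (x ∷ xs)) (λ j xs → G (suc j) (x ∷ xs)))) ⟩
     ∫ Λ (λ t → ∫ (biased t s) (λ x → ∫ C (λ xs → kernel ss xs * F (x ∷ xs))))
       ≡⟨ ∫-cong Λ (λ t → trans (∫-swap (biased t s) C _) (∫-cong C (λ xs → ∫-*ˡ (biased t s) (kernel ss xs) _))) ⟩
     ∫ Λ (λ t → ∫ C (λ xs → kernel ss xs * ∫ (biased t s) (λ x → F (x ∷ xs))))
       ≡⟨ trans (∫-swap Λ C _) (∫-cong C (λ xs → ∫-*ˡ Λ (kernel ss xs) _)) ⟩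
     ∫ C (λ xs → kernel ss xs * ∫ Λ (λ t → ∫ (biased t s) (λ x → F (x ∷ xs))))
       -- The entry `s` given to `G` is a placeholder; the update at position 0 overwrites it.
       ≡⟨ ∫-cong C (λ xs → cong (kernel ss xs *_) (G zero (s ∷ xs) s)) ⟩
     ∫ C (λ xs → kernel ss xs * ∫ (cube m) (λ x → dot s x * F (x ∷ xs)))
       ≡⟨ ∫-cong C (λ xs → trans (sym (∫-*ˡ (cube m) (kernel ss xs) _))
            (∫-cong (cube m) (λ x → lem (kernel ss xs) (dot s x) (F (x ∷ xs))))) ⟩
     ∫ C (λ xs → ∫ (cube m) (λ x → dot s x * kernel ss xs * F (x ∷ xs)))
       ≡⟨ trans (∫-swap C (cube m) _) (sym (∫-power (cube m) r _)) ⟩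
     ∫ (cubes (suc r)) (λ xs → kernel (s ∷ ss) xs * F xs) ∎
     where
     open ≡-Reasoning
     C = cubes r
     lem : ∀ a b c → a * (b * c) ≡ b * a * c
     lem = solve-∀ ringℚ

   χ : ∀ {r} → Vec (Fin m) r → Vec (Vec Bool m) r → ℚ
   χ []      []       = 1ℚ
   χ (i ∷ I) (x ∷ xs) = sg (lookup x i) * χ I xs

   form : ∀ {r} → (Vec (Fin m) r → ℚ) → Vec (Vec Bool m) r → ℚ
   form c []       = c []
   form c (s ∷ ss) = sum (λ i → sg (lookup s i) * form (λ I → c (i ∷ I)) ss)

   form-cong : ∀ {r} {c d : Vec (Fin m) r → ℚ} → (∀ I → c I ≡ d I) → ∀ ss → form c ss ≡ form d ss
   form-cong h []       = h []
   form-cong h (s ∷ ss) = sum-cong (λ i → cong (sg (lookup s i) *_) (form-cong (λ I → h (i ∷ I)) ss))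

   form-*ˡ : ∀ {r} a (c : Vec (Fin m) r → ℚ) ss → form (λ I → a * c I) ss ≡ a * form c ss
   form-*ˡ a c []       = refl
   form-*ˡ a c (s ∷ ss) = trans (sum-cong (λ i → trans (cong (sg (lookup s i) *_) (form-*ˡ a (λ I → c (i ∷ I)) ss))
     (lem (sg (lookup s i)) a (form (λ I → c (i ∷ I)) ss)))) (sum-*ˡ {m} a _)
     where
     lem : ∀ x y z → x * (y * z) ≡ y * (x * z)
     lem = solve-∀ ringℚ

   ∫-form : ∀ {A : Set} (L : Measure A) {r} (c : A → Vec (Fin m) r → ℚ) ss →
     ∫ L (λ a → form (c a) ss) ≡ form (λ I → ∫ L (λ a → c a I)) ss
   ∫-form L c []       = refl
   ∫-form L c (s ∷ ss) = trans (∫-sum L {m} (λ i a → sg (lookup s i) * form (λ I → c a (i ∷ I)) ss)) (sum-cong (λ i → trans (∫-*ˡ L (sg (lookup s i)) _)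
     (cong (sg (lookup s i) *_) (∫-form L (λ a I → c a (i ∷ I)) ss))))

   kernel-form : ∀ {r} (ss xs : Vec (Vec Bool m) r) → kernel ss xs ≡ form (λ I → χ I xs) ss
   kernel-form []       []       = refl
   kernel-form (s ∷ ss) (x ∷ xs) = begin
     dot s x * kernel ss xs
       ≡⟨ ℚ.*-comm (dot s x) (kernel ss xs) ⟩
     kernel ss xs * dot s x
       ≡⟨ sum-*ˡ {m} (kernel ss xs) _ ⟨
     sum (λ i → kernel ss xs * (sg (lookup s i) * sg (lookup x i)))
       ≡⟨ sum-cong (λ i → trans (lem (kernel ss xs) (sg (lookup s i)) (sg (lookup x i)))
            (cong (sg (lookup s i) *_) (trans (cong (sg (lookup x i) *_) (kernel-form ss xs))
              (sym (form-*ˡ (sg (lookup x i)) (λ I → χ I xs) ss))))) ⟩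
     sum (λ i → sg (lookup s i) * form (λ I → sg (lookup x i) * χ I xs) ss) ∎
     where
     open ≡-Reasoning
     lem : ∀ a b c → a * (b * c) ≡ b * (c * a)
     lem = solve-∀ ringℚ

   fourier : ∀ {r} → (Vec (Vec Bool m) r → ℚ) → Vec (Fin m) r → ℚ
   fourier {r} F I = ∫ (cubes r) (λ xs → χ I xs * F xs)

   -- `extract` is a combination of values of F with total weight at most `norm Λ ^ r`, a constant
   -- independent of m. On the other hand it computes the multilinear form whose coefficients are
   -- the Fourier coefficients with one sign from each block.
   form-bounded : ∀ {k} → Extractor k Λ → ∀ {r} (F : Vec (Vec Bool m) r → ℚ) D → Good F → (∀ xs → ∣ F xs ∣ ≤ D) →
     ∀ ss → ∣ form (fourier F) ss ∣ ≤ norm Λ ^ r * D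
   form-bounded (nodes , _) {r} F D G h ss = subst (λ z → ∣ z ∣ ≤ norm Λ ^ r * D) eq (extract-bounded nodes ss F D h)
     where
     eq : extract ss F ≡ form (fourier F) ss
     eq = trans (extract-kernel ss F G) (trans
       (∫-cong (cubes r) (λ xs → trans (cong (_* F xs) (kernel-form ss xs)) (trans (ℚ.*-comm _ (F xs))
         (trans (sym (form-*ˡ (F xs) (λ I → χ I xs) ss)) (form-cong (λ I → ℚ.*-comm (F xs) (χ I xs)) ss)))))
       (∫-form (cubes r) (λ xs I → χ I xs * F xs) ss))

-- Moments of random sign sums and lower bounds for multilinear forms.

module Khinchine where

 open Cubes
 open Measures
 open Rationals
 open Subsets
 open Probability
 open import Data.Rational using (_+_; _*_; _-_; -_; _≤_; ∣_∣)
 open import Data.Vec using (lookup; tabulate)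

 3ℚ : ℚ
 3ℚ = 1ℚ + 1ℚ + 1ℚ

 6ℚ : ℚ
 6ℚ = 3ℚ + 3ℚ

 0≤3 : 0ℚ ≤ 3ℚ
 0≤3 = +-nonneg (+-nonneg 0≤1 0≤1) 0≤1

 rademacher : ∀ {m} → (Fin m → ℚ) → Vec Bool m → ℚ
 rademacher u s = sum (λ i → sg (lookup s i) * u i)

 rademacher² : ∀ {m} (u : Fin m → ℚ) →
   ∫ (cube m) (λ s → rademacher u s * rademacher u s) ≡ sum (λ i → u i * u i)
 rademacher² {zero}  u = ∫-power-[] coin _
 rademacher² {suc m} u = begin
   ∫ (cube (suc m)) (λ s → rademacher u s * rademacher u s)
     ≡⟨ ∫-cube m _ ⟩
   ½ * (∫ M (λ s → (1ℚ * a + Y s) * (1ℚ * a + Y s)) + ∫ M (λ s → ((- 1ℚ) * a + Y s) * ((- 1ℚ) * a + Y s)))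
     ≡⟨ trans (cong (½ *_) (sym (∫-+ M _ _))) (sym (∫-*ˡ M ½ _)) ⟩
   ∫ M (λ s → ½ * ((1ℚ * a + Y s) * (1ℚ * a + Y s) + ((- 1ℚ) * a + Y s) * ((- 1ℚ) * a + Y s)))
     ≡⟨ ∫-cong M (λ s → lem a (Y s)) ⟩
   ∫ M (λ s → a * a + Y s * Y s)
     ≡⟨ const-+ (cube-prob m) (a * a) (λ s → Y s * Y s) ⟩
   a * a + ∫ M (λ s → Y s * Y s)
     ≡⟨ cong (a * a +_) (rademacher² (λ i → u (suc i))) ⟩
   sum (λ i → u i * u i) ∎
   where
   open ≡-Reasoning
   M = cube m
   a = u zero
   Y = rademacher (λ i → u (suc i))
   lem : ∀ a y → ½ * ((1ℚ * a + y) * (1ℚ * a + y) + ((- 1ℚ) * a + y) * ((- 1ℚ) * a + y)) ≡ a * a + y * y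
   lem = solve-∀ ringℚ

 fourth : ℚ → ℚ
 fourth x = x * x * (x * x)

 fourth-nonneg : ∀ x → 0ℚ ≤ fourth x
 fourth-nonneg x = square-nonneg (x * x)

 -- Averaged over one more sign, (±a + y)⁴ becomes y⁴ + 6a²y² + a⁴. The middle term matches that of
 -- 3(a² + V)², and a surplus of 2a⁴ is left.
 rademacher⁴ : ∀ {m} (u : Fin m → ℚ) →
   ∫ (cube m) (λ s → fourth (rademacher u s)) ≤ 3ℚ * (sum (λ i → u i * u i) * sum (λ i → u i * u i))
 rademacher⁴ {zero}  u = ℚ.≤-reflexive (∫-power-[] coin _)
 rademacher⁴ {suc m} u = begin
   ∫ (cube (suc m)) (λ s → fourth (rademacher u s))
     ≡⟨ ∫-cube m _ ⟩
   ½ * (∫ M (λ s → fourth (1ℚ * a + Y s)) + ∫ M (λ s → fourth ((- 1ℚ) * a + Y s)))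
     ≡⟨ trans (cong (½ *_) (sym (∫-+ M _ _))) (sym (∫-*ˡ M ½ _)) ⟩
   ∫ M (λ s → ½ * (fourth (1ℚ * a + Y s) + fourth ((- 1ℚ) * a + Y s)))
     ≡⟨ ∫-cong M (λ s → lem a (Y s)) ⟩
   ∫ M (λ s → fourth (Y s) + (6ℚ * (a * a) * (Y s * Y s) + fourth a))
     ≡⟨ trans (∫-+ M _ _) (cong (∫ M (λ s → fourth (Y s)) +_) (trans (+-const (cube-prob m) _ (fourth a))
          (cong (_+ fourth a) (∫-*ˡ M (6ℚ * (a * a)) _)))) ⟩
   ∫ M (λ s → fourth (Y s)) + (6ℚ * (a * a) * ∫ M (λ s → Y s * Y s) + fourth a)
     ≡⟨ cong (λ z → ∫ M (λ s → fourth (Y s)) + (6ℚ * (a * a) * z + fourth a)) (rademacher² (λ i → u (suc i))) ⟩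
   ∫ M (λ s → fourth (Y s)) + (6ℚ * (a * a) * V + fourth a)
     ≤⟨ ℚ.+-monoˡ-≤ (6ℚ * (a * a) * V + fourth a) (rademacher⁴ (λ i → u (suc i))) ⟩
   3ℚ * (V * V) + (6ℚ * (a * a) * V + fourth a)
     ≤⟨ ≤-by ((1ℚ + 1ℚ) * fourth a) (*-nonneg (+-nonneg 0≤1 0≤1) (fourth-nonneg a)) (lem₂ a V) ⟩
   3ℚ * ((a * a + V) * (a * a + V)) ∎
   where
   open ℚ.≤-Reasoning
   M = cube m
   a = u zero
   Y = rademacher (λ i → u (suc i))
   V = sum (λ i → u (suc i) * u (suc i))
   lem : ∀ a y → ½ * ((1ℚ * a + y) * (1ℚ * a + y) * ((1ℚ * a + y) * (1ℚ * a + y)) +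
       ((- 1ℚ) * a + y) * ((- 1ℚ) * a + y) * (((- 1ℚ) * a + y) * ((- 1ℚ) * a + y))) ≡
     y * y * (y * y) + ((1ℚ + 1ℚ + 1ℚ + (1ℚ + 1ℚ + 1ℚ)) * (a * a) * (y * y) + a * a * (a * a))
   lem = solve-∀ ringℚ
   lem₂ : ∀ a v → (1ℚ + 1ℚ + 1ℚ) * ((a * a + v) * (a * a + v)) ≡
     (1ℚ + 1ℚ + 1ℚ) * (v * v) + ((1ℚ + 1ℚ + 1ℚ + (1ℚ + 1ℚ + 1ℚ)) * (a * a) * v + a * a * (a * a)) + (1ℚ + 1ℚ) * (a * a * (a * a))
   lem₂ = solve-∀ ringℚ

 sum-+ : ∀ {m} (F G : Fin m → ℚ) → sum (λ i → F i + G i) ≡ sum F + sum G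
 sum-+ {zero}  F G = refl
 sum-+ {suc m} F G = trans (cong (F zero + G zero +_) (sum-+ (λ i → F (suc i)) (λ i → G (suc i))))
   (lem (F zero) (G zero) (sum (λ i → F (suc i))) (sum (λ i → G (suc i))))
   where
   lem : ∀ a b x y → a + b + (x + y) ≡ a + x + (b + y)
   lem = solve-∀ ringℚ

 cauchy-schwarz : ∀ {m} (a : Fin m → ℚ) → sum a * sum a ≤ ι m * sum (λ i → a i * a i)
 cauchy-schwarz {zero}  a = ℚ.≤-reflexive (trans (ℚ.*-zeroˡ 0ℚ) (sym (ℚ.*-zeroʳ (ι 0))))
 cauchy-schwarz {suc m} a = begin
   (x + A) * (x + A)
     ≡⟨ lem x A ⟩
   x * x + (x * A + x * A) + A * A
     ≤⟨ ℚ.+-monoʳ-≤ (x * x + (x * A + x * A)) (cauchy-schwarz (λ i → a (suc i))) ⟩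
   x * x + (x * A + x * A) + ι m * Q
     ≤⟨ ℚ.+-monoˡ-≤ (ι m * Q) (ℚ.+-monoʳ-≤ (x * x) cross) ⟩
   x * x + (ι m * (x * x) + Q) + ι m * Q
     ≡⟨ trans (lem₂ (ι m) (x * x) Q) (cong (_* (x * x + Q)) (sym (ι-suc m))) ⟩
   ι (suc m) * (x * x + Q) ∎
   where
   open ℚ.≤-Reasoning
   x = a zero
   A = sum (λ i → a (suc i))
   Q = sum (λ i → a (suc i) * a (suc i))
   lem : ∀ x A → (x + A) * (x + A) ≡ x * x + (x * A + x * A) + A * A
   lem = solve-∀ ringℚ
   lem₂ : ∀ n y q → y + (n * y + q) + n * q ≡ (1ℚ + n) * (y + q)
   lem₂ = solve-∀ ringℚ
   lem₃ : ∀ x y → x * x + y * y ≡ x * y + x * y + (x - y) * (x - y)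
   lem₃ = solve-∀ ringℚ
   cross : x * A + x * A ≤ ι m * (x * x) + Q
   cross = begin
     x * A + x * A
       ≡⟨ trans (sym (ℚ.*-distribˡ-+ x A A)) (trans (cong (x *_) (sym (sum-+ (λ i → a (suc i)) (λ i → a (suc i))))) (sym (sum-*ˡ x (λ i → a (suc i) + a (suc i))))) ⟩
     sum (λ i → x * (a (suc i) + a (suc i)))
       ≤⟨ sum-mono _ _ (λ i → ℚ.≤-trans (ℚ.≤-reflexive (ℚ.*-distribˡ-+ x (a (suc i)) (a (suc i))))
            (≤-by _ (square-nonneg (x - a (suc i))) (lem₃ x (a (suc i))))) ⟩
     sum (λ i → x * x + a (suc i) * a (suc i))
       ≡⟨ trans (sum-+ {m} (λ _ → x * x) (λ i → a (suc i) * a (suc i))) (cong (_+ Q) (sum-const m (x * x))) ⟩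
     ι m * (x * x) + Q ∎

 -- |u| ≥ u²/S − u⁴/S³, with denominators cleared.
 truncation : ∀ S u → 0ℚ ≤ S → S * S * (u * u) ≤ S * S * S * ∣ u ∣ + fourth u
 truncation S u 0≤S = subst₂ (λ x y → S * S * x ≤ S * S * S * a + y) (∣p∣²≡p² u) (cong₂ _*_ (∣p∣²≡p² u) (∣p∣²≡p² u)) bound
   where
   a = ∣ u ∣
   0≤a = ℚ.0≤∣p∣ u
   lem₁ : ∀ S a → S * S * S * a + a * a * (a * a) ≡ S * S * (a * a) + (S * S * a * (S - a) + a * a * (a * a))
   lem₁ = solve-∀ ringℚ
   lem₂ : ∀ S a → S * S * S * a + a * a * (a * a) ≡ S * S * (a * a) + (a * a * ((a - S) * (a + S)) + S * S * S * a)
   lem₂ = solve-∀ ringℚ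
   bound : S * S * (a * a) ≤ S * S * S * a + fourth a
   bound with ℚ.≤-total a S
   ... | inj₁ a≤S = ≤-by _ (+-nonneg (*-nonneg (*-nonneg (*-nonneg 0≤S 0≤S) 0≤a) (0≤q-p a≤S)) (fourth-nonneg a)) (lem₁ S a)
   ... | inj₂ S≤a = ≤-by _ (+-nonneg (*-nonneg (*-nonneg 0≤a 0≤a) (*-nonneg (0≤q-p S≤a) (+-nonneg 0≤a 0≤S)))
                       (*-nonneg (*-nonneg (*-nonneg 0≤S 0≤S) 0≤S) 0≤a)) (lem₂ S a)

 module Forms (Λ : Measure ℚ) (m : ℕ) where
   open Extraction Λ m

   ∑ᵛ : ∀ {r} → (Vec (Fin m) r → ℚ) → ℚ
   ∑ᵛ {zero}  F = F []
   ∑ᵛ {suc r} F = sum (λ i → ∑ᵛ (λ I → F (i ∷ I)))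

   ∑ᵛ-mono : ∀ {r} (F G : Vec (Fin m) r → ℚ) → (∀ I → F I ≤ G I) → ∑ᵛ F ≤ ∑ᵛ G
   ∑ᵛ-mono {zero}  F G h = h []
   ∑ᵛ-mono {suc r} F G h = sum-mono _ _ (λ i → ∑ᵛ-mono _ _ (λ I → h (i ∷ I)))

   ∑ᵛ-const : ∀ r c → ∑ᵛ {r} (λ _ → c) ≡ ι m ^ r * c
   ∑ᵛ-const zero    c = sym (ℚ.*-identityˡ c)
   ∑ᵛ-const (suc r) c = trans (sum-cong {m} (λ i → ∑ᵛ-const r c))
     (trans (sum-const m (ι m ^ r * c)) (sym (ℚ.*-assoc (ι m) (ι m ^ r) c)))

   ∫-∑ᵛ : ∀ {A : Set} (L : Measure A) {r} (F : A → Vec (Fin m) r → ℚ) →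
     ∫ L (λ a → ∑ᵛ (F a)) ≡ ∑ᵛ (λ I → ∫ L (λ a → F a I))
   ∫-∑ᵛ L {zero}  F = refl
   ∫-∑ᵛ L {suc r} F = trans (∫-sum L (λ i a → ∑ᵛ (λ I → F a (i ∷ I))))
     (sum-cong (λ i → ∫-∑ᵛ L (λ a I → F a (i ∷ I))))

   form² : ∀ {r} (c : Vec (Fin m) r → ℚ) →
     ∫ (cubes r) (λ ss → form c ss * form c ss) ≡ ∑ᵛ (λ I → c I * c I)
   form² {zero}  c = ∫-power-[] (cube m) _
   form² {suc r} c = begin
     ∫ (cubes (suc r)) (λ ss → form c ss * form c ss)
       ≡⟨ trans (∫-power (cube m) r _) (∫-swap (cube m) (cubes r) _) ⟩
     ∫ (cubes r) (λ ss → ∫ (cube m) (λ s → rademacher (λ i → form (λ I → c (i ∷ I)) ss) s * rademacher (λ i → form (λ I → c (i ∷ I)) ss) s))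
       ≡⟨ ∫-cong (cubes r) (λ ss → rademacher² (λ i → form (λ I → c (i ∷ I)) ss)) ⟩
     ∫ (cubes r) (λ ss → sum (λ i → form (λ I → c (i ∷ I)) ss * form (λ I → c (i ∷ I)) ss))
       ≡⟨ ∫-sum (cubes r) {m} (λ i ss → form (λ I → c (i ∷ I)) ss * form (λ I → c (i ∷ I)) ss) ⟩
     sum (λ i → ∫ (cubes r) (λ ss → form (λ I → c (i ∷ I)) ss * form (λ I → c (i ∷ I)) ss))
       ≡⟨ sum-cong (λ i → form² (λ I → c (i ∷ I))) ⟩
     ∑ᵛ (λ I → c I * c I) ∎
     where open ≡-Reasoning

   form⁴-bound : ℕ → ℚ → ℚ
   form⁴-bound zero    B = fourth B
   form⁴-bound (suc r) B = 3ℚ * (ι m * (ι m * form⁴-bound r B))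

   -- Each block contributes the constant 3 of `rademacher⁴` and two factors m: one from
   -- Cauchy-Schwarz applied to the squares, one from the sum over the pairs of the block.
   form⁴ : ∀ {r} (c : Vec (Fin m) r → ℚ) B → (∀ I → ∣ c I ∣ ≤ B) →
     ∫ (cubes r) (λ ss → fourth (form c ss)) ≤ form⁴-bound r B
   form⁴ {zero}  c B h = begin
     ∫ (cubes 0) (λ ss → fourth (form c ss)) ≡⟨ ∫-power-[] (cube m) _ ⟩
     fourth (c [])    ≡⟨ cong₂ _*_ (∣p∣²≡p² (c [])) (∣p∣²≡p² (c [])) ⟨
     fourth ∣ c [] ∣  ≤⟨ *-mono (square-nonneg ∣ c [] ∣) (square-nonneg B) sq sq ⟩
     fourth B         ∎
     where
     open ℚ.≤-Reasoning
     sq : ∣ c [] ∣ * ∣ c [] ∣ ≤ B * B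
     sq = *-mono (ℚ.0≤∣p∣ (c [])) (ℚ.≤-trans (ℚ.0≤∣p∣ (c [])) (h [])) (h []) (h [])
   form⁴ {suc r} c B h = begin
     ∫ (cubes (suc r)) (λ ss → fourth (form c ss))
       ≡⟨ trans (∫-power (cube m) r _) (∫-swap (cube m) (cubes r) _) ⟩
     ∫ (cubes r) (λ ss → ∫ (cube m) (λ s → fourth (rademacher (u ss) s)))
       ≤⟨ mono (cubes-prob r) _ _ (λ ss → ℚ.≤-trans (rademacher⁴ (u ss)) (*-monoˡ 3ℚ 0≤3 (cauchy-schwarz (λ i → u ss i * u ss i)))) ⟩
     ∫ (cubes r) (λ ss → 3ℚ * (ι m * sum (λ i → fourth (u ss i))))
       ≡⟨ trans (∫-*ˡ (cubes r) 3ℚ _) (cong (3ℚ *_) (trans (∫-*ˡ (cubes r) (ι m) _)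
            (cong (ι m *_) (∫-sum (cubes r) {m} (λ i ss → fourth (u ss i)))))) ⟩
     3ℚ * (ι m * sum (λ i → ∫ (cubes r) (λ ss → fourth (u ss i))))
       ≤⟨ *-monoˡ 3ℚ 0≤3 (*-monoˡ (ι m) (ι-nonneg m) (sum-mono _ _ (λ i → form⁴ (λ I → c (i ∷ I)) B (λ I → h (i ∷ I))))) ⟩
     3ℚ * (ι m * sum {m} (λ i → form⁴-bound r B))
       ≡⟨ cong (λ z → 3ℚ * (ι m * z)) (sum-const m (form⁴-bound r B)) ⟩
     3ℚ * (ι m * (ι m * form⁴-bound r B)) ∎
     where
     open ℚ.≤-Reasoning
     u : Vec (Vec Bool m) r → Fin m → ℚ
     u ss i = form (λ I → c (i ∷ I)) ss

   form⁴-bound≡ : ∀ r B → form⁴-bound r B ≡ 3ℚ ^ r * ι m ^ (r ℕ.+ r) * fourth B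
   form⁴-bound≡ zero    B = lem (fourth B)
     where
     lem : ∀ x → x ≡ 1ℚ * 1ℚ * x
     lem = solve-∀ ringℚ
   form⁴-bound≡ (suc r) B = trans (cong (λ z → 3ℚ * (ι m * (ι m * z))) (form⁴-bound≡ r B))
     (trans (lem 3ℚ (ι m) (3ℚ ^ r) (ι m ^ (r ℕ.+ r)) (fourth B))
       (cong (λ z → 3ℚ * 3ℚ ^ r * (ι m * ι m ^ z) * fourth B) (sym (+-suc r r))))
     where
     open import Data.Nat.Properties using (+-suc)
     lem : ∀ t m a b c → t * (m * (m * (a * b * c))) ≡ t * a * (m * (m * b)) * c
     lem = solve-∀ ringℚ

   -- When the signs of the first block copy those of the inner forms, the whole form becomes the
   -- sum of their absolute values.
   ∑∣form∣ : ∀ {r} (c : Vec (Fin m) (suc r) → ℚ) D → (∀ ss → ∣ form c ss ∣ ≤ D) →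
     ∀ ss → sum (λ i → ∣ form (λ I → c (i ∷ I)) ss ∣) ≤ D
   ∑∣form∣ c D h ss = ℚ.≤-trans (ℚ.≤-reflexive (sum-cong signed))
     (ℚ.≤-trans (p≤∣p∣ (form c (s ∷ ss))) (h (s ∷ ss)))
     where
     u : Fin m → ℚ
     u i = form (λ I → c (i ∷ I)) ss
     sign : ℚ → Bool
     sign x with ℚ.≤-total 0ℚ x
     ... | inj₁ _ = false
     ... | inj₂ _ = true
     sign-* : ∀ x → ∣ x ∣ ≡ sg (sign x) * x
     sign-* x with ℚ.≤-total 0ℚ x
     ... | inj₁ 0≤x = trans (ℚ.0≤p⇒∣p∣≡p 0≤x) (sym (ℚ.*-identityˡ x))
     ... | inj₂ x≤0 = trans (sym (ℚ.∣-p∣≡∣p∣ x)) (trans (ℚ.0≤p⇒∣p∣≡p (neg-mono x≤0)) (lem x))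
       where
       lem : ∀ x → - x ≡ (- 1ℚ) * x
       lem = solve-∀ ringℚ
     s = tabulate (λ i → sign (u i))
     signed : ∀ i → ∣ u i ∣ ≡ sg (lookup s i) * u i
     signed i = trans (sign-* (u i)) (cong (λ b → sg b * u i) (sym (Vec.lookup∘tabulate (λ i → sign (u i)) i)))

   -- The signs of the first block are chosen greedily, those of the others at
   -- random.
   form-lower : ∀ {r} (c : Vec (Fin m) (suc r) → ℚ) B D S → 0ℚ ≤ S → (∀ I → ∣ c I ∣ ≤ B) →
     (∀ ss → ∣ form c ss ∣ ≤ D) →
     S * S * ∑ᵛ (λ I → c I * c I) ≤ S * S * S * D + 3ℚ ^ r * ι m ^ suc (r ℕ.+ r) * fourth B
   form-lower {r} c B D S 0≤S hB hD = begin
     S * S * ∑ᵛ (λ I → c I * c I)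
       ≡⟨ trans (sym (sum-*ˡ (S * S) (λ i → ∑ᵛ (λ I → c (i ∷ I) * c (i ∷ I)))))
            (sum-cong (λ i → trans (cong (S * S *_) (sym (form² (λ I → c (i ∷ I))))) (sym (∫-*ˡ C (S * S) _)))) ⟩
     sum (λ i → ∫ C (λ ss → S * S * (u ss i * u ss i)))
       -- Khinchine's inequality in a form without roots: `S` is the scale of the truncation and
       -- remains free until the constants are fixed.
       ≤⟨ sum-mono _ _ (λ i → mono (cubes-prob r) _ _ (λ ss → truncation S (u ss i) 0≤S)) ⟩
     sum (λ i → ∫ C (λ ss → S * S * S * ∣ u ss i ∣ + fourth (u ss i)))
       ≡⟨ trans (sum-cong (λ i → trans (∫-+ C _ _) (cong (_+ ∫ C (λ ss → fourth (u ss i))) (∫-*ˡ C (S * S * S) _))))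
            (trans (sum-+ (λ i → S * S * S * ∫ C (λ ss → ∣ u ss i ∣)) (λ i → ∫ C (λ ss → fourth (u ss i))))
              (cong (_+ sum (λ i → ∫ C (λ ss → fourth (u ss i)))) (trans (sum-*ˡ {m} (S * S * S) (λ i → ∫ C (λ ss → ∣ u ss i ∣)))
                (cong (S * S * S *_) (sym (∫-sum C {m} (λ i ss → ∣ u ss i ∣))))))) ⟩
     S * S * S * ∫ C (λ ss → sum (λ i → ∣ u ss i ∣)) + sum (λ i → ∫ C (λ ss → fourth (u ss i)))
       ≤⟨ ℚ.+-mono-≤ (*-monoˡ (S * S * S) (*-nonneg (*-nonneg 0≤S 0≤S) 0≤S)
              (≤-const (cubes-prob r) D (∑∣form∣ c D hD)))
            (sum-mono _ _ (λ i → form⁴ (λ I → c (i ∷ I)) B (λ I → hB (i ∷ I)))) ⟩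
     S * S * S * D + sum {m} (λ i → form⁴-bound r B)
       ≡⟨ cong (S * S * S * D +_) (trans (sum-const m _) (trans (cong (ι m *_) (form⁴-bound≡ r B))
            (lem (ι m) (3ℚ ^ r) (ι m ^ (r ℕ.+ r)) (fourth B)))) ⟩
     S * S * S * D + 3ℚ ^ r * ι m ^ suc (r ℕ.+ r) * fourth B ∎
     where
     open ℚ.≤-Reasoning
     C = cubes r
     u : Vec (Vec Bool m) r → Fin m → ℚ
     u ss i = form (λ I → c (i ∷ I)) ss
     lem : ∀ m a b c → m * (a * b * c) ≡ a * (m * b) * c
     lem = solve-∀ ringℚ

-- Blocks of disjoint pairs of vertices and their random flips.

module Blocks where

 open Cubes
 open Measures
 open Permutations
 open Rationals
 open Subsets
 open Probability
 open import Data.Bool using (not; _∨_; _xor_)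
 open import Data.Fin using (inject≤; remQuot)
 open import Data.Fin.Permutation using (permutation)
 open import Data.Fin.Subset using (∣_∣)
 open import Data.Maybe using (Maybe; just; nothing)
 open import Data.Rational using (_+_; _*_; _-_; -_; _≤_)
 open import Data.Vec using (lookup; map; updateAt)

 -- `point` is injective because `locate` inverts it; vertices outside the pairs are located at
 -- `nothing` and are fixed by every flip.
 record Pairing (n r m : ℕ) : Set where
   field
     point   : Fin r → Fin m → Bool → Fin n
     locate  : Fin n → Maybe (Fin r × Fin m × Bool)
     locate-point : ∀ j i b → locate (point j i b) ≡ just (j , i , b)
     point-locate : ∀ {x j i b} → locate x ≡ just (j , i , b) → point j i b ≡ x

 pairing : ∀ {n} r m → r ℕ.* m ℕ.* 2 ℕ.≤ n → Pairing n r m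
 pairing {n} r m le = record { point = point ; locate = locate ; locate-point = locate-point ; point-locate = point-locate _ }
   where
   bit : Bool → Fin 2
   bit false = zero
   bit true  = suc zero
   unbit : Fin 2 → Bool
   unbit zero    = false
   unbit (suc _) = true
   bit-unbit : ∀ c → bit (unbit c) ≡ c
   bit-unbit zero       = refl
   bit-unbit (suc zero) = refl
   unbit-bit : ∀ b → unbit (bit b) ≡ b
   unbit-bit false = refl
   unbit-bit true  = refl
   code : Fin r → Fin m → Bool → Fin (r ℕ.* m ℕ.* 2)
   code j i b = combine (combine j i) (bit b)
   inner : Bool → Fin r × Fin m → Fin r × Fin m × Bool
   inner b (j , i) = j , i , b
   outer : Fin (r ℕ.* m) × Fin 2 → Fin r × Fin m × Bool
   outer (ji , c) = inner (unbit c) (remQuot {r} m ji)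
   decode : Fin (r ℕ.* m ℕ.* 2) → Fin r × Fin m × Bool
   decode c = outer (remQuot {r ℕ.* m} 2 c)
   decode-code : ∀ j i b → decode (code j i b) ≡ (j , i , b)
   decode-code j i b = trans (cong outer (Fin.remQuot-combine (combine j i) (bit b)))
     (trans (cong (inner (unbit (bit b))) (Fin.remQuot-combine j i)) (cong (λ b → j , i , b) (unbit-bit b)))
   code-decode : ∀ c → (let (j , i , b) = decode c in code j i b) ≡ c
   code-decode c = trans (cong₂ combine (Fin.combine-remQuot {r} m (proj₁ (remQuot {r ℕ.* m} 2 c)))
     (bit-unbit (proj₂ (remQuot {r ℕ.* m} 2 c)))) (Fin.combine-remQuot {r ℕ.* m} 2 c)
   point : Fin r → Fin m → Bool → Fin n
   point j i b = inject≤ (code j i b) le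
   locate : Fin n → Maybe (Fin r × Fin m × Bool)
   locate x with toℕ x ℕ.<? r ℕ.* m ℕ.* 2
   ... | yes lt = just (decode (fromℕ< lt))
   ... | no _   = nothing
   locate-point : ∀ j i b → locate (point j i b) ≡ just (j , i , b)
   locate-point j i b with toℕ (point j i b) ℕ.<? r ℕ.* m ℕ.* 2
   ... | yes lt = cong just (trans (cong decode (Fin.toℕ-injective (trans (Fin.toℕ-fromℕ< lt) (Fin.toℕ-inject≤ _ le)))) (decode-code j i b))
   ... | no nlt = ⊥-elim (nlt (subst (ℕ._< r ℕ.* m ℕ.* 2) (sym (Fin.toℕ-inject≤ (code j i b) le)) (Fin.toℕ<n (code j i b))))
   point-locate : ∀ x {j i b} → locate x ≡ just (j , i , b) → point j i b ≡ x
   point-locate x eq with toℕ x ℕ.<? r ℕ.* m ℕ.* 2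
   point-locate x refl | yes lt = Fin.toℕ-injective (trans (Fin.toℕ-inject≤ _ le)
     (trans (cong toℕ (code-decode (fromℕ< lt))) (Fin.toℕ-fromℕ< lt)))

 xor-twice : ∀ b c → (b xor c) xor c ≡ b
 xor-twice false false = refl
 xor-twice false true  = refl
 xor-twice true  false = refl
 xor-twice true  true  = refl

 ∫-power-updateAt : ∀ {A : Set} (L : Measure A) (φ : A → A) → (∀ F → ∫ L (λ a → F (φ a)) ≡ ∫ L F) →
   ∀ {l} (j : Fin l) F → ∫ (power L l) (λ xs → F (updateAt xs j φ)) ≡ ∫ (power L l) F
 ∫-power-updateAt L φ h {suc l} zero F = trans (∫-power L l _) (trans
   (h (λ v → ∫ (power L l) (λ xs → F (v ∷ xs)))) (sym (∫-power L l F)))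
 ∫-power-updateAt L φ h {suc l} (suc j) F = trans (∫-power L l _) (trans
   (∫-cong L (λ v → ∫-power-updateAt L φ h j (λ xs → F (v ∷ xs)))) (sym (∫-power L l F)))

 ∫-coin-not : ∀ F → ∫ coin (λ b → F (not b)) ≡ ∫ coin F
 ∫-coin-not F = trans (∫-coin (λ b → F (not b))) (trans (cong (½ *_) (ℚ.+-comm (F true) (F false))) (sym (∫-coin F)))

 module Flips {n r m} (P : Pairing n r m) (Λ : Measure ℚ) where
   open Pairing P
   open Extraction Λ m

   Signs : Set
   Signs = Vec (Vec Bool m) r

   at : Signs → Fin r → Fin m → Bool
   at ε j i = lookup (lookup ε j) i

   swapped : Signs → Fin n → Fin n
   swapped ε x with locate x
   ... | nothing          = x
   ... | just (j , i , b) = point j i (b xor at ε j i)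

   swapped-point : ∀ ε j i b → swapped ε (point j i b) ≡ point j i (b xor at ε j i)
   swapped-point ε j i b rewrite locate-point j i b = refl

   swapped-just : ∀ ε {x j i b} → locate x ≡ just (j , i , b) → swapped ε x ≡ point j i (b xor at ε j i)
   swapped-just ε {x} eq rewrite eq = refl

   swapped-nothing : ∀ ε {x} → locate x ≡ nothing → swapped ε x ≡ x
   swapped-nothing ε eq rewrite eq = refl

   swapped-involutive : ∀ ε x → swapped ε (swapped ε x) ≡ x
   swapped-involutive ε x with locate x in eq
   ... | nothing rewrite eq = refl
   ... | just (j , i , b) = trans (swapped-point ε j i (b xor at ε j i))
     (trans (cong (point j i) (xor-twice b (at ε j i))) (point-locate eq))

   flips : Signs → Permutation′ n
   flips ε = permutation (swapped ε) (swapped ε) (swapped-involutive ε) (swapped-involutive ε)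

   -- The signs of these pairs are the only ones on which the flipped tuple depends
   -- (`swapped-agree`).
   hits : ∀ {l} → Vec (Fin n) l → Fin r → Subset m
   hits []       j = ∅
   hits (v ∷ p) j with locate v
   ... | nothing = hits p j
   ... | just (j′ , i , b) with j′ Fin.≟ j
   ...   | yes _ = ins i (hits p j)
   ...   | no _  = hits p j

   ∣hits∣≤ : ∀ {l} (p : Vec (Fin n) l) j → ∣ hits p j ∣ ℕ.≤ l
   ∣hits∣≤ []       j = ℕ.≤-reflexive (∣∅∣ m)
   ∣hits∣≤ (v ∷ p) j with locate v
   ... | nothing = ℕ.m≤n⇒m≤1+n (∣hits∣≤ p j)
   ... | just (j′ , i , b) with j′ Fin.≟ j
   ...   | yes _ = ℕ.≤-trans (∣ins∣≤ i (hits p j)) (ℕ.s≤s (∣hits∣≤ p j))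
   ...   | no _  = ℕ.m≤n⇒m≤1+n (∣hits∣≤ p j)

   hits-point : ∀ {l} (p : Vec (Fin n) l) j i → lookup (hits p j) i ≡ true →
     ∃[ b ] lookup (toSet p) (point j i b) ≡ true
   hits-point []      j i h = ⊥-elim (true≢false h (lookup-∅ i))
   hits-point (v ∷ p) j i h with locate v in eq
   ... | nothing = let (b , h′) = hits-point p j i h in b , lookup-ins-mono v (toSet p) _ h′
   ... | just (j′ , i′ , b) with j′ Fin.≟ j
   ...   | no _ = let (b′ , h′) = hits-point p j i h in b′ , lookup-ins-mono v (toSet p) _ h′
   ...   | yes refl with i′ Fin.≟ i
   ...     | yes refl = b , subst (λ x → lookup (ins v (toSet p)) x ≡ true) (sym (point-locate eq)) (lookup-ins v (toSet p))
   ...     | no ne = let (b′ , h′) = hits-point p j i (trans (sym (lookup-ins-≢ (hits p j) ne)) h)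
                     in b′ , lookup-ins-mono v (toSet p) _ h′

   Agree : ∀ {l} → Vec (Fin n) l → Signs → Signs → Set
   Agree p ε δ = ∀ j i → lookup (hits p j) i ≡ true → at ε j i ≡ at δ j i

   swapped-agree : ∀ {l} (p : Vec (Fin n) l) ε δ → Agree p ε δ → map (swapped ε) p ≡ map (swapped δ) p
   swapped-agree []      ε δ h = refl
   swapped-agree (v ∷ p) ε δ h = cong₂ _∷_ head (swapped-agree p ε δ (λ j i e → h j i (grow j i e)))
     where
     grow : ∀ j i → lookup (hits p j) i ≡ true → lookup (hits (v ∷ p) j) i ≡ true
     grow j i e with locate v
     ... | nothing = e
     ... | just (j′ , i′ , b) with j′ Fin.≟ j
     ...   | yes _ = lookup-ins-mono i′ (hits p j) i e
     ...   | no _  = e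
     self : ∀ {j i b} → locate v ≡ just (j , i , b) → lookup (hits (v ∷ p) j) i ≡ true
     self {j} {i} eq with locate v
     self {j} {i} refl | just _ with j Fin.≟ j
     ...   | yes _ = lookup-ins i (hits p j)
     ...   | no ne = ⊥-elim (ne refl)
     case : ∀ l → locate v ≡ l → swapped ε v ≡ swapped δ v
     case nothing            eq = trans (swapped-nothing ε eq) (sym (swapped-nothing δ eq))
     case (just (j , i , b)) eq = trans (swapped-just ε eq)
       (trans (cong (λ c → point j i (b xor c)) (h j i (self eq))) (sym (swapped-just δ eq)))
     head : swapped ε v ≡ swapped δ v
     head = case (locate v) refl

   OnHits : ∀ {l} → Vec (Fin n) l → (Signs → ℚ) → Set
   OnHits p F = ∀ ε δ → Agree p ε δ → F ε ≡ F δ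

   -- A k-tuple meets at most k pairs of a block, so in each block the function depends on at most k
   -- signs and has degree at most k.
   onHits-good : ∀ {k} → Extractor k Λ → ∀ (p : Vec (Fin n) k) F → OnHits p F → Good F
   onHits-good E p F h j xs = junta-key E (hits p j) _ (λ x y e → h _ _ (agree x y e)) (∣hits∣≤ p j)
     where
     agree : ∀ x y → (∀ i → lookup (hits p j) i ≡ true → lookup x i ≡ lookup y i) →
       Agree p (xs Vec.[ j ]≔ x) (xs Vec.[ j ]≔ y)
     agree x y e j′ i hit with j′ Fin.≟ j
     ... | yes refl = trans (cong (λ z → lookup z i) (Vec.lookup∘updateAt j xs))
           (trans (e i hit) (cong (λ z → lookup z i) (sym (Vec.lookup∘updateAt j xs))))
     ... | no ne = cong (λ z → lookup z i) (trans (Vec.lookup∘updateAt′ j′ j ne xs) (sym (Vec.lookup∘updateAt′ j′ j ne xs)))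

   flipAt : Fin r → Fin m → Signs → Signs
   flipAt j i ε = updateAt ε j (λ x → updateAt x i not)

   ∫-flipAt : ∀ j i F → ∫ (cubes r) (λ ε → F (flipAt j i ε)) ≡ ∫ (cubes r) F
   ∫-flipAt j i F = ∫-power-updateAt (cube m) _ (∫-power-updateAt coin not ∫-coin-not i) j F

   sg-not : ∀ b → sg (not b) ≡ - sg b
   sg-not false = refl
   sg-not true  = refl

   χ-flipAt : ∀ {r} (I : Vec (Fin m) r) j ε →
     χ I (updateAt ε j (λ x → updateAt x (lookup I j) not)) ≡ - χ I ε
   χ-flipAt (i ∷ I) zero (x ∷ ε) = trans (cong (λ b → sg b * χ I ε) (Vec.lookup∘updateAt i x))
     (trans (cong (_* χ I ε) (sg-not (lookup x i))) (sym (ℚ.neg-distribˡ-* (sg (lookup x i)) (χ I ε))))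
   χ-flipAt (i ∷ I) (suc j) (x ∷ ε) = trans (cong (sg (lookup x i) *_) (χ-flipAt I j ε))
     (sym (ℚ.neg-distribʳ-* (sg (lookup x i)) (χ I ε)))

   at-flipAt : ∀ j i ε j′ i′ → ¬ (j ≡ j′ × i ≡ i′) → at (flipAt j i ε) j′ i′ ≡ at ε j′ i′
   at-flipAt j i ε j′ i′ ne with j′ Fin.≟ j
   ... | no j≢ = cong (λ z → lookup z i′) (Vec.lookup∘updateAt′ j′ j j≢ ε)
   ... | yes refl = trans (cong (λ z → lookup z i′) (Vec.lookup∘updateAt j ε))
     (Vec.lookup∘updateAt′ i′ i (λ e → ne (refl , sym e)) (lookup ε j))

   self-negative : ∀ {x} → x ≡ - x → x ≡ 0ℚ
   self-negative {x} e = ℚ.≤-antisym (half (ℚ.≤-reflexive (lem e))) (half′ (ℚ.≤-reflexive (sym (lem e))))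
     where
     lem : ∀ {x} → x ≡ - x → x + x ≡ 0ℚ
     lem {x} e = trans (cong (x +_) e) (ℚ.+-inverseʳ x)
     half : x + x ≤ 0ℚ → x ≤ 0ℚ
     half h with ℚ.≤-total x 0ℚ
     ... | inj₁ p = p
     ... | inj₂ p = ℚ.≤-trans (≤-by x p refl) h
     half′ : 0ℚ ≤ x + x → 0ℚ ≤ x
     half′ h with ℚ.≤-total 0ℚ x
     ... | inj₁ p = p
     ... | inj₂ p = ℚ.≤-trans h (ℚ.≤-trans (ℚ.+-monoʳ-≤ x p) (ℚ.≤-reflexive (ℚ.+-identityʳ x)))

   -- Flipping the sign of a pair not met by the tuple preserves F and negates the character, so the
   -- coefficient equals its own negative.
   fourier-missed : ∀ {l} (p : Vec (Fin n) l) F → OnHits p F → ∀ (I : Vec (Fin m) r) j →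
     lookup (hits p j) (lookup I j) ≡ false → fourier F I ≡ 0ℚ
   fourier-missed p F h I j miss = self-negative (trans
     (sym (∫-flipAt j (lookup I j) (λ ε → χ I ε * F ε)))
     (trans (∫-cong (cubes r) (λ ε → trans (cong₂ _*_ (χ-flipAt I j ε) (h _ ε (agree ε)))
       (sym (ℚ.neg-distribˡ-* (χ I ε) (F ε))))) (∫-neg (cubes r) _)))
     where
     agree : ∀ ε → Agree p (flipAt j (lookup I j) ε) ε
     agree ε j′ i′ hit = at-flipAt j (lookup I j) ε j′ i′ (λ { (refl , refl) → true≢false hit miss })

   ∣χ∣ : ∀ {r} (I : Vec (Fin m) r) ε → ℚ.∣ χ I ε ∣ ≡ 1ℚ
   ∣χ∣ []      []      = refl
   ∣χ∣ (i ∷ I) (x ∷ ε) = trans (ℚ.∣p*q∣≡∣p∣*∣q∣ (sg (lookup x i)) (χ I ε))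
     (trans (cong₂ _*_ (∣sg∣ (lookup x i)) (∣χ∣ I ε)) refl)
     where
     ∣sg∣ : ∀ b → ℚ.∣ sg b ∣ ≡ 1ℚ
     ∣sg∣ false = refl
     ∣sg∣ true  = refl

   χ² : ∀ {r} (I : Vec (Fin m) r) ε → χ I ε * χ I ε ≡ 1ℚ
   χ² I ε = trans (sym (∣p∣²≡p² (χ I ε))) (cong₂ _*_ (∣χ∣ I ε) (∣χ∣ I ε))

   ∣fourier∣≤1 : ∀ F (I : Vec (Fin m) r) → (∀ ε → ℚ.∣ F ε ∣ ≤ 1ℚ) → ℚ.∣ fourier F I ∣ ≤ 1ℚ
   ∣fourier∣≤1 F I h = ℚ.≤-trans (∣∣-≤ (cubes-prob r) _) (≤-const (cubes-prob r) 1ℚ (λ ε →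
     ℚ.≤-trans (ℚ.≤-reflexive (trans (ℚ.∣p*q∣≡∣p∣*∣q∣ (χ I ε) (F ε))
       (trans (cong (_* ℚ.∣ F ε ∣) (∣χ∣ I ε)) (ℚ.*-identityˡ ℚ.∣ F ε ∣)))) (h ε)))

 meetsAll : ∀ {n} r → (Fin r → Bool → Fin n) → Subset n → ℚ
 meetsAll zero    f A = 1ℚ
 meetsAll (suc r) f A = 𝟙 (lookup A (f zero false) ∨ lookup A (f zero true)) * meetsAll r (λ j → f (suc j)) A

 meetsAll-nonneg : ∀ {n} r f (A : Subset n) → 0ℚ ≤ meetsAll r f A
 meetsAll-nonneg zero    f A = 0≤1
 meetsAll-nonneg (suc r) f A = *-nonneg (𝟙-nonneg (lookup A (f zero false) ∨ lookup A (f zero true))) (meetsAll-nonneg r _ A)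

 meetsAll-true : ∀ {n} r f (A : Subset n) → (∀ j → ∃[ b ] lookup A (f j b) ≡ true) → meetsAll r f A ≡ 1ℚ
 meetsAll-true zero    f A h = refl
 meetsAll-true (suc r) f A h = trans (cong₂ _*_ (cong 𝟙 (or (h zero))) (meetsAll-true r _ A (λ j → h (suc j)))) refl
   where
   or : ∃[ b ] lookup A (f zero b) ≡ true → (lookup A (f zero false) ∨ lookup A (f zero true)) ≡ true
   or (false , e) rewrite e = refl
   or (true  , e) with lookup A (f zero false)
   ... | true  = refl
   ... | false = e

 meetsAll-ins : ∀ {n} r f (A : Subset n) v → (∀ j b → ¬ v ≡ f j b) → meetsAll r f (ins v A) ≡ meetsAll r f A
 meetsAll-ins zero    f A v h = refl
 meetsAll-ins (suc r) f A v h = cong₂ _*_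
   (cong 𝟙 (cong₂ _∨_ (lookup-ins-≢ A (h zero false)) (lookup-ins-≢ A (h zero true))))
   (meetsAll-ins r _ A v (λ j → h (suc j)))

 module _ {n : ℕ} (a b : Fin (suc n)) where

   private
     U = unif (suc n)
     meets : Subset (suc n) → ℚ
     meets A = 𝟙 (lookup A a ∨ lookup A b)
     c = (1ℚ + 1ℚ) * inv (suc n)

   -- The first vertex lies in the pair with probability at most 2 / n, and then Q does not see it;
   -- otherwise a later vertex must meet the pair. Summing over the positions, one vertex of the
   -- tuple is spent on the pair and Q is averaged over the others.
   ∫-meets : ∀ k (Q : Subset (suc n) → ℚ) → (∀ A → 0ℚ ≤ Q A) →
     (∀ v A → v ≡ a ⊎ v ≡ b → Q (ins v A) ≡ Q A) →
     ∫ (power U (suc k)) (λ p → meets (toSet p) * Q (toSet p)) ≤ ι (suc k) * c * ∫ (power U k) (λ p → Q (toSet p))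
   ∫-meets k Q Q≥0 ignore = begin
     ∫ (power U (suc k)) (λ p → meets (toSet p) * Q (toSet p))
       ≡⟨ trans (∫-power U k _) (∫-swap U (power U k) _) ⟩
     ∫ (power U k) (λ p → ∫ U (λ v → meets (ins v (toSet p)) * Q (ins v (toSet p))))
       ≤⟨ mono (power-prob (unif-prob n) k) _ _ (λ p → mono (unif-prob n) _ _ (λ v → split (toSet p) v)) ⟩
     ∫ (power U k) (λ p → ∫ U (λ v → 𝟙 (lookup ab v) * Q (toSet p) + meets (toSet p) * Q (ins v (toSet p))))
       ≡⟨ trans (∫-cong (power U k) (λ p → trans (∫-+ U _ _) (cong (_+ ∫ U (λ v → meets (toSet p) * Q (ins v (toSet p)))) (∫-*ʳ U (Q (toSet p)) _))))
            (∫-+ (power U k) _ _) ⟩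
     ∫ (power U k) (λ p → ∫ U (λ v → 𝟙 (lookup ab v)) * Q (toSet p)) + ∫ (power U k) (λ p → ∫ U (λ v → meets (toSet p) * Q (ins v (toSet p))))
       ≤⟨ ℚ.+-mono-≤ (mono (power-prob (unif-prob n) k) _ _ (λ p → *-monoʳ (Q (toSet p)) (Q≥0 (toSet p)) ab≤)) (later k) ⟩
     ∫ (power U k) (λ p → c * Q (toSet p)) + ι k * c * ∫ (power U k) (λ p → Q (toSet p))
       ≡⟨ trans (cong (_+ ι k * c * ∫ (power U k) (λ p → Q (toSet p))) (∫-*ˡ (power U k) c _))
            (trans (lem c (ι k) (∫ (power U k) (λ p → Q (toSet p)))) (cong (λ z → z * c * ∫ (power U k) (λ p → Q (toSet p))) (sym (ι-suc k)))) ⟩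
     ι (suc k) * c * ∫ (power U k) (λ p → Q (toSet p)) ∎
     where
     open ℚ.≤-Reasoning
     ab = ins a (ins b ∅)
     lem : ∀ c k x → c * x + k * c * x ≡ (1ℚ + k) * c * x
     lem = solve-∀ ringℚ
     ab≤ : ∫ U (λ v → 𝟙 (lookup ab v)) ≤ c
     ab≤ = begin
       ∫ U (λ v → 𝟙 (lookup ab v)) ≡⟨ ∫-unif-lookup ab ⟩
       inv (suc n) * ι ∣ ab ∣
         ≤⟨ *-monoˡ (inv (suc n)) (inv-nonneg (suc n)) (ι-mono (ℕ.≤-trans (∣ins∣≤ a (ins b ∅)) (ℕ.s≤s (ℕ.≤-trans (∣ins∣≤ b ∅) (ℕ.s≤s (ℕ.≤-reflexive (∣∅∣ (suc n)))))))) ⟩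
       inv (suc n) * ι 2           ≡⟨ cong (inv (suc n) *_) (trans (ι-suc 1) (cong (1ℚ +_) ι-1)) ⟩
       inv (suc n) * (1ℚ + 1ℚ)     ≡⟨ ℚ.*-comm (inv (suc n)) (1ℚ + 1ℚ) ⟩
       c                           ∎
     split : ∀ A v → meets (ins v A) * Q (ins v A) ≤ 𝟙 (lookup ab v) * Q A + meets A * Q (ins v A)
     split A v with v Fin.≟ a | v Fin.≟ b
     ... | yes refl | _ = begin
       meets (ins v A) * Q (ins v A) ≤⟨ *-monoʳ (Q (ins v A)) (Q≥0 (ins v A)) (𝟙-≤1 (lookup (ins v A) a ∨ lookup (ins v A) b)) ⟩
       1ℚ * Q (ins v A)              ≡⟨ cong₂ _*_ (cong 𝟙 (sym (lookup-ins v (ins b ∅)))) (ignore v A (inj₁ refl)) ⟩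
       𝟙 (lookup ab v) * Q A         ≤⟨ ≤-by (meets A * Q (ins v A)) (*-nonneg (𝟙-nonneg (lookup A a ∨ lookup A b)) (Q≥0 (ins v A))) refl ⟩
       𝟙 (lookup ab v) * Q A + meets A * Q (ins v A) ∎
     ... | no _ | yes refl = begin
       meets (ins v A) * Q (ins v A) ≤⟨ *-monoʳ (Q (ins v A)) (Q≥0 (ins v A)) (𝟙-≤1 (lookup (ins v A) a ∨ lookup (ins v A) b)) ⟩
       1ℚ * Q (ins v A)              ≡⟨ cong₂ _*_ (cong 𝟙 (sym (lookup-ins-mono a (ins v ∅) v (lookup-ins v ∅)))) (ignore v A (inj₂ refl)) ⟩
       𝟙 (lookup ab v) * Q A         ≤⟨ ≤-by (meets A * Q (ins v A)) (*-nonneg (𝟙-nonneg (lookup A a ∨ lookup A b)) (Q≥0 (ins v A))) refl ⟩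
       𝟙 (lookup ab v) * Q A + meets A * Q (ins v A) ∎
     ... | no v≢a | no v≢b = begin
       meets (ins v A) * Q (ins v A) ≡⟨ cong (λ z → 𝟙 z * Q (ins v A)) (cong₂ _∨_ (lookup-ins-≢ A v≢a) (lookup-ins-≢ A v≢b)) ⟩
       meets A * Q (ins v A)         ≤⟨ ≤-by (𝟙 (lookup ab v) * Q A) (*-nonneg (𝟙-nonneg (lookup ab v)) (Q≥0 A)) (ℚ.+-comm (𝟙 (lookup ab v) * Q A) _) ⟩
       𝟙 (lookup ab v) * Q A + meets A * Q (ins v A) ∎
     later : ∀ k → ∫ (power U k) (λ p → ∫ U (λ v → meets (toSet p) * Q (ins v (toSet p)))) ≤ ι k * c * ∫ (power U k) (λ p → Q (toSet p))
     later zero = ℚ.≤-reflexive (trans (∫-power-[] U _) (trans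
       (∫-≡0 U (λ v → trans (cong (λ z → 𝟙 z * Q (ins v ∅)) (cong₂ _∨_ (lookup-∅ a) (lookup-∅ b))) (ℚ.*-zeroˡ (Q (ins v ∅)))))
       (sym (trans (cong (λ z → z * c * ∫ (power U 0) (λ p → Q (toSet p))) ι-0) (lem₀ c (∫ (power U 0) (λ p → Q (toSet p))))))))
       where
       lem₀ : ∀ c x → 0ℚ * c * x ≡ 0ℚ
       lem₀ = solve-∀ ringℚ
     later (suc k) = begin
       ∫ (power U (suc k)) (λ p → ∫ U (λ v → meets (toSet p) * Q (ins v (toSet p))))
         ≡⟨ ∫-swap (power U (suc k)) U _ ⟩
       ∫ U (λ v → ∫ (power U (suc k)) (λ p → meets (toSet p) * Q (ins v (toSet p))))
         ≤⟨ mono (unif-prob n) _ _ (λ v → ∫-meets k (λ A → Q (ins v A)) (λ A → Q≥0 (ins v A))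
              (λ w A e → trans (cong Q (ins-comm v w A)) (ignore w (ins v A) e))) ⟩
       ∫ U (λ v → ι (suc k) * c * ∫ (power U k) (λ p → Q (ins v (toSet p))))
         ≡⟨ ∫-*ˡ U (ι (suc k) * c) _ ⟩
       ι (suc k) * c * ∫ U (λ v → ∫ (power U k) (λ p → Q (ins v (toSet p))))
         ≡⟨ cong (ι (suc k) * c *_) (∫-power U k _) ⟨
       ι (suc k) * c * ∫ (power U (suc k)) (λ p → Q (toSet p)) ∎

 -- Each of the r disjoint pairs uses up a vertex of the tuple. The bound `K` on the length is fixed
 -- so that every step costs the same factor.
 ∫-meetsAll : ∀ {n} K k → k ℕ.≤ K → ∀ r (f : Fin r → Bool → Fin (suc n)) →
   (∀ i j b c → f i b ≡ f j c → i ≡ j) →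
   ∫ (power (unif (suc n)) k) (λ p → meetsAll r f (toSet p)) ≤ (ι K * ((1ℚ + 1ℚ) * inv (suc n))) ^ r
 ∫-meetsAll {n} K k le zero f inj = ℚ.≤-reflexive (const (power-prob (unif-prob n) k) 1ℚ)
 ∫-meetsAll {n} K zero le (suc r) f inj = ℚ.≤-trans (ℚ.≤-reflexive (trans (∫-power-[] (unif (suc n)) _)
   (trans (cong (λ z → 𝟙 z * meetsAll r (λ j → f (suc j)) ∅) (cong₂ _∨_ (lookup-∅ (f zero false)) (lookup-∅ (f zero true)))) (ℚ.*-zeroˡ (meetsAll r (λ j → f (suc j)) ∅)))))
   (^-nonneg (suc r) (*-nonneg (ι-nonneg K) (*-nonneg (+-nonneg 0≤1 0≤1) (inv-nonneg (suc n)))))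
 ∫-meetsAll {n} K (suc k) le (suc r) f inj = begin
   ∫ (power U (suc k)) (λ p → meetsAll (suc r) f (toSet p))
     ≤⟨ ∫-meets (f zero false) (f zero true) k (meetsAll r g) (meetsAll-nonneg r g) ignore ⟩
   ι (suc k) * c * ∫ (power U k) (λ p → meetsAll r g (toSet p))
     ≤⟨ *-mono (nonneg (power-prob (unif-prob n) k) _ (λ p → meetsAll-nonneg r g (toSet p)))
          (*-nonneg (ι-nonneg K) 0≤c) (*-monoʳ c 0≤c (ι-mono le))
          (∫-meetsAll K k (ℕ.≤-trans (ℕ.n≤1+n k) le) r g (λ i j b c e → Fin.suc-injective (inj (suc i) (suc j) b c e))) ⟩
   ι K * c * (ι K * c) ^ r ∎
   where
   open ℚ.≤-Reasoning
   U = unif (suc n)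
   g = λ j → f (suc j)
   c = (1ℚ + 1ℚ) * inv (suc n)
   0≤c = *-nonneg (+-nonneg 0≤1 0≤1) (inv-nonneg (suc n))
   distinct-pairs : ∀ {v} b → v ≡ f zero b → ∀ j b′ → ¬ v ≡ g j b′
   distinct-pairs b refl j b′ e with inj zero (suc j) b b′ e
   ... | ()
   ignore : ∀ v A → v ≡ f zero false ⊎ v ≡ f zero true → meetsAll r g (ins v A) ≡ meetsAll r g A
   ignore v A (inj₁ e) = meetsAll-ins r g A v (distinct-pairs false e)
   ignore v A (inj₂ e) = meetsAll-ins r g A v (distinct-pairs true e)

-- Correlating two set functions through their signed averages.

module Correlation where

 open Cubes using (sg; sg²; coin; cube; ∫-cube; cube-prob; ½-nonneg)
 open Measures
 open Permutations
 open Rationals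
 open Subsets
 open Probability
 open import Data.Bool using (not; _xor_)
 open import Data.Fin.Permutation using (_≈_; transpose)
 open import Data.Fin.Subset using (∣_∣)
 open import Data.Rational using (_+_; _*_; _-_; -_; _≤_)
 open import Data.Vec using (lookup; map; tabulate; _++_)

 pairsOf : ∀ {A : Set} r → (Fin r → Bool → A) → Vec A (r ℕ.* 2)
 pairsOf zero    f = []
 pairsOf (suc r) f = f zero false ∷ f zero true ∷ pairsOf r (λ j → f (suc j))

 map-pairsOf : ∀ {A B : Set} (g : A → B) r f → map g (pairsOf r f) ≡ pairsOf r (λ j b → g (f j b))
 map-pairsOf g zero    f = refl
 map-pairsOf g (suc r) f = cong (λ z → g (f zero false) ∷ g (f zero true) ∷ z) (map-pairsOf g r _)

 pairsOf-cong : ∀ {A : Set} r {f g : Fin r → Bool → A} → (∀ j b → f j b ≡ g j b) → pairsOf r f ≡ pairsOf r g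
 pairsOf-cong zero    h = refl
 pairsOf-cong (suc r) h = cong₂ _∷_ (h zero false) (cong₂ _∷_ (h zero true) (pairsOf-cong r (λ j → h (suc j))))

 pairsOf-injective : ∀ {A : Set} r {f g : Fin r → Bool → A} → pairsOf r f ≡ pairsOf r g → ∀ j b → f j b ≡ g j b
 pairsOf-injective (suc r) e zero    false = Vec.∷-injectiveˡ e
 pairsOf-injective (suc r) e zero    true  = Vec.∷-injectiveˡ (Vec.∷-injectiveʳ e)
 pairsOf-injective (suc r) e (suc j) b     = pairsOf-injective r (Vec.∷-injectiveʳ (Vec.∷-injectiveʳ e)) j b

 private
   variable
     n : ℕ

 -- The alternating sum of Φ over the sets obtained from A by adding one point of
 -- each of r pairs, divided by 2 ^ r.
 diff : (Subset n → ℚ) → ∀ r → Vec (Fin n) (r ℕ.* 2) → Subset n → ℚ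
 diff Φ zero    []           A = Φ A
 diff Φ (suc r) (a ∷ b ∷ xs) A = ½ * (diff Φ r xs (ins a A) - diff Φ r xs (ins b A))

 meanDiff : (Subset n → ℚ) → ∀ r s → Vec (Fin n) (r ℕ.* 2) → ℚ
 meanDiff {n} Φ r s xs = ∫ (power (unif n) s) (λ R → diff Φ r xs (toSet R))

 signProduct : ∀ {r} → Vec Bool r → ℚ
 signProduct []      = 1ℚ
 signProduct (b ∷ σ) = sg b * signProduct σ

 signProduct² : ∀ {r} (σ : Vec Bool r) → signProduct σ * signProduct σ ≡ 1ℚ
 signProduct² []      = refl
 signProduct² (b ∷ σ) = trans (lem (sg b) (signProduct σ)) (cong₂ _*_ (sg² b) (signProduct² σ))
   where
   lem : ∀ a b → a * b * (a * b) ≡ a * a * (b * b)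
   lem = solve-∀ ringℚ

 addAll : ∀ {l} → Vec (Fin n) l → Subset n → Subset n
 addAll []       A = A
 addAll (x ∷ xs) A = ins x (addAll xs A)

 addAll-ins : ∀ {l} (xs : Vec (Fin n) l) a A → addAll xs (ins a A) ≡ ins a (addAll xs A)
 addAll-ins []       a A = refl
 addAll-ins (x ∷ xs) a A = trans (cong (ins x) (addAll-ins xs a A)) (ins-comm x a (addAll xs A))

 toSet-++ : ∀ {l m} (xs : Vec (Fin n) l) (ys : Vec (Fin n) m) → toSet (xs ++ ys) ≡ addAll xs (toSet ys)
 toSet-++ []       ys = refl
 toSet-++ (x ∷ xs) ys = cong (ins x) (toSet-++ xs ys)

 select : ∀ {A : Set} {r} → (Fin r → Bool → A) → Vec Bool r → Vec A r
 select f σ = tabulate (λ j → f j (lookup σ j))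

 diff-select : ∀ (Φ : Subset n → ℚ) r f A →
   diff Φ r (pairsOf r f) A ≡ ∫ (cube r) (λ σ → signProduct σ * Φ (addAll (select f σ) A))
 diff-select Φ zero    f A = sym (trans (∫-power-[] coin _) (ℚ.*-identityˡ (Φ A)))
 diff-select Φ (suc r) f A = begin
   ½ * (diff Φ r (pairsOf r g) (ins (f zero false) A) - diff Φ r (pairsOf r g) (ins (f zero true) A))
     ≡⟨ cong₂ (λ x y → ½ * (x - y)) (diff-select Φ r g _) (diff-select Φ r g _) ⟩
   ½ * (∫ M (λ σ → signProduct σ * Φ (addAll (select g σ) (ins (f zero false) A))) -
        ∫ M (λ σ → signProduct σ * Φ (addAll (select g σ) (ins (f zero true) A))))
     ≡⟨ cong (½ *_) (cong₂ _+_ (∫-cong M (λ σ → trans (cong (λ B → signProduct σ * Φ B) (addAll-ins (select g σ) (f zero false) A))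
            (cong (_* Φ (addAll (select f (false ∷ σ)) A)) (sym (ℚ.*-identityˡ (signProduct σ))))))
          (trans (sym (∫-neg M _)) (∫-cong M (λ σ → trans (cong (λ B → - (signProduct σ * Φ B)) (addAll-ins (select g σ) (f zero true) A))
            (lem (signProduct σ) (Φ (addAll (select f (true ∷ σ)) A))))))) ⟩
   ½ * (∫ M (λ σ → 1ℚ * signProduct σ * Φ (addAll (select f (false ∷ σ)) A)) +
        ∫ M (λ σ → (- 1ℚ) * signProduct σ * Φ (addAll (select f (true ∷ σ)) A)))
     ≡⟨ ∫-cube r _ ⟨
   ∫ (cube (suc r)) (λ σ → signProduct σ * Φ (addAll (select f σ) A)) ∎
   where
   open ≡-Reasoning
   M = cube r
   g = λ j → f (suc j)
   lem : ∀ a b → - (a * b) ≡ (- 1ℚ) * a * b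
   lem = solve-∀ ringℚ

 diff-twist : ∀ (Φ : Subset n → ℚ) {r} (σ : Vec Bool r) f A →
   diff Φ r (pairsOf r (λ j b → f j (b xor lookup σ j))) A ≡ signProduct σ * diff Φ r (pairsOf r f) A
 diff-twist Φ []      f A = sym (ℚ.*-identityˡ (Φ A))
 diff-twist Φ {suc r} (b ∷ σ) f A = trans
   (cong₂ (λ x y → ½ * (x - y)) (diff-twist Φ σ g (ins (f zero b) A)) (diff-twist Φ σ g (ins (f zero (not b)) A)))
   (swap b)
   where
   g = λ j → f (suc j)
   d : Bool → ℚ
   d b = diff Φ r (pairsOf r g) (ins (f zero b) A)
   lem₁ : ∀ s x y → ½ * (s * x - s * y) ≡ 1ℚ * s * (½ * (x - y))
   lem₁ = solve-∀ ringℚ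
   lem₂ : ∀ s x y → ½ * (s * y - s * x) ≡ (- 1ℚ) * s * (½ * (x - y))
   lem₂ = solve-∀ ringℚ
   swap : ∀ b → ½ * (signProduct σ * d b - signProduct σ * d (not b)) ≡ sg b * signProduct σ * (½ * (d false - d true))
   swap false = lem₁ (signProduct σ) (d false) (d true)
   swap true  = lem₂ (signProduct σ) (d false) (d true)

 ∣diff∣≤1 : ∀ (Φ : Subset n → ℚ) → (∀ A → ℚ.∣ Φ A ∣ ≤ 1ℚ) → ∀ r xs A → ℚ.∣ diff Φ r xs A ∣ ≤ 1ℚ
 ∣diff∣≤1 Φ h zero    []           A = h A
 ∣diff∣≤1 Φ h (suc r) (a ∷ b ∷ xs) A = begin
   ℚ.∣ ½ * (x - y) ∣      ≡⟨ ℚ.∣p*q∣≡∣p∣*∣q∣ ½ (x - y) ⟩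
   ½ * ℚ.∣ x - y ∣        ≤⟨ *-monoˡ ½ ½-nonneg (ℚ.∣p-q∣≤∣p∣+∣q∣ x y) ⟩
   ½ * (ℚ.∣ x ∣ + ℚ.∣ y ∣) ≤⟨ *-monoˡ ½ ½-nonneg (ℚ.+-mono-≤ (∣diff∣≤1 Φ h r xs (ins a A)) (∣diff∣≤1 Φ h r xs (ins b A))) ⟩
   ½ * (1ℚ + 1ℚ)          ≡⟨⟩
   1ℚ                     ∎
   where
   open ℚ.≤-Reasoning
   x = diff Φ r xs (ins a A)
   y = diff Φ r xs (ins b A)

 sgn-sg : ∀ b x → sgn (sg b * x) ≡ sg b * sgn x
 sgn-sg false x = trans (cong sgn (ℚ.*-identityˡ x)) (sym (ℚ.*-identityˡ (sgn x)))
 sgn-sg true  x = trans (cong sgn (lem x)) (trans (sgn-neg x) (sym (lem (sgn x))))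
   where
   lem : ∀ x → (- 1ℚ) * x ≡ - x
   lem = solve-∀ ringℚ

 sgn-signProduct : ∀ {r} (σ : Vec Bool r) x → sgn (signProduct σ * x) ≡ signProduct σ * sgn x
 sgn-signProduct []      x = trans (cong sgn (ℚ.*-identityˡ x)) (sym (ℚ.*-identityˡ (sgn x)))
 sgn-signProduct (b ∷ σ) x = trans (cong sgn (ℚ.*-assoc (sg b) (signProduct σ) x)) (trans (sgn-sg b (signProduct σ * x))
   (trans (cong (sg b *_) (sgn-signProduct σ x)) (sym (ℚ.*-assoc (sg b) (signProduct σ) (sgn x)))))

 image-cong : ∀ {π ρ : Permutation′ n} → π ≈ ρ → ∀ A → image π A ≡ image ρ A
 image-cong {π = π} {ρ} h A = Vec.tabulate-cong (λ y → cong (lookup A) (flip-cong {π = π} {ρ} h y))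

 image-∘ : ∀ (π ρ : Permutation′ n) A → image ρ (image π A) ≡ image (π ∘ₚ ρ) A
 image-∘ π ρ A = Vec.tabulate-cong (λ y → lookup-image π A (ρ ⟨$⟩ˡ y))

 image-transpose : ∀ (a b : Fin n) A → lookup A a ≡ lookup A b → image (transpose a b) A ≡ A
 image-transpose a b A h = lookup-ext (λ i → trans (lookup-image (transpose a b) A i) (pointwise i))
   where
   pointwise : ∀ i → lookup A (transpose a b ⟨$⟩ˡ i) ≡ lookup A i
   pointwise i with i Fin.≟ b
   ... | yes refl = h
   ... | no _ with i Fin.≟ a
   ...   | yes refl = sym h
   ...   | no _ = refl

 x≡-x⇒x≡0 : ∀ {x} → x ≡ - x → x ≡ 0ℚ
 x≡-x⇒x≡0 {x} e = trans (lem x) (trans (cong (½ *_) (trans (cong (x +_) e) (ℚ.+-inverseʳ x))) (ℚ.*-zeroʳ ½))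
   where
   lem : ∀ x → x ≡ ½ * (x + x)
   lem = solve-∀ ringℚ

 ∈-++ˡ : ∀ {l m} (xs : Vec (Fin n) l) (ys : Vec (Fin n) m) j → lookup (toSet (xs ++ ys)) (lookup xs j) ≡ true
 ∈-++ˡ (x ∷ xs) ys zero    = lookup-ins x (toSet (xs ++ ys))
 ∈-++ˡ (x ∷ xs) ys (suc j) = lookup-ins-mono x (toSet (xs ++ ys)) _ (∈-++ˡ xs ys j)

 ∉-++ʳ : ∀ {l m} (xs : Vec (Fin n) l) (ys : Vec (Fin n) m) i → lookup (toSet (xs ++ ys)) i ≡ false → lookup (toSet ys) i ≡ false
 ∉-++ʳ []       ys i h = h
 ∉-++ʳ (x ∷ xs) ys i h = ∉-++ʳ xs ys i (proj₂ (fresh-∷ {y = x} (xs ++ ys) h))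

 ∉-tail : ∀ {l m} (xs : Vec (Fin n) l) (ys : Vec (Fin n) m) → Distinct (xs ++ ys) → ∀ j → lookup (toSet ys) (lookup xs j) ≡ false
 ∉-tail (x ∷ xs) ys (h , d) zero    = ∉-++ʳ xs ys x h
 ∉-tail (x ∷ xs) ys (h , d) (suc j) = ∉-tail xs ys d j

 ∉-++ˡ : ∀ {l m} (xs : Vec (Fin n) l) (ys : Vec (Fin n) m) i → lookup (toSet (xs ++ ys)) i ≡ false → lookup (toSet xs) i ≡ false
 ∉-++ˡ []       ys i h = lookup-∅ i
 ∉-++ˡ (x ∷ xs) ys i h = let (ne , h′) = fresh-∷ {y = x} (xs ++ ys) h in ∷-fresh xs ne (∉-++ˡ xs ys i h′)

 distinct-++ˡ : ∀ {l m} (xs : Vec (Fin n) l) (ys : Vec (Fin n) m) → Distinct (xs ++ ys) → Distinct xs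
 distinct-++ˡ []       ys d       = tt
 distinct-++ˡ (x ∷ xs) ys (h , d) = ∉-++ˡ xs ys x h , distinct-++ˡ xs ys d

 distinct-++ʳ : ∀ {l m} (xs : Vec (Fin n) l) (ys : Vec (Fin n) m) → Distinct (xs ++ ys) → Distinct ys
 distinct-++ʳ []       ys d       = d
 distinct-++ʳ (x ∷ xs) ys (_ , d) = distinct-++ʳ xs ys d

 ¬true⇒false : ∀ {b} → ¬ b ≡ true → b ≡ false
 ¬true⇒false {true}  h = ⊥-elim (h refl)
 ¬true⇒false {false} h = refl

 nonempty : ∀ (e : Subset n) {k} → ∣ e ∣ ≡ suc k → ∃[ x ] lookup e x ≡ true
 nonempty (true ∷ e)  h = zero , refl
 nonempty (false ∷ e) h = let (x , p) = nonempty e h in suc x , p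

 enumerate : ∀ s (e : Subset n) → ∣ e ∣ ≡ s → ∃[ R ] (Distinct {l = s} R × toSet R ≡ e)
 enumerate zero    e h = [] , tt , sym (∣e∣≡0 e h)
 enumerate (suc s) e h with nonempty e h
 ... | x , p with enumerate s (del x e) (ℕ.suc-injective (trans (sym (∣del∣ x e p)) h))
 ...   | R , d , eq = x ∷ R , (trans (cong (λ A → lookup A x) eq) (lookup-del x e) , d) ,
           trans (cong (ins x) eq) (ins-del x e p)

 complete : ∀ {r} s (xs : Vec (Fin n) r) → Distinct xs → ∀ (e : Subset n) → ∣ e ∣ ≡ r ℕ.+ s →
   (∀ j → lookup e (lookup xs j) ≡ true) → ∃[ R ] (Distinct {l = r ℕ.+ s} (xs ++ R) × toSet (xs ++ R) ≡ e)
 complete s []       d       e h mem = enumerate s e h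
 complete s (x ∷ xs) (fr , d) e h mem with complete s xs d (del x e) (ℕ.suc-injective (trans (sym (∣del∣ x e (mem zero))) h)) mem′
   where
   mem′ : ∀ j → lookup (del x e) (lookup xs j) ≡ true
   mem′ j = trans (lookup-del-≢ {a = x} e (λ x≡ → true≢false (subst (λ v → lookup (toSet xs) v ≡ true) (sym x≡) (∈ xs j)) fr)) (mem (suc j))
     where
     ∈ : ∀ {n l} (xs : Vec (Fin n) l) j → lookup (toSet xs) (lookup xs j) ≡ true
     ∈ (y ∷ ys) zero    = lookup-ins y (toSet ys)
     ∈ (y ∷ ys) (suc j) = lookup-ins-mono y (toSet ys) _ (∈ ys j)
 ... | R , d′ , eq = R , (trans (cong (λ A → lookup A x) eq) (lookup-del x e) , d′) ,
     trans (cong (ins x) eq) (ins-del x e (mem zero))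

 distinct-pairs : ∀ r {s} (f : Fin r → Bool → Fin n) (R : Vec (Fin n) s) → (∀ {i b j c} → f i b ≡ f j c → i ≡ j × b ≡ c) →
   Distinct R → (∀ j b → lookup (toSet R) (f j b) ≡ false) → Distinct (pairsOf r f ++ R)
 distinct-pairs zero    f R inj d h = d
 distinct-pairs (suc r) f R inj d h =
   ∷-fresh (pairsOf r g ++ R) (λ e → case-false (proj₂ (inj e))) (away false r (λ j → suc j) (λ ())) ,
   away true r (λ j → suc j) (λ ()) ,
   distinct-pairs r g R (λ e → let (p , q) = inj e in Fin.suc-injective p , q) d (λ j → h (suc j))
   where
   g = λ j → f (suc j)
   case-false : ¬ true ≡ false
   case-false ()
   away : ∀ b r′ (u : Fin r′ → Fin (suc r)) → (∀ {j} → ¬ u j ≡ zero) → lookup (toSet (pairsOf r′ (λ j → f (u j)) ++ R)) (f zero b) ≡ false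
   away b zero     u ne = h zero b
   away b (suc r′) u ne = ∷-fresh (f (u zero) true ∷ pairsOf r′ (λ j → f (u (suc j))) ++ R) (λ e → ne (proj₁ (inj e)))
     (∷-fresh (pairsOf r′ (λ j → f (u (suc j))) ++ R) (λ e → ne (proj₁ (inj e))) (away b r′ (λ j → u (suc j)) ne))

 pairsOf-distinct : ∀ r (f : Fin r → Bool → Fin n) → (∀ {i b j c} → f i b ≡ f j c → i ≡ j × b ≡ c) → Distinct (pairsOf r f)
 pairsOf-distinct r f inj = distinct-++ˡ (pairsOf r f) [] (distinct-pairs r f [] inj tt (λ j b → lookup-∅ (f j b)))

 xor-cancelʳ : ∀ b c d → b xor d ≡ c xor d → b ≡ c
 xor-cancelʳ false false d e = refl
 xor-cancelʳ true  true  d e = refl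
 xor-cancelʳ false true  false ()
 xor-cancelʳ false true  true  ()
 xor-cancelʳ true  false false ()
 xor-cancelʳ true  false true  ()

 module Positions {n r : ℕ} (s : ℕ) (f : Fin r → Bool → Fin (suc n))
   (f-injective : ∀ {i b j c} → f i b ≡ f j c → i ≡ j × b ≡ c) where

   U = unif (suc n)
   P = perms (suc n)
   T = power U s

   twist : Vec Bool r → Fin r → Bool → Fin (suc n)
   twist σ j b = f j (b xor lookup σ j)

   twist-injective : ∀ σ {i b j c} → twist σ i b ≡ twist σ j c → i ≡ j × b ≡ c
   twist-injective σ {i} {b} {j} {c} e with f-injective e
   ... | refl , q = refl , xor-cancelʳ b c (lookup σ i) q

   Splits : Subset (suc n) → Set
   Splits e = ∀ j → lookup e (f j false) ≡ not (lookup e (f j true))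

   splits? : ∀ e → (∃[ j ] lookup e (f j false) ≡ lookup e (f j true)) ⊎ Splits e
   splits? e = search r (λ j → lookup e (f j false)) (λ j → lookup e (f j true))
     where
     search : ∀ r (a b : Fin r → Bool) → (∃[ j ] a j ≡ b j) ⊎ (∀ j → a j ≡ not (b j))
     search zero    a b = inj₂ λ ()
     search (suc r) a b with a zero Bool.≟ b zero | search r (λ j → a (suc j)) (λ j → b (suc j))
     ... | yes e | _ = inj₁ (zero , e)
     ... | no _  | inj₁ (j , e) = inj₁ (suc j , e)
     ... | no ne | inj₂ h = inj₂ λ { zero → ≢⇒not (a zero) (b zero) ne ; (suc j) → h j }
       where
       ≢⇒not : ∀ x y → ¬ x ≡ y → x ≡ not y
       ≢⇒not false false ne = ⊥-elim (ne refl)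
       ≢⇒not false true  ne = refl
       ≢⇒not true  false ne = refl
       ≢⇒not true  true  ne = ⊥-elim (ne refl)

   Valid : Vec (Fin (suc n)) s → Set
   Valid R = Distinct (pairsOf r f ++ R)

   -- `σ` records which vertex of each pair lies in e, and `R` lists the vertices of e outside the
   -- pairs.
   decompose : ∀ e → ∣ e ∣ ≡ r ℕ.+ s → Splits e →
     ∃[ σ ] ∃[ R ] Valid R × toSet (select f σ ++ R) ≡ e
   decompose e size split with complete s (select f σ) distinct-first e size member
     where
     σ = tabulate (λ j → lookup e (f j true))
     member : ∀ j → lookup e (lookup (select f σ) j) ≡ true
     member j = trans (cong (lookup e) (trans (Vec.lookup∘tabulate (λ j → f j (lookup σ j)) j)
       (cong (f j) (Vec.lookup∘tabulate (λ j → lookup e (f j true)) j)))) (chosen (lookup e (f j true)) refl)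
       where
       chosen : ∀ b → lookup e (f j true) ≡ b → lookup e (f j b) ≡ true
       chosen true  h = h
       chosen false h = trans (split j) (cong not h)
     distinct-first : Distinct (select f σ)
     distinct-first = go r (λ j → j) (λ e → e)
       where
       fresh : ∀ r′ (u : Fin r′ → Fin r) {j₀} → (∀ {j} → ¬ u j ≡ j₀) →
         lookup (toSet (tabulate (λ j → f (u j) (lookup σ (u j))))) (f j₀ (lookup σ j₀)) ≡ false
       fresh zero     u {j₀} ne = lookup-∅ (f j₀ (lookup σ j₀))
       fresh (suc r′) u {j₀} ne = ∷-fresh (tabulate (λ j → f (u (suc j)) (lookup σ (u (suc j))))) (λ e → ne (proj₁ (f-injective e))) (fresh r′ (λ j → u (suc j)) ne)
       go : ∀ r′ (u : Fin r′ → Fin r) → (∀ {i j} → u i ≡ u j → i ≡ j) → Distinct (tabulate (λ j → f (u j) (lookup σ (u j))))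
       go zero     u inj = tt
       go (suc r′) u inj = fresh r′ (λ j → u (suc j)) (λ e → case (inj e)) , go r′ (λ j → u (suc j)) (λ e → Fin.suc-injective (inj e))
         where
         case : ∀ {j : Fin r′} → ¬ suc j ≡ zero
         case ()
   ... | R , d , eq = σ , R , distinct-pairs r f R f-injective (distinct-++ʳ (select f σ) R d) outside , eq
     where
     σ = tabulate (λ j → lookup e (f j true))
     outside : ∀ j b → lookup (toSet R) (f j b) ≡ false
     outside j b with b Bool.≟ lookup e (f j true)
     ... | yes refl = subst (λ v → lookup (toSet R) v ≡ false)
           (trans (Vec.lookup∘tabulate (λ j → f j (lookup σ j)) j) (cong (f j) (Vec.lookup∘tabulate (λ j → lookup e (f j true)) j)))
           (∉-tail (select f σ) R d j)
     ... | no ne = ∉-++ʳ (select f σ) R (f j b) (trans (cong (λ A → lookup A (f j b)) eq) (unchosen b (lookup e (f j true)) refl ne))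
       where
       unchosen : ∀ b c → lookup e (f j true) ≡ c → ¬ b ≡ c → lookup e (f j b) ≡ false
       unchosen false false h ne = ⊥-elim (ne refl)
       unchosen false true  h ne = trans (split j) (cong not h)
       unchosen true  false h ne = h
       unchosen true  true  h ne = ⊥-elim (ne refl)

   firsts : Vec (Fin (suc n)) r
   firsts = tabulate (λ j → f j false)

   module Averaged (Φ : Subset (suc n) → ℚ) (Φ-uniform : Uniform (r ℕ.+ s) Φ) where

     tuple : Permutation′ (suc n) → Vec (Fin (suc n)) (r ℕ.* 2)
     tuple α = map (α ⟨$⟩ʳ_) (pairsOf r f)

     -- With this sign as a weight the mean difference contributes its absolute value, and flips of
     -- the pairs act on `φ` by `signProduct`.
     φ : Permutation′ (suc n) → ℚ
     φ α = sgn (meanDiff Φ r s (tuple α))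

     φ-ext : Extensional φ
     φ-ext {π} {ρ} h = cong (λ xs → sgn (meanDiff Φ r s xs)) (map-ext {π = π} {ρ} h (pairsOf r f))

     φ²≤1 : ∀ α → φ α * φ α ≤ 1ℚ
     φ²≤1 α = sgn²≤1 (meanDiff Φ r s (tuple α))

     meanDiff-twist : ∀ σ g → meanDiff Φ r s (pairsOf r (λ j b → g j (b xor lookup σ j))) ≡ signProduct σ * meanDiff Φ r s (pairsOf r g)
     meanDiff-twist σ g = trans (∫-cong T (λ R → diff-twist Φ σ g (toSet R))) (∫-*ˡ T (signProduct σ) _)

     φ-twist : ∀ σ κ → (∀ j b → κ ⟨$⟩ʳ f j b ≡ f j (b xor lookup σ j)) → ∀ α → φ (κ ∘ₚ α) ≡ signProduct σ * φ α
     φ-twist σ κ h α = trans (cong sgn (trans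
       (cong (meanDiff Φ r s) (trans (map-pairsOf ((κ ∘ₚ α) ⟨$⟩ʳ_) r f) (pairsOf-cong r (λ j b → cong (α ⟨$⟩ʳ_) (h j b)))))
       (trans (meanDiff-twist σ (λ j b → α ⟨$⟩ʳ f j b)) (cong (λ xs → signProduct σ * meanDiff Φ r s xs) (sym (map-pairsOf (α ⟨$⟩ʳ_) r f))))))
       (sgn-signProduct σ (meanDiff Φ r s (tuple α)))

     -- By symmetry `avg` is determined by one number: it vanishes unless e has r + s vertices and
     -- exactly one in each pair, and on such sets it is constant up to `signProduct`. This makes
     -- the product of two such averages tractable.
     avg : Subset (suc n) → ℚ
     avg e = ∫ P (λ α → φ α * Φ (image α e))

     -- The random permutation α is replaced by κ followed by α, which has the same law; as c² = 1,
     -- the factor c may be moved to the other side.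
     avg-transport : ∀ c κ → c * c ≡ 1ℚ → (∀ α → φ (κ ∘ₚ α) ≡ c * φ α) → ∀ e → avg (image κ e) ≡ c * avg e
     avg-transport c κ c² h e = begin
       ∫ P (λ α → φ α * Φ (image α (image κ e)))
         ≡⟨ ∫-cong P (λ α → cong₂ _*_ (back α) (cong Φ (image-∘ κ α e))) ⟩
       ∫ P (λ α → c * φ (κ ∘ₚ α) * Φ (image (κ ∘ₚ α) e))
         ≡⟨ ∫-perms-right κ (λ α → c * φ α * Φ (image α e)) (λ {π} {ρ} h → cong₂ (λ x y → c * x * Φ y) (φ-ext {π} {ρ} h) (image-cong {π = π} {ρ} h e)) ⟩
       ∫ P (λ α → c * φ α * Φ (image α e))
         ≡⟨ trans (∫-cong P (λ α → ℚ.*-assoc c (φ α) (Φ (image α e)))) (∫-*ˡ P c _) ⟩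
       c * avg e ∎
       where
       open ≡-Reasoning
       back : ∀ α → φ α ≡ c * φ (κ ∘ₚ α)
       back α = trans (sym (ℚ.*-identityˡ (φ α))) (trans (cong (_* φ α) (sym c²))
         (trans (ℚ.*-assoc c c (φ α)) (cong (c *_) (sym (h α)))))

     avg-size : ∀ e → ¬ ∣ e ∣ ≡ r ℕ.+ s → avg e ≡ 0ℚ
     avg-size e ne = ∫-≡0 P (λ α → trans (cong (φ α *_) (Φ-uniform (image α e) (λ h → ne (trans (sym (∣image∣ α e)) h)))) (ℚ.*-zeroʳ (φ α)))

     -- Transposing the two vertices of the pair leaves e unchanged and negates `φ`, so the average
     -- equals its own negative.
     avg-unsplit : ∀ e j → lookup e (f j false) ≡ lookup e (f j true) → avg e ≡ 0ℚ
     avg-unsplit e j h = x≡-x⇒x≡0 (trans (cong avg (sym (image-transpose (f j false) (f j true) e h)))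
       (trans (avg-transport (signProduct σ) τ (signProduct² σ) (φ-twist σ τ moves) e)
       (trans (cong (_* avg e) (single-sign j)) (lem (avg e)))))
       where
       lem : ∀ x → (- 1ℚ) * x ≡ - x
       lem = solve-∀ ringℚ
       τ = transpose (f j false) (f j true)
       single : ∀ {r} → Fin r → Vec Bool r
       single zero    = true ∷ Vec.replicate _ false
       single (suc j) = false ∷ single j
       σ = single j
       none-sign : ∀ r → signProduct (Vec.replicate r false) ≡ 1ℚ
       none-sign zero    = refl
       none-sign (suc r) = trans (ℚ.*-identityˡ _) (none-sign r)
       single-sign : ∀ {r} (j : Fin r) → signProduct (single j) ≡ - 1ℚ
       single-sign {suc r} zero = cong ((- 1ℚ) *_) (none-sign r)
       single-sign (suc j) = trans (ℚ.*-identityˡ _) (single-sign j)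
       lookup-single : ∀ {r} (j : Fin r) → lookup (single j) j ≡ true
       lookup-single zero    = refl
       lookup-single (suc j) = lookup-single j
       lookup-single-≢ : ∀ {r} {j i : Fin r} → ¬ j ≡ i → lookup (single j) i ≡ false
       lookup-single-≢ {j = zero}  {zero}  ne = ⊥-elim (ne refl)
       lookup-single-≢ {j = zero}  {suc i} ne = Vec.lookup-replicate i false
       lookup-single-≢ {j = suc j} {zero}  ne = refl
       lookup-single-≢ {j = suc j} {suc i} ne = lookup-single-≢ (λ e → ne (cong suc e))
       xor-false : ∀ b → b ≡ b xor false
       xor-false false = refl
       xor-false true  = refl
       transpose-matchʳ : ∀ (a b : Fin (suc n)) → ¬ a ≡ b → transpose a b ⟨$⟩ʳ b ≡ a
       transpose-matchʳ a b ne with b Fin.≟ a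
       ... | yes refl = ⊥-elim (ne refl)
       ... | no _ with b Fin.≟ b
       ...   | yes _ = refl
       ...   | no n = ⊥-elim (n refl)
       f≢t : ¬ false ≡ true
       f≢t ()
       moves : ∀ i b → τ ⟨$⟩ʳ f i b ≡ f i (b xor lookup σ i)
       moves i b with j Fin.≟ i
       ... | no ne = trans (transpose-mismatch (λ e → ne (proj₁ (f-injective e))) (λ e → ne (proj₁ (f-injective e))))
                       (cong (f i) (trans (xor-false b) (cong (b xor_) (sym (lookup-single-≢ ne)))))
       moves i false | yes refl = trans (transpose-matchˡ (f i false) (f i true)) (cong (f i) (sym (lookup-single i)))
       moves i true  | yes refl = trans (transpose-matchʳ (f i false) (f i true) (λ e → f≢t (proj₂ (f-injective e))))
                                    (cong (λ c → f i (true xor c)) (sym (lookup-single i)))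

     toSet-select : ∀ κ σ (R : Vec (Fin (suc n)) s) → (∀ j b → κ ⟨$⟩ʳ f j b ≡ f j (b xor lookup σ j)) →
       image κ (toSet (firsts ++ R)) ≡ toSet (select f σ ++ map (κ ⟨$⟩ʳ_) R)
     toSet-select κ σ R h = trans (image-toSet κ (firsts ++ R)) (cong toSet (trans (Vec.map-++ (κ ⟨$⟩ʳ_) firsts R)
       (cong (_++ map (κ ⟨$⟩ʳ_) R) (trans (sym (Vec.tabulate-∘ (κ ⟨$⟩ʳ_) (λ j → f j false))) (Vec.tabulate-cong (λ j → h j false))))))

     -- A permutation that flips the pairs according to σ and carries R to R′ transports one average
     -- to the other.
     avg-select : ∀ σ R R′ → Valid R → Valid R′ →
       avg (toSet (select f σ ++ R′)) ≡ signProduct σ * avg (toSet (firsts ++ R))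
     avg-select σ R R′ v v′ with extend (pairsOf r f ++ R) (pairsOf r (twist σ) ++ R′) v
         (distinct-pairs r (twist σ) R′ (λ {i} {b} {j} {c} → twist-injective σ {i} {b} {j} {c}) (distinct-++ʳ (pairsOf r f) R′ v′) (λ j b → outside j (b xor lookup σ j)))
       where
       outside : ∀ j b → lookup (toSet R′) (f j b) ≡ false
       outside j b = go r f v′ j b
         where
         go : ∀ r (f : Fin r → Bool → Fin (suc n)) → Distinct (pairsOf r f ++ R′) → ∀ j b → lookup (toSet R′) (f j b) ≡ false
         go (suc r) f (h₁ , h₂ , d) zero    false = ∉-++ʳ (pairsOf r (λ j → f (suc j))) R′ _ (proj₂ (fresh-∷ {y = f zero true} (pairsOf r (λ j → f (suc j)) ++ R′) h₁))
         go (suc r) f (h₁ , h₂ , d) zero    true  = ∉-++ʳ (pairsOf r (λ j → f (suc j))) R′ _ h₂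
         go (suc r) f (h₁ , h₂ , d) (suc j) b     = go r (λ j → f (suc j)) d j b
     ... | κ , eq = trans (cong avg (trans (cong (λ z → toSet (select f σ ++ z)) (sym mapR)) (sym (toSet-select κ σ R moves))))
         (avg-transport (signProduct σ) κ (signProduct² σ) (φ-twist σ κ moves) (toSet (firsts ++ R)))
       where
       halves = Vec.++-injective (map (κ ⟨$⟩ʳ_) (pairsOf r f)) (pairsOf r (twist σ)) (trans (sym (Vec.map-++ (κ ⟨$⟩ʳ_) (pairsOf r f) R)) eq)
       mapR : map (κ ⟨$⟩ʳ_) R ≡ R′
       mapR = proj₂ halves
       moves : ∀ j b → κ ⟨$⟩ʳ f j b ≡ f j (b xor lookup σ j)
       moves = pairsOf-injective r (trans (sym (map-pairsOf (κ ⟨$⟩ʳ_) r f)) (proj₁ halves))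

     avg-constant : ∀ R R′ → Valid R → Valid R′ → avg (toSet (firsts ++ R′)) ≡ avg (toSet (firsts ++ R))
     avg-constant R R′ v v′ = trans (cong (λ z → avg (toSet (z ++ R′))) (Vec.tabulate-cong (λ j → cong (f j) (sym (Vec.lookup-replicate j false)))))
       (trans (avg-select (Vec.replicate r false) R R′ v v′) (trans (cong (_* avg (toSet (firsts ++ R))) (none-sign r)) (ℚ.*-identityˡ _)))
       where
       none-sign : ∀ r → signProduct (Vec.replicate r false) ≡ 1ℚ
       none-sign zero    = refl
       none-sign (suc r) = trans (ℚ.*-identityˡ _) (none-sign r)

     avg-invalid : ∀ R → ¬ Valid R → avg (toSet (firsts ++ R)) ≡ 0ℚ
     avg-invalid R nv with ∣ toSet (firsts ++ R) ∣ ℕ.≟ r ℕ.+ s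
     ... | no ne = avg-size (toSet (firsts ++ R)) ne
     ... | yes size with splits? (toSet (firsts ++ R))
     ...   | inj₁ (j , h) = avg-unsplit (toSet (firsts ++ R)) j h
     ...   | inj₂ split = ⊥-elim (nv (distinct-pairs r f R f-injective (distinct-++ʳ firsts R d) outside))
       where
       d : Distinct (firsts ++ R)
       d with distinct? (firsts ++ R)
       ... | yes d = d
       ... | no nd = ⊥-elim (ℕ.<⇒≢ (¬distinct⇒∣toSet∣< (firsts ++ R) nd) size)
       member : ∀ j → lookup (toSet (firsts ++ R)) (f j false) ≡ true
       member j = subst (λ v → lookup (toSet (firsts ++ R)) v ≡ true) (Vec.lookup∘tabulate (λ j → f j false) j) (∈-++ˡ firsts R j)
       not-injective : ∀ {b} → true ≡ not b → b ≡ false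
       not-injective {false} e = refl
       outside : ∀ j b → lookup (toSet R) (f j b) ≡ false
       outside j false = subst (λ v → lookup (toSet R) v ≡ false) (Vec.lookup∘tabulate (λ j → f j false) j) (∉-tail firsts R d j)
       outside j true  = ∉-++ʳ firsts R (f j true) (not-injective (trans (sym (member j)) (split j)))

     weight : ℚ
     weight = ∫ P (λ α → ℚ.∣ meanDiff Φ r s (tuple α) ∣)

     avg-mean : ∫ T (λ R → avg (toSet (firsts ++ R))) ≡ weight
     avg-mean = begin
       ∫ T (λ R → avg (toSet (firsts ++ R)))
         ≡⟨ ∫-swap T P _ ⟩
       ∫ P (λ α → ∫ T (λ R → φ α * Φ (image α (toSet (firsts ++ R)))))
         ≡⟨ ∫-cong P (λ α → trans (∫-*ˡ T (φ α) _) (cong (φ α *_) (trans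
              (∫-cong T (λ R → cong Φ (trans (image-toSet α (firsts ++ R)) (cong toSet (Vec.map-++ (α ⟨$⟩ʳ_) firsts R)))))
              (∫-power-map U (α ⟨$⟩ʳ_) (unif-permute α) s (λ R → Φ (toSet (map (α ⟨$⟩ʳ_) firsts ++ R))))))) ⟩
       ∫ P (λ α → φ α * Z (map (α ⟨$⟩ʳ_) firsts))
         -- A dummy average over σ. For each σ a change of variables flips the pairs, so that
         -- `firsts` becomes `select f σ` and `φ` yields the factor `signProduct σ`; together the
         -- terms form the mean difference.
         ≡⟨ const (cube-prob r) _ ⟨
       ∫ (cube r) (λ σ → ∫ P (λ α → φ α * Z (map (α ⟨$⟩ʳ_) firsts)))
         ≡⟨ ∫-cong (cube r) chosen ⟩
       ∫ (cube r) (λ σ → ∫ P (λ α → φ α * (signProduct σ * Z (map (α ⟨$⟩ʳ_) (select f σ)))))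
         ≡⟨ trans (∫-swap (cube r) P _) (∫-cong P (λ α → trans (∫-*ˡ (cube r) (φ α) _) (cong (φ α *_) (sym (expand α))))) ⟩
       ∫ P (λ α → φ α * meanDiff Φ r s (tuple α))
         ≡⟨ ∫-cong P (λ α → sgn-* (meanDiff Φ r s (tuple α))) ⟩
       weight ∎
       where
       open ≡-Reasoning
       Z : Vec (Fin (suc n)) r → ℚ
       Z ys = ∫ T (λ R → Φ (toSet (ys ++ R)))
       map-select : ∀ α σ → select (λ j b → α ⟨$⟩ʳ f j b) σ ≡ map (α ⟨$⟩ʳ_) (select f σ)
       map-select α σ = Vec.tabulate-∘ (α ⟨$⟩ʳ_) (λ j → f j (lookup σ j))
       expand : ∀ α → meanDiff Φ r s (tuple α) ≡ ∫ (cube r) (λ σ → signProduct σ * Z (map (α ⟨$⟩ʳ_) (select f σ)))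
       expand α = begin
         ∫ T (λ R → diff Φ r (tuple α) (toSet R))
           ≡⟨ ∫-cong T (λ R → trans (cong (λ xs → diff Φ r xs (toSet R)) (map-pairsOf (α ⟨$⟩ʳ_) r f)) (diff-select Φ r (λ j b → α ⟨$⟩ʳ f j b) (toSet R))) ⟩
         ∫ T (λ R → ∫ (cube r) (λ σ → signProduct σ * Φ (addAll (select (λ j b → α ⟨$⟩ʳ f j b) σ) (toSet R))))
           ≡⟨ ∫-swap T (cube r) _ ⟩
         ∫ (cube r) (λ σ → ∫ T (λ R → signProduct σ * Φ (addAll (select (λ j b → α ⟨$⟩ʳ f j b) σ) (toSet R))))
           ≡⟨ ∫-cong (cube r) (λ σ → trans (∫-*ˡ T (signProduct σ) _) (cong (signProduct σ *_) (∫-cong T (λ R → cong Φ (trans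
                (cong (λ ys → addAll ys (toSet R)) (map-select α σ)) (sym (toSet-++ (map (α ⟨$⟩ʳ_) (select f σ)) R))))))) ⟩
         ∫ (cube r) (λ σ → signProduct σ * Z (map (α ⟨$⟩ʳ_) (select f σ))) ∎
       chosen : ∀ σ → ∫ P (λ α → φ α * Z (map (α ⟨$⟩ʳ_) firsts)) ≡ ∫ P (λ α → φ α * (signProduct σ * Z (map (α ⟨$⟩ʳ_) (select f σ))))
       chosen σ with extend (pairsOf r f) (pairsOf r (twist σ)) (pairsOf-distinct r f f-injective) (pairsOf-distinct r (twist σ) (λ {i} {b} {j} {c} → twist-injective σ {i} {b} {j} {c}))
       ... | κ , eq = begin
         ∫ P (λ α → φ α * Z (map (α ⟨$⟩ʳ_) firsts))
           ≡⟨ ∫-perms-right κ (λ α → φ α * Z (map (α ⟨$⟩ʳ_) firsts)) (λ {π} {ρ} h → cong₂ (λ x y → x * Z y) (φ-ext {π} {ρ} h) (map-ext {π = π} {ρ} h firsts)) ⟨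
         ∫ P (λ α → φ (κ ∘ₚ α) * Z (map ((κ ∘ₚ α) ⟨$⟩ʳ_) firsts))
           ≡⟨ ∫-cong P (λ α → trans (cong₂ _*_ (φ-twist σ κ moves α) (cong Z (moved α))) (lem (signProduct σ) (φ α) (Z (map (α ⟨$⟩ʳ_) (select f σ))))) ⟩
         ∫ P (λ α → φ α * (signProduct σ * Z (map (α ⟨$⟩ʳ_) (select f σ)))) ∎
         where
         moves : ∀ j b → κ ⟨$⟩ʳ f j b ≡ f j (b xor lookup σ j)
         moves = pairsOf-injective r (trans (sym (map-pairsOf (κ ⟨$⟩ʳ_) r f)) eq)
         moved : ∀ α → map ((κ ∘ₚ α) ⟨$⟩ʳ_) firsts ≡ map (α ⟨$⟩ʳ_) (select f σ)
         moved α = trans (sym (Vec.tabulate-∘ ((κ ∘ₚ α) ⟨$⟩ʳ_) (λ j → f j false)))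
           (trans (Vec.tabulate-cong (λ j → cong (α ⟨$⟩ʳ_) (moves j false))) (Vec.tabulate-∘ (α ⟨$⟩ʳ_) (λ j → f j (lookup σ j))))
         lem : ∀ a b c → a * b * c ≡ b * (a * c)
         lem = solve-∀ ringℚ

     weight-nonneg : 0ℚ ≤ weight
     weight-nonneg = nonneg (perms-prob (suc n)) _ (λ α → ℚ.0≤∣p∣ (meanDiff Φ r s (tuple α)))

     -- The average has one common value on valid tuples and vanishes on the others, while its mean
     -- is `weight`, which is nonnegative; a negative common value is impossible.
     avg-nonneg : ∀ R → Valid R → 0ℚ ≤ avg (toSet (firsts ++ R))
     avg-nonneg R v with ℚ.≤-total 0ℚ (avg (toSet (firsts ++ R)))
     ... | inj₁ h = h
     ... | inj₂ a≤0 = subst₂ _≤_ refl (neg-neg _) (neg-mono (*-cancelˡ (inv (suc n) ^ s) (^-pos s (inv-pos n)) (begin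
       inv (suc n) ^ s * (- avg (toSet (firsts ++ R)))
         ≤⟨ ∫-power-point (unif-prob n) (inv-nonneg (suc n)) (unif-point (suc n)) (λ R → - avg (toSet (firsts ++ R))) negative R ⟩
       ∫ T (λ R → - avg (toSet (firsts ++ R)))
         ≡⟨ trans (∫-neg T _) (cong -_ avg-mean) ⟩
       - weight
         ≤⟨ neg-mono weight-nonneg ⟩
       0ℚ
         ≡⟨ ℚ.*-zeroʳ (inv (suc n) ^ s) ⟨
       inv (suc n) ^ s * 0ℚ ∎)))
       where
       open ℚ.≤-Reasoning
       negative : ∀ R′ → 0ℚ ≤ - avg (toSet (firsts ++ R′))
       negative R′ with distinct? (pairsOf r f ++ R′)
       ... | yes v′ = subst (λ z → 0ℚ ≤ - z) (sym (avg-constant R R′ v v′)) (neg-mono a≤0)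
       ... | no nv  = subst (λ z → 0ℚ ≤ - z) (sym (avg-invalid R′ nv)) ℚ.≤-refl

   module Product (Φ Ψ : Subset (suc n) → ℚ) (Φ-uniform : Uniform (r ℕ.+ s) Φ) (Ψ-uniform : Uniform (r ℕ.+ s) Ψ) where
     module A = Averaged Φ Φ-uniform
     module B = Averaged Ψ Ψ-uniform

     -- On a set that splits the pairs, both averages carry the same factor `signProduct σ`, whose
     -- square is 1.
     product-nonneg : ∀ e → 0ℚ ≤ A.avg e * B.avg e
     product-nonneg e with ∣ e ∣ ℕ.≟ r ℕ.+ s
     ... | no ne = ℚ.≤-reflexive (sym (trans (cong (_* B.avg e) (A.avg-size e ne)) (ℚ.*-zeroˡ (B.avg e))))
     ... | yes size with splits? e
     ...   | inj₁ (j , h) = ℚ.≤-reflexive (sym (trans (cong (_* B.avg e) (A.avg-unsplit e j h)) (ℚ.*-zeroˡ (B.avg e))))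
     ...   | inj₂ split with decompose e size split
     ...     | σ , R , v , refl = subst (0ℚ ≤_) (sym eq) (*-nonneg (A.avg-nonneg R v) (B.avg-nonneg R v))
       where
       a = A.avg (toSet (firsts ++ R))
       b = B.avg (toSet (firsts ++ R))
       lem : ∀ s a b → s * a * (s * b) ≡ s * s * (a * b)
       lem = solve-∀ ringℚ
       eq : A.avg (toSet (select f σ ++ R)) * B.avg (toSet (select f σ ++ R)) ≡ a * b
       eq = trans (cong₂ _*_ (A.avg-select σ R R v v) (B.avg-select σ R R v v))
         (trans (lem (signProduct σ) a b) (trans (cong (_* (a * b)) (signProduct² σ)) (ℚ.*-identityˡ (a * b))))

     -- As functions of R, both averages are nonnegative multiples of the indicator of valid tuples,
     -- which is its own square and has mean at most 1.
     chebyshev : A.weight * B.weight ≤ ∫ T (λ R → A.avg (toSet (firsts ++ R)) * B.avg (toSet (firsts ++ R)))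
     chebyshev = begin
       A.weight * B.weight
         ≡⟨ cong₂ _*_ A.avg-mean B.avg-mean ⟨
       ∫ T a * ∫ T b
         ≡⟨ trans (∫-*ʳ T (∫ T b) a) refl ⟨
       ∫ T (λ R → a R * ∫ T b)
         ≡⟨ ∫-cong T (λ R → ∫-*ˡ T (a R) b) ⟨
       ∫ T (λ R → ∫ T (λ R′ → a R * b R′))
         ≤⟨ mono T-prob _ _ (λ R → ≤-const T-prob (a R * b R) (compare R)) ⟩
       ∫ T (λ R → a R * b R) ∎
       where
       open ℚ.≤-Reasoning
       T-prob = power-prob (unif-prob n) s
       a = λ R → A.avg (toSet (firsts ++ R))
       b = λ R → B.avg (toSet (firsts ++ R))
       compare : ∀ R R′ → a R * b R′ ≤ a R * b R
       compare R R′ with distinct? (pairsOf r f ++ R)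
       ... | no nv = ℚ.≤-reflexive (trans (zero-left (b R′)) (sym (zero-left (b R))))
         where
         zero-left : ∀ x → a R * x ≡ 0ℚ
         zero-left x = trans (cong (_* x) (A.avg-invalid R nv)) (ℚ.*-zeroˡ x)
       ... | yes v with distinct? (pairsOf r f ++ R′)
       ...   | yes v′ = ℚ.≤-reflexive (cong (a R *_) (B.avg-constant R R′ v v′))
       ...   | no nv′ = *-monoˡ (a R) (A.avg-nonneg R v) (subst (_≤ b R) (sym (B.avg-invalid R′ nv′)) (B.avg-nonneg R v))

     shared : Permutation′ (suc n) → Permutation′ (suc n) → ℚ
     shared α β = ∫ (power U (r ℕ.+ s)) (λ p → Φ (toSet (map (α ⟨$⟩ʳ_) p)) * Ψ (toSet (map (β ⟨$⟩ʳ_) p)))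

     -- The factor is the probability that the first r entries of a random tuple are exactly
     -- `firsts`. As the product of the averages is nonnegative, all other tuples may be discarded.
     correlation : inv (suc n) ^ r * (A.weight * B.weight) ≤ ∫ P (λ α → ∫ P (λ β → A.φ α * B.φ β * shared α β))
     correlation = begin
       inv (suc n) ^ r * (A.weight * B.weight)
         ≤⟨ *-monoˡ (inv (suc n) ^ r) (^-nonneg r (inv-nonneg (suc n))) chebyshev ⟩
       inv (suc n) ^ r * ∫ T (λ R → A.avg (toSet (firsts ++ R)) * B.avg (toSet (firsts ++ R)))
         ≤⟨ ∫-power-point (unif-prob n) (inv-nonneg (suc n)) (unif-point (suc n))
              (λ ys → ∫ T (λ R → A.avg (toSet (ys ++ R)) * B.avg (toSet (ys ++ R))))
              (λ ys → nonneg (power-prob (unif-prob n) s) _ (λ R → product-nonneg (toSet (ys ++ R)))) firsts ⟩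
       ∫ (power U r) (λ ys → ∫ T (λ R → A.avg (toSet (ys ++ R)) * B.avg (toSet (ys ++ R))))
         ≡⟨ ∫-power-++ U r s _ ⟨
       ∫ Q (λ p → A.avg (toSet p) * B.avg (toSet p))
         ≡⟨ ∫-cong Q (λ p → trans (sym (∫-*ʳ P (B.avg (toSet p)) _)) (∫-cong P (λ α → sym (∫-*ˡ P (A.φ α * Φ (image α (toSet p))) _)))) ⟩
       ∫ Q (λ p → ∫ P (λ α → ∫ P (λ β → A.φ α * Φ (image α (toSet p)) * (B.φ β * Ψ (image β (toSet p))))))
         ≡⟨ trans (∫-swap Q P _) (∫-cong P (λ α → ∫-swap Q P _)) ⟩
       ∫ P (λ α → ∫ P (λ β → ∫ Q (λ p → A.φ α * Φ (image α (toSet p)) * (B.φ β * Ψ (image β (toSet p))))))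
         ≡⟨ ∫-cong P (λ α → ∫-cong P (λ β → trans (∫-cong Q (λ p → trans
              (cong₂ (λ x y → A.φ α * Φ x * (B.φ β * Ψ y)) (image-toSet α p) (image-toSet β p))
              (lem (A.φ α) (Φ (toSet (map (α ⟨$⟩ʳ_) p))) (B.φ β) (Ψ (toSet (map (β ⟨$⟩ʳ_) p)))))) (∫-*ˡ Q (A.φ α * B.φ β) _))) ⟩
       ∫ P (λ α → ∫ P (λ β → A.φ α * B.φ β * shared α β)) ∎
       where
       open ℚ.≤-Reasoning
       Q = power U (r ℕ.+ s)
       lem : ∀ a x b y → a * x * (b * y) ≡ a * b * (x * y)
       lem = solve-∀ ringℚ

-- The mean square of the Fourier coefficients of the overlap.

module Energy where

 open Blocks
 open Correlation
 open Cubes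
 open Khinchine
 open Measures
 open Permutations
 open Rationals
 open Subsets
 open Probability
 open import Data.Bool using (_xor_)
 open import Data.Maybe.Properties using (just-injective)
 open import Data.Rational using (_+_; _*_; _-_; -_; _≤_; ∣_∣)
 open import Data.Vec using (lookup; map; tabulate)

 module Spread {n q : ℕ} (s m : ℕ) (P : Pairing (suc n) (suc q) m)
   (Φ Ψ : Subset (suc n) → ℚ) (Φ-uniform : Uniform (suc q ℕ.+ s) Φ) (Ψ-uniform : Uniform (suc q ℕ.+ s) Ψ)
   (0≤Φ : ∀ e → 0ℚ ≤ Φ e) (Φ≤1 : ∀ e → Φ e ≤ 1ℚ) (0≤Ψ : ∀ e → 0ℚ ≤ Ψ e) (Ψ≤1 : ∀ e → Ψ e ≤ 1ℚ)
   (Λ : Measure ℚ) (Λ-extracts : Extractor (suc q ℕ.+ s) Λ) where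

   open Pairing P
   open Flips P Λ
   open Extraction Λ m
   open Forms Λ m

   private
     r k : ℕ
     r = suc q
     k = r ℕ.+ s
     S = perms (suc n)
     S-prob = perms-prob (suc n)
     Q = power (unif (suc n)) k
     Q-prob = power-prob (unif-prob n) k

   overlap′ : Permutation′ (suc n) → Permutation′ (suc n) → ℚ
   overlap′ α β = ∫ Q (λ p → Φ (toSet (map (α ⟨$⟩ʳ_) p)) * Ψ (toSet (map (β ⟨$⟩ʳ_) p)))

   positions : Vec (Fin m) r → Fin r → Bool → Fin (suc n)
   positions I j b = point j (lookup I j) b

   point-injective : ∀ {j i b j′ i′ b′} → point j i b ≡ point j′ i′ b′ → (j , i , b) ≡ (j′ , i′ , b′)
   point-injective {j} {i} {b} {j′} {i′} {b′} e =
     just-injective (trans (sym (locate-point j i b)) (trans (cong locate e) (locate-point j′ i′ b′)))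

   positions-injective : ∀ I {i b j c} → positions I i b ≡ positions I j c → i ≡ j × b ≡ c
   positions-injective I e with point-injective e
   ... | eq = cong proj₁ eq , cong (λ z → proj₂ (proj₂ z)) eq

   module At (I : Vec (Fin m) r) where
     open Positions s (positions I) (λ {i} {b} {j} {c} → positions-injective I {i} {b} {j} {c}) public
     open Product Φ Ψ Φ-uniform Ψ-uniform public

   private
     -- Centring at one value of the overlap, instead of at the expected value ν, keeps every term
     -- between -1 and 1; it costs only a factor 2 in the bound D.
     μ : ℚ
     μ = overlap′ Perm.id Perm.id

     0≤overlap : ∀ α β → 0ℚ ≤ overlap′ α β
     0≤overlap α β = nonneg Q-prob _ (λ p → *-nonneg (0≤Φ _) (0≤Ψ _))

     product≤1 : ∀ a b → Φ a * Ψ b ≤ 1ℚ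
     product≤1 a b = ℚ.≤-trans (*-mono (0≤Ψ b) 0≤1 (Φ≤1 a) (Ψ≤1 b)) (ℚ.≤-reflexive refl)

     overlap≤1 : ∀ α β → overlap′ α β ≤ 1ℚ
     overlap≤1 α β = ≤-const Q-prob 1ℚ (λ p → product≤1 _ _)

     unit-difference : ∀ {x y} → 0ℚ ≤ x → x ≤ 1ℚ → 0ℚ ≤ y → y ≤ 1ℚ → ∣ x - y ∣ ≤ 1ℚ
     unit-difference {x} {y} 0≤x x≤1 0≤y y≤1 = ∣p∣≤
       (≤-by (1ℚ - x + y) (+-nonneg (0≤q-p x≤1) 0≤y) (lem₁ x y))
       (≤-by (x + (1ℚ - y)) (+-nonneg 0≤x (0≤q-p y≤1)) (lem₂ x y))
       where
       lem₁ : ∀ x y → 1ℚ ≡ x - y + (1ℚ - x + y)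
       lem₁ = solve-∀ ringℚ
       lem₂ : ∀ x y → 1ℚ ≡ - (x - y) + (x + (1ℚ - y))
       lem₂ = solve-∀ ringℚ

     term : Permutation′ (suc n) → Permutation′ (suc n) → Vec (Fin (suc n)) k → Signs → ℚ
     term α β p ε = Φ (toSet (map (α ⟨$⟩ʳ_) p)) * Ψ (toSet (map ((flips ε ∘ₚ β) ⟨$⟩ʳ_) p)) - μ

     centred : Permutation′ (suc n) → Permutation′ (suc n) → Signs → ℚ
     centred α β ε = overlap′ α (flips ε ∘ₚ β) - μ

     centred-terms : ∀ α β ε → centred α β ε ≡ ∫ Q (λ p → term α β p ε)
     centred-terms α β ε = sym (trans (∫-- Q _ (λ _ → μ)) (cong (λ z → overlap′ α (flips ε ∘ₚ β) - z) (const Q-prob μ)))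

     term-onHits : ∀ α β p → OnHits p (term α β p)
     term-onHits α β p ε δ h = cong (λ z → Φ (toSet (map (α ⟨$⟩ʳ_) p)) * Ψ (toSet z) - μ)
       (trans (Vec.map-∘ (β ⟨$⟩ʳ_) (swapped ε) p) (trans (cong (map (β ⟨$⟩ʳ_)) (swapped-agree p ε δ h)) (sym (Vec.map-∘ (β ⟨$⟩ʳ_) (swapped δ) p))))

     centred-good : ∀ α β → Good (centred α β)
     centred-good α β j xs s = begin
       ∫ Λ (λ t → ∫ (biased t s) (λ x → centred α β (xs Vec.[ j ]≔ x)))
         ≡⟨ ∫-cong Λ (λ t → ∫-cong (biased t s) (λ x → centred-terms α β _)) ⟩
       ∫ Λ (λ t → ∫ (biased t s) (λ x → ∫ Q (λ p → term α β p (xs Vec.[ j ]≔ x))))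
         ≡⟨ ∫-key Q (λ p x → term α β p (xs Vec.[ j ]≔ x)) (λ p → onHits-good Λ-extracts p (term α β p) (term-onHits α β p) j xs) s ⟩
       ∫ (cube m) (λ x → dot s x * ∫ Q (λ p → term α β p (xs Vec.[ j ]≔ x)))
         ≡⟨ ∫-cong (cube m) (λ x → cong (dot s x *_) (sym (centred-terms α β _))) ⟩
       ∫ (cube m) (λ x → dot s x * centred α β (xs Vec.[ j ]≔ x)) ∎
       where open ≡-Reasoning

     B : ℚ
     B = (ι k * ((1ℚ + 1ℚ) * inv (suc n))) ^ r

     fourier-terms : ∀ α β I → fourier (centred α β) I ≡ ∫ Q (λ p → fourier (term α β p) I)
     fourier-terms α β I = trans (∫-cong (cubes r) (λ ε → trans (cong (χ I ε *_) (centred-terms α β ε)) (sym (∫-*ˡ Q (χ I ε) _))))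
       (∫-swap (cubes r) Q _)

     ∣fourier-term∣ : ∀ α β I p → ∣ fourier (term α β p) I ∣ ≤ meetsAll r (positions I) (toSet p)
     ∣fourier-term∣ α β I p with search r (λ j → lookup (hits p j) (lookup I j))
       where
       search : ∀ r (h : Fin r → Bool) → (∃[ j ] h j ≡ false) ⊎ (∀ j → h j ≡ true)
       search zero    h = inj₂ λ ()
       search (suc r) h with h zero in eq | search r (λ j → h (suc j))
       ... | false | _ = inj₁ (zero , eq)
       ... | true  | inj₁ (j , e) = inj₁ (suc j , e)
       ... | true  | inj₂ a = inj₂ λ { zero → eq ; (suc j) → a j }
     ... | inj₁ (j , miss) = subst (λ z → ∣ z ∣ ≤ meetsAll r (positions I) (toSet p)) (sym (fourier-missed p (term α β p) (term-onHits α β p) I j miss))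
           (meetsAll-nonneg r (positions I) (toSet p))
     ... | inj₂ all = subst (∣ fourier (term α β p) I ∣ ≤_) (sym (meetsAll-true r (positions I) (toSet p) (λ j → hits-point p j (lookup I j) (all j))))
           (∣fourier∣≤1 (term α β p) I (λ ε → unit-difference (*-nonneg (0≤Φ _) (0≤Ψ _)) (product≤1 _ _) (0≤overlap Perm.id Perm.id) (overlap≤1 Perm.id Perm.id)))

     -- A tuple contributes to the coefficient at I only if it meets the chosen pair of every block,
     -- an event of probability O(n^(-r)).
     ∣fourier∣≤B : ∀ α β I → ∣ fourier (centred α β) I ∣ ≤ B
     ∣fourier∣≤B α β I = begin
       ∣ fourier (centred α β) I ∣                   ≡⟨ cong ∣_∣ (fourier-terms α β I) ⟩
       ∣ ∫ Q (λ p → fourier (term α β p) I) ∣         ≤⟨ ∣∣-≤ Q-prob _ ⟩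
       ∫ Q (λ p → ∣ fourier (term α β p) I ∣)         ≤⟨ mono Q-prob _ _ (∣fourier-term∣ α β I) ⟩
       ∫ Q (λ p → meetsAll r (positions I) (toSet p)) ≤⟨ ∫-meetsAll k k ℕ.≤-refl r (positions I) (λ i j b c e → proj₁ (positions-injective I e)) ⟩
       B ∎
       where open ℚ.≤-Reasoning

     χ-product : ∀ {r} (I : Vec (Fin m) r) (ε : Vec (Vec Bool m) r) → signProduct (tabulate (λ j → lookup (lookup ε j) (lookup I j))) ≡ χ I ε
     χ-product []      []      = refl
     χ-product (i ∷ I) (x ∷ ε) = cong (sg (lookup x i) *_) (χ-product I ε)

     ∫-χ : ∀ I → ∫ (cubes r) (χ I) ≡ 0ℚ
     ∫-χ I = trans (∫-cong (cubes r) (λ ε → sym (ℚ.*-identityʳ (χ I ε)))) (fourier-missed [] (λ _ → 1ℚ) (λ _ _ _ → refl) I zero (lookup-∅ (lookup I zero)))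

     overlap-ext : ∀ α → Extensional (overlap′ α)
     overlap-ext α {π} {ρ} h = ∫-cong Q (λ p → cong (λ z → Φ (toSet (map (α ⟨$⟩ʳ_) p)) * Ψ (toSet z)) (map-ext {π = π} {ρ} h p))

     module Signed (I : Vec (Fin m) r) where
       open At I

       ψ-flip : ∀ ε β → B.φ (flips ε ∘ₚ β) ≡ χ I ε * B.φ β
       ψ-flip ε β = trans (B.φ-twist σ (flips ε) moves β) (cong (_* B.φ β) (χ-product I ε))
         where
         σ = tabulate (λ j → lookup (lookup ε j) (lookup I j))
         moves : ∀ j b → flips ε ⟨$⟩ʳ positions I j b ≡ positions I j (b xor lookup σ j)
         moves j b = trans (swapped-point ε j (lookup I j) b)
           (cong (λ c → positions I j (b xor c)) (sym (Vec.lookup∘tabulate (λ j → lookup (lookup ε j) (lookup I j)) j)))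

       ψ-flipped : ∀ α ε → ∫ S (λ β → B.φ β * overlap′ α (flips ε ∘ₚ β)) ≡ χ I ε * ∫ S (λ β → B.φ β * overlap′ α β)
       ψ-flipped α ε = begin
         ∫ S (λ β → B.φ β * overlap′ α (flips ε ∘ₚ β))
           ≡⟨ ∫-cong S (λ β → trans (cong (_* overlap′ α (flips ε ∘ₚ β)) (back β)) (ℚ.*-assoc (χ I ε) _ _)) ⟩
         ∫ S (λ β → χ I ε * (B.φ (flips ε ∘ₚ β) * overlap′ α (flips ε ∘ₚ β)))
           ≡⟨ ∫-*ˡ S (χ I ε) _ ⟩
         χ I ε * ∫ S (λ β → B.φ (flips ε ∘ₚ β) * overlap′ α (flips ε ∘ₚ β))
           ≡⟨ cong (χ I ε *_) (∫-perms-right (flips ε) (λ β → B.φ β * overlap′ α β)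
                (λ {π} {ρ} h → cong₂ _*_ (B.φ-ext {π} {ρ} h) (overlap-ext α {π} {ρ} h))) ⟩
         χ I ε * ∫ S (λ β → B.φ β * overlap′ α β) ∎
         where
         open ≡-Reasoning
         back : ∀ β → B.φ β ≡ χ I ε * B.φ (flips ε ∘ₚ β)
         back β = trans (sym (ℚ.*-identityˡ (B.φ β))) (trans (cong (_* B.φ β) (sym (χ² I ε)))
           (trans (ℚ.*-assoc (χ I ε) (χ I ε) (B.φ β)) (cong (χ I ε *_) (sym (ψ-flip ε β)))))

       -- The flip inside the overlap is absorbed into β at the price of the character, which
       -- cancels that of the Fourier coefficient. The constant `μ` disappears because the character
       -- has mean 0, there being at least one block.
       ∫-ψ-fourier : ∀ α → ∫ S (λ β → B.φ β * fourier (centred α β) I) ≡ ∫ S (λ β → B.φ β * overlap′ α β)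
       ∫-ψ-fourier α = begin
         ∫ S (λ β → B.φ β * fourier (centred α β) I)
           ≡⟨ ∫-cong S (λ β → sym (∫-*ˡ (cubes r) (B.φ β) _)) ⟩
         ∫ S (λ β → ∫ (cubes r) (λ ε → B.φ β * (χ I ε * (overlap′ α (flips ε ∘ₚ β) - μ))))
           ≡⟨ ∫-swap S (cubes r) _ ⟩
         ∫ (cubes r) (λ ε → ∫ S (λ β → B.φ β * (χ I ε * (overlap′ α (flips ε ∘ₚ β) - μ))))
           ≡⟨ ∫-cong (cubes r) (λ ε → trans (∫-cong S (λ β → lem (B.φ β) (χ I ε) (overlap′ α (flips ε ∘ₚ β)) μ))
                (trans (∫-- S _ _) (cong₂ _-_ (trans (∫-*ˡ S (χ I ε) _) (cong (χ I ε *_) (ψ-flipped α ε))) (∫-*ˡ S (χ I ε * μ) B.φ)))) ⟩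
         ∫ (cubes r) (λ ε → χ I ε * (χ I ε * X) - χ I ε * μ * ∫ S B.φ)
           ≡⟨ ∫-cong (cubes r) (λ ε → trans (lem₂ (χ I ε) X μ (∫ S B.φ)) (cong (λ z → z * X - χ I ε * (μ * ∫ S B.φ)) (χ² I ε))) ⟩
         ∫ (cubes r) (λ ε → 1ℚ * X - χ I ε * (μ * ∫ S B.φ))
           ≡⟨ trans (∫-- (cubes r) _ _) (cong₂ _-_ (const (cubes-prob r) (1ℚ * X)) (trans (∫-*ʳ (cubes r) (μ * ∫ S B.φ) (χ I)) (cong (_* (μ * ∫ S B.φ)) (∫-χ I)))) ⟩
         1ℚ * X - 0ℚ * (μ * ∫ S B.φ)
           ≡⟨ lem₃ X (μ * ∫ S B.φ) ⟩
         X ∎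
         where
         open ≡-Reasoning
         X = ∫ S (λ β → B.φ β * overlap′ α β)
         lem : ∀ p c x u → p * (c * (x - u)) ≡ c * (p * x) - c * u * p
         lem = solve-∀ ringℚ
         lem₂ : ∀ c x u p → c * (c * x) - c * u * p ≡ c * c * x - c * (u * p)
         lem₂ = solve-∀ ringℚ
         lem₃ : ∀ x y → 1ℚ * x - 0ℚ * y ≡ x
         lem₃ = solve-∀ ringℚ

       fourier-correlation : inv (suc n) ^ r * (A.weight * B.weight) ≤ ∫ S (λ α → ∫ S (λ β → A.φ α * B.φ β * fourier (centred α β) I))
       fourier-correlation = ℚ.≤-trans correlation (ℚ.≤-reflexive (∫-cong S (λ α → sym (begin
         ∫ S (λ β → A.φ α * B.φ β * fourier (centred α β) I)
           ≡⟨ trans (∫-cong S (λ β → ℚ.*-assoc (A.φ α) (B.φ β) _)) (∫-*ˡ S (A.φ α) _) ⟩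
         A.φ α * ∫ S (λ β → B.φ β * fourier (centred α β) I)
           ≡⟨ cong (A.φ α *_) (∫-ψ-fourier α) ⟩
         A.φ α * ∫ S (λ β → B.φ β * overlap′ α β)
           ≡⟨ trans (∫-cong S (λ β → ℚ.*-assoc (A.φ α) (B.φ β) _)) (∫-*ˡ S (A.φ α) _) ⟨
         ∫ S (λ β → A.φ α * B.φ β * overlap′ α β) ∎))))
         where open ≡-Reasoning

       -- Cauchy-Schwarz, linearised: 2lux - l² ≤ x² whenever u² ≤ 1, because the difference is (x -
       -- lu)² + l²(1 - u²).
       second-moment : ∀ l → 0ℚ ≤ l → l ≤ inv (suc n) ^ r * (A.weight * B.weight) →
         l * l ≤ ∫ S (λ α → ∫ S (λ β → fourier (centred α β) I * fourier (centred α β) I))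
       second-moment l 0≤l l≤ = begin
         l * l
           ≡⟨ lem l ⟩
         (l + l) * l - l * l
           ≤⟨ ℚ.+-monoˡ-≤ (- (l * l)) (*-monoˡ (l + l) (+-nonneg 0≤l 0≤l) (ℚ.≤-trans l≤ fourier-correlation)) ⟩
         (l + l) * ∫ S (λ α → ∫ S (λ β → A.φ α * B.φ β * c α β)) - l * l
           ≡⟨ cong₂ _-_ (trans (sym (∫-*ˡ S (l + l) _)) (∫-cong S (λ α → sym (∫-*ˡ S (l + l) _)))) (sym (trans (∫-cong S (λ α → const S-prob (l * l))) (const S-prob (l * l)))) ⟩
         ∫ S (λ α → ∫ S (λ β → (l + l) * (A.φ α * B.φ β * c α β))) - ∫ S (λ α → ∫ S (λ β → l * l))
           ≡⟨ trans (sym (∫-- S _ _)) (∫-cong S (λ α → sym (∫-- S _ _))) ⟩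
         ∫ S (λ α → ∫ S (λ β → (l + l) * (A.φ α * B.φ β * c α β) - l * l))
           ≤⟨ mono S-prob _ _ (λ α → mono S-prob _ _ (λ β → pointwise (A.φ α * B.φ β) (c α β) (unit α β))) ⟩
         ∫ S (λ α → ∫ S (λ β → c α β * c α β)) ∎
         where
         open ℚ.≤-Reasoning
         c = λ α β → fourier (centred α β) I
         lem : ∀ l → l * l ≡ (l + l) * l - l * l
         lem = solve-∀ ringℚ
         unit : ∀ α β → A.φ α * B.φ β * (A.φ α * B.φ β) ≤ 1ℚ
         unit α β = ℚ.≤-trans (ℚ.≤-reflexive (sq (A.φ α) (B.φ β))) (ℚ.≤-trans
           (*-mono (square-nonneg (B.φ β)) 0≤1 (A.φ²≤1 α) (B.φ²≤1 β)) (ℚ.≤-reflexive refl))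
           where
           sq : ∀ a b → a * b * (a * b) ≡ a * a * (b * b)
           sq = solve-∀ ringℚ
         pointwise : ∀ u x → u * u ≤ 1ℚ → (l + l) * (u * x) - l * l ≤ x * x
         pointwise u x u² = ≤-by ((x - l * u) * (x - l * u) + l * l * (1ℚ - u * u))
           (+-nonneg (square-nonneg (x - l * u)) (*-nonneg (square-nonneg l) (0≤q-p u²))) (lem₂ l u x)
           where
           lem₂ : ∀ l u x → x * x ≡ (l + l) * (u * x) - l * l + ((x - l * u) * (x - l * u) + l * l * (1ℚ - u * u))
           lem₂ = solve-∀ ringℚ

   -- `form-lower` is applied for every α and β and averaged only afterwards: the lower bound on the
   -- coefficients is available in the mean, while the upper bounds `B` and D hold for all
   -- permutations.
   energy : ∀ κ D ν σ → 0ℚ ≤ κ → 0ℚ ≤ σ →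
     (∀ I → κ ≤ At.A.weight I) → (∀ I → κ ≤ At.B.weight I) →
     (∀ α β → ∣ overlap′ α β - ν ∣ ≤ D) →
     σ * σ * (ι m ^ suc q * (inv (suc n) ^ suc q * (κ * κ) * (inv (suc n) ^ suc q * (κ * κ)))) ≤
     σ * σ * σ * (norm Λ ^ suc q * (D + D)) +
       3ℚ ^ q * ι m ^ suc (q ℕ.+ q) * fourth ((ι (suc q ℕ.+ s) * ((1ℚ + 1ℚ) * inv (suc n))) ^ suc q)
   energy κ D ν σ 0≤κ 0≤σ κ≤A κ≤B near = begin
     σ * σ * (ι m ^ r * (l * l))
       ≡⟨ cong (σ * σ *_) (sym (∑ᵛ-const r (l * l))) ⟩
     σ * σ * ∑ᵛ {r} (λ I → l * l)
       ≤⟨ *-monoˡ (σ * σ) (*-nonneg 0≤σ 0≤σ) (∑ᵛ-mono _ _ (λ I → Signed.second-moment I l 0≤l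
            (*-monoˡ (inv (suc n) ^ r) (^-nonneg r (inv-nonneg (suc n))) (*-mono 0≤κ (ℚ.≤-trans 0≤κ (κ≤A I)) (κ≤A I) (κ≤B I))))) ⟩
     σ * σ * ∑ᵛ {r} (λ I → ∫ S (λ α → ∫ S (λ β → c α β I * c α β I)))
       ≡⟨ cong (σ * σ *_) (trans (sym (∫-∑ᵛ S (λ α I → ∫ S (λ β → c α β I * c α β I)))) (∫-cong S (λ α → sym (∫-∑ᵛ S (λ β I → c α β I * c α β I))))) ⟩
     σ * σ * ∫ S (λ α → ∫ S (λ β → ∑ᵛ (λ I → c α β I * c α β I)))
       ≡⟨ trans (sym (∫-*ˡ S (σ * σ) _)) (∫-cong S (λ α → sym (∫-*ˡ S (σ * σ) _))) ⟩
     ∫ S (λ α → ∫ S (λ β → σ * σ * ∑ᵛ (λ I → c α β I * c α β I)))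
       ≤⟨ ≤-const S-prob _ (λ α → ≤-const S-prob _ (λ β → form-lower (c α β) B (norm Λ ^ r * (D + D)) σ 0≤σ (∣fourier∣≤B α β)
            (form-bounded {k} Λ-extracts (centred α β) (D + D) (centred-good α β) (λ ε → close α (flips ε ∘ₚ β))))) ⟩
     σ * σ * σ * (norm Λ ^ r * (D + D)) + 3ℚ ^ q * ι m ^ suc (q ℕ.+ q) * fourth B ∎
     where
     open ℚ.≤-Reasoning
     l = inv (suc n) ^ r * (κ * κ)
     0≤l : 0ℚ ≤ l
     0≤l = *-nonneg (^-nonneg r (inv-nonneg (suc n))) (*-nonneg 0≤κ 0≤κ)
     c = λ α β → fourier (centred α β)
     lem : ∀ x u v → x - u ≡ x - v - (u - v)
     lem = solve-∀ ringℚ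
     close : ∀ α β → ∣ overlap′ α β - μ ∣ ≤ D + D
     close α β = ℚ.≤-trans (ℚ.≤-reflexive (cong ∣_∣ (lem (overlap′ α β) μ ν)))
       (ℚ.≤-trans (ℚ.∣p-q∣≤∣p∣+∣q∣ (overlap′ α β - ν) (μ - ν)) (ℚ.+-mono-≤ (near α β) (near Perm.id Perm.id)))

-- Controlling oscillation of low order by biases of higher orders.

module Degrees where

 open Correlation using (diff; meanDiff)
 open Measures
 open Rationals
 open Subsets
 open Probability
 open import Data.Rational using (_+_; _*_; _-_; -_; _≤_; ∣_∣)

 2ℚ : ℚ
 2ℚ = 1ℚ + 1ℚ

 0≤2 : 0ℚ ≤ 2ℚ
 0≤2 = +-nonneg 0≤1 0≤1

 module _ {n : ℕ} where

   private
     U = unif (suc n)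
     U-prob = unif-prob n
     T = power U
     T-prob = power-prob U-prob

   -- The discrepancy argument sees only `bias`, whereas exact vanishing on samples needs
   -- `oscillation`, in which different choices of R cannot cancel. They coincide at s = 0.
   oscillation bias : (Subset (suc n) → ℚ) → ℕ → ℕ → ℚ
   oscillation Φ r s = ∫ (T (r ℕ.* 2)) (λ xs → ∫ (T s) (λ R → ∣ diff Φ r xs (toSet R) ∣))
   bias        Φ r s = ∫ (T (r ℕ.* 2)) (λ xs → ∣ meanDiff Φ r s xs ∣)

   ∫-∣∣-spread : ∀ {A : Set} {L : Measure A} → Probability L → ∀ F →
     ∫ L (λ a → ∣ F a ∣) ≤ ∣ ∫ L F ∣ + ∫ L (λ a → ∫ L (λ b → ∣ F a - F b ∣))
   ∫-∣∣-spread {L = L} P F = ℚ.≤-trans (mono P _ _ bound) (ℚ.≤-reflexive (const-+ P ∣ ∫ L F ∣ _))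
     where
     bound : ∀ a → ∣ F a ∣ ≤ ∣ ∫ L F ∣ + ∫ L (λ b → ∣ F a - F b ∣)
     bound a = ℚ.≤-trans (∣∣-mono-triangle (F a) (∫ L F)) (ℚ.+-monoʳ-≤ ∣ ∫ L F ∣
       (subst (λ z → ∣ z ∣ ≤ ∫ L (λ b → ∣ F a - F b ∣))
         (trans (∫-- L (λ _ → F a) F) (cong (_- ∫ L F) (const P (F a)))) (∣∣-≤ P (λ b → F a - F b))))

   exchange : (Subset (suc n) → ℚ) → ℕ → ℚ
   exchange Q s = ∫ U (λ v → ∫ U (λ v′ → ∫ (T s) (λ R → ∣ Q (ins v (toSet R)) - Q (ins v′ (toSet R)) ∣)))

   -- One vertex is replaced at a time.
   hybrid : ∀ s (Q : Subset (suc n) → ℚ) →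
     ∫ (T (suc s)) (λ R → ∫ (T (suc s)) (λ R′ → ∣ Q (toSet R) - Q (toSet R′) ∣)) ≤ ι (suc s) * exchange Q s
   hybrid s Q = begin
     ∫ (T (suc s)) (λ R → ∫ (T (suc s)) (λ R′ → ∣ Q (toSet R) - Q (toSet R′) ∣))
       ≡⟨ trans (∫-power U s _) (∫-cong U (λ v → ∫-cong (T s) (λ R → ∫-power U s _))) ⟩
     ∫ U (λ v → ∫ (T s) (λ R → ∫ U (λ v′ → ∫ (T s) (λ R′ → ∣ q v R - q v′ R′ ∣))))
       ≤⟨ mono U-prob _ _ (λ v → mono (T-prob s) _ _ (λ R → mono U-prob _ _ (λ v′ → mono (T-prob s) _ _ (λ R′ → triangle (q v R) (q v′ R) (q v′ R′))))) ⟩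
     ∫ U (λ v → ∫ (T s) (λ R → ∫ U (λ v′ → ∫ (T s) (λ R′ → ∣ q v R - q v′ R ∣ + ∣ q v′ R - q v′ R′ ∣))))
       ≡⟨ ∫-cong U (λ v → ∫-cong (T s) (λ R → trans (∫-cong U (λ v′ → const-+ (T-prob s) ∣ q v R - q v′ R ∣ _)) (∫-+ U _ _))) ⟩
     ∫ U (λ v → ∫ (T s) (λ R → ∫ U (λ v′ → ∣ q v R - q v′ R ∣) + ∫ U (λ v′ → ∫ (T s) (λ R′ → ∣ q v′ R - q v′ R′ ∣))))
       ≡⟨ trans (∫-cong U (λ v → ∫-+ (T s) _ _)) (∫-+ U _ _) ⟩
     ∫ U (λ v → ∫ (T s) (λ R → ∫ U (λ v′ → ∣ q v R - q v′ R ∣))) + ∫ U (λ v → ∫ (T s) (λ R → ∫ U (λ v′ → ∫ (T s) (λ R′ → ∣ q v′ R - q v′ R′ ∣))))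
       ≡⟨ cong₂ _+_ (∫-cong U (λ v → ∫-swap (T s) U _)) (trans (const U-prob _) (∫-swap (T s) U _)) ⟩
     exchange Q s + ∫ U (λ v′ → ∫ (T s) (λ R → ∫ (T s) (λ R′ → ∣ q v′ R - q v′ R′ ∣)))
       ≤⟨ ℚ.+-monoʳ-≤ (exchange Q s) (rest s) ⟩
     exchange Q s + ι s * exchange Q s
       ≡⟨ trans (lem (exchange Q s) (ι s)) (cong (_* exchange Q s) (sym (ι-suc s))) ⟩
     ι (suc s) * exchange Q s ∎
     where
     open ℚ.≤-Reasoning
     q : ∀ {s} → Fin (suc n) → Vec (Fin (suc n)) s → ℚ
     q v R = Q (ins v (toSet R))
     lem : ∀ x y → x + y * x ≡ (1ℚ + y) * x
     lem = solve-∀ ringℚ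
     lem₂ : ∀ x y z → x - z ≡ x - y + (y - z)
     lem₂ = solve-∀ ringℚ
     triangle : ∀ x y z → ∣ x - z ∣ ≤ ∣ x - y ∣ + ∣ y - z ∣
     triangle x y z = subst (λ w → ∣ w ∣ ≤ ∣ x - y ∣ + ∣ y - z ∣) (sym (lem₂ x y z)) (ℚ.∣p+q∣≤∣p∣+∣q∣ (x - y) (y - z))
     rest : ∀ s → ∫ U (λ v′ → ∫ (T s) (λ R → ∫ (T s) (λ R′ → ∣ q v′ R - q v′ R′ ∣))) ≤ ι s * exchange Q s
     rest zero = ℚ.≤-reflexive (trans (∫-≡0 U (λ v → trans (∫-power-[] U _) (trans (∫-power-[] U _) (cong ∣_∣ (ℚ.+-inverseʳ (Q (ins v ∅)))))))
       (sym (trans (cong (_* exchange Q 0) ι-0) (ℚ.*-zeroˡ (exchange Q 0)))))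
     rest (suc s) = begin
       ∫ U (λ w → ∫ (T (suc s)) (λ R → ∫ (T (suc s)) (λ R′ → ∣ q w R - q w R′ ∣)))
         ≤⟨ mono U-prob _ _ (λ w → hybrid s (λ A → Q (ins w A))) ⟩
       ∫ U (λ w → ι (suc s) * exchange (λ A → Q (ins w A)) s)
         ≡⟨ ∫-*ˡ U (ι (suc s)) _ ⟩
       ι (suc s) * ∫ U (λ w → exchange (λ A → Q (ins w A)) s)
         ≡⟨ cong (ι (suc s) *_) (trans (∫-swap U U _) (∫-cong U (λ v → trans (∫-swap U U _) (∫-cong U (λ v′ →
              trans (∫-cong U (λ w → ∫-cong (T s) (λ R → cong₂ (λ x y → ∣ Q x - Q y ∣) (ins-comm w v (toSet R)) (ins-comm w v′ (toSet R)))))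
                (sym (∫-power U s _))))))) ⟩
       ι (suc s) * exchange Q (suc s) ∎

   -- A function of R deviates from its mean by at most the effect of replacing all vertices of R,
   -- and replacing one vertex is twice a difference of order r + 1.
   oscillation-step : ∀ Φ r s → oscillation Φ r (suc s) ≤ bias Φ r (suc s) + 2ℚ * ι (suc s) * oscillation Φ (suc r) s
   oscillation-step Φ r s = begin
     oscillation Φ r (suc s)
       ≤⟨ mono (T-prob (r ℕ.* 2)) _ _ (λ xs → ℚ.≤-trans (∫-∣∣-spread (T-prob (suc s)) (λ R → diff Φ r xs (toSet R)))
            (ℚ.+-monoʳ-≤ ∣ meanDiff Φ r (suc s) xs ∣ (hybrid s (diff Φ r xs)))) ⟩
     ∫ X (λ xs → ∣ meanDiff Φ r (suc s) xs ∣ + ι (suc s) * exchange (diff Φ r xs) s)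
       ≡⟨ trans (∫-+ X _ _) (cong (bias Φ r (suc s) +_) (trans (∫-*ˡ X (ι (suc s)) _) (cong (ι (suc s) *_) double))) ⟩
     bias Φ r (suc s) + ι (suc s) * (2ℚ * oscillation Φ (suc r) s)
       ≡⟨ cong (bias Φ r (suc s) +_) (lem (ι (suc s)) 2ℚ (oscillation Φ (suc r) s)) ⟩
     bias Φ r (suc s) + 2ℚ * ι (suc s) * oscillation Φ (suc r) s ∎
     where
     open ℚ.≤-Reasoning
     X = T (r ℕ.* 2)
     lem : ∀ a b c → a * (b * c) ≡ b * a * c
     lem = solve-∀ ringℚ
     two : ∀ x y → ∣ x - y ∣ ≡ 2ℚ * ∣ ½ * (x - y) ∣
     two x y = trans (lem₂ ∣ x - y ∣) (cong (2ℚ *_) (sym (ℚ.∣p*q∣≡∣p∣*∣q∣ ½ (x - y))))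
       where
       lem₂ : ∀ z → z ≡ (1ℚ + 1ℚ) * (½ * z)
       lem₂ = solve-∀ ringℚ
     D : Fin (suc n) → Fin (suc n) → Vec (Fin (suc n)) (r ℕ.* 2) → ℚ
     D v v′ xs = ∫ (T s) (λ R → ∣ diff Φ (suc r) (v ∷ v′ ∷ xs) (toSet R) ∣)
     double : ∫ X (λ xs → exchange (diff Φ r xs) s) ≡ 2ℚ * oscillation Φ (suc r) s
     double = trans
       (∫-cong X (λ xs → ∫-cong U (λ v → ∫-cong U (λ v′ → trans (∫-cong (T s) (λ R → two (diff Φ r xs (ins v (toSet R))) (diff Φ r xs (ins v′ (toSet R))))) (∫-*ˡ (T s) 2ℚ _)))))
       (trans (trans (∫-cong X (λ xs → trans (∫-cong U (λ v → ∫-*ˡ U 2ℚ _)) (∫-*ˡ U 2ℚ _))) (∫-*ˡ X 2ℚ _))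
       (cong (2ℚ *_) (trans (∫-swap X U (λ xs v → ∫ U (λ v′ → D v v′ xs))) (trans (∫-cong U (λ v → trans (∫-swap X U (λ xs v′ → D v v′ xs)) (sym (∫-power U (r ℕ.* 2) _)))) (sym (∫-power U (suc (r ℕ.* 2)) _))))))

   oscillation-0 : ∀ Φ r → oscillation Φ r 0 ≤ bias Φ r 0
   oscillation-0 Φ r = ℚ.≤-reflexive (∫-cong (T (r ℕ.* 2)) (λ xs → trans (∫-power-[] U _) (cong ∣_∣ (sym (∫-power-[] U _)))))

   -- The step is iterated until no free vertex is left; each step multiplies the bound by at most 1
   -- + 2K.
   oscillation-≤ : ∀ Φ κ K → 0ℚ ≤ κ → ∀ s r → s ℕ.≤ K → (∀ r′ s′ → r′ ℕ.+ s′ ≡ r ℕ.+ s → r ℕ.≤ r′ → bias Φ r′ s′ ≤ κ) →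
     oscillation Φ r s ≤ κ * (1ℚ + 2ℚ * ι K) ^ s
   oscillation-≤ Φ κ K 0≤κ zero r le h = ℚ.≤-trans (oscillation-0 Φ r) (ℚ.≤-trans (h r 0 refl ℕ.≤-refl) (ℚ.≤-reflexive (sym (ℚ.*-identityʳ κ))))
   oscillation-≤ Φ κ K 0≤κ (suc s) r le h = begin
     oscillation Φ r (suc s)
       ≤⟨ oscillation-step Φ r s ⟩
     bias Φ r (suc s) + 2ℚ * ι (suc s) * oscillation Φ (suc r) s
       ≤⟨ ℚ.+-mono-≤ (h r (suc s) refl ℕ.≤-refl) (*-mono 0≤osc (*-nonneg 0≤2 (ι-nonneg K)) (*-monoˡ 2ℚ 0≤2 (ι-mono le))
            (oscillation-≤ Φ κ K 0≤κ s (suc r) (ℕ.≤-trans (ℕ.n≤1+n s) le)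
              (λ r′ s′ e le′ → h r′ s′ (trans e (sym (ℕ.+-suc r s))) (ℕ.≤-trans (ℕ.n≤1+n r) le′)))) ⟩
     κ + 2ℚ * ι K * (κ * c ^ s)
       ≤⟨ ℚ.+-monoˡ-≤ (2ℚ * ι K * (κ * c ^ s)) (≤-by {κ} (κ * (c ^ s - 1ℚ)) (*-nonneg 0≤κ (0≤q-p (^-≥1 s 1≤c))) (lem κ (c ^ s))) ⟩
     κ * c ^ s + 2ℚ * ι K * (κ * c ^ s)
       ≡⟨ lem₂ κ (2ℚ * ι K) (c ^ s) ⟩
     κ * (c * c ^ s) ∎
     where
     open ℚ.≤-Reasoning
     c = 1ℚ + 2ℚ * ι K
     1≤c : 1ℚ ≤ c
     1≤c = ≤-by (2ℚ * ι K) (*-nonneg 0≤2 (ι-nonneg K)) refl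
     0≤osc : 0ℚ ≤ oscillation Φ (suc r) s
     0≤osc = nonneg (T-prob (suc r ℕ.* 2)) _ (λ xs → nonneg (T-prob s) _ (λ R → ℚ.0≤∣p∣ (diff Φ (suc r) xs (toSet R))))
     lem : ∀ κ p → κ * p ≡ κ + κ * (p - 1ℚ)
     lem = solve-∀ ringℚ
     lem₂ : ∀ κ t p → κ * p + t * (κ * p) ≡ κ * ((1ℚ + t) * p)
     lem₂ = solve-∀ ringℚ

-- Ramsey's theorem for two colours.

module Ramsey where

 open import Data.List using (List; []; _∷_; length)
 open import Data.List.Relation.Binary.Sublist.Propositional using (_⊆_; []; _∷_; _∷ʳ_; ⊆-refl; ⊆-trans)
 open import Data.Nat using (_+_; _≤_; _≤?_)
 open import Data.Nat.Properties using (≤-refl; ≤-trans; ≤-reflexive; +-suc; +-mono-≤; ≰⇒>; <⇒≤; <-irrefl; ≤-<-trans; +-monoʳ-<; suc-injective)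
 open import Relation.Binary.PropositionalEquality using (_≡_; refl; cong; sym; trans)

 Homogeneous : {A : Set} → ℕ → (List A → Bool) → List A → Bool → Set
 Homogeneous k χ ys c = ∀ zs → zs ⊆ ys → length zs ≡ k → χ zs ≡ c

 homogeneous-⊆ : ∀ {A : Set} {k χ c} {ys ys′ : List A} → ys′ ⊆ ys → Homogeneous k χ ys c → Homogeneous k χ ys′ c
 homogeneous-⊆ s h zs zs⊆ len = h zs (⊆-trans zs⊆ s) len

 -- The colour of a sublist of length k + 1 depends only on its first element, the usual halfway
 -- stage of the induction on k.
 data EndHomogeneous {A : Set} (k : ℕ) (χ : List A → Bool) : List A → Set where
   []  : EndHomogeneous k χ []
   add : ∀ {y ys} c → Homogeneous k (λ zs → χ (y ∷ zs)) ys c → EndHomogeneous k χ ys → EndHomogeneous k χ (y ∷ ys)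

 -- The elements are sorted by the colour that each of them forces as a first element.
 split : ∀ {A : Set} {k χ} {ys : List A} → EndHomogeneous k χ ys →
   ∃[ us ] ∃[ vs ] us ⊆ ys × vs ⊆ ys × Homogeneous (suc k) χ us true × Homogeneous (suc k) χ vs false × length us + length vs ≡ length ys
 split [] = [] , [] , [] , [] , empty , empty , refl
   where
   empty : ∀ {A : Set} {k χ c} → Homogeneous {A} (suc k) χ [] c
   empty [] s ()
 split {k = k} {χ} (add {y} {ys} c h e) with split e
 ... | us , vs , su , sv , hu , hv , len with c
 ...   | true  = y ∷ us , vs , refl ∷ su , y ∷ʳ sv , cons , hv , cong suc len
   where
   cons : Homogeneous (suc k) χ (y ∷ us) true
   cons zs (.y ∷ʳ s) l = hu zs s l
   cons (.y ∷ zs) (refl ∷ s) l = h zs (⊆-trans s su) (suc-injective l)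
 ...   | false = us , y ∷ vs , y ∷ʳ su , refl ∷ sv , hu , cons , trans (+-suc (length us) (length vs)) (cong suc len)
   where
   cons : Homogeneous (suc k) χ (y ∷ vs) false
   cons zs (.y ∷ʳ s) l = hv zs s l
   cons (.y ∷ zs) (refl ∷ s) l = h zs (⊆-trans s sv) (suc-injective l)

 RamseyProperty EndProperty : ℕ → ℕ → ℕ → Set₁
 RamseyProperty k L M = ∀ {A : Set} (χ : List A → Bool) xs → M ≤ length xs →
   ∃[ ys ] ys ⊆ xs × L ≤ length ys × ∃[ c ] Homogeneous k χ ys c
 EndProperty k L M = ∀ {A : Set} (χ : List A → Bool) xs → M ≤ length xs →
   ∃[ ys ] ys ⊆ xs × L ≤ length ys × EndHomogeneous k χ ys

 []⊆ : ∀ {A : Set} (xs : List A) → [] ⊆ xs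
 []⊆ []       = []
 []⊆ (x ∷ xs) = x ∷ʳ []⊆ xs

 halve : ∀ L a b → L + L ≤ a + b → L ≤ a ⊎ L ≤ b
 halve L a b h with L ≤? a | L ≤? b
 ... | yes p | _ = inj₁ p
 ... | no _  | yes q = inj₂ q
 ... | no p  | no q = ⊥-elim (<-irrefl refl (≤-<-trans h (≤-trans (s≤s (+-mono-≤ (<⇒≤ (≰⇒> p)) ≤-refl)) (+-monoʳ-< L (≰⇒> q)))))

 ramsey : ∀ k L → ∃[ M ] RamseyProperty k L M
 end-homogeneous : ∀ k → (∀ L → ∃[ M ] RamseyProperty k L M) → ∀ L → ∃[ M ] EndProperty k L M

 end-homogeneous k R zero    = 0 , λ χ xs _ → [] , []⊆ xs , z≤n , []
 end-homogeneous k R (suc L) = suc M₂ , find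
   where
   M₁ = proj₁ (end-homogeneous k R L)
   M₂ = proj₁ (R M₁)
   find : EndProperty k (suc L) (suc M₂)
   find χ (x ∷ xs) (s≤s le) =
     let ys , s , l , c , h = proj₂ (R M₁) (λ zs → χ (x ∷ zs)) xs le
         ys′ , s′ , l′ , e = proj₂ (end-homogeneous k R L) χ ys l
     in x ∷ ys′ , refl ∷ ⊆-trans s′ s , s≤s l′ , add c (homogeneous-⊆ s′ h) e

 ramsey zero    L = L , λ χ xs le → xs , ⊆-refl , le , χ [] , λ { [] s l → refl }
 ramsey (suc k) L = M , find
   where
   M = proj₁ (end-homogeneous k (ramsey k) (L + L))
   find : RamseyProperty (suc k) L M
   find χ xs le with proj₂ (end-homogeneous k (ramsey k) (L + L)) χ xs le
   ... | ys , s , l , e with split e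
   ...   | us , vs , su , sv , hu , hv , len with halve L (length us) (length vs) (≤-trans l (≤-reflexive (sym len)))
   ...     | inj₁ p = us , ⊆-trans su s , p , true , hu
   ...     | inj₂ p = vs , ⊆-trans sv s , p , false , hv

 RamseyMany : ℕ → ℕ → ℕ → ℕ → Set₁
 RamseyMany k L p M = ∀ {A : Set} (χ : Fin p → List A → Bool) xs → M ≤ length xs →
   ∃[ ys ] ys ⊆ xs × L ≤ length ys × (∀ i → ∃[ c ] Homogeneous k (χ i) ys c)

 -- The colourings are treated one after the other, since homogeneity passes to sublists.
 ramsey-many : ∀ k L p → ∃[ M ] RamseyMany k L p M
 ramsey-many k L zero    = L , λ χ xs le → xs , ⊆-refl , le , λ ()
 ramsey-many k L (suc p) = proj₁ (ramsey k M) , λ χ xs le →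
   let ys , s , l , c , h = proj₂ (ramsey k M) (χ zero) xs le
       ys′ , s′ , l′ , hs = proj₂ (ramsey-many k L p) (λ i → χ (suc i)) ys l
   in ys′ , ⊆-trans s′ s , l′ , λ { zero → c , homogeneous-⊆ s′ h ; (suc i) → hs i }
   where M = proj₁ (ramsey-many k L p)

-- Finite differences and the linear systems behind g(k).

module Types where

 open import Defs using (alternatingSum; OnlyConstantSolutions)
 open import Algebra.Properties.CommutativeMonoid.Sum using (sum)
 open import Data.Bool using (not)
 open import Data.Fin using (inject≤)
 open import Data.Fin.Patterns using (0F; 1F)
 open import Data.Integer using (ℤ; +_; 0ℤ; 1ℤ; -1ℤ; _*_; _-_; -_; _^_) renaming (_+_ to _ℤ+_)
 open import Data.Integer.Tactic.RingSolver renaming (solve-∀ to ℤ-solve-∀)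
 open import Data.Nat using (_+_; _∸_; _≤_; _<_; s≤s⁻¹)
 open import Data.Nat.Combinatorics using (_C_; nCk+nC[k+1]≡[n+1]C[k+1]; k>n⇒nCk≡0)
 open import Data.Vec using (replicate)

 ⟦_⟧ : Bool → ℤ
 ⟦ true ⟧  = 1ℤ
 ⟦ false ⟧ = 0ℤ

 -- The sum of (-1)^i (r C i) F(i) over i ≤ r, in the form of Pascal's rule; `∑-coefficient` proves
 -- the agreement.
 D : ℕ → (ℕ → ℤ) → ℤ
 D zero    F = F 0
 D (suc r) F = D r F - D r (λ i → F (suc i))

 Δ : ∀ {q} → Vec ℕ q → (Vec ℕ q → ℤ) → ℤ
 Δ []      F = F []
 Δ (b ∷ β) F = D b (λ i → Δ β (λ c → F (i ∷ c)))

 zeros : ∀ {q} → Vec ℕ q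
 zeros = replicate _ 0

 total : ∀ {q} → Vec ℕ q → ℕ
 total = Vec.sum

 total-zeros : ∀ q → total (zeros {q}) ≡ 0
 total-zeros zero    = refl
 total-zeros (suc q) = total-zeros q

 D-cong : ∀ r {F G} → (∀ i → F i ≡ G i) → D r F ≡ D r G
 D-cong zero    h = h 0
 D-cong (suc r) h = cong₂ _-_ (D-cong r h) (D-cong r (λ i → h (suc i)))

 D-local : ∀ r {F} → (∀ i → i ≤ r → F i ≡ 0ℤ) → D r F ≡ 0ℤ
 D-local zero    h = h 0 z≤n
 D-local (suc r) h = cong₂ _-_ (D-local r (λ i le → h i (ℕ.m≤n⇒m≤1+n le))) (D-local r (λ i le → h (suc i) (s≤s le)))

 alternate : ℕ → ℤ → ℤ
 alternate zero    x = x
 alternate (suc r) x = - alternate r x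

 alternate-0 : ∀ r → alternate r 0ℤ ≡ 0ℤ
 alternate-0 zero    = refl
 alternate-0 (suc r) = cong -_ (alternate-0 r)

 alternate-injective : ∀ r {x} → alternate r x ≡ 0ℤ → x ≡ 0ℤ
 alternate-injective zero    h = h
 alternate-injective (suc r) h = alternate-injective r (ℤ.neg-injective h)

 D-lower : ∀ r {F} → (∀ i → i < r → F i ≡ 0ℤ) → D r F ≡ alternate r (F r)
 D-lower zero    h = refl
 D-lower (suc r) {F} h = trans (cong₂ _-_
     (trans (D-lower r (λ i lt → h i (ℕ.m<n⇒m<1+n lt))) (trans (cong (alternate r) (h r ℕ.≤-refl)) (alternate-0 r)))
     (D-lower r (λ i lt → h (suc i) (s≤s lt))))
   (ℤ.+-identityˡ (- alternate r (F (suc r))))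

 D-vanish : ∀ r {F} → (∀ i → i < r → F i ≡ 0ℤ) → D r F ≡ 0ℤ → F r ≡ 0ℤ
 D-vanish r h e = alternate-injective r (trans (sym (D-lower r h)) e)

 D-- : ∀ r F G → D r (λ i → F i - G i) ≡ D r F - D r G
 D-- zero    F G = refl
 D-- (suc r) F G = trans (cong₂ _-_ (D-- r F G) (D-- r (λ i → F (suc i)) (λ i → G (suc i))))
   (lem (D r F) (D r G) (D r (λ i → F (suc i))) (D r (λ i → G (suc i))))
   where
   lem : ∀ a b c d → a - b - (c - d) ≡ a - c - (b - d)
   lem = ℤ-solve-∀

 D-const : ∀ r x → D (suc r) (λ _ → x) ≡ 0ℤ
 D-const r x = ℤ.+-inverseʳ (D r (λ _ → x))

 Δ-cong : ∀ {q} (β : Vec ℕ q) {F G} → (∀ c → F c ≡ G c) → Δ β F ≡ Δ β G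
 Δ-cong []      h = h []
 Δ-cong (b ∷ β) h = D-cong b (λ i → Δ-cong β (λ c → h (i ∷ c)))

 Δ-local : ∀ {q} (β : Vec ℕ q) {F} → (∀ c → total c ≤ total β → F c ≡ 0ℤ) → Δ β F ≡ 0ℤ
 Δ-local []      h = h [] z≤n
 Δ-local (b ∷ β) h = D-local b (λ i le → Δ-local β (λ c le′ → h (i ∷ c) (ℕ.+-mono-≤ le le′)))

 Δ-- : ∀ {q} (β : Vec ℕ q) F G → Δ β (λ c → F c - G c) ≡ Δ β F - Δ β G
 Δ-- []      F G = refl
 Δ-- (b ∷ β) F G = trans (D-cong b (λ i → Δ-- β (λ c → F (i ∷ c)) (λ c → G (i ∷ c)))) (D-- b _ _)

 Δ-zeros : ∀ {q} (F : Vec ℕ q → ℤ) → Δ zeros F ≡ F zeros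
 Δ-zeros {zero}  F = refl
 Δ-zeros {suc q} F = Δ-zeros (λ c → F (0 ∷ c))

 Δ-const : ∀ {q} (β : Vec ℕ q) x → ¬ total β ≡ 0 → Δ β (λ _ → x) ≡ 0ℤ
 Δ-const []          x ne = ⊥-elim (ne refl)
 Δ-const (zero ∷ β)  x ne = Δ-const β x ne
 Δ-const (suc b ∷ β) x ne = D-const b (Δ β (λ _ → x))

 ∑< : ℕ → (ℕ → ℤ) → ℤ
 ∑< zero    f = 0ℤ
 ∑< (suc n) f = f 0 ℤ+ ∑< n (λ i → f (suc i))

 sum≡∑< : ∀ n (f : ℕ → ℤ) → sum ℤ.+-0-commutativeMonoid {n} (λ i → f (toℕ i)) ≡ ∑< n f
 sum≡∑< zero    f = refl
 sum≡∑< (suc n) f = cong (f 0 ℤ+_) (sum≡∑< n (λ i → f (suc i)))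

 ∑<-cong : ∀ n {f g} → (∀ i → f i ≡ g i) → ∑< n f ≡ ∑< n g
 ∑<-cong zero    h = refl
 ∑<-cong (suc n) h = cong₂ _ℤ+_ (h 0) (∑<-cong n (λ i → h (suc i)))

 ∑<-- : ∀ n f g → ∑< n (λ i → f i - g i) ≡ ∑< n f - ∑< n g
 ∑<-- zero    f g = refl
 ∑<-- (suc n) f g = trans (cong (f 0 - g 0 ℤ+_) (∑<-- n (λ i → f (suc i)) (λ i → g (suc i))))
   (lem (f 0) (g 0) (∑< n (λ i → f (suc i))) (∑< n (λ i → g (suc i))))
   where
   lem : ∀ a b c d → a - b ℤ+ (c - d) ≡ a ℤ+ c - (b ℤ+ d)
   lem = ℤ-solve-∀

 ∑<-last : ∀ n f → ∑< (suc n) f ≡ ∑< n f ℤ+ f n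
 ∑<-last zero    f = ℤ.+-comm (f 0) 0ℤ
 ∑<-last (suc n) f = trans (cong (f 0 ℤ+_) (∑<-last n (λ i → f (suc i)))) (sym (ℤ.+-assoc (f 0) (∑< n (λ i → f (suc i))) (f (suc n))))

 coefficient : ℕ → ℕ → ℤ
 coefficient r i = -1ℤ ^ i * + (r C i)

 pascal : ∀ r i → coefficient (suc r) (suc i) ≡ coefficient r (suc i) - coefficient r i
 pascal r i = trans (cong (λ z → -1ℤ * -1ℤ ^ i * z) (trans (cong +_ (sym (nCk+nC[k+1]≡[n+1]C[k+1] r i))) (ℤ.pos-+ (r C i) (r C suc i))))
   (lem (-1ℤ ^ i) (+ (r C i)) (+ (r C suc i)))
   where
   lem : ∀ s a b → -1ℤ * s * (a ℤ+ b) ≡ -1ℤ * s * b - s * a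
   lem = ℤ-solve-∀

 ∑-coefficient : ∀ r F → ∑< (suc r) (λ i → coefficient r i * F i) ≡ D r F
 ∑-coefficient zero    F = lem (F 0)
   where
   lem : ∀ x → 1ℤ * 1ℤ * x ℤ+ 0ℤ ≡ x
   lem = ℤ-solve-∀
 ∑-coefficient (suc r) F = begin
   coefficient (suc r) 0 * F 0 ℤ+ ∑< (suc r) (λ i → coefficient (suc r) (suc i) * F (suc i))
     ≡⟨ cong (coefficient r 0 * F 0 ℤ+_) (trans (∑<-cong (suc r) (λ i → trans (cong (_* F (suc i)) (pascal r i))
          (lem (coefficient r (suc i)) (coefficient r i) (F (suc i))))) (∑<-- (suc r) (λ i → coefficient r (suc i) * F (suc i)) (λ i → coefficient r i * F (suc i)))) ⟩
   coefficient r 0 * F 0 ℤ+ (∑< (suc r) (λ i → coefficient r (suc i) * F (suc i)) - ∑< (suc r) (λ i → coefficient r i * F (suc i)))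
     ≡⟨ ℤ.+-assoc (coefficient r 0 * F 0) (∑< (suc r) (λ i → coefficient r (suc i) * F (suc i))) (- ∑< (suc r) (λ i → coefficient r i * F (suc i))) ⟨
   ∑< (suc (suc r)) (λ i → coefficient r i * F i) - ∑< (suc r) (λ i → coefficient r i * F (suc i))
     ≡⟨ cong₂ _-_ (trans (∑<-last (suc r) (λ i → coefficient r i * F i)) (trans (cong (∑< (suc r) (λ i → coefficient r i * F i) ℤ+_) top) (ℤ.+-identityʳ (∑< (suc r) (λ i → coefficient r i * F i)))))
          (∑-coefficient r (λ i → F (suc i))) ⟩
   ∑< (suc r) (λ i → coefficient r i * F i) - D r (λ i → F (suc i))
     ≡⟨ cong (_- D r (λ i → F (suc i))) (∑-coefficient r F) ⟩
   D (suc r) F ∎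
   where
   open ≡-Reasoning
   lem : ∀ a b x → (a - b) * x ≡ a * x - b * x
   lem = ℤ-solve-∀
   lem₂ : ∀ s x → s * 0ℤ * x ≡ 0ℤ
   lem₂ = ℤ-solve-∀
   top : coefficient r (suc r) * F (suc r) ≡ 0ℤ
   top = trans (cong (λ z → -1ℤ ^ suc r * + z * F (suc r)) (k>n⇒nCk≡0 (ℕ.n<1+n r))) (lem₂ (-1ℤ ^ suc r) (F (suc r)))

 bit : Bool → Fin 2
 bit true  = 1F
 bit false = 0F

 alternatingSum-D : ∀ (θ : ℕ → Bool) {m} r (r≤m : r ≤ m) → alternatingSum {m} (λ i → bit (θ (toℕ i))) r r≤m ≡ D r (λ i → ⟦ θ i ⟧)
 alternatingSum-D θ r r≤m = trans (sum-cong (suc r) (λ i → trans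
     (cong (λ z → -1ℤ ^ toℕ i * + (r C toℕ i) * + toℕ (bit (θ z))) (Fin.toℕ-inject≤ i (s≤s r≤m)))
     (cong (-1ℤ ^ toℕ i * + (r C toℕ i) *_) (bit-value (θ (toℕ i))))))
   (trans (sum≡∑< (suc r) (λ i → coefficient r i * ⟦ θ i ⟧)) (∑-coefficient r (λ i → ⟦ θ i ⟧)))
   where
   bit-value : ∀ b → + toℕ (bit b) ≡ ⟦ b ⟧
   bit-value true  = refl
   bit-value false = refl
   sum-cong : ∀ n {f g : Fin n → ℤ} → (∀ i → f i ≡ g i) → sum ℤ.+-0-commutativeMonoid f ≡ sum ℤ.+-0-commutativeMonoid g
   sum-cong zero    h = refl
   sum-cong (suc n) h = cong₂ _ℤ+_ (h zero) (sum-cong n (λ i → h (suc i)))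

 ⟦⟧≡0 : ∀ {b} → ⟦ b ⟧ ≡ 0ℤ → b ≡ false
 ⟦⟧≡0 {false} h = refl

 module Constancy {k g} (only : OnlyConstantSolutions k g) where

   -- For m ≥ 2 this is the defining property of g. The definition does not cover m = 0 and m = 1,
   -- which occur for slices of functions of several variables and are checked directly.
   univariate : ∀ m → m ≤ k → (θ : ℕ → Bool) → (∀ r → r ≤ m → m ≤ r + g → D r (λ i → ⟦ θ i ⟧) ≡ 0ℤ) →
     θ 0 ≡ false → ∀ i → i ≤ m → θ i ≡ false
   univariate zero          le θ h e zero z≤n = e
   univariate (suc zero)    le θ h e zero _ = e
   univariate (suc zero)    le θ h e (suc zero) _ = ⟦⟧≡0 (ℤ.neg-injective (trans (sym (trans (cong (λ b → ⟦ b ⟧ - ⟦ θ 1 ⟧) e) (ℤ.+-identityˡ _)))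
     (h 1 (s≤s z≤n) (s≤s z≤n))))
   univariate (suc zero)    le θ h e (suc (suc i)) (s≤s ())
   univariate (suc (suc m)) le θ h e i i≤m with only (suc (suc m)) (s≤s (s≤s z≤n)) le (λ i → bit (θ (toℕ i)))
       (λ r m≤r+g r≤m → trans (alternatingSum-D θ r r≤m) (h r r≤m m≤r+g))
   ... | inj₁ all-0 = bit-0 (trans (cong (λ j → bit (θ j)) (sym (Fin.toℕ-fromℕ< (s≤s i≤m)))) (all-0 (fromℕ< (s≤s i≤m))))
     where
     bit-0 : ∀ {b} → bit b ≡ 0F → b ≡ false
     bit-0 {false} _ = refl
   ... | inj₂ all-1 = ⊥-elim (absurd (trans (sym (all-1 zero)) (cong bit e)))
     where
     absurd : ¬ _≡_ {A = Fin 2} 1F 0F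
     absurd ()

   Vanishing : ∀ {q} → ℕ → (Vec ℕ q → Bool) → Set
   Vanishing {q} m θ = ∀ (β : Vec ℕ q) → total β ≤ m → m ≤ total β + g → Δ β (λ c → ⟦ θ c ⟧) ≡ 0ℤ

   -- With the values for smaller first coordinates known to vanish, the top
   -- difference in the first coordinate is the value itself.
   constant-false : ∀ q m → m ≤ k → (θ : Vec ℕ q → Bool) → Vanishing m θ →
     θ zeros ≡ false → ∀ c → total c ≤ m → θ c ≡ false
   constant-false zero    m m≤k θ h e [] le = e
   constant-false (suc q) m m≤k θ h e (j ∷ c) le = below (suc j) j ℕ.≤-refl c le
     where
     -- On the axis all other differences are of order 0, so the hypothesis reduces to the
     -- univariate system.
     axis : ∀ i → i ≤ m → θ (i ∷ zeros) ≡ false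
     axis = univariate m m≤k (λ i → θ (i ∷ zeros)) (λ r r≤m m≤r+g → trans (D-cong r (λ i → sym (Δ-zeros (λ c → ⟦ θ (i ∷ c) ⟧))))
       (h (r ∷ zeros) (subst (_≤ m) (sym (r+0 r)) r≤m) (subst (λ z → m ≤ z + g) (sym (r+0 r)) m≤r+g))) e
       where
       r+0 : ∀ r → r + total (zeros {q}) ≡ r
       r+0 r = trans (cong (λ z → r + z) (total-zeros q)) (ℕ.+-identityʳ r)
     below : ∀ J j → j < J → ∀ c → j + total c ≤ m → θ (j ∷ c) ≡ false
     below (suc J) j (s≤s j≤J) c le = constant-false q (m ∸ j) (ℕ.≤-trans (ℕ.m∸n≤m m j) m≤k) (λ c → θ (j ∷ c)) slice
         (axis j j≤m) c (subst (_≤ m ∸ j) (ℕ.m+n∸m≡n j (total c)) (ℕ.∸-monoˡ-≤ j le))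
       where
       j≤m : j ≤ m
       j≤m = ℕ.≤-trans (ℕ.m≤m+n j (total c)) le
       j+[m∸j] : j + (m ∸ j) ≡ m
       j+[m∸j] = ℕ.m+[n∸m]≡n j≤m
       slice : Vanishing (m ∸ j) (λ c → θ (j ∷ c))
       slice β β≤ ≤β = D-vanish j {λ i → Δ β (λ c → ⟦ θ (i ∷ c) ⟧)}
         (λ i i<j → Δ-local β (λ c c≤β → cong ⟦_⟧ (below J i (ℕ.<-≤-trans i<j j≤J) c
           (ℕ.≤-trans (ℕ.+-mono-≤ (ℕ.<⇒≤ i<j) (ℕ.≤-trans c≤β β≤)) (ℕ.≤-reflexive j+[m∸j])))))
         (h (j ∷ β) (ℕ.≤-trans (ℕ.+-monoʳ-≤ j β≤) (ℕ.≤-reflexive j+[m∸j]))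
           (subst (_≤ j + total β + g) j+[m∸j] (ℕ.≤-trans (ℕ.+-monoʳ-≤ j ≤β) (ℕ.≤-reflexive (sym (ℕ.+-assoc j (total β) g))))))

   -- If the value at the origin is true, the complement is considered. Its differences vanish too,
   -- because all orders involved are at least k - g > 0 and such differences kill constants.
   constant : g < k → ∀ q (θ : Vec ℕ q → Bool) → Vanishing k θ → ∀ c → total c ≤ k → θ c ≡ θ zeros
   constant g<k q θ h c le with θ zeros in eq
   ... | false = constant-false q k ℕ.≤-refl θ h eq c le
   ... | true  = not-false (constant-false q k ℕ.≤-refl (λ c → not (θ c)) h′ (cong not eq) c le)
     where
     not-false : ∀ {b} → not b ≡ false → b ≡ true
     not-false {true} _ = refl
     complement : ∀ b → ⟦ not b ⟧ ≡ 1ℤ - ⟦ b ⟧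
     complement true  = refl
     complement false = refl
     h′ : Vanishing k (λ c → not (θ c))
     h′ β β≤ ≤β = trans (Δ-cong β (λ c → complement (θ c))) (trans (Δ-- β (λ _ → 1ℤ) (λ c → ⟦ θ c ⟧))
       (cong₂ _-_ (Δ-const β 1ℤ (λ e → ℕ.<⇒≱ g<k (subst (λ z → k ≤ z + g) e ≤β))) (h β β≤ ≤β)))

 -- Here the equations include all orders r = 1, ..., m, and vanishing differences of every positive
 -- order force a constant. So the number g of the theorem exists and is smaller than the
 -- uniformity, which keeps the lowest order positive.
 onlyConstant-pred : ∀ k → OnlyConstantSolutions (suc k) k
 onlyConstant-pred k m 2≤m m≤k α h = decide (α zero) refl
   where
   -- Extended by 0 beyond m; differences of order at most m never look there.
   F : ℕ → ℤ
   F i with i ℕ.<? suc m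
   ... | yes lt = + toℕ (α (fromℕ< lt))
   ... | no _   = 0ℤ
   F-α : ∀ i → F (toℕ i) ≡ + toℕ (α i)
   F-α i with toℕ i ℕ.<? suc m
   ... | yes lt = cong (λ j → + toℕ (α j)) (Fin.fromℕ<-toℕ i lt)
   ... | no nlt = ⊥-elim (nlt (Fin.toℕ<n i))
   sum-cong : ∀ n {f g : Fin n → ℤ} → (∀ i → f i ≡ g i) → sum ℤ.+-0-commutativeMonoid f ≡ sum ℤ.+-0-commutativeMonoid g
   sum-cong zero    h = refl
   sum-cong (suc n) h = cong₂ _ℤ+_ (h zero) (sum-cong n (λ i → h (suc i)))
   D-F : ∀ r → suc r ≤ m → D (suc r) F ≡ 0ℤ
   D-F r le = trans (sym (trans (sum-cong (suc (suc r)) (λ i → cong (-1ℤ ^ toℕ i * + (suc r C toℕ i) *_)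
       (trans (sym (F-α (inject≤ i (s≤s le)))) (cong F (Fin.toℕ-inject≤ i (s≤s le))))))
     (trans (sum≡∑< (suc (suc r)) (λ i → coefficient (suc r) i * F i)) (∑-coefficient (suc r) F))))
     (h (suc r) (ℕ.≤-trans m≤k (s≤s (ℕ.m≤n+m k r))) le)
   G : ℕ → ℤ
   G i = F i - F 0
   D-G : ∀ r → r ≤ m → D r G ≡ 0ℤ
   D-G zero    le = ℤ.+-inverseʳ (F 0)
   D-G (suc r) le = trans (D-- (suc r) F (λ _ → F 0)) (cong₂ _-_ (D-F r le) (D-const r (F 0)))
   G-0 : ∀ I i → i < I → i ≤ m → G i ≡ 0ℤ
   G-0 (suc I) i (s≤s i≤I) le = D-vanish i {G} (λ j j<i → G-0 I j (ℕ.<-≤-trans j<i i≤I) (ℕ.≤-trans (ℕ.<⇒≤ j<i) le)) (D-G i le)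
   α-const : ∀ i → α i ≡ α zero
   α-const i = Fin.toℕ-injective (ℤ.+-injective (trans (sym (F-α i)) (trans (ℤ.i-j≡0⇒i≡j (F (toℕ i)) (F 0) (G-0 (suc (toℕ i)) (toℕ i) ℕ.≤-refl (s≤s⁻¹ (Fin.toℕ<n i)))) (F-α zero))))
   decide : ∀ x → α zero ≡ x → (∀ i → α i ≡ 0F) ⊎ (∀ i → α i ≡ 1F)
   decide zero       e = inj₁ (λ i → trans (α-const i) e)
   decide (suc zero) e = inj₂ (λ i → trans (α-const i) e)

-- Blow-ups, independent positions in a sample, and integrality.

module Blowup where

 open Correlation using (diff; ∉-++ˡ; ∉-++ʳ)
 open Measures
 open Permutations using (Distinct; fresh-∷)
 open Rationals
 open Subsets
 open Probability
 open import Data.Integer as ℤ using (ℤ; +_; -[1+_]; 0ℤ)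
 open import Data.Rational using (_+_; _*_; _-_; -_; _≤_; _<_; ∣_∣; _/_; toℚᵘ)
 open import Data.Vec using (lookup; map; concat; zipWith; _++_; _[_]≔_)

 product : ∀ {A : Set} {u} → Vec A u → (A → ℚ) → ℚ
 product []       G = 1ℚ
 product (v ∷ vs) G = G v * product vs G

 -- The product of F over the transversals of a u-fold blow-up of k points.
 blowup : ∀ {A : Set} {u k} → (Vec A k → ℚ) → Vec (Vec A u) k → ℚ
 blowup F []       = F []
 blowup F (y ∷ ys) = product y (λ v → blowup (λ xs → F (v ∷ xs)) ys)

 blowupSize : ℕ → ℕ → ℕ
 blowupSize u zero    = 1
 blowupSize u (suc k) = u ℕ.* blowupSize u k

 product-nonneg : ∀ {A : Set} {u} (y : Vec A u) G → (∀ v → 0ℚ ≤ G v) → 0ℚ ≤ product y G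
 product-nonneg []      G h = 0≤1
 product-nonneg (v ∷ y) G h = *-nonneg (h v) (product-nonneg y G h)

 product-≤1 : ∀ {A : Set} {u} (y : Vec A u) G → (∀ v → 0ℚ ≤ G v) → (∀ v → G v ≤ 1ℚ) → product y G ≤ 1ℚ
 product-≤1 []      G h h′ = ℚ.≤-refl
 product-≤1 (v ∷ y) G h h′ = ℚ.≤-trans (*-mono (product-nonneg y G h) 0≤1 (h′ v) (product-≤1 y G h h′)) (ℚ.≤-reflexive refl)

 blowup-nonneg : ∀ {A : Set} {u k} (F : Vec A k → ℚ) → (∀ xs → 0ℚ ≤ F xs) → ∀ (ys : Vec (Vec A u) k) → 0ℚ ≤ blowup F ys
 blowup-nonneg F h []       = h []
 blowup-nonneg F h (y ∷ ys) = product-nonneg y _ (λ v → blowup-nonneg _ (λ xs → h (v ∷ xs)) ys)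

 blowup-≤1 : ∀ {A : Set} {u k} (F : Vec A k → ℚ) → (∀ xs → 0ℚ ≤ F xs) → (∀ xs → F xs ≤ 1ℚ) → ∀ (ys : Vec (Vec A u) k) → blowup F ys ≤ 1ℚ
 blowup-≤1 F h h′ []       = h′ []
 blowup-≤1 F h h′ (y ∷ ys) = product-≤1 y _ (λ v → blowup-nonneg _ (λ xs → h (v ∷ xs)) ys) (λ v → blowup-≤1 _ (λ xs → h (v ∷ xs)) (λ xs → h′ (v ∷ xs)) ys)

 product-factor : ∀ {A : Set} {u} (y : Vec A u) G → ¬ product y G ≡ 0ℚ → ∀ i → ¬ G (lookup y i) ≡ 0ℚ
 product-factor (v ∷ y) G ne zero    e = ne (trans (cong (_* product y G) e) (ℚ.*-zeroˡ (product y G)))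
 product-factor (v ∷ y) G ne (suc i) e = product-factor y G (λ e′ → ne (trans (cong (G v *_) e′) (ℚ.*-zeroʳ (G v)))) i e

 blowup-transversal : ∀ {A : Set} {u k} (F : Vec A k → ℚ) (ys : Vec (Vec A u) k) → ¬ blowup F ys ≡ 0ℚ →
   ∀ I → ¬ F (zipWith lookup ys I) ≡ 0ℚ
 blowup-transversal F []       ne []      e = ne e
 blowup-transversal F (y ∷ ys) ne (i ∷ I) e = blowup-transversal (λ xs → F (lookup y i ∷ xs)) ys (product-factor y _ ne i) I e

 ∫-product : ∀ {A : Set} (L : Measure A) u G → ∫ (power L u) (λ y → product y G) ≡ ∫ L G ^ u
 ∫-product L zero    G = ∫-power-[] L _
 ∫-product L (suc u) G = trans (∫-power L u _) (trans (∫-cong L (λ v → ∫-*ˡ (power L u) (G v) _))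
   (trans (∫-*ʳ L (∫ (power L u) (λ y → product y G)) G) (cong (∫ L G *_) (∫-product L u G))))

 -- At each vertex Jensen's inequality is applied twice: to exchange the mean with the power
 -- supplied by induction, and for the u independent copies. This is the counting form of the
 -- theorem that positive density forces complete k-partite subhypergraphs.
 ∫-blowup : ∀ {A : Set} {L : Measure A} → Probability L → ∀ u k (F : Vec A k → ℚ) → (∀ xs → 0ℚ ≤ F xs) →
   ∫ (power L k) F ^ blowupSize u k ≤ ∫ (power (power L u) k) (blowup F)
 ∫-blowup {L = L} P u zero    F h = ℚ.≤-reflexive (trans (ℚ.*-identityʳ _) (trans (∫-power-[] L F) (sym (∫-power-[] (power L u) (blowup F)))))
 ∫-blowup {L = L} P u (suc k) F h = begin
   ∫ (power L (suc k)) F ^ (u ℕ.* blowupSize u k)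
     ≡⟨ trans (cong (_^ (u ℕ.* blowupSize u k)) (∫-power L k F)) (sym (^-^ _ (blowupSize u k) u)) ⟩
   (∫ L (λ v → ∫ (power L k) (λ xs → F (v ∷ xs))) ^ blowupSize u k) ^ u
     ≤⟨ ^-mono u (^-nonneg (blowupSize u k) (nonneg P _ (λ v → nonneg (power-prob P k) _ (λ xs → h (v ∷ xs)))))
          (ℚ.≤-trans (jensen P _ (λ v → nonneg (power-prob P k) _ (λ xs → h (v ∷ xs))) (blowupSize u k))
            (mono P _ _ (λ v → ∫-blowup P u k (λ xs → F (v ∷ xs)) (λ xs → h (v ∷ xs))))) ⟩
   (∫ L (λ v → ∫ M (blowup (λ xs → F (v ∷ xs))))) ^ u
     ≡⟨ cong (_^ u) (∫-swap L M _) ⟩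
   (∫ M (λ ys → ∫ L (λ v → blowup (λ xs → F (v ∷ xs)) ys))) ^ u
     ≤⟨ jensen (power-prob (power-prob P u) k) _ (λ ys → nonneg P _ (λ v → blowup-nonneg _ (λ xs → h (v ∷ xs)) ys)) u ⟩
   ∫ M (λ ys → (∫ L (λ v → blowup (λ xs → F (v ∷ xs)) ys)) ^ u)
     ≡⟨ ∫-cong M (λ ys → sym (∫-product L u (λ v → blowup (λ xs → F (v ∷ xs)) ys))) ⟩
   ∫ M (λ ys → ∫ (power L u) (λ y → blowup F (y ∷ ys)))
     ≡⟨ trans (∫-swap M (power L u) _) (sym (∫-power (power L u) k _)) ⟩
   ∫ (power (power L u) (suc k)) (blowup F) ∎
   where
   open ℚ.≤-Reasoning
   M = power (power L u) k

 ∫-concat : ∀ {A : Set} (L : Measure A) a u F → ∫ (power L (a ℕ.* u)) F ≡ ∫ (power (power L u) a) (λ ys → F (concat ys))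
 ∫-concat L zero    u F = trans (∫-power-[] L F) (sym (∫-power-[] (power L u) _))
 ∫-concat L (suc a) u F = trans (∫-power-++ L u (a ℕ.* u) F) (trans
   (∫-cong (power L u) (λ y → ∫-concat L a u (λ zs → F (y ++ zs)))) (sym (∫-power (power L u) a _)))

 lookup-concat : ∀ {A : Set} {a u} (ys : Vec (Vec A u) a) p i → lookup (concat ys) (Fin.combine p i) ≡ lookup (lookup ys p) i
 lookup-concat (y ∷ ys) zero    i = Vec.lookup-++ˡ y (concat ys) i
 lookup-concat (y ∷ ys) (suc p) i = trans (Vec.lookup-++ʳ y (concat ys) (Fin.combine p i)) (lookup-concat ys p i)

 map-fresh : ∀ {A : Set} {N l} (y : Vec A N) q v (zs : Vec (Fin N) l) → lookup (toSet zs) q ≡ false →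
   map (lookup (y [ q ]≔ v)) zs ≡ map (lookup y) zs
 map-fresh y q v []       h = refl
 map-fresh y q v (z ∷ zs) h with fresh-∷ {y = z} zs h
 ... | ne , h′ = cong₂ _∷_ (Vec.lookup∘updateAt′ z q ne y) (map-fresh y q v zs h′)

 -- Redrawing the coordinate at position q does not affect the other positions, which differ from q;
 -- so the values at distinct positions are independent.
 marginal : ∀ {A : Set} {L : Measure A} → Probability L → ∀ {N a b} (qs : Vec (Fin N) a) (Rs : Vec (Fin N) b) → Distinct (qs ++ Rs) →
   ∀ (G : Vec A a → Vec A b → ℚ) →
   ∫ (power L N) (λ y → G (map (lookup y) qs) (map (lookup y) Rs)) ≡ ∫ (power L a) (λ xs → ∫ (power L b) (λ R → G xs R))
 marginal {L = L} P {N} [] [] d G = trans (const (power-prob P N) (G [] []))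
   (sym (trans (∫-power-[] L _) (∫-power-[] L _)))
 marginal {L = L} P {N} {b = suc b} [] (q ∷ Rs) (h , d) G = begin
   ∫ (power L N) (λ y → G [] (lookup y q ∷ map (lookup y) Rs))
     ≡⟨ ∫-power-resample P q _ ⟩
   ∫ (power L N) (λ y → ∫ L (λ v → G [] (lookup (y [ q ]≔ v) q ∷ map (lookup (y [ q ]≔ v)) Rs)))
     ≡⟨ ∫-cong (power L N) (λ y → ∫-cong L (λ v → cong₂ (λ a b → G [] (a ∷ b)) (Vec.lookup∘updateAt q y) (map-fresh y q v Rs h))) ⟩
   ∫ (power L N) (λ y → ∫ L (λ v → G [] (v ∷ map (lookup y) Rs)))
     ≡⟨ ∫-swap (power L N) L _ ⟩
   ∫ L (λ v → ∫ (power L N) (λ y → G [] (v ∷ map (lookup y) Rs)))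
     ≡⟨ ∫-cong L (λ v → trans (marginal P [] Rs d (λ xs R → G xs (v ∷ R))) (∫-power-[] L _)) ⟩
   ∫ L (λ v → ∫ (power L b) (λ R → G [] (v ∷ R)))
     ≡⟨ trans (sym (∫-power L b _)) (sym (∫-power-[] L _)) ⟩
   ∫ (power L 0) (λ xs → ∫ (power L (suc b)) (λ R → G xs R)) ∎
   where open ≡-Reasoning
 marginal {L = L} P {N} {suc a} {b} (q ∷ qs) Rs (h , d) G = begin
   ∫ (power L N) (λ y → G (lookup y q ∷ map (lookup y) qs) (map (lookup y) Rs))
     ≡⟨ ∫-power-resample P q _ ⟩
   ∫ (power L N) (λ y → ∫ L (λ v → G (lookup (y [ q ]≔ v) q ∷ map (lookup (y [ q ]≔ v)) qs) (map (lookup (y [ q ]≔ v)) Rs)))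
     ≡⟨ ∫-cong (power L N) (λ y → ∫-cong L (λ v → cong₂ (λ a b → G a b)
          (cong₂ _∷_ (Vec.lookup∘updateAt q y) (map-fresh y q v qs (∉-++ˡ qs Rs q h))) (map-fresh y q v Rs (∉-++ʳ qs Rs q h)))) ⟩
   ∫ (power L N) (λ y → ∫ L (λ v → G (v ∷ map (lookup y) qs) (map (lookup y) Rs)))
     ≡⟨ ∫-swap (power L N) L _ ⟩
   ∫ L (λ v → ∫ (power L N) (λ y → G (v ∷ map (lookup y) qs) (map (lookup y) Rs)))
     ≡⟨ ∫-cong L (λ v → marginal P qs Rs d (λ xs R → G (v ∷ xs) R)) ⟩
   ∫ L (λ v → ∫ (power L a) (λ xs → ∫ (power L b) (λ R → G (v ∷ xs) R)))
     ≡⟨ ∫-power L a _ ⟨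
   ∫ (power L (suc a)) (λ xs → ∫ (power L b) (λ R → G xs R)) ∎
   where open ≡-Reasoning

 opaque
   ζ : ℤ → ℚ
   ζ z = z / 1

   toℚᵘ-ζ : ∀ z → toℚᵘ (ζ z) ℚᵘ.≃ ℚᵘ.mkℚᵘ z 0
   toℚᵘ-ζ z = ℚ.toℚᵘ-fromℚᵘ (ℚᵘ.mkℚᵘ z 0)

   ζ-0 : ζ 0ℤ ≡ 0ℚ
   ζ-0 = refl

   ζ-1 : ζ ℤ.1ℤ ≡ 1ℚ
   ζ-1 = refl

 ζ-+ : ∀ x y → ζ (x ℤ.+ y) ≡ ζ x + ζ y
 ζ-+ x y = ℚ.toℚᵘ-injective (ℚᵘ.≃-trans (toℚᵘ-ζ (x ℤ.+ y)) (ℚᵘ.≃-sym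
   (ℚᵘ.≃-trans (ℚ.toℚᵘ-homo-+ (ζ x) (ζ y))
   (ℚᵘ.≃-trans (ℚᵘ.+-cong (toℚᵘ-ζ x) (toℚᵘ-ζ y))
   (ℚᵘ.*≡* (cong (ℤ._* ℤ.1ℤ) (cong₂ ℤ._+_ (ℤ.*-identityʳ x) (ℤ.*-identityʳ y))))))))

 ζ-neg : ∀ x → ζ (ℤ.- x) ≡ - ζ x
 ζ-neg x = sym (unique (trans (sym (ζ-+ x (ℤ.- x))) (trans (cong ζ (ℤ.+-inverseʳ x)) ζ-0)))
   where
   unique : ∀ {a b} → a + b ≡ 0ℚ → - a ≡ b
   unique {a} {b} e = trans (lem a b) (trans (cong (_- (a + b)) (sym (ℚ.+-identityʳ b))) (trans (cong (λ z → b + 0ℚ - z) e) (lem₂ b)))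
     where
     lem : ∀ a b → - a ≡ b - (a + b)
     lem = solve-∀ ringℚ
     lem₂ : ∀ b → b + 0ℚ - 0ℚ ≡ b
     lem₂ = solve-∀ ringℚ

 ζ-- : ∀ x y → ζ (x ℤ.- y) ≡ ζ x - ζ y
 ζ-- x y = trans (ζ-+ x (ℤ.- y)) (cong (λ w → ζ x + w) (ζ-neg y))

 ζ-≡0 : ∀ z → ζ z ≡ 0ℚ → z ≡ 0ℤ
 ζ-≡0 z e with ℚᵘ.≃-trans (ℚᵘ.≃-sym (toℚᵘ-ζ z)) (ℚᵘ.≃-reflexive (cong toℚᵘ e))
 ... | ℚᵘ.*≡* h = trans (sym (ℤ.*-identityʳ z)) h

 ζ-small : ∀ z → ∣ ζ z ∣ < 1ℚ → z ≡ 0ℤ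
 ζ-small z h = pick z (ζ≤ z h)
   where
   ζ-pos : ∀ m → ζ (+ m) ≡ ι m
   ζ-pos zero    = trans ζ-0 (sym ι-0)
   ζ-pos (suc m) = trans (ζ-+ (+ 1) (+ m)) (trans (cong₂ _+_ ζ-1 (ζ-pos m)) (sym (ι-suc m)))
   big : ∀ m → 1ℚ ≤ ι (suc m)
   big m = subst (_≤ ι (suc m)) ι-1 (ι-mono (ℕ.s≤s ℕ.z≤n))
   ζ≤ : ∀ z → ∣ ζ z ∣ < 1ℚ → ι ℤ.∣ z ∣ < 1ℚ
   ζ≤ (+ m)      h = ℚ.≤-<-trans (ℚ.≤-trans (ℚ.≤-reflexive (sym (ζ-pos m))) (p≤∣p∣ (ζ (+ m)))) h
   ζ≤ (-[1+ m ]) h = ℚ.≤-<-trans (ℚ.≤-trans (ℚ.≤-reflexive (trans (sym (neg-neg (ι (suc m)))) (cong -_ (trans (cong -_ (sym (ζ-pos (suc m)))) (sym (ζ-neg (+ suc m))))))) (-p≤∣p∣ (ζ (-[1+ m ])))) h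
   pick : ∀ z → ι ℤ.∣ z ∣ < 1ℚ → z ≡ 0ℤ
   pick (+ zero)   h = refl
   pick (+ suc m)  h = ⊥-elim (ℚ.<-irrefl refl (ℚ.≤-<-trans (big m) h))
   pick -[1+ m ]   h = ⊥-elim (ℚ.<-irrefl refl (ℚ.≤-<-trans (big m) h))

 -- Once the powers of 2 are cleared, a difference is an integer and vanishes as soon as it is small
 -- (`ζ-small`). This turns an estimate in the mean into exact equations.
 diff-integral : ∀ {n} (edge : Subset n → Bool) r xs A → ∃[ z ] (1ℚ + 1ℚ) ^ r * diff (λ e → 𝟙 (edge e)) r xs A ≡ ζ z
 diff-integral edge zero [] A with edge A
 ... | true  = ℤ.1ℤ , trans refl (sym ζ-1)
 ... | false = 0ℤ , trans refl (sym ζ-0)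
 diff-integral edge (suc r) (a ∷ b ∷ xs) A with diff-integral edge r xs (ins a A) | diff-integral edge r xs (ins b A)
 ... | x , ex | y , ey = x ℤ.- y , trans (lem ((1ℚ + 1ℚ) ^ r) (diff (λ e → 𝟙 (edge e)) r xs (ins a A)) (diff (λ e → 𝟙 (edge e)) r xs (ins b A)))
     (trans (cong₂ _-_ ex ey) (sym (ζ-- x y)))
   where
   lem : ∀ p x y → (1ℚ + 1ℚ) * p * (½ * (x - y)) ≡ p * x - p * y
   lem = solve-∀ ringℚ

-- From homogeneous samples to the equations for g(k).

module Structure where

 open import Defs using (OnlyConstantSolutions)
 open Blowup
 open Correlation using (diff)
 open Permutations using (Distinct; distinct?; ∣toSet∣; ¬distinct⇒∣toSet∣<; fresh-∷)
 open Ramsey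
 open Rationals
 open Subsets
 open Types using (⟦_⟧; D; D-cong; Δ; total; module Constancy)
 open import Data.Fin using (finToFun; funToFin)
 import Data.Fin.Subset as Sub
 open import Data.Integer as ℤ using (ℤ; 0ℤ)
 open import Data.List as List using (List; []; _∷_; length; allFin)
 import Data.List.Properties as List
 open import Data.List.Relation.Binary.Sublist.Propositional using (_⊆_; []; _∷_; _∷ʳ_; ⊆-refl; ⊆-trans)
 open import Data.List.Relation.Binary.Sublist.Propositional.Properties using (++⁺)
 open import Data.Nat using (_∸_)
 open import Data.Rational using (_+_; _*_; _-_; -_; _≤_; _<_; ∣_∣)
 open import Data.Vec using (lookup; replicate)

 private
   variable
     n : ℕ

 listSet : List (Fin n) → Subset n
 listSet []       = ∅
 listSet (x ∷ xs) = ins x (listSet xs)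

 listSet-insert : ∀ (xs : List (Fin n)) y ys → listSet (xs List.++ y ∷ ys) ≡ ins y (listSet (xs List.++ ys))
 listSet-insert []       y ys = refl
 listSet-insert (x ∷ xs) y ys = trans (cong (ins x) (listSet-insert xs y ys)) (ins-comm x y _)

 listSet-toList : ∀ {l} (xs : Vec (Fin n) l) → listSet (Vec.toList xs) ≡ toSet xs
 listSet-toList []       = refl
 listSet-toList (x ∷ xs) = cong (ins x) (listSet-toList xs)

 AllDistinct : List (Fin n) → Set
 AllDistinct []       = ⊤
 AllDistinct (x ∷ xs) = lookup (listSet xs) x ≡ false × AllDistinct xs

 listSet-⊆ : ∀ {xs ys : List (Fin n)} → xs ⊆ ys → ∀ i → lookup (listSet ys) i ≡ false → lookup (listSet xs) i ≡ false
 listSet-⊆ []         i h = h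
 listSet-⊆ {ys = y ∷ ys} (.y ∷ʳ s) i h with y Fin.≟ i
 ... | yes refl = ⊥-elim (true≢false (lookup-ins y (listSet ys)) h)
 ... | no ne    = listSet-⊆ s i (trans (sym (lookup-ins-≢ (listSet ys) ne)) h)
 listSet-⊆ {xs = x ∷ xs} {ys = .x ∷ ys} (refl ∷ s) i h with x Fin.≟ i
 ... | yes refl = ⊥-elim (true≢false (lookup-ins x (listSet ys)) h)
 ... | no ne    = trans (lookup-ins-≢ (listSet xs) ne) (listSet-⊆ s i (trans (sym (lookup-ins-≢ (listSet ys) ne)) h))

 allDistinct-⊆ : ∀ {xs ys : List (Fin n)} → xs ⊆ ys → AllDistinct ys → AllDistinct xs
 allDistinct-⊆ []         d       = tt
 allDistinct-⊆ (y ∷ʳ s)   (_ , d) = allDistinct-⊆ s d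
 allDistinct-⊆ {xs = x ∷ xs} (refl ∷ s) (h , d) = listSet-⊆ s x h , allDistinct-⊆ s d

 ∣listSet∣ : ∀ (xs : List (Fin n)) → AllDistinct xs → Sub.∣ listSet xs ∣ ≡ length xs
 ∣listSet∣ {n} []   d       = ∣∅∣ n
 ∣listSet∣ (x ∷ xs) (h , d) = trans (∣ins∣ x (listSet xs) h) (cong suc (∣listSet∣ xs d))

 tabulate-distinct : ∀ {u} m (f : Fin m → Fin u) → (∀ {i j} → f i ≡ f j → i ≡ j) → AllDistinct (List.tabulate f)
 tabulate-distinct zero    f inj = tt
 tabulate-distinct (suc m) f inj = fresh m (λ j → suc j) (λ ()) , tabulate-distinct m (λ j → f (suc j)) (λ e → Fin.suc-injective (inj e))
   where
   fresh : ∀ m′ (g : Fin m′ → Fin (suc m)) → (∀ {j} → ¬ g j ≡ zero) → lookup (listSet (List.tabulate (λ j → f (g j)))) (f zero) ≡ false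
   fresh zero     g ne = lookup-∅ (f zero)
   fresh (suc m′) g ne = trans (lookup-ins-≢ _ (λ e → ne (inj e))) (fresh m′ (λ j → g (suc j)) ne)

 size-distinct : ∀ {l} (xs : Vec (Fin n) l) → Sub.∣ toSet xs ∣ ≡ l → Distinct xs
 size-distinct xs e with distinct? xs
 ... | yes d = d
 ... | no nd = ⊥-elim (ℕ.<⇒≢ (¬distinct⇒∣toSet∣< xs nd) e)

 toSet-∈ : ∀ {n u l} (f : Fin n → Fin u) (xs : Vec (Fin n) l) {x} → lookup (toSet xs) x ≡ true → lookup (toSet (Vec.map f xs)) (f x) ≡ true
 toSet-∈ f []       {x} h = ⊥-elim (true≢false h (lookup-∅ x))
 toSet-∈ f (y ∷ xs) {x} h with y Fin.≟ x
 ... | yes refl = lookup-ins (f y) (toSet (Vec.map f xs))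
 ... | no ne    = lookup-ins-mono (f y) (toSet (Vec.map f xs)) (f x) (toSet-∈ f xs (trans (sym (lookup-ins-≢ (toSet xs) ne)) h))

 distinct-map⁻ : ∀ {n u l} (f : Fin n → Fin u) (xs : Vec (Fin n) l) → Distinct (Vec.map f xs) → Distinct xs
 distinct-map⁻ f []       d = tt
 distinct-map⁻ f (x ∷ xs) (h , d) = Correlation.¬true⇒false (λ e → true≢false (toSet-∈ f xs e) h) , distinct-map⁻ f xs d

 -- The list with c i copies of i, in increasing order.
 expand : ∀ {q} → Vec ℕ q → List (Fin q)
 expand []      = []
 expand (b ∷ β) = List.replicate b zero List.++ List.map suc (expand β)

 length-expand : ∀ {q} (β : Vec ℕ q) → length (expand β) ≡ total β
 length-expand []      = refl
 length-expand (b ∷ β) = trans (List.length-++ (List.replicate b zero))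
   (cong₂ ℕ._+_ (List.length-replicate b) (trans (List.length-map suc (expand β)) (length-expand β)))

 -- The alternating sum over all sublists; on `expand β` it becomes the mixed difference `Δ β`
 -- (`alt-expand`).
 alt : ∀ {A : Set} → List A → (List A → ℤ) → ℤ
 alt []       F = F []
 alt (x ∷ xs) F = alt xs F ℤ.- alt xs (λ zs → F (x ∷ zs))

 alt-cong : ∀ {A : Set} (xs : List A) {F G} → (∀ zs → F zs ≡ G zs) → alt xs F ≡ alt xs G
 alt-cong []       h = h []
 alt-cong (x ∷ xs) h = cong₂ ℤ._-_ (alt-cong xs h) (alt-cong xs (λ zs → h (x ∷ zs)))

 alt-map : ∀ {A B : Set} (f : A → B) xs F → alt (List.map f xs) F ≡ alt xs (λ zs → F (List.map f zs))
 alt-map f []       F = refl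
 alt-map f (x ∷ xs) F = cong₂ ℤ._-_ (alt-map f xs F) (alt-map f xs (λ zs → F (f x ∷ zs)))

 alt-replicate : ∀ {A : Set} b (x : A) ys F → alt (List.replicate b x List.++ ys) F ≡ D b (λ i → alt ys (λ zs → F (List.replicate i x List.++ zs)))
 alt-replicate zero    x ys F = refl
 alt-replicate (suc b) x ys F = cong₂ ℤ._-_ (alt-replicate b x ys F) (alt-replicate b x ys (λ zs → F (x ∷ zs)))

 alt-expand : ∀ {q} (β : Vec ℕ q) F → alt (expand β) F ≡ Δ β (λ c → F (expand c))
 alt-expand []      F = refl
 alt-expand (b ∷ β) F = trans (alt-replicate b zero (List.map suc (expand β)) F)
   (D-cong b (λ i → trans (alt-map suc (expand β) _) (alt-expand β (λ zs → F (List.replicate i zero List.++ List.map suc zs)))))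

 expand-ones-zeros : ∀ a b → expand (replicate a 1 Vec.++ replicate b 0) ≡ List.tabulate {n = a} (λ i → i ↑ˡ b)
 expand-ones-zeros zero    b = expand-zeros b
   where
   expand-zeros : ∀ b → expand (replicate b 0) ≡ []
   expand-zeros zero    = refl
   expand-zeros (suc b) = cong (List.map suc) (expand-zeros b)
 expand-ones-zeros (suc a) b = cong (zero ∷_) (trans (cong (List.map suc) (expand-ones-zeros a b)) (List.map-tabulate (λ i → i ↑ˡ b) suc))

 expand-zeros-ones : ∀ a b → expand (replicate a 0 Vec.++ replicate b 1) ≡ List.tabulate {n = b} (λ i → a ↑ʳ i)
 expand-zeros-ones zero zero    = refl
 expand-zeros-ones zero (suc b) = cong (zero ∷_) (trans (cong (List.map suc) (expand-zeros-ones zero b)) (List.map-tabulate (λ i → i) suc))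
 expand-zeros-ones (suc a) b    = trans (cong (List.map suc) (expand-zeros-ones a b)) (List.map-tabulate (λ i → a ↑ʳ i) suc)

 total-replicate : ∀ a x → total (replicate a x) ≡ a ℕ.* x
 total-replicate zero    x = refl
 total-replicate (suc a) x = cong (x ℕ.+_) (total-replicate a x)

 total-++ : ∀ {a b} (xs : Vec ℕ a) (ys : Vec ℕ b) → total (xs Vec.++ ys) ≡ total xs ℕ.+ total ys
 total-++ []       ys = refl
 total-++ (x ∷ xs) ys = trans (cong (x ℕ.+_) (total-++ xs ys)) (sym (ℕ.+-assoc x (total xs) (total ys)))

 -- A 0/1-valued function on k-sets cannot have vanishing differences of order
 -- r₀ = k - g on a sample of 2k parts (part 0 being the reference part) of u
 -- vertices each which is complete on the first k parts and empty on the last k.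
 module Sample {k′ g r₀ u : ℕ} (only : OnlyConstantSolutions (suc k′) g) (r₀+g : r₀ ℕ.+ g ≡ suc k′) (0<r₀ : 0 ℕ.< r₀)
   {n : ℕ} (edge : Subset n → Bool) (y : Vec (Fin n) ((suc k′ ℕ.+ suc k′) ℕ.* u))
   (exact : ∀ (qs : Vec (Fin ((suc k′ ℕ.+ suc k′) ℕ.* u)) (r₀ ℕ.* 2)) (Rs : Vec (Fin ((suc k′ ℕ.+ suc k′) ℕ.* u)) g) → Distinct (qs Vec.++ Rs) →
     diff (λ e → 𝟙 (edge e)) r₀ (Vec.map (lookup y) qs) (toSet (Vec.map (lookup y) Rs)) ≡ 0ℚ) where

   open Constancy {suc k′} {g} only

   k q N : ℕ
   k = suc k′
   q = k′ ℕ.+ k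
   N = (k ℕ.+ k) ℕ.* u

   Φ : Subset n → ℚ
   Φ e = 𝟙 (edge e)

   place : Fin (suc q) → Fin u → Fin N
   place p i = combine p i

   at : Fin (suc q) → Fin u → Fin n
   at p i = lookup y (place p i)

   column : Fin N → Fin u
   column z = proj₂ (Fin.remQuot {suc q} u z)

   column-place : ∀ p i → column (place p i) ≡ i
   column-place p i = cong proj₂ (Fin.remQuot-combine p i)

   -- A difference of order r + 1 is half the difference of two differences of order r, so vanishing
   -- at order r₀ passes to the higher orders up to k.
   exact-up : ∀ e {s} → s ℕ.+ e ≡ g → (qs : Vec (Fin N) ((e ℕ.+ r₀) ℕ.* 2)) (Rs : Vec (Fin N) s) → Distinct (qs Vec.++ Rs) →
     diff Φ (e ℕ.+ r₀) (Vec.map (lookup y) qs) (toSet (Vec.map (lookup y) Rs)) ≡ 0ℚ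
   exact-up zero    {s} eq qs Rs d = lemma s (trans (sym eq) (ℕ.+-identityʳ s)) Rs d
     where
     lemma : ∀ t → g ≡ t → (Rs : Vec (Fin N) t) → Distinct (qs Vec.++ Rs) → diff Φ r₀ (Vec.map (lookup y) qs) (toSet (Vec.map (lookup y) Rs)) ≡ 0ℚ
     lemma t refl Rs d = exact qs Rs d
   exact-up (suc e) {s} eq (a ∷ b ∷ qs) Rs (fa , fb , d) = trans (cong₂ (λ x z → ½ * (x - z))
       (exact-up e {suc s} (trans (sym (ℕ.+-suc s e)) eq) qs (a ∷ Rs) (move a (proj₂ (fresh-∷ {y = b} (qs Vec.++ Rs) fa))))
       (exact-up e {suc s} (trans (sym (ℕ.+-suc s e)) eq) qs (b ∷ Rs) (move b fb))) refl
     where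
     toSet-move : ∀ {l} (qs : Vec (Fin N) l) a → toSet (qs Vec.++ (a ∷ Rs)) ≡ ins a (toSet (qs Vec.++ Rs))
     toSet-move []       a = refl
     toSet-move (q ∷ qs) a = trans (cong (ins q) (toSet-move qs a)) (ins-comm q a _)
     move : ∀ a → lookup (toSet (qs Vec.++ Rs)) a ≡ false → Distinct (qs Vec.++ (a ∷ Rs))
     move a h = size-distinct (qs Vec.++ (a ∷ Rs)) (trans (cong Sub.∣_∣ (toSet-move qs a))
       (trans (∣ins∣ a (toSet (qs Vec.++ Rs)) h) (trans (cong suc (∣toSet∣ (qs Vec.++ Rs) d)) (sym (ℕ.+-suc _ s)))))

   vertices : List (Fin (suc q)) → List (Fin u) → List (Fin n)
   vertices = List.zipWith at

   value : List (Fin (suc q)) → List (Fin u) → Bool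
   value ts cs = edge (listSet (vertices ts cs))

   -- The remaining vertices of the k-set are taken from the reference part 0, which is listed
   -- first.
   fullType : List (Fin q) → List (Fin (suc q))
   fullType zs = List.replicate (k ∸ length zs) zero List.++ List.map suc zs

   module Homog (C : List (Fin u)) (C-distinct : AllDistinct C) (C-long : k ℕ.+ k ℕ.≤ length C)
     (homogeneous : ∀ ts → length ts ≡ k → ∃[ v ] Homogeneous k (value ts) C v) where

     base : List (Fin u)
     base = List.take k C

     base⊆C : base ⊆ C
     base⊆C = take-⊆ k C
       where
       take-⊆ : ∀ {A : Set} j (xs : List A) → List.take j xs ⊆ xs
       take-⊆ zero    xs       = []⊆ xs
       take-⊆ (suc j) []       = []
       take-⊆ (suc j) (x ∷ xs) = refl ∷ take-⊆ j xs

     length-base : length base ≡ k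
     length-base = trans (List.length-take k C) (ℕ.m≤n⇒m⊓n≡m (ℕ.≤-trans (ℕ.m≤m+n k k) C-long))

     value-base : ∀ ts → length ts ≡ k → ∀ cs → cs ⊆ C → length cs ≡ k → value ts cs ≡ value ts base
     value-base ts l cs s lc = let v , h = homogeneous ts l in trans (h cs s lc) (sym (h base base⊆C length-base))

     pairsAt : ∀ {R} → Vec (Fin q) R → Vec (Fin u) R → Vec (Fin u) R → Vec (Fin N) (R ℕ.* 2)
     pairsAt []       []       []       = []
     pairsAt (x ∷ xs) (b ∷ bs) (a ∷ as) = place zero b ∷ place (suc x) a ∷ pairsAt xs bs as

     θℤ : List (Fin q) → ℤ
     θℤ zs = ⟦ value (fullType zs) base ⟧

     -- When the difference is expanded, every pair adds either its reference vertex, in column b,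
     -- or its vertex of part `suc x`, in column a. The chosen columns are collected in `B` and
     -- `cs`. The order B, bs, rs, cs, as ensures that each resulting set lists its columns in the
     -- order of `C` with the reference part first, so that homogeneity replaces them by `base`.
     evaluate : ∀ {R} (xs : Vec (Fin q) R) bs as (B rs : List (Fin u)) ps cs → length ps ≡ length cs →
       length (B List.++ rs) ℕ.+ length ps ℕ.+ R ≡ k →
       (B List.++ Vec.toList bs) List.++ rs List.++ cs List.++ Vec.toList as ⊆ C →
       diff Φ R (Vec.map (lookup y) (pairsAt xs bs as)) (listSet (List.map (at zero) (B List.++ rs) List.++ vertices (List.map suc ps) cs)) ≡
       ½ ^ R * ζ (alt (Vec.toList xs) (λ zs → θℤ (ps List.++ zs)))
     evaluate [] [] [] B rs ps cs lps size s = trans (final (edge _) refl) (sym (ℚ.*-identityˡ _))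
       where
       shape : value (fullType ps) ((B List.++ rs) List.++ cs) ≡ edge (listSet (List.map (at zero) (B List.++ rs) List.++ vertices (List.map suc ps) cs))
       shape = cong (λ z → edge (listSet z)) (trans (cong (λ m → vertices (List.replicate m zero List.++ List.map suc ps) ((B List.++ rs) List.++ cs)) count)
         (zip-replicate (B List.++ rs)))
         where
         count : k ∸ length ps ≡ length (B List.++ rs)
         count = trans (cong (_∸ length ps) (trans (sym size) (ℕ.+-identityʳ _))) (ℕ.m+n∸n≡m (length (B List.++ rs)) (length ps))
         zip-replicate : ∀ X → vertices (List.replicate (length X) zero List.++ List.map suc ps) (X List.++ cs) ≡ List.map (at zero) X List.++ vertices (List.map suc ps) cs
         zip-replicate []      = refl
         zip-replicate (x ∷ X) = cong (at zero x ∷_) (zip-replicate X)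
       total-length : length ((B List.++ rs) List.++ cs) ≡ k
       total-length = trans (List.length-++ (B List.++ rs)) (trans (cong (length (B List.++ rs) ℕ.+_) (sym lps)) (trans (sym (ℕ.+-identityʳ _)) size))
       type-length : length (fullType ps) ≡ k
       type-length = trans (List.length-++ (List.replicate (k ∸ length ps) zero)) (trans (cong₂ ℕ._+_ (List.length-replicate (k ∸ length ps)) (List.length-map suc ps))
         (ℕ.m∸n+n≡m (ℕ.≤-trans (ℕ.m≤n+m (length ps) (length (B List.++ rs))) (ℕ.≤-reflexive (trans (sym (ℕ.+-identityʳ _)) size)))))
       arranged : (B List.++ rs) List.++ cs ⊆ C
       arranged = subst (_⊆ C) (trans (cong₂ (λ b c → b List.++ rs List.++ c) (List.++-identityʳ B) (List.++-identityʳ cs)) (sym (List.++-assoc B rs cs))) s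
       same : edge (listSet (List.map (at zero) (B List.++ rs) List.++ vertices (List.map suc ps) cs)) ≡ value (fullType ps) base
       same = trans (sym shape) (value-base (fullType ps) type-length _ arranged total-length)
       final : ∀ b → edge (listSet (List.map (at zero) (B List.++ rs) List.++ vertices (List.map suc ps) cs)) ≡ b → 𝟙 b ≡ ζ (θℤ (ps List.++ []))
       final b e = trans (embed b) (cong (λ c → ζ ⟦ c ⟧) (trans (sym e) (trans same (cong (λ z → value (fullType z) base) (sym (List.++-identityʳ ps))))))
         where
         embed : ∀ b → 𝟙 b ≡ ζ ⟦ b ⟧
         embed true  = sym ζ-1
         embed false = sym ζ-0
     evaluate {suc R} (x ∷ xs) (b ∷ bs) (a ∷ as) B rs ps cs lps size s = trans (cong₂ (λ u v → ½ * (u - v)) first second)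
         (trans (lem (½ ^ R) (ζ X) (ζ Y)) (cong (½ * ½ ^ R *_) (sym (ζ-- X Y))))
       where
       X = alt (Vec.toList xs) (λ zs → θℤ (ps List.++ zs))
       Y = alt (Vec.toList xs) (λ zs → θℤ (ps List.++ x ∷ zs))
       lem : ∀ h x y → ½ * (h * x - h * y) ≡ ½ * h * (x - y)
       lem = solve-∀ ringℚ
       S = listSet (List.map (at zero) (B List.++ rs) List.++ vertices (List.map suc ps) cs)
       smaller : ∀ {A : Set} (zs : List A) z ws → zs List.++ ws ⊆ zs List.++ z ∷ ws
       smaller zs z ws = ++⁺ (⊆-refl {x = zs}) (z ∷ʳ ⊆-refl)
       put-b : ins (at zero b) S ≡ listSet (List.map (at zero) ((B List.++ b ∷ []) List.++ rs) List.++ vertices (List.map suc ps) cs)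
       put-b = sym (trans (cong (λ z → listSet (z List.++ vertices (List.map suc ps) cs)) (trans (cong (List.map (at zero)) (List.++-assoc B (b ∷ []) rs)) (List.map-++ (at zero) B (b ∷ rs))))
         (trans (cong listSet (List.++-assoc (List.map (at zero) B) (at zero b ∷ List.map (at zero) rs) _))
         (trans (listSet-insert (List.map (at zero) B) (at zero b) _)
         (cong (λ z → ins (at zero b) (listSet z)) (trans (sym (List.++-assoc (List.map (at zero) B) _ _)) (cong (List._++ vertices (List.map suc ps) cs) (sym (List.map-++ (at zero) B rs))))))))
       zip-snoc : ∀ ps cs → length ps ≡ length cs → vertices (List.map suc (ps List.++ x ∷ [])) (cs List.++ a ∷ []) ≡ vertices (List.map suc ps) cs List.++ at (suc x) a ∷ []
       zip-snoc []       []       e = refl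
       zip-snoc (p ∷ ps) (c ∷ cs) e = cong (at (suc p) c ∷_) (zip-snoc ps cs (ℕ.suc-injective e))
       put-a : ins (at (suc x) a) S ≡ listSet (List.map (at zero) (B List.++ rs) List.++ vertices (List.map suc (ps List.++ x ∷ [])) (cs List.++ a ∷ []))
       put-a = sym (trans (cong (λ z → listSet (List.map (at zero) (B List.++ rs) List.++ z)) (zip-snoc ps cs lps))
         (trans (cong listSet (sym (List.++-assoc (List.map (at zero) (B List.++ rs)) (vertices (List.map suc ps) cs) _)))
         (trans (listSet-insert (List.map (at zero) (B List.++ rs) List.++ vertices (List.map suc ps) cs) (at (suc x) a) [])
         (cong (λ z → ins (at (suc x) a) (listSet z)) (List.++-identityʳ (List.map (at zero) (B List.++ rs) List.++ vertices (List.map suc ps) cs))))))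
       first : diff Φ R (Vec.map (lookup y) (pairsAt xs bs as)) (ins (at zero b) S) ≡ ½ ^ R * ζ X
       first = trans (cong (diff Φ R (Vec.map (lookup y) (pairsAt xs bs as))) put-b)
         (evaluate xs bs as (B List.++ b ∷ []) rs ps cs lps
           (trans (cong (λ z → z ℕ.+ length ps ℕ.+ R) (trans (cong length (List.++-assoc B (b ∷ []) rs)) (trans (List.length-++ B) (trans (ℕ.+-suc (length B) (length rs)) (cong suc (sym (List.length-++ B)))))))
             (trans (sym (ℕ.+-suc (length (B List.++ rs) ℕ.+ length ps) R)) size))
           (⊆-trans (++⁺ (subst (λ z → z ⊆ B List.++ b ∷ Vec.toList bs) (sym (List.++-assoc B (b ∷ []) (Vec.toList bs))) ⊆-refl)
             (++⁺ (⊆-refl {x = rs}) (smaller cs a (Vec.toList as)))) s))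
       second : diff Φ R (Vec.map (lookup y) (pairsAt xs bs as)) (ins (at (suc x) a) S) ≡ ½ ^ R * ζ Y
       second = trans (cong (diff Φ R (Vec.map (lookup y) (pairsAt xs bs as))) put-a)
         (trans (evaluate xs bs as B rs (ps List.++ x ∷ []) (cs List.++ a ∷ [])
           (trans (List.length-++ ps) (trans (cong (ℕ._+ 1) lps) (sym (List.length-++ cs))))
           (trans (cong (λ z → length (B List.++ rs) ℕ.+ z ℕ.+ R) (trans (List.length-++ ps) (ℕ.+-comm (length ps) 1)))
             (trans (cong (ℕ._+ R) (ℕ.+-suc (length (B List.++ rs)) (length ps))) (trans (sym (ℕ.+-suc (length (B List.++ rs) ℕ.+ length ps) R)) size)))
           (⊆-trans (++⁺ (smaller B b (Vec.toList bs)) (++⁺ (⊆-refl {x = rs}) (subst (λ z → z ⊆ cs List.++ a ∷ Vec.toList as) (sym (List.++-assoc cs (a ∷ []) (Vec.toList as))) ⊆-refl))) s))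
           (cong (½ ^ R *_) (cong ζ (alt-cong (Vec.toList xs) (λ zs → cong θℤ (List.++-assoc ps (x ∷ []) zs))))))

     -- Already the columns of the positions are distinct, being those of a sublist of `C`.
     pairs-distinct : ∀ {R s} (xs : Vec (Fin q) R) bs as (rs : Vec (Fin u) s) → Vec.toList bs List.++ Vec.toList rs List.++ Vec.toList as ⊆ C →
       Distinct (pairsAt xs bs as Vec.++ Vec.map (place zero) rs)
     pairs-distinct {R} {s} xs bs as rs sub = distinct-map⁻ column _ (size-distinct _ (trans (cong Sub.∣_∣ (columns xs bs as))
       (trans (∣listSet∣ _ (allDistinct-⊆ sub C-distinct)) lengths)))
       where
       columns : ∀ {R} (xs : Vec (Fin q) R) bs as → toSet (Vec.map column (pairsAt xs bs as Vec.++ Vec.map (place zero) rs)) ≡ listSet (Vec.toList bs List.++ Vec.toList rs List.++ Vec.toList as)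
       columns [] [] [] = trans (cong toSet (trans (sym (Vec.map-∘ column (place zero) rs)) (trans (Vec.map-cong (λ i → column-place zero i) rs) (Vec.map-id rs))))
         (trans (sym (listSet-toList rs)) (cong listSet (sym (List.++-identityʳ (Vec.toList rs)))))
       columns (x ∷ xs) (b ∷ bs) (a ∷ as) = trans (cong₂ (λ u v → ins u (ins v _)) (column-place zero b) (column-place (suc x) a))
         (cong (ins b) (trans (cong (ins a) (columns xs bs as)) (trans (cong (λ z → ins a (listSet z)) (sym (List.++-assoc (Vec.toList bs) (Vec.toList rs) (Vec.toList as))))
           (trans (sym (listSet-insert (Vec.toList bs List.++ Vec.toList rs) a (Vec.toList as))) (cong listSet (List.++-assoc (Vec.toList bs) (Vec.toList rs) (a ∷ Vec.toList as)))))))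
       lengths : length (Vec.toList bs List.++ Vec.toList rs List.++ Vec.toList as) ≡ R ℕ.* 2 ℕ.+ s
       lengths = trans (List.length-++ (Vec.toList bs)) (trans (cong₂ ℕ._+_ (Vec.length-toList bs) (trans (List.length-++ (Vec.toList rs)) (cong₂ ℕ._+_ (Vec.length-toList rs) (Vec.length-toList as))))
         (arith R s))
         where
         arith : ∀ R s → R ℕ.+ (s ℕ.+ R) ≡ R ℕ.* 2 ℕ.+ s
         arith R s = trans (cong (R ℕ.+_) (ℕ.+-comm s R)) (trans (sym (ℕ.+-assoc R R s)) (cong (ℕ._+ s) (trans (cong (R ℕ.+_) (sym (ℕ.+-identityʳ R))) (ℕ.*-comm 2 R))))

     columnsVec : ∀ a (xs : List (Fin u)) → a ℕ.≤ length xs → ∃[ v ] ∃[ ws ] xs ≡ Vec.toList {n = a} v List.++ ws × length ws ≡ length xs ∸ a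
     columnsVec zero    xs       le = [] , xs , refl , refl
     columnsVec (suc a) (x ∷ xs) (ℕ.s≤s le) with columnsVec a xs le
     ... | v , ws , refl , l = x ∷ v , ws , refl , l

     θ : Vec ℕ q → Bool
     θ c = value (fullType (expand c)) base

     -- A difference of order R uses 2R columns for the pairs and s = k - R for the free reference
     -- vertices. As R ≤ k this is at most 2k, the length required of `C`.
     vanishing : Vanishing k θ
     vanishing β β≤k k≤β+g = trans (sym (alt-expand β θℤ)) (subst (λ zs → alt zs θℤ ≡ 0ℤ) (Vec.toList∘fromList (expand β)) zero-alt)
       where
       R = length (expand β)
       R≡ : R ≡ total β
       R≡ = length-expand β
       s = k ∸ R
       R≤k : R ℕ.≤ k
       R≤k = subst (ℕ._≤ k) (sym R≡) β≤k
       r₀≤R : r₀ ℕ.≤ R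
       r₀≤R = ℕ.+-cancelʳ-≤ g r₀ R (subst₂ ℕ._≤_ (sym r₀+g) (cong (ℕ._+ g) (sym R≡)) k≤β+g)
       e = R ∸ r₀
       e+r₀ : e ℕ.+ r₀ ≡ R
       e+r₀ = ℕ.m∸n+n≡m r₀≤R
       xs = Vec.fromList (expand β)
       s+R : s ℕ.+ R ≡ k
       s+R = ℕ.m∸n+n≡m R≤k
       zero-alt : alt (Vec.toList xs) θℤ ≡ 0ℤ
       zero-alt with columnsVec R C (ℕ.≤-trans R≤k (ℕ.≤-trans (ℕ.m≤m+n k k) C-long))
       ... | bs , C₁ , refl , l₁ with columnsVec s C₁ (subst (s ℕ.≤_) (sym l₁) (ℕ.≤-trans (ℕ.m∸n≤m k R) (ℕ.≤-trans (ℕ.≤-reflexive (sym (ℕ.m+n∸n≡m k k))) (ℕ.∸-mono C-long R≤k))))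
       ...   | rs , C₂ , refl , l₂ with columnsVec R C₂ (subst (R ℕ.≤_) (sym (trans l₂ (cong (_∸ s) l₁))) room)
         where
         room : R ℕ.≤ length C ∸ R ∸ s
         room = ℕ.≤-trans R≤k (ℕ.≤-trans (ℕ.≤-reflexive (sym (ℕ.m+n∸n≡m k k))) (ℕ.≤-trans (ℕ.∸-monoˡ-≤ k C-long)
           (ℕ.≤-reflexive (trans (cong (length C ∸_) (trans (sym s+R) (ℕ.+-comm s R))) (sym (ℕ.∸-+-assoc (length C) R s))))))
       ...     | as , C₃ , refl , l₃ = ζ-≡0 _ (cancel R (trans (sym (evaluate xs bs as [] (Vec.toList rs) [] [] refl size sub)) (trans (cong (diff Φ R (Vec.map (lookup y) (pairsAt xs bs as))) rest-set) zero-diff)))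
         where
         cancel : ∀ R {x} → ½ ^ R * x ≡ 0ℚ → x ≡ 0ℚ
         cancel zero    {x} h = trans (sym (ℚ.*-identityˡ x)) h
         cancel (suc R) {x} h = cancel R (trans (lem (½ ^ R) x) (trans (cong (λ z → (1ℚ + 1ℚ) * z) h) refl))
           where
           lem : ∀ p x → p * x ≡ (1ℚ + 1ℚ) * (½ * p * x)
           lem = solve-∀ ringℚ
         size : length (Vec.toList rs) ℕ.+ 0 ℕ.+ R ≡ k
         size = trans (cong (ℕ._+ R) (trans (ℕ.+-identityʳ _) (Vec.length-toList rs))) s+R
         sub : Vec.toList bs List.++ Vec.toList rs List.++ Vec.toList as ⊆ Vec.toList bs List.++ Vec.toList rs List.++ Vec.toList as List.++ C₃
         sub = ++⁺ (⊆-refl {x = Vec.toList bs}) (++⁺ (⊆-refl {x = Vec.toList rs}) (subst (_⊆ Vec.toList as List.++ C₃) (List.++-identityʳ (Vec.toList as)) (++⁺ (⊆-refl {x = Vec.toList as}) ([]⊆ C₃))))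
         rest-set : listSet (List.map (at zero) (Vec.toList rs) List.++ []) ≡ toSet (Vec.map (lookup y) (Vec.map (place zero) rs))
         rest-set = trans (cong listSet (trans (List.++-identityʳ _) (sym (Vec.toList-map (at zero) rs)))) (trans (listSet-toList (Vec.map (at zero) rs)) (cong toSet (Vec.map-∘ (lookup y) (place zero) rs)))
         s+e : s ℕ.+ e ≡ g
         s+e = ℕ.+-cancelʳ-≡ r₀ (s ℕ.+ e) g (trans (ℕ.+-assoc s e r₀) (trans (cong (s ℕ.+_) e+r₀) (trans s+R (trans (sym r₀+g) (ℕ.+-comm r₀ g)))))
         zero-diff : diff Φ R (Vec.map (lookup y) (pairsAt xs bs as)) (toSet (Vec.map (lookup y) (Vec.map (place zero) rs))) ≡ 0ℚ
         zero-diff = at-R R e+r₀ (pairsAt xs bs as) (pairs-distinct xs bs as rs sub)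
           where
           at-R : ∀ R → e ℕ.+ r₀ ≡ R → (ps : Vec (Fin N) (R ℕ.* 2)) → Distinct (ps Vec.++ Vec.map (place zero) rs) →
             diff Φ R (Vec.map (lookup y) ps) (toSet (Vec.map (lookup y) (Vec.map (place zero) rs))) ≡ 0ℚ
           at-R _ refl ps d = exact-up e s+e ps (Vec.map (place zero) rs) d

     -- Padded to length k, `c₁` takes one vertex from each of the first k parts, the reference part
     -- included, and `c₂` one from each of the last k.
     c₁ c₂ : Vec ℕ q
     c₁ = replicate k′ 1 Vec.++ replicate k 0
     c₂ = replicate k′ 0 Vec.++ replicate k 1

     total-c₁ : total c₁ ≡ k′
     total-c₁ = trans (total-++ (replicate k′ 1) (replicate k 0)) (trans (cong₂ ℕ._+_ (trans (total-replicate k′ 1) (ℕ.*-identityʳ k′)) (trans (total-replicate k 0) (ℕ.*-zeroʳ k))) (ℕ.+-identityʳ k′))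

     total-c₂ : total c₂ ≡ k
     total-c₂ = trans (total-++ (replicate k′ 0) (replicate k 1)) (cong₂ ℕ._+_ (trans (total-replicate k′ 0) (ℕ.*-zeroʳ k′)) (trans (total-replicate k 1) (ℕ.*-identityʳ k)))

     fullType-c₁ : fullType (expand c₁) ≡ List.tabulate {n = k} (λ i → i ↑ˡ k)
     fullType-c₁ = trans (cong₂ (λ m zs → List.replicate m zero List.++ List.map suc zs) one (expand-ones-zeros k′ k)) (cong (zero ∷_) (List.map-tabulate (λ i → i ↑ˡ k) suc))
       where
       one : k ∸ length (expand c₁) ≡ 1
       one = trans (cong (k ∸_) (trans (length-expand c₁) total-c₁)) (ℕ.m+n∸n≡m 1 k′)

     fullType-c₂ : fullType (expand c₂) ≡ List.tabulate {n = k} (λ i → k ↑ʳ i)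
     fullType-c₂ = trans (cong₂ (λ m zs → List.replicate m zero List.++ List.map suc zs) none (expand-zeros-ones k′ k)) (List.map-tabulate (λ i → k′ ↑ʳ i) suc)
       where
       none : k ∸ length (expand c₂) ≡ 0
       none = trans (cong (k ∸_) (trans (length-expand c₂) total-c₂)) (ℕ.n∸n≡0 k)

     homogeneous-contradiction : value (List.tabulate {n = k} (λ i → i ↑ˡ k)) base ≡ true → value (List.tabulate {n = k} (λ i → k ↑ʳ i)) base ≡ false → ⊥
     homogeneous-contradiction h₁ h₂ = true≢false (trans (cong (λ ts → value ts base) fullType-c₁) h₁)
       (trans (constant g<k q θ vanishing c₁ (ℕ.≤-trans (ℕ.≤-reflexive total-c₁) (ℕ.n≤1+n k′)))
         (trans (sym (constant g<k q θ vanishing c₂ (ℕ.≤-reflexive total-c₂))) (trans (cong (λ ts → value ts base) fullType-c₂) h₂)))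
       where
       g<k : g ℕ.< k
       g<k = subst (g ℕ.<_) r₀+g (ℕ.+-monoˡ-≤ g 0<r₀)

   -- Ramsey's theorem is applied to the columns, with one colouring for each of the (2k)^k
   -- sequences of k parts.
   contradiction : ∀ {M} → RamseyMany k (k ℕ.+ k) ((k ℕ.+ k) ℕ.^ k) M → M ℕ.≤ u →
     (∀ (I : Vec (Fin u) k) → edge (toSet (Vec.tabulate (λ j → at (j ↑ˡ k) (lookup I j)))) ≡ true) →
     (∀ (I : Vec (Fin u) k) → edge (toSet (Vec.tabulate (λ j → at (k ↑ʳ j) (lookup I j)))) ≡ false) → ⊥
   contradiction ramseyM large full empty with ramseyM (λ j → value (List.tabulate {n = k} (finToFun j))) (allFin u) (ℕ.≤-trans large (ℕ.≤-reflexive (sym (List.length-tabulate {n = u} (λ i → i)))))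
   ... | C , C⊆ , long , hom = homogeneous-contradiction (trans (value-tabulate (λ j → j ↑ˡ k)) (full I)) (trans (value-tabulate (λ j → k ↑ʳ j)) (empty I))
     where
     all-types : ∀ ts → length ts ≡ k → ∃[ v ] Homogeneous k (value ts) C v
     all-types ts l = subst (λ ts → ∃[ v ] Homogeneous k (value ts) C v) eq (hom (funToFin f))
       where
       f : Fin k → Fin (suc q)
       f i = List.lookup ts (Fin.cast (sym l) i)
       tabulate-lookup : ∀ {A : Set} (ts : List A) k (l : length ts ≡ k) → List.tabulate {n = k} (λ i → List.lookup ts (Fin.cast (sym l) i)) ≡ ts
       tabulate-lookup ts k refl = trans (List.tabulate-cong (λ i → cong (List.lookup ts) (Fin.cast-is-id refl i))) (List.tabulate-lookup ts)
       eq : List.tabulate {n = k} (finToFun (funToFin f)) ≡ ts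
       eq = trans (List.tabulate-cong (Fin.finToFun-funToFin f)) (tabulate-lookup ts k l)
     open Homog C (allDistinct-⊆ C⊆ (tabulate-distinct u (λ i → i) (λ e → e))) long all-types
     listVec : ∀ {A : Set} {m} (xs : List A) → length xs ≡ m → ∃[ v ] Vec.toList {n = m} v ≡ xs
     listVec []       refl = [] , refl
     listVec (x ∷ xs) refl = let v , e = listVec xs refl in x ∷ v , cong (x ∷_) e
     I = proj₁ (listVec base length-base)
     value-tabulate : ∀ f → value (List.tabulate {n = k} f) base ≡ edge (toSet (Vec.tabulate (λ j → at (f j) (lookup I j))))
     value-tabulate f = cong edge (trans (cong (λ z → listSet (vertices (List.tabulate f) z)) (sym (proj₂ (listVec base length-base)))) (zip-tabulate f I))
       where
       zip-tabulate : ∀ {m} (f : Fin m → Fin (suc q)) (I : Vec (Fin u) m) → listSet (vertices (List.tabulate f) (Vec.toList I)) ≡ toSet (Vec.tabulate (λ j → at (f j) (lookup I j)))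
       zip-tabulate f []      = refl
       zip-tabulate f (i ∷ I) = cong (ins (at (f zero) i)) (zip-tabulate (λ j → f (suc j)) I)

-- Finding an exact sample from small oscillation.

module Supersaturation where

 open import Defs using (OnlyConstantSolutions)
 open Blowup
 open Correlation using (diff)
 open Degrees
 open Measures
 open Permutations using (Distinct; distinct?; repeated)
 open Ramsey
 open Rationals
 open Structure using (module Sample)
 open Subsets
 open Probability
 open import Data.Bool using (not)
 open import Data.Rational using (_+_; _*_; _-_; -_; _≤_; _<_; ∣_∣)
 open import Data.Vec using (lookup; concat; zipWith; _++_)

 module _ (em : ExcludedMiddle 0ℓ) where

   positive-point : ∀ {A : Set} {L : Measure A} → Probability L → ∀ F → 0ℚ < ∫ L F → ∃[ a ] 0ℚ < F a
   positive-point {A} {L} P F h with em {∃[ a ] 0ℚ < F a}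
   ... | yes p = p
   ... | no np = ⊥-elim (ℚ.<-irrefl refl (ℚ.<-≤-trans h (≤-const P 0ℚ (λ a → ℚ.≮⇒≥ (λ lt → np (a , lt))))))

   module _ {k′ g r₀ : ℕ} (only : OnlyConstantSolutions (suc k′) g) (r₀+g : r₀ ℕ.+ g ≡ suc k′) (0<r₀ : 0 ℕ.< r₀)
     {M : ℕ} (ramseyM : RamseyMany (suc k′) (suc k′ ℕ.+ suc k′) ((suc k′ ℕ.+ suc k′) ℕ.^ suc k′) M) where

     private
       k u N N′ : ℕ
       k = suc k′
       -- Increased by one so that `N` is `suc N′` by computation, the form in which `unif-prob`
       -- applies.
       u = suc M
       N = (k ℕ.+ k) ℕ.* u
       N′ = M ℕ.+ (k′ ℕ.+ k) ℕ.* u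

     -- 2^r₀ makes the differences integral, and the powers of N undo the probability of one choice
     -- of positions: when `threshold * bad y` is below 1, all differences on the sample y vanish.
     threshold : ℚ
     threshold = 2ℚ ^ r₀ * (ι N ^ (r₀ ℕ.* 2) * ι N ^ g)

     threshold-pos : 0ℚ < threshold
     threshold-pos = *-pos (^-pos r₀ (ℚ.<-≤-trans 0<1 (≤-by 1ℚ 0≤1 refl))) (*-pos (^-pos (r₀ ℕ.* 2) (ι-pos N′)) (^-pos g (ι-pos N′)))

     exponent : ℕ
     exponent = blowupSize u k

     module _ {n : ℕ} (edge : Subset (suc n) → Bool) where

       private
         V = Fin (suc n)
         U = unif (suc n)
         U-prob = unif-prob n
         Φ : Subset (suc n) → ℚ
         Φ e = 𝟙 (edge e)
         F F′ : Vec V k → ℚ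
         F xs = Φ (toSet xs)
         F′ xs = 1ℚ - F xs
         Q = power (unif N)
         Q-prob : ∀ a → Probability (Q a)
         Q-prob = power-prob (unif-prob N′)
         S = power (power U u) k
         S-prob = power-prob (power-prob U-prob u) k

         size : Vec V N → Vec (Fin N) (r₀ ℕ.* 2) → Vec (Fin N) g → ℚ
         size y qs Rs = ∣ diff Φ r₀ (Vec.map (lookup y) qs) (toSet (Vec.map (lookup y) Rs)) ∣

         size-nonneg : ∀ y qs Rs → 0ℚ ≤ size y qs Rs
         size-nonneg y qs Rs = ℚ.0≤∣p∣ _

         bad : Vec V N → ℚ
         bad y = ∫ (Q (r₀ ℕ.* 2)) (λ qs → ∫ (Q g) (λ Rs → 𝟙 (not (repeated (qs ++ Rs))) * size y qs Rs))

         osc = oscillation Φ r₀ g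

         osc-nonneg : 0ℚ ≤ osc
         osc-nonneg = nonneg (power-prob U-prob (r₀ ℕ.* 2)) _ (λ xs → nonneg (power-prob U-prob g) _ (λ R → ℚ.0≤∣p∣ _))

         -- Distinct positions of a random sample carry independent vertices, so every choice of
         -- positions without repetition contributes exactly the oscillation, and the others
         -- nothing.
         mean-bad : ∫ (power U N) bad ≤ osc
         mean-bad = begin
           ∫ (power U N) bad
             ≡⟨ trans (∫-swap (power U N) (Q (r₀ ℕ.* 2)) _) (∫-cong (Q (r₀ ℕ.* 2)) (λ qs → ∫-swap (power U N) (Q g) _)) ⟩
           ∫ (Q (r₀ ℕ.* 2)) (λ qs → ∫ (Q g) (λ Rs → ∫ (power U N) (λ y → 𝟙 (not (repeated (qs ++ Rs))) * size y qs Rs)))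
             ≤⟨ ≤-const (Q-prob (r₀ ℕ.* 2)) osc (λ qs → ≤-const (Q-prob g) osc (λ Rs → each qs Rs)) ⟩
           osc ∎
           where
           open ℚ.≤-Reasoning
           each : ∀ qs Rs → ∫ (power U N) (λ y → 𝟙 (not (repeated (qs ++ Rs))) * size y qs Rs) ≤ osc
           each qs Rs with distinct? (qs ++ Rs)
           ... | yes d = ℚ.≤-reflexive (trans (∫-cong (power U N) (λ y → ℚ.*-identityˡ (size y qs Rs)))
                 (marginal U-prob qs Rs d (λ xs R → ∣ diff Φ r₀ xs (toSet R) ∣)))
           ... | no _  = ℚ.≤-trans (ℚ.≤-reflexive (∫-≡0 (power U N) (λ y → ℚ.*-zeroˡ (size y qs Rs)))) osc-nonneg

         point-bad : ∀ y qs Rs → Distinct (qs ++ Rs) → 2ℚ ^ r₀ * size y qs Rs ≤ threshold * bad y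
         point-bad y qs Rs d = begin
           2ℚ ^ r₀ * size y qs Rs
             ≡⟨ cong (2ℚ ^ r₀ *_) (trans (sym (ℚ.*-identityˡ _)) (cong (_* size y qs Rs) (sym (cong₂ _*_ (unit (r₀ ℕ.* 2)) (unit g))))) ⟩
           2ℚ ^ r₀ * (ι N ^ (r₀ ℕ.* 2) * inv N ^ (r₀ ℕ.* 2) * (ι N ^ g * inv N ^ g) * size y qs Rs)
             ≡⟨ lem (2ℚ ^ r₀) (ι N ^ (r₀ ℕ.* 2)) (inv N ^ (r₀ ℕ.* 2)) (ι N ^ g) (inv N ^ g) (size y qs Rs) ⟩
           threshold * (inv N ^ (r₀ ℕ.* 2) * (inv N ^ g * size y qs Rs))
             ≤⟨ *-monoˡ threshold (ℚ.<⇒≤ threshold-pos) (begin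
                  inv N ^ (r₀ ℕ.* 2) * (inv N ^ g * size y qs Rs)
                    ≡⟨ cong (λ z → inv N ^ (r₀ ℕ.* 2) * (inv N ^ g * z)) (sym (trans (cong (_* size y qs Rs) one) (ℚ.*-identityˡ _))) ⟩
                  inv N ^ (r₀ ℕ.* 2) * (inv N ^ g * G qs Rs)
                    ≤⟨ *-monoˡ _ (^-nonneg (r₀ ℕ.* 2) (inv-nonneg N)) (∫-power-point (unif-prob N′) (inv-nonneg N) (unif-point N) (G qs) (G-nonneg qs) Rs) ⟩
                  inv N ^ (r₀ ℕ.* 2) * ∫ (Q g) (G qs)
                    ≤⟨ ∫-power-point (unif-prob N′) (inv-nonneg N) (unif-point N) (λ qs → ∫ (Q g) (G qs)) (λ qs → nonneg (Q-prob g) _ (G-nonneg qs)) qs ⟩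
                  bad y ∎) ⟩
           threshold * bad y ∎
           where
           open ℚ.≤-Reasoning
           G : Vec (Fin N) (r₀ ℕ.* 2) → Vec (Fin N) g → ℚ
           G qs Rs = 𝟙 (not (repeated (qs ++ Rs))) * size y qs Rs
           G-nonneg : ∀ qs Rs → 0ℚ ≤ G qs Rs
           G-nonneg qs Rs = *-nonneg (𝟙-nonneg (not (repeated (qs ++ Rs)))) (size-nonneg y qs Rs)
           one : 𝟙 (not (repeated (qs ++ Rs))) ≡ 1ℚ
           one with distinct? (qs ++ Rs)
           ... | yes _ = refl
           ... | no nd = ⊥-elim (nd d)
           unit : ∀ a → ι N ^ a * inv N ^ a ≡ 1ℚ
           unit a = trans (sym (^-distrib-* (ι N) (inv N) a)) (trans (cong (_^ a) (ι*inv N′)) (1^ a))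
           lem : ∀ t a a′ b b′ x → t * (a * a′ * (b * b′) * x) ≡ t * (a * b) * (a′ * (b′ * x))
           lem = solve-∀ ringℚ

         F-nonneg : ∀ xs → 0ℚ ≤ F xs
         F-nonneg xs = 𝟙-nonneg (edge (toSet xs))

         F′-nonneg : ∀ xs → 0ℚ ≤ F′ xs
         F′-nonneg xs = 0≤q-p (𝟙-≤1 (edge (toSet xs)))

         F′-≤1 : ∀ xs → F′ xs ≤ 1ℚ
         F′-≤1 xs = ≤-by (F xs) (F-nonneg xs) (lem (F xs))
           where
           lem : ∀ x → 1ℚ ≡ 1ℚ - x + x
           lem = solve-∀ ringℚ

       private
         gain : Vec (Vec V u) k → Vec (Vec V u) k → ℚ
         gain Y₁ Y₂ = blowup F Y₁ * blowup F′ Y₂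
         -- One positive value settles everything: `gain` is then nonzero, which makes the first
         -- half complete and the second half empty, and `threshold * bad` lies below `gain` ≤ 1,
         -- which makes all differences vanish.
         excess : Vec (Vec V u) k → Vec (Vec V u) k → ℚ
         excess Y₁ Y₂ = gain Y₁ Y₂ - threshold * bad (concat (Y₁ ++ Y₂))

       module Chosen (Y₁ Y₂ : Vec (Vec V u) k) (positive : 0ℚ < excess Y₁ Y₂) where

         private
           y : Vec V N
           y = concat (Y₁ ++ Y₂)
           lt : threshold * bad y < gain Y₁ Y₂
           lt = subst₂ _<_ (ℚ.+-identityˡ _) (lem (gain Y₁ Y₂) (threshold * bad y)) (ℚ.+-monoˡ-< (threshold * bad y) positive)
             where
             lem : ∀ a b → a - b + b ≡ a
             lem = solve-∀ ringℚ
           bad-nonneg : 0ℚ ≤ threshold * bad y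
           bad-nonneg = *-nonneg (ℚ.<⇒≤ threshold-pos) (nonneg (Q-prob (r₀ ℕ.* 2)) _ (λ qs → nonneg (Q-prob g) _ (λ Rs → *-nonneg (𝟙-nonneg (not (repeated (qs ++ Rs)))) (size-nonneg y qs Rs))))
           gain≤1 : gain Y₁ Y₂ ≤ 1ℚ
           gain≤1 = ℚ.≤-trans (*-mono (blowup-nonneg F′ F′-nonneg Y₂) 0≤1 (blowup-≤1 F F-nonneg (λ xs → 𝟙-≤1 (edge (toSet xs))) Y₁) (blowup-≤1 F′ F′-nonneg F′-≤1 Y₂)) (ℚ.≤-reflexive refl)
           gain≢0 : ¬ gain Y₁ Y₂ ≡ 0ℚ
           gain≢0 e = ℚ.<-irrefl refl (ℚ.≤-<-trans bad-nonneg (subst (threshold * bad y <_) e lt))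
           exact : ∀ (qs : Vec (Fin N) (r₀ ℕ.* 2)) (Rs : Vec (Fin N) g) → Distinct (qs ++ Rs) → diff Φ r₀ (Vec.map (lookup y) qs) (toSet (Vec.map (lookup y) Rs)) ≡ 0ℚ
           exact qs Rs d with diff-integral edge r₀ (Vec.map (lookup y) qs) (toSet (Vec.map (lookup y) Rs))
           ... | z , eq = cancel (2ℚ ^ r₀) (^-pos r₀ (ℚ.<-≤-trans 0<1 (≤-by 1ℚ 0≤1 refl))) (trans eq (trans (cong ζ (ζ-small z small-z)) ζ-0))
             where
             X = diff Φ r₀ (Vec.map (lookup y) qs) (toSet (Vec.map (lookup y) Rs))
             small-z : ∣ ζ z ∣ < 1ℚ
             small-z = ℚ.≤-<-trans (ℚ.≤-reflexive (trans (cong ∣_∣ (sym eq)) (trans (ℚ.∣p*q∣≡∣p∣*∣q∣ (2ℚ ^ r₀) X)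
               (cong (_* ∣ X ∣) (ℚ.0≤p⇒∣p∣≡p (^-nonneg r₀ 0≤2)))))) (ℚ.≤-<-trans (point-bad y qs Rs d) (ℚ.<-≤-trans lt gain≤1))
             cancel : ∀ p → 0ℚ < p → ∀ {x} → p * x ≡ 0ℚ → x ≡ 0ℚ
             cancel p 0<p {x} e = ℚ.≤-antisym (*-cancelˡ p 0<p (ℚ.≤-reflexive (trans e (sym (ℚ.*-zeroʳ p))))) (*-cancelˡ p 0<p (ℚ.≤-reflexive (trans (ℚ.*-zeroʳ p) (sym e))))
           vertex : ∀ p i → lookup y (combine p i) ≡ lookup (lookup (Y₁ ++ Y₂) p) i
           vertex = lookup-concat (Y₁ ++ Y₂)
           zip-tabulate : ∀ {m} (Y : Vec (Vec V u) m) I → zipWith lookup Y I ≡ Vec.tabulate (λ j → lookup (lookup Y j) (lookup I j))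
           zip-tabulate []      []      = refl
           zip-tabulate (y ∷ Y) (i ∷ I) = cong (lookup y i ∷_) (zip-tabulate Y I)
           nonzero : ∀ {b} → ¬ 𝟙 b ≡ 0ℚ → b ≡ true
           nonzero {true}  ne = refl
           nonzero {false} ne = ⊥-elim (ne refl)
           nonzero′ : ∀ {b} → ¬ 1ℚ - 𝟙 b ≡ 0ℚ → b ≡ false
           nonzero′ {true}  ne = ⊥-elim (ne refl)
           nonzero′ {false} ne = refl
           full : ∀ (I : Vec (Fin u) k) → edge (toSet (Vec.tabulate (λ j → lookup y (combine (j ↑ˡ k) (lookup I j))))) ≡ true
           full I = trans (cong (λ z → edge (toSet z)) (trans (Vec.tabulate-cong (λ j → trans (vertex (j ↑ˡ k) (lookup I j)) (cong (λ z → lookup z (lookup I j)) (Vec.lookup-++ˡ Y₁ Y₂ j)))) (sym (zip-tabulate Y₁ I))))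
             (nonzero (blowup-transversal F Y₁ (λ e → gain≢0 (trans (cong (_* blowup F′ Y₂) e) (ℚ.*-zeroˡ (blowup F′ Y₂)))) I))
           empty : ∀ (I : Vec (Fin u) k) → edge (toSet (Vec.tabulate (λ j → lookup y (combine (k ↑ʳ j) (lookup I j))))) ≡ false
           empty I = trans (cong (λ z → edge (toSet z)) (trans (Vec.tabulate-cong (λ j → trans (vertex (k ↑ʳ j) (lookup I j)) (cong (λ z → lookup z (lookup I j)) (Vec.lookup-++ʳ Y₁ Y₂ j)))) (sym (zip-tabulate Y₂ I))))
             (nonzero′ (blowup-transversal F′ Y₂ (λ e → gain≢0 (trans (cong (blowup F Y₁ *_) e) (ℚ.*-zeroʳ (blowup F Y₁)))) I))

         impossible : ⊥
         impossible = Sample.contradiction only r₀+g 0<r₀ edge y exact ramseyM (ℕ.n≤1+n M) full empty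

       -- Otherwise some sample is complete on its first half, empty on its second
       -- half, and has no nonzero difference of order r₀.
       supersaturation : ∀ η → 0ℚ ≤ η → η ≤ ∫ (power U k) (λ xs → 𝟙 (edge (toSet xs))) → η ≤ 1ℚ - ∫ (power U k) (λ xs → 𝟙 (edge (toSet xs))) →
         threshold * oscillation (λ e → 𝟙 (edge e)) r₀ g < η ^ exponent * η ^ exponent → ⊥
       supersaturation η 0≤η dense sparse small =
         let Y₁ , h = positive-point S-prob (λ Y₁ → ∫ S (λ Y₂ → excess Y₁ Y₂)) mean-excess
             Y₂ , h′ = positive-point S-prob (λ Y₂ → excess Y₁ Y₂) h
         in Chosen.impossible Y₁ Y₂ h′
         where
         mean-gain : η ^ exponent * η ^ exponent ≤ ∫ S (λ Y₁ → ∫ S (λ Y₂ → gain Y₁ Y₂))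
         mean-gain = subst (η ^ exponent * η ^ exponent ≤_) (sym (trans (∫-cong S (λ Y₁ → ∫-*ˡ S (blowup F Y₁) (blowup F′))) (∫-*ʳ S (∫ S (blowup F′)) (blowup F))))
           (*-mono (^-nonneg exponent 0≤η) (ℚ.≤-trans (^-nonneg exponent 0≤η) first) first second)
           where
           first : η ^ exponent ≤ ∫ S (blowup F)
           first = ℚ.≤-trans (^-mono exponent 0≤η dense) (∫-blowup U-prob u k F F-nonneg)
           second : η ^ exponent ≤ ∫ S (blowup F′)
           second = ℚ.≤-trans (^-mono exponent 0≤η (ℚ.≤-trans sparse (ℚ.≤-reflexive (sym (trans (∫-- (power U k) _ F) (cong (_- ∫ (power U k) F) (const (power-prob U-prob k) 1ℚ)))))))
             (∫-blowup U-prob u k F′ F′-nonneg)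
         mean-excess : 0ℚ < ∫ S (λ Y₁ → ∫ S (λ Y₂ → excess Y₁ Y₂))
         mean-excess = subst (0ℚ <_) (sym (trans (∫-cong S (λ Y₁ → ∫-- S (gain Y₁) (λ Y₂ → threshold * bad (concat (Y₁ ++ Y₂))))) (∫-- S (λ Y₁ → ∫ S (gain Y₁)) (λ Y₁ → ∫ S (λ Y₂ → threshold * bad (concat (Y₁ ++ Y₂)))))))
           (0<q-p (ℚ.≤-<-trans (ℚ.≤-trans (ℚ.≤-reflexive mean) (*-monoˡ threshold (ℚ.<⇒≤ threshold-pos) mean-bad)) (ℚ.<-≤-trans small mean-gain)))
           where
           mean : ∫ S (λ Y₁ → ∫ S (λ Y₂ → threshold * bad (concat (Y₁ ++ Y₂)))) ≡ threshold * ∫ (power U N) bad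
           mean = trans (∫-cong S (λ Y₁ → ∫-*ˡ S threshold (λ Y₂ → bad (concat (Y₁ ++ Y₂))))) (trans (∫-*ˡ S threshold (λ Y₁ → ∫ S (λ Y₂ → bad (concat (Y₁ ++ Y₂))))) (cong (threshold *_)
             (sym (trans (∫-concat U (k ℕ.+ k) u bad) (∫-power-++ (power U u) k k (λ Y → bad (concat Y)))))))

-- Densities and intersections as means over random tuples.

module Density where

 open import Defs using (Hypergraph; edge; uniform; density; edgeCount; commonEdges; IsDisc)
 open Measures
 open Permutations using (distinct?; repeated; ∣toSet∣; ∫-repeated)
 open Rationals
 open Subsets
 open Probability
 open import Data.Bool using (_∧_)
 open import Data.Fin.Subset using () renaming (∣_∣ to size)
 open import Data.Integer as ℤ using (+_)
 open import Data.Nat.Combinatorics using (_C_)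
 open import Data.Rational using (_+_; _*_; _-_; -_; _≤_; _<_; ∣_∣; _/_; toℚᵘ)

 /-* : ∀ e c → + e / suc c * ι (suc c) ≡ ι e
 /-* e c = ℚ.toℚᵘ-injective (begin
   toℚᵘ (+ e / suc c * ι (suc c))
     ≈⟨ ℚ.toℚᵘ-homo-* (+ e / suc c) (ι (suc c)) ⟩
   toℚᵘ (+ e / suc c) ℚᵘ.* toℚᵘ (ι (suc c))
     ≈⟨ ℚᵘ.*-cong (ℚ.toℚᵘ-fromℚᵘ (ℚᵘ.mkℚᵘ (+ e) c)) (toℚᵘ-ι (suc c)) ⟩
   ℚᵘ.mkℚᵘ (+ e) c ℚᵘ.* ℚᵘ.mkℚᵘ (+ suc c) 0
     ≈⟨ ℚᵘ.*≡* (trans (ℤ.*-identityʳ (+ e ℤ.* + suc c)) (cong (λ z → + e ℤ.* + z) (sym (ℕ.*-identityʳ (suc c))))) ⟩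
   ℚᵘ.mkℚᵘ (+ e) 0
     ≈⟨ toℚᵘ-ι e ⟨
   toℚᵘ (ι e) ∎)
   where open ℚᵘ.≃-Reasoning

 small-inv : ∀ a ε → 0ℚ < ε → ∃[ n₀ ] (∀ n → n₀ ℕ.≤ suc n → a * inv (suc n) ≤ ε)
 small-inv a ε 0<ε with archimedean a | archimedean-inv 0<ε
 ... | m , a≤m | t , t≤ε = m ℕ.* suc t , λ n le → ℚ.≤-trans (begin
   a * inv (suc n)
     ≤⟨ *-monoʳ (inv (suc n)) (inv-nonneg (suc n)) a≤m ⟩
   ι m * inv (suc n)
     ≡⟨ trans (sym (ℚ.*-identityʳ (ι m * inv (suc n)))) (trans (cong (ι m * inv (suc n) *_) (sym (ι*inv t))) (lem (ι m) (inv (suc n)) (ι (suc t)) (inv (suc t)))) ⟩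
   ι m * ι (suc t) * (inv (suc n) * inv (suc t))
     ≤⟨ *-monoʳ _ (*-nonneg (inv-nonneg (suc n)) (inv-nonneg (suc t))) (ℚ.≤-trans (ℚ.≤-reflexive (sym (ι-* m (suc t)))) (ι-mono le)) ⟩
   ι (suc n) * (inv (suc n) * inv (suc t))
     ≡⟨ trans (sym (ℚ.*-assoc (ι (suc n)) (inv (suc n)) (inv (suc t)))) (trans (cong (_* inv (suc t)) (ι*inv n)) (ℚ.*-identityˡ (inv (suc t)))) ⟩
   inv (suc t) ∎) t≤ε
   where
   open ℚ.≤-Reasoning
   lem : ∀ a b c d → a * b * (c * d) ≡ a * c * (b * d)
   lem = solve-∀ ringℚ

 ofSize-true : ∀ {n k} (e : Subset n) → size e ≡ k → ofSize k e ≡ true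
 ofSize-true {k = k} e refl with size e ℕ.≡ᵇ size e | ℕ.≡⇒≡ᵇ (size e) (size e) refl
 ... | true | _ = refl

 indicator-uniform : ∀ {n k} (G : Hypergraph n k) → Uniform k (λ e → 𝟙 (edge G e))
 indicator-uniform G e ne with edge G e in eq
 ... | true  = ⊥-elim (ne (uniform G e eq))
 ... | false = refl

 pullback : ∀ {n k} → Hypergraph n k → Permutation′ n → Hypergraph n k
 pullback G α = record
   { edge    = λ e → edge G (image α e)
   ; uniform = λ e h → trans (sym (∣image∣ α e)) (uniform G (image α e) h)
   }

 𝟙-∧ : ∀ a b → 𝟙 (a ∧ b) ≡ 𝟙 a * 𝟙 b
 𝟙-∧ true  b = sym (ℚ.*-identityˡ (𝟙 b))
 𝟙-∧ false b = sym (ℚ.*-zeroˡ (𝟙 b))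

 module _ {n : ℕ} (k : ℕ) where

   private
     N : ℚ
     N = ι (suc n)
     T = power (unif (suc n)) k
     T-prob = power-prob (unif-prob n) k

   -- The probability that the vertices of a random tuple are distinct.
   simple : ℚ
   simple = ∫ T (λ xs → 𝟙 (ofSize k (toSet xs)))

   mean : Hypergraph (suc n) k → ℚ
   mean G = ∫ T (λ xs → 𝟙 (edge G (toSet xs)))

   simple-count : N ^ k * simple ≡ (k !ℚ) * ι (suc n C k)
   simple-count = trans (∫-tuples n k (λ e → 𝟙 (ofSize k e)) ofSize-uniform) (cong ((k !ℚ) *_) (∫-ofSize (suc n) k))
     where
     ofSize-uniform : Uniform k (λ e → 𝟙 (ofSize k e))
     ofSize-uniform e ne with size e ℕ.≡ᵇ k in eq
     ... | true  = ⊥-elim (ne (ℕ.≡ᵇ⇒≡ (size e) k (subst Data.Bool.T (sym eq) _)))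
     ... | false = refl

   mean-count : ∀ G → N ^ k * mean G ≡ (k !ℚ) * ι (edgeCount G)
   mean-count G = trans (∫-tuples n k (λ e → 𝟙 (edge G e)) (indicator-uniform G)) (cong ((k !ℚ) *_) (sym (length-filterᵇ (suc n) (edge G))))

   1≤simple+ : 1ℚ ≤ simple + ι k * ι k * inv (suc n)
   1≤simple+ = begin
     1ℚ
       ≤⟨ const-≤ T-prob 1ℚ bound ⟩
     ∫ T (λ xs → 𝟙 (ofSize k (toSet xs)) + 𝟙 (repeated xs))
       ≡⟨ ∫-+ T (λ xs → 𝟙 (ofSize k (toSet xs))) (λ xs → 𝟙 (repeated xs)) ⟩
     simple + ∫ T (λ xs → 𝟙 (repeated xs))
       ≤⟨ ℚ.+-monoʳ-≤ simple (∫-repeated n k) ⟩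
     simple + ι k * ι k * inv (suc n) ∎
     where
     open ℚ.≤-Reasoning
     bound : ∀ xs → 1ℚ ≤ 𝟙 (ofSize k (toSet xs)) + 𝟙 (repeated xs)
     bound xs with distinct? xs
     ... | yes d = ≤-by 0ℚ ℚ.≤-refl (cong (λ b → 𝟙 b + 0ℚ) (ofSize-true {k = k} (toSet xs) (∣toSet∣ xs d)))
     ... | no _  = ≤-by (𝟙 (ofSize k (toSet xs))) (𝟙-nonneg (ofSize k (toSet xs))) (ℚ.+-comm (𝟙 (ofSize k (toSet xs))) 1ℚ)

   ½≤simple : ι k * ι k * inv (suc n) ≤ ½ → ½ ≤ simple
   ½≤simple few = ≤-by {½} ((simple + ε - 1ℚ) + (½ - ε)) (+-nonneg (0≤q-p 1≤simple+) (0≤q-p few)) (lem simple ε)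
     where
     ε = ι k * ι k * inv (suc n)
     lem : ∀ s ε → s ≡ ½ + ((s + ε - 1ℚ) + (½ - ε))
     lem = solve-∀ ringℚ

   module _ (0<simple : 0ℚ < simple) where

     private
       N^k>0 : 0ℚ < N ^ k
       N^k>0 = ^-pos k (ι-pos n)

     density-count : ∀ (G : Hypergraph (suc n) k) → density {suc n} {k} G * ι (suc n C k) ≡ ι (edgeCount {suc n} {k} G)
     density-count G with suc n C k in eq
     ... | suc c = /-* (edgeCount G) c
     ... | zero  = ⊥-elim (ℚ.<-irrefl refl (subst (0ℚ <_) (trans simple-count (trans (cong ((k !ℚ) *_) (trans (cong ι eq) ι-0)) (ℚ.*-zeroʳ (k !ℚ)))) (*-pos N^k>0 0<simple)))

     -- `mean` and `simple` count sets with the same factor k! / n^k, which cancels.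
     mean-density : ∀ G → mean G ≡ density G * simple
     mean-density G = ℚ.≤-antisym (*-cancelˡ (N ^ k) N^k>0 (ℚ.≤-reflexive eq)) (*-cancelˡ (N ^ k) N^k>0 (ℚ.≤-reflexive (sym eq)))
       where
       lem : ∀ f p c → f * (p * c) ≡ p * (f * c)
       lem = solve-∀ ringℚ
       lem₂ : ∀ f p c → p * (f * c) ≡ f * (p * c)
       lem₂ = solve-∀ ringℚ
       eq : N ^ k * mean G ≡ N ^ k * (density G * simple)
       eq = trans (mean-count G) (trans (cong ((k !ℚ) *_) (sym (density-count G))) (trans (lem (k !ℚ) (density G) (ι (suc n C k)))
         (trans (cong (density G *_) (sym simple-count)) (lem₂ (N ^ k) (density G) simple))))

     meeting : Hypergraph (suc n) k → Hypergraph (suc n) k → Permutation′ (suc n) → Permutation′ (suc n) → ℚ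
     meeting G H α β = ∫ T (λ p → 𝟙 (edge G (toSet (Vec.map (α ⟨$⟩ʳ_) p))) * 𝟙 (edge H (toSet (Vec.map (β ⟨$⟩ʳ_) p))))

     meeting-count : ∀ G H α β → N ^ k * meeting G H α β ≡ (k !ℚ) * ι (commonEdges (pullback G α) (pullback H β))
     meeting-count G H α β = trans (cong (N ^ k *_) (∫-cong T (λ p → sym (trans (𝟙-∧ (edge G (image α (toSet p))) (edge H (image β (toSet p))))
         (cong₂ (λ x y → 𝟙 (edge G x) * 𝟙 (edge H y)) (image-toSet α p) (image-toSet β p))))))
       (trans (∫-tuples n k (λ e → 𝟙 (edge G (image α e) ∧ edge H (image β e))) common-uniform)
         (cong ((k !ℚ) *_) (sym (length-filterᵇ (suc n) (λ e → edge G (image α e) ∧ edge H (image β e))))))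
       where
       common-uniform : Uniform k (λ e → 𝟙 (edge G (image α e) ∧ edge H (image β e)))
       common-uniform e ne = trans (𝟙-∧ (edge G (image α e)) (edge H (image β e)))
         (trans (cong (_* 𝟙 (edge H (image β e))) (indicator-uniform (pullback G α) e ne)) (ℚ.*-zeroˡ (𝟙 (edge H (image β e)))))

     -- Scaled by k! / n^k, the deviation in the definition of the discrepancy becomes the deviation
     -- of `meeting`.
     meeting-near : ∀ G H d → IsDisc G H d → ∀ α β →
       ∣ meeting G H α β - density G * density H * simple ∣ ≤ inv (suc n) ^ k * ((k !ℚ) * d)
     meeting-near G H d isDisc α β = begin
       ∣ X - ν ∣
         ≡⟨ cong ∣_∣ (trans (sym (ℚ.*-identityˡ (X - ν))) (trans (cong (_* (X - ν)) (sym unit)) (lem (N ^ k) (inv (suc n) ^ k) X ν))) ⟩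
       ∣ inv (suc n) ^ k * (N ^ k * X - N ^ k * ν) ∣
         ≡⟨ cong (λ z → ∣ inv (suc n) ^ k * z ∣) (trans (cong₂ _-_ (meeting-count G H α β) count-ν) (lem₂ (k !ℚ) c (density G * density H * ι (suc n C k)))) ⟩
       ∣ inv (suc n) ^ k * ((k !ℚ) * (c - density G * density H * ι (suc n C k))) ∣
         ≡⟨ trans (ℚ.∣p*q∣≡∣p∣*∣q∣ (inv (suc n) ^ k) _) (cong₂ _*_ (ℚ.0≤p⇒∣p∣≡p (^-nonneg k (inv-nonneg (suc n))))
              (trans (ℚ.∣p*q∣≡∣p∣*∣q∣ (k !ℚ) _) (cong (_* ∣ c - density G * density H * ι (suc n C k) ∣) (ℚ.0≤p⇒∣p∣≡p (ℚ.<⇒≤ (!ℚ-pos k)))))) ⟩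
       inv (suc n) ^ k * ((k !ℚ) * ∣ c - density G * density H * ι (suc n C k) ∣)
         ≤⟨ *-monoˡ _ (^-nonneg k (inv-nonneg (suc n))) (*-monoˡ (k !ℚ) (ℚ.<⇒≤ (!ℚ-pos k)) deviation≤d) ⟩
       inv (suc n) ^ k * ((k !ℚ) * d) ∎
       where
       open ℚ.≤-Reasoning
       X = meeting G H α β
       ν = density G * density H * simple
       c = ι (commonEdges (pullback G α) (pullback H β))
       unit : N ^ k * inv (suc n) ^ k ≡ 1ℚ
       unit = trans (sym (^-distrib-* N (inv (suc n)) k)) (trans (cong (_^ k) (ι*inv n)) (1^ k))
       lem : ∀ a b x y → a * b * (x - y) ≡ b * (a * x - a * y)
       lem = solve-∀ ringℚ
       lem₂ : ∀ f x y → f * x - f * y ≡ f * (x - y)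
       lem₂ = solve-∀ ringℚ
       lem₃ : ∀ a p s → a * (p * s) ≡ p * (a * s)
       lem₃ = solve-∀ ringℚ
       lem₄ : ∀ p f b → p * (f * b) ≡ f * (p * b)
       lem₄ = solve-∀ ringℚ
       count-ν : N ^ k * ν ≡ (k !ℚ) * (density G * density H * ι (suc n C k))
       count-ν = trans (lem₃ (N ^ k) (density G * density H) simple) (trans (cong (density G * density H *_) simple-count) (lem₄ (density G * density H) (k !ℚ) (ι (suc n C k))))
       deviation≤d : ∣ c - density G * density H * ι (suc n C k) ∣ ≤ d
       deviation≤d = subst₂ (λ x y → ∣ x - density G * density H * y ∣ ≤ d) (sym (ι≡ (commonEdges (pullback G α) (pullback H β)))) (sym (ι≡ (suc n C k)))
         (proj₂ isDisc (pullback G α) (pullback H β) (α , λ e → refl) (β , λ e → refl))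

 -- The recursion of `counting` over the bits hides its symmetry, which is read off from random
 -- tuples instead: on these a permutation acts entrywise.
 ∫-image : ∀ n k (Φ : Subset (suc n) → ℚ) → Uniform k Φ → ∀ ρ → ∫ (counting (suc n)) (λ e → Φ (image ρ e)) ≡ ∫ (counting (suc n)) Φ
 ∫-image n k Φ Φ-uniform ρ = ℚ.≤-antisym (*-cancelˡ (k !ℚ) (!ℚ-pos k) (ℚ.≤-reflexive eq)) (*-cancelˡ (k !ℚ) (!ℚ-pos k) (ℚ.≤-reflexive (sym eq)))
   where
   T = power (unif (suc n)) k
   eq : (k !ℚ) * ∫ (counting (suc n)) (λ e → Φ (image ρ e)) ≡ (k !ℚ) * ∫ (counting (suc n)) Φ
   eq = trans (sym (∫-tuples n k (λ e → Φ (image ρ e)) (λ e ne → Φ-uniform (image ρ e) (λ h → ne (trans (sym (∣image∣ ρ e)) h)))))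
     (trans (cong (ι (suc n) ^ k *_) (trans (∫-cong T (λ xs → cong Φ (image-toSet ρ xs)))
       (∫-power-map (unif (suc n)) (ρ ⟨$⟩ʳ_) (unif-permute ρ) k (λ xs → Φ (toSet xs)))))
     (∫-tuples n k Φ Φ-uniform))

-- Existence of the discrepancy.

module Maximum where

 open import Defs
 open Density using (pullback)
 open import Data.Bool using (_∧_)
 import Data.Fin.Permutation as Perm
 open import Data.List using ([]; _∷_; length; filterᵇ)
 open import Data.Nat.Combinatorics using (_C_)

 length-filterᵇ-≤ : ∀ {A : Set} (p : A → Bool) xs → length (filterᵇ p xs) ℕ.≤ length xs
 length-filterᵇ-≤ p []       = z≤n
 length-filterᵇ-≤ p (x ∷ xs) with p x
 ... | true  = s≤s (length-filterᵇ-≤ p xs)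
 ... | false = ℕ.m≤n⇒m≤1+n (length-filterᵇ-≤ p xs)

 module _ (em : ExcludedMiddle 0ℓ) where

   -- The admissible values are given only by a predicate, so excluded middle decides at each step
   -- whether a new value is available.
   maximise : ∀ (P : ℕ → Set) (f : ℕ → ℚ) B →
     ∃[ c ] (c ℕ.≤ B × P c) → ∃[ c ] P c × (∀ c′ → c′ ℕ.≤ B → P c′ → f c′ ℚ.≤ f c)
   maximise P f zero    (.0 , z≤n , p) = 0 , p , λ { .0 z≤n _ → ℚ.≤-refl }
   maximise P f (suc B) (c₀ , le , p) with em {∃[ c ] (c ℕ.≤ B × P c)} | em {P (suc B)}
   ... | no n | _ = c₀ , p , λ c′ le′ p′ → subst (λ c → f c ℚ.≤ f c₀) (trans (top c₀ le p) (sym (top c′ le′ p′))) ℚ.≤-refl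
     where
     top : ∀ c → c ℕ.≤ suc B → P c → c ≡ suc B
     top c le p = ℕ.≤-antisym le (ℕ.≰⇒> (λ le′ → n (c , le′ , p)))
   ... | yes h | no n with maximise P f B h
   ...   | c , pc , max = c , pc , λ c′ le′ p′ → max c′ (ℕ.s≤s⁻¹ (ℕ.≤∧≢⇒< le′ (λ e → n (subst P e p′)))) p′
   maximise P f (suc B) (c₀ , le , p) | yes h | yes pB with maximise P f B h
   ...   | c , pc , max with ℚ.≤-total (f c) (f (suc B))
   ...     | inj₁ up = suc B , pB , bound
     where
     bound : ∀ c′ → c′ ℕ.≤ suc B → P c′ → f c′ ℚ.≤ f (suc B)
     bound c′ le′ p′ with c′ ℕ.≟ suc B
     ... | yes refl = ℚ.≤-refl
     ... | no ne = ℚ.≤-trans (max c′ (ℕ.s≤s⁻¹ (ℕ.≤∧≢⇒< le′ ne)) p′) up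
   ...     | inj₂ down = c , pc , bound
     where
     bound : ∀ c′ → c′ ℕ.≤ suc B → P c′ → f c′ ℚ.≤ f c
     bound c′ le′ p′ with c′ ℕ.≟ suc B
     ... | yes refl = down
     ... | no ne = max c′ (ℕ.s≤s⁻¹ (ℕ.≤∧≢⇒< le′ ne)) p′

   -- The deviation depends on the copies only through the number of common edges, so the maximum
   -- runs over a nonempty bounded set of naturals.
   disc-exists : ∀ {n k} (G H : Hypergraph n k) → ∃[ d ] 0ℚ ℚ.≤ d × IsDisc G H d
   disc-exists {n} {k} G H = f c , ℚ.0≤∣p∣ (X c) , attained , largest
     where
     X f : ℕ → ℚ
     X c = ℕ→ℚ c ℚ.- density G ℚ.* density H ℚ.* ℕ→ℚ (n C k)
     f c = ℚ.∣ X c ∣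
     P : ℕ → Set
     P c = ∃[ G′ ] ∃[ H′ ] G′ ≅ G × H′ ≅ H × commonEdges {n} {k} G′ H′ ≡ c
     G₀ = pullback G Perm.id
     H₀ = pullback H Perm.id
     bounded : ∀ (G H : Hypergraph n k) → commonEdges G H ℕ.≤ length (subsets n)
     bounded G H = length-filterᵇ-≤ (λ e → edge G e ∧ edge H e) (subsets n)
     best : ∃[ c ] P c × (∀ c′ → c′ ℕ.≤ length (subsets n) → P c′ → f c′ ℚ.≤ f c)
     best = maximise P f (length (subsets n)) (commonEdges G₀ H₀ , bounded G₀ H₀ , G₀ , H₀ , (Perm.id , λ e → refl) , (Perm.id , λ e → refl) , refl)
     c = proj₁ best
     attained : ∃[ G′ ] ∃[ H′ ] G′ ≅ G × H′ ≅ H × f c ≡ f (commonEdges {n} {k} G′ H′)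
     attained = let G′ , H′ , isoG , isoH , eq = proj₁ (proj₂ best) in G′ , H′ , isoG , isoH , cong f (sym eq)
     largest : ∀ G′ H′ → G′ ≅ G → H′ ≅ H → f (commonEdges {n} {k} G′ H′) ℚ.≤ f c
     largest G′ H′ isoG isoH = proj₂ (proj₂ best) (commonEdges G′ H′) (bounded G′ H′) (G′ , H′ , isoG , isoH , refl)

-- Large biases of one order force a large discrepancy.

module Discrepancy where

 open import Defs using (Hypergraph; edge; density; IsDisc)
 open Blocks using (pairing)
 open Correlation using (diff; meanDiff; ∣diff∣≤1; pairsOf; pairsOf-distinct)
 open Cubes using (extractor)
 open Degrees using (bias; 2ℚ; 0≤2)
 open Density
 open Khinchine using (3ℚ; fourth)
 open Measures
 open Permutations
 open Rationals
 open Subsets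
 open Probability
 open import Data.Rational using (_+_; _*_; _-_; -_; _≤_; _<_; ∣_∣)

 scaled-sqrt : ∀ a′ n → ∃[ w ] suc a′ ℕ.* (w ℕ.* w) ℕ.≤ n × n ℕ.< suc a′ ℕ.* (suc w ℕ.* suc w)
 scaled-sqrt a′ zero = 0 , ℕ.≤-reflexive (ℕ.*-zeroʳ a′) , s≤s z≤n
 scaled-sqrt a′ (suc n) with scaled-sqrt a′ n
 ... | w , lo , hi with suc n ℕ.<? suc a′ ℕ.* (suc w ℕ.* suc w)
 ...   | yes lt = w , ℕ.m≤n⇒m≤1+n lo , lt
 ...   | no nlt = suc w , ℕ.≮⇒≥ nlt , ℕ.≤-<-trans hi (ℕ.*-monoʳ-< (suc a′) (ℕ.*-mono-< (ℕ.n<1+n (suc w)) (ℕ.n<1+n (suc w))))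

 -- The number m of pairs in a block is taken to be a square, so that powers of √m are rational.
 scaled-sqrt-≥ : ∀ a′ n → suc a′ ℕ.≤ n → ∃[ w′ ] suc a′ ℕ.* (suc w′ ℕ.* suc w′) ℕ.≤ n × n ℕ.≤ suc a′ ℕ.* 4 ℕ.* (suc w′ ℕ.* suc w′)
 scaled-sqrt-≥ a′ n a≤n with scaled-sqrt a′ n
 ... | zero , lo , hi = ⊥-elim (ℕ.<⇒≱ hi (ℕ.≤-trans (ℕ.≤-reflexive (ℕ.*-identityʳ (suc a′))) a≤n))
 ... | suc w′ , lo , hi = w′ , lo , ℕ.≤-trans (ℕ.<⇒≤ hi) (ℕ.≤-trans (ℕ.*-monoʳ-≤ (suc a′) double) (ℕ.≤-reflexive (sym (ℕ.*-assoc (suc a′) 4 (suc w′ ℕ.* suc w′)))))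
   where
   w = suc w′
   double : suc w ℕ.* suc w ℕ.≤ 4 ℕ.* (w ℕ.* w)
   double = ℕ.≤-trans (ℕ.*-mono-≤ {suc w} {2 ℕ.* w} {suc w} {2 ℕ.* w} le le) (ℕ.≤-reflexive (lemma w))
     where
     le : suc w ℕ.≤ 2 ℕ.* w
     le = ℕ.≤-trans (ℕ.+-monoˡ-≤ w (s≤s (z≤n {w′}))) (ℕ.≤-reflexive (cong (w ℕ.+_) (sym (ℕ.+-identityʳ w))))
     lemma : ∀ w → 2 ℕ.* w ℕ.* (2 ℕ.* w) ≡ 4 ℕ.* (w ℕ.* w)
     lemma w = trans (ℕ.*-assoc 2 w (2 ℕ.* w)) (trans (cong (2 ℕ.*_) (trans (sym (ℕ.*-assoc w 2 w)) (trans (cong (ℕ._* w) (ℕ.*-comm w 2)) (ℕ.*-assoc 2 w w)))) (sym (ℕ.*-assoc 2 2 (w ℕ.* w))))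

 module _ (q s : ℕ) where

   private
     r k : ℕ
     r = suc q
     k = r ℕ.+ s

   module _ {n : ℕ} (Φ : Subset (suc n) → ℚ) (∣Φ∣≤1 : ∀ e → ∣ Φ e ∣ ≤ 1ℚ) where

     ∣meanDiff∣≤1 : ∀ xs → ∣ meanDiff Φ r s xs ∣ ≤ 1ℚ
     ∣meanDiff∣≤1 xs = ℚ.≤-trans (∣∣-≤ (power-prob (unif-prob n) s) (λ R → diff Φ r xs (toSet R)))
       (≤-const (power-prob (unif-prob n) s) 1ℚ (λ R → ∣diff∣≤1 Φ ∣Φ∣≤1 r xs (toSet R)))

     -- `bias` uses independent vertices, whereas the blocks supply pairs without repetition;
     -- passing from one to the other costs at most κ for large n, hence the 2κ in the hypothesis.
     bias≤ : ∀ κ (f : Fin r → Bool → Fin (suc n)) → (∀ {i b j c} → f i b ≡ f j c → i ≡ j × b ≡ c) →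
       2ℚ * κ ≤ bias Φ r s → ι (r ℕ.* 2) * ι (r ℕ.* 2) * inv (suc n) ≤ κ →
       κ ≤ ∫ (perms (suc n)) (λ α → ∣ meanDiff Φ r s (Vec.map (α ⟨$⟩ʳ_) (pairsOf r f)) ∣)
     bias≤ κ f f-injective big small = ≤-by {κ} ((bias Φ r s - 2ℚ * κ) + (κ - ε) + (W + ε - bias Φ r s))
       (+-nonneg (+-nonneg (0≤q-p big) (0≤q-p small)) (0≤q-p (∫-perms-≥ n (λ xs → ∣ meanDiff Φ r s xs ∣) (λ xs → ℚ.0≤∣p∣ _) ∣meanDiff∣≤1 (pairsOf r f) (pairsOf-distinct r f f-injective))))
       (lem W κ ε (bias Φ r s))
       where
       ε = ι (r ℕ.* 2) * ι (r ℕ.* 2) * inv (suc n)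
       W = ∫ (perms (suc n)) (λ α → ∣ meanDiff Φ r s (Vec.map (α ⟨$⟩ʳ_) (pairsOf r f)) ∣)
       lem : ∀ W κ ε b → W ≡ κ + ((b - (1ℚ + 1ℚ) * κ) + (κ - ε) + (W + ε - b))
       lem = solve-∀ ringℚ

   -- With σ = K w^q N^{-r} and m = w², the left side of the energy inequality
   -- exceeds twice its last term, so the term linear in the discrepancy is large.
   balance : ∀ (κ K W w P L D t b : ℚ) → 0ℚ < K → 0ℚ < W → 0ℚ < P →
     2ℚ * (t * fourth b) ≤ K * K * (κ * κ * (κ * κ)) →
     K * W * P * (K * W * P) * (W * W * (w * w) * (P * (κ * κ) * (P * (κ * κ)))) ≤
       K * W * P * (K * W * P) * (K * W * P) * (L * (D + D)) + t * (W * W * (W * W) * (w * w)) * fourth (b * P) →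
     κ * κ * (κ * κ) * (w * w * W * P) ≤ 2ℚ * 2ℚ * (K * L * D)
   balance κ K W w P L D t b 0<K 0<W 0<P large h = *-cancelˡ (K * K * W * W * W * P * P * P)
     (*-pos (*-pos (*-pos (*-pos (*-pos (*-pos (*-pos 0<K 0<K) 0<W) 0<W) 0<W) 0<P) 0<P) 0<P)
     (≤-by (2ℚ * (R - A) + (W * W * (W * W) * (w * w)) * fourth P * (K * K * (κ * κ * (κ * κ)) - 2ℚ * (t * fourth b)))
       (+-nonneg (*-nonneg 0≤2 (0≤q-p h)) (*-nonneg (*-nonneg (*-nonneg (square-nonneg (W * W)) (square-nonneg w)) (square-nonneg (P * P))) (0≤q-p large)))
       (lem κ K W w P L D t b))
     where
     A = K * W * P * (K * W * P) * (W * W * (w * w) * (P * (κ * κ) * (P * (κ * κ))))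
     R = K * W * P * (K * W * P) * (K * W * P) * (L * (D + D)) + t * (W * W * (W * W) * (w * w)) * fourth (b * P)
     lem : ∀ κ K W w P L D t b →
       K * K * W * W * W * P * P * P * ((1ℚ + 1ℚ) * (1ℚ + 1ℚ) * (K * L * D)) ≡
       K * K * W * W * W * P * P * P * (κ * κ * (κ * κ) * (w * w * W * P)) +
       ((1ℚ + 1ℚ) * (K * W * P * (K * W * P) * (K * W * P) * (L * (D + D)) + t * (W * W * (W * W) * (w * w)) * ((b * P) * (b * P) * ((b * P) * (b * P))) -
         K * W * P * (K * W * P) * (W * W * (w * w) * (P * (κ * κ) * (P * (κ * κ))))) +
        (W * W * (W * W) * (w * w)) * (P * P * (P * P)) * (K * K * (κ * κ * (κ * κ)) - (1ℚ + 1ℚ) * (t * (b * b * (b * b)))))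
     lem = solve-∀ ringℚ

   LargeDiscrepancy : ℚ → ℚ → ℕ → Set
   LargeDiscrepancy κ c n₀ = ∀ n → n₀ ℕ.≤ suc n → ∀ (G H : Hypergraph (suc n) k) →
     2ℚ * κ ≤ bias (λ e → 𝟙 (edge G e)) r s → 2ℚ * κ ≤ bias (λ e → 𝟙 (edge H e)) r s →
     ∀ d → 0ℚ ≤ d → IsDisc G H d → c * c * ι (suc n) ^ suc k ≤ d * d

   largeDiscrepancy : ∀ κ → 0ℚ < κ → ∃[ c ] 0ℚ < c × ∃[ n₀ ] LargeDiscrepancy κ c n₀
   largeDiscrepancy κ 0<κ = c , *-pos 0<c₁ (^-pos (suc r) (inv-pos e)) , n₁ ℕ.⊔ (n₂ ℕ.⊔ suc a′) , bound
     where
     κ⁴ : ℚ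
     κ⁴ = κ * κ * (κ * κ)
     κ⁴-pos : 0ℚ < κ⁴
     κ⁴-pos = *-pos (*-pos 0<κ 0<κ) (*-pos 0<κ 0<κ)
     Λ = proj₁ (extractor (q ℕ.+ s))
     t b L F K c₁ c : ℚ
     t = 3ℚ ^ q
     b = (ι k * 2ℚ) ^ r
     L = norm Λ ^ r
     F = k !ℚ
     x = proj₁ (archimedean-inv κ⁴-pos)
     y = proj₁ (archimedean (2ℚ * (t * fourth b)))
     -- `y` bounds twice the constant of the fourth-moment term and `suc x` makes up for the factor
     -- κ⁴, so that K²κ⁴ dominates that term.
     K = ι (suc (y ℕ.* suc x))
     K-large : 2ℚ * (t * fourth b) ≤ K * K * κ⁴
     K-large = begin
       2ℚ * (t * fourth b)             ≤⟨ proj₂ (archimedean (2ℚ * (t * fourth b))) ⟩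
       ι y                             ≡⟨ trans (sym (ℚ.*-identityʳ (ι y))) (cong (ι y *_) (sym (ι*inv x))) ⟩
       ι y * (ι (suc x) * inv (suc x)) ≡⟨ trans (sym (ℚ.*-assoc (ι y) (ι (suc x)) (inv (suc x)))) (cong (_* inv (suc x)) (sym (ι-* y (suc x)))) ⟩
       ι (y ℕ.* suc x) * inv (suc x)   ≤⟨ *-mono (inv-nonneg (suc x)) (*-nonneg (ι-nonneg _) (ι-nonneg _)) K²≥ (proj₂ (archimedean-inv κ⁴-pos)) ⟩
       K * K * κ⁴                      ∎
       where
       open ℚ.≤-Reasoning
       K²≥ : ι (y ℕ.* suc x) ≤ K * K
       K²≥ = subst (ι (y ℕ.* suc x) ≤_) (ι-* (suc (y ℕ.* suc x)) (suc (y ℕ.* suc x))) (ι-mono (ℕ.≤-trans (ℕ.n≤1+n _) (ℕ.m≤m*n (suc (y ℕ.* suc x)) (suc (y ℕ.* suc x)))))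
     z = proj₁ (archimedean (2ℚ * 2ℚ * (K * L * F)))
     a′ e : ℕ
     -- `suc a′` is 2r, the number of vertices that the r blocks take for each index of a pair;
     -- `suc e` is 4 · 2r, an upper bound for n / w².
     a′ = suc (q ℕ.* 2)
     e = 3 ℕ.+ a′ ℕ.* 4
     c₁ = κ⁴ * inv (suc z)
     0<c₁ : 0ℚ < c₁
     0<c₁ = *-pos κ⁴-pos (inv-pos z)
     c = c₁ * inv (suc e) ^ suc r
     n₁ = proj₁ (small-inv (ι (r ℕ.* 2) * ι (r ℕ.* 2)) κ 0<κ)
     n₂ = proj₁ (small-inv (ι k * ι k) ½ (ℚ.positive⁻¹ ½))

     bound : LargeDiscrepancy κ c (n₁ ℕ.⊔ (n₂ ℕ.⊔ suc a′))
     bound n le G H biasG biasH d 0≤d isDisc = final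
       where
       N N^s i P : ℚ
       N = ι (suc n)
       i = inv (suc n)
       P = i ^ r
       N^s = N ^ s
       le₁ : n₁ ℕ.≤ suc n
       le₁ = ℕ.≤-trans (ℕ.m≤m⊔n n₁ (n₂ ℕ.⊔ suc a′)) le
       le₂ : n₂ ℕ.≤ suc n
       le₂ = ℕ.≤-trans (ℕ.≤-trans (ℕ.m≤m⊔n n₂ (suc a′)) (ℕ.m≤n⊔m n₁ (n₂ ℕ.⊔ suc a′))) le
       le₃ : suc a′ ℕ.≤ suc n
       le₃ = ℕ.≤-trans (ℕ.≤-trans (ℕ.m≤n⊔m n₂ (suc a′)) (ℕ.m≤n⊔m n₁ (n₂ ℕ.⊔ suc a′))) le
       0<simple : 0ℚ < simple {n} k
       0<simple = ℚ.<-≤-trans (ℚ.positive⁻¹ ½) (½≤simple {n} k (proj₂ (small-inv (ι k * ι k) ½ (ℚ.positive⁻¹ ½)) n le₂))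
       root = scaled-sqrt-≥ a′ (suc n) le₃
       w′ = proj₁ root
       m : ℕ
       m = suc w′ ℕ.* suc w′
       w W D : ℚ
       w = ι (suc w′)
       W = w ^ q
       D = i ^ k * (F * d)
       room : r ℕ.* m ℕ.* 2 ℕ.≤ suc n
       room = ℕ.≤-trans (ℕ.≤-reflexive (trans (ℕ.*-assoc r m 2) (trans (cong (r ℕ.*_) (ℕ.*-comm m 2)) (sym (ℕ.*-assoc r 2 m))))) (proj₁ (proj₂ root))
       Φ Ψ : Subset (suc n) → ℚ
       Φ e = 𝟙 (edge G e)
       Ψ e = 𝟙 (edge H e)
       ∣𝟙∣≤1 : ∀ b → ∣ 𝟙 b ∣ ≤ 1ℚ
       ∣𝟙∣≤1 b = ℚ.≤-trans (ℚ.≤-reflexive (ℚ.0≤p⇒∣p∣≡p (𝟙-nonneg b))) (𝟙-≤1 b)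
       module E = Energy.Spread {n} {q} s m (pairing r m room) Φ Ψ (indicator-uniform G) (indicator-uniform H)
         (λ e → 𝟙-nonneg (edge G e)) (λ e → 𝟙-≤1 (edge G e)) (λ e → 𝟙-nonneg (edge H e)) (λ e → 𝟙-≤1 (edge H e)) Λ (proj₂ (extractor (q ℕ.+ s)))
       raw : _
       raw = E.energy κ D (density G * density H * simple {n} k) (K * W * P) (ℚ.<⇒≤ 0<κ)
         (*-nonneg (*-nonneg (ι-nonneg _) (^-nonneg q (ι-nonneg (suc w′)))) (^-nonneg r (inv-nonneg (suc n))))
         (λ I → bias≤ Φ (λ e → ∣𝟙∣≤1 (edge G e)) κ (E.positions I) (λ {i} {b} {j} {c} → E.positions-injective I {i} {b} {j} {c}) biasG (proj₂ (small-inv (ι (r ℕ.* 2) * ι (r ℕ.* 2)) κ 0<κ) n le₁))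
         (λ I → bias≤ Ψ (λ e → ∣𝟙∣≤1 (edge H e)) κ (E.positions I) (λ {i} {b} {j} {c} → E.positions-injective I {i} {b} {j} {c}) biasH (proj₂ (small-inv (ι (r ℕ.* 2) * ι (r ℕ.* 2)) κ 0<κ) n le₁))
         (meeting-near k 0<simple G H d isDisc)
       square-power : ∀ j → ι m ^ j ≡ w ^ j * w ^ j
       square-power j = trans (cong (_^ j) (ι-* (suc w′) (suc w′))) (^-distrib-* w w j)
       power-r : ι m ^ r ≡ W * W * (w * w)
       power-r = trans (cong₂ _*_ (ι-* (suc w′) (suc w′)) (square-power q)) (ℚ.*-comm (w * w) (W * W))
       power-2q+1 : ι m ^ suc (q ℕ.+ q) ≡ W * W * (W * W) * (w * w)
       power-2q+1 = trans (cong₂ _*_ (ι-* (suc w′) (suc w′)) (trans (^-+ (ι m) q q) (cong₂ _*_ (square-power q) (square-power q)))) (ℚ.*-comm (w * w) (W * W * (W * W)))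
       base : (ι k * ((1ℚ + 1ℚ) * i)) ^ r ≡ b * P
       base = trans (cong (_^ r) (sym (ℚ.*-assoc (ι k) 2ℚ i))) (^-distrib-* (ι k * 2ℚ) i r)
       0<W : 0ℚ < W
       0<W = ^-pos q (ι-pos w′)
       0<P : 0ℚ < P
       0<P = ^-pos r (inv-pos n)
       balanced : κ⁴ * (w * w * W * P) ≤ 2ℚ * 2ℚ * (K * L * D)
       balanced = balance κ K W w P L D t b (ι-pos _) 0<W 0<P K-large
         (subst₂ _≤_ (cong (λ v → K * W * P * (K * W * P) * (v * (P * (κ * κ) * (P * (κ * κ))))) power-r)
           (cong₂ (λ u v → K * W * P * (K * W * P) * (K * W * P) * (L * (D + D)) + t * u * fourth v) power-2q+1 base) raw)
       -- With m = w² and W = w^(r-1) this is m^((r+1)/2) n^(k-r).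
       X : ℚ
       X = w * w * W * N^s
       N^s*i^s : N^s * i ^ s ≡ 1ℚ
       N^s*i^s = trans (sym (^-distrib-* N i s)) (trans (cong (_^ s) (ι*inv n)) (1^ s))
       d-large : c₁ * X ≤ d
       d-large = *-cancelˡ (ι (suc z) * P) (*-pos (ι-pos z) 0<P) (begin
         ι (suc z) * P * (κ⁴ * inv (suc z) * (w * w * W * N^s))
           ≡⟨ lem₁ (ι (suc z)) (inv (suc z)) P κ⁴ (w * w * W) N^s ⟩
         ι (suc z) * inv (suc z) * (N^s * (κ⁴ * (w * w * W * P)))
           ≡⟨ trans (cong (_* (N^s * (κ⁴ * (w * w * W * P)))) (ι*inv z)) (ℚ.*-identityˡ _) ⟩
         N^s * (κ⁴ * (w * w * W * P))
           ≤⟨ *-monoˡ N^s (^-nonneg s (ι-nonneg (suc n))) balanced ⟩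
         N^s * (2ℚ * 2ℚ * (K * L * (i ^ k * (F * d))))
           ≡⟨ cong (λ v → N^s * (2ℚ * 2ℚ * (K * L * (v * (F * d))))) (^-+ i r s) ⟩
         N^s * (2ℚ * 2ℚ * (K * L * (P * i ^ s * (F * d))))
           ≡⟨ lem₂ N^s (2ℚ * 2ℚ) (K * L) P (i ^ s) F d ⟩
         N^s * i ^ s * (2ℚ * 2ℚ * (K * L * F)) * (P * d)
           ≡⟨ cong (_* (P * d)) (trans (cong (_* (2ℚ * 2ℚ * (K * L * F))) N^s*i^s) (ℚ.*-identityˡ (2ℚ * 2ℚ * (K * L * F)))) ⟩
         2ℚ * 2ℚ * (K * L * F) * (P * d)
           ≤⟨ *-monoʳ (P * d) (*-nonneg (ℚ.<⇒≤ 0<P) 0≤d) (ℚ.≤-trans (proj₂ (archimedean (2ℚ * 2ℚ * (K * L * F)))) (ι-mono (ℕ.n≤1+n z))) ⟩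
         ι (suc z) * (P * d)
           ≡⟨ ℚ.*-assoc (ι (suc z)) P d ⟨
         ι (suc z) * P * d ∎)
         where
         open ℚ.≤-Reasoning
         lem₁ : ∀ z z′ P κ⁴ x y → z * P * (κ⁴ * z′ * (x * y)) ≡ z * z′ * (y * (κ⁴ * (x * P)))
         lem₁ = solve-∀ ringℚ
         lem₂ : ∀ y f x P j F d → y * (f * (x * (P * j * (F * d)))) ≡ y * j * (f * (x * F)) * (P * d)
         lem₂ = solve-∀ ringℚ
       Y : ℚ
       Y = inv (suc e) ^ suc r
       w²-large : inv (suc e) * N ≤ w * w
       w²-large = *-cancelˡ (ι (suc e)) (ι-pos e) (begin
         ι (suc e) * (inv (suc e) * N) ≡⟨ trans (sym (ℚ.*-assoc (ι (suc e)) (inv (suc e)) N)) (trans (cong (_* N) (ι*inv e)) (ℚ.*-identityˡ N)) ⟩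
         N                             ≤⟨ ι-mono (proj₂ (proj₂ root)) ⟩
         ι (suc e ℕ.* m)               ≡⟨ trans (ι-* (suc e) m) (cong (ι (suc e) *_) (ι-* (suc w′) (suc w′))) ⟩
         ι (suc e) * (w * w)           ∎)
         where open ℚ.≤-Reasoning
       -- The square of `X` has order n^(k+1+s); the surplus n^s is given away.
       final : c * c * N ^ suc k ≤ d * d
       final = begin
         c₁ * Y * (c₁ * Y) * N ^ suc k
           ≡⟨ trans (cong (λ v → c₁ * Y * (c₁ * Y) * v) (^-+ N (suc r) s)) (lem₁ c₁ Y (N ^ suc r) N^s) ⟩
         c₁ * c₁ * (Y * N ^ suc r) * (Y * N^s)
           ≤⟨ *-mono (*-nonneg (^-nonneg (suc r) (inv-nonneg (suc e))) 0≤N^s) (*-nonneg (square-nonneg c₁) (^-nonneg (suc r) (square-nonneg w)))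
                (*-monoˡ (c₁ * c₁) (square-nonneg c₁) (ℚ.≤-trans (ℚ.≤-reflexive (sym (^-distrib-* (inv (suc e)) N (suc r)))) (^-mono (suc r) (*-nonneg (inv-nonneg (suc e)) (ι-nonneg (suc n))) w²-large)))
                (*-mono 0≤N^s (ℚ.≤-trans 0≤1 1≤N^s) (ℚ.≤-trans (^-≤1 (suc r) (inv-nonneg (suc e)) inv≤1) 1≤N^s) ℚ.≤-refl) ⟩
         c₁ * c₁ * (w * w) ^ suc r * (N^s * N^s)
           ≡⟨ trans (cong (λ v → c₁ * c₁ * (w * w * (w * w * v)) * (N^s * N^s)) (^-distrib-* w w q)) (lem₂ c₁ w W N^s) ⟩
         c₁ * X * (c₁ * X)
           ≤⟨ *-mono (*-nonneg (ℚ.<⇒≤ 0<c₁) X-nonneg) 0≤d d-large d-large ⟩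
         d * d ∎
         where
         open ℚ.≤-Reasoning
         lem₁ : ∀ c Y a b → c * Y * (c * Y) * (a * b) ≡ c * c * (Y * a) * (Y * b)
         lem₁ = solve-∀ ringℚ
         lem₂ : ∀ c w W y → c * c * (w * w * (w * w * (W * W))) * (y * y) ≡ c * (w * w * W * y) * (c * (w * w * W * y))
         lem₂ = solve-∀ ringℚ
         0≤N^s : 0ℚ ≤ N^s
         0≤N^s = ^-nonneg s (ι-nonneg (suc n))
         1≤ι : ∀ n → 1ℚ ≤ ι (suc n)
         1≤ι n = subst (_≤ ι (suc n)) ι-1 (ι-mono (s≤s z≤n))
         1≤N^s : 1ℚ ≤ N^s
         1≤N^s = ^-≥1 s (1≤ι n)
         inv≤1 : inv (suc e) ≤ 1ℚ
         inv≤1 = subst (inv (suc e) ≤_) (ι*inv e) (subst (_≤ ι (suc e) * inv (suc e)) (ℚ.*-identityˡ (inv (suc e))) (*-monoʳ (inv (suc e)) (inv-nonneg (suc e)) (1≤ι e)))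
         X-nonneg : 0ℚ ≤ X
         X-nonneg = *-nonneg (*-nonneg (square-nonneg w) (ℚ.<⇒≤ 0<W)) 0≤N^s

-- The upper bound, by pigeonhole over the orders.

module Upper where

 open import Defs
 open Degrees using (bias; oscillation-≤; 2ℚ; 0≤2)
 open Density
 open Discrepancy
 open Maximum
 open Measures
 open Ramsey
 open Rationals
 open Subsets using (𝟙; 𝟙-≤1; ofSize; toSet)
 open Supersaturation
 open import Data.Rational using (_+_; _*_; _-_; -_; _≤_; _<_)

 positive-bound : ∀ {m} (c : Fin m → ℚ) → (∀ i → 0ℚ < c i) → ∃[ c₀ ] 0ℚ < c₀ × (∀ i → c₀ ≤ c i)
 positive-bound {zero}  c pos = 1ℚ , 0<1 , λ ()
 positive-bound {suc m} c pos with positive-bound (λ i → c (suc i)) (λ i → pos (suc i))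
 ... | c₀ , 0<c₀ , below with ℚ.≤-total c₀ (c zero)
 ...   | inj₁ le = c₀ , 0<c₀ , λ { zero → le ; (suc i) → below i }
 ...   | inj₂ ge = c zero , pos zero , λ { zero → ℚ.≤-refl ; (suc i) → ℚ.≤-trans ge (below i) }

 upper-bound : ∀ {m} (a : Fin m → ℕ) → ∃[ a₀ ] (∀ i → a i ℕ.≤ a₀)
 upper-bound {zero}  a = 0 , λ ()
 upper-bound {suc m} a with upper-bound (λ i → a (suc i))
 ... | a₀ , above = a zero ℕ.⊔ a₀ , λ { zero → ℕ.m≤m⊔n (a zero) a₀ ; (suc i) → ℕ.≤-trans (above i) (ℕ.m≤n⊔m (a zero) a₀) }

 module _ (em : ExcludedMiddle 0ℓ) {k′ g : ℕ} (only : OnlyConstantSolutions (suc k′) g) (g≤k′ : g ℕ.≤ k′) where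

   private
     k r₀ : ℕ
     k = suc k′
     r₀ = k ℕ.∸ g
     r₀+g : r₀ ℕ.+ g ≡ k
     r₀+g = ℕ.m∸n+n≡m (ℕ.m≤n⇒m≤1+n g≤k′)
     0<r₀ : 0 ℕ.< r₀
     0<r₀ = ℕ.m<n⇒0<n∸m (s≤s g≤k′)

     -- `suc (order s)` is k - s, so s in `Fin (suc g)` runs over the g + 1 orders k, ..., k - g,
     -- one fewer than there are hypergraphs.
     order : Fin (suc g) → ℕ
     order s = k′ ℕ.∸ toℕ s

     order+ : ∀ s → suc (order s) ℕ.+ toℕ s ≡ k
     order+ s = cong suc (ℕ.m∸n+n≡m (ℕ.≤-trans (ℕ.s≤s⁻¹ (Fin.toℕ<n s)) g≤k′))

   module _ (γ : ℚ) (0<γ : 0ℚ < γ) where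

     private
       M = proj₁ (ramsey-many k (k ℕ.+ k) ((k ℕ.+ k) ℕ.^ k))
       ramseyM = proj₂ (ramsey-many k (k ℕ.+ k) ((k ℕ.+ k) ℕ.^ k))
       η ε T A : ℚ
       -- The mean of the indicator over tuples is the density times `simple`, and `simple` is at
       -- least ½ for large n.
       η = γ * ½
       0<η : 0ℚ < η
       0<η = *-pos 0<γ (ℚ.positive⁻¹ ½)
       x = exponent em only r₀+g 0<r₀ ramseyM
       T = threshold em only r₀+g 0<r₀ ramseyM
       ε = η ^ x * η ^ x
       0<ε : 0ℚ < ε
       0<ε = *-pos (^-pos x 0<η) (^-pos x 0<η)
       A = T * (2ℚ * (1ℚ + 2ℚ * ι g) ^ g)
       n₁ = proj₁ (small-inv A (½ * ε) (*-pos (ℚ.positive⁻¹ ½) 0<ε))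
       κ : ℚ
       -- Independent of n: small enough that the oscillation bound, multiplied by the threshold,
       -- stays below ε.
       κ = inv (suc n₁)
       Aκ<ε : A * κ < ε
       Aκ<ε = ℚ.≤-<-trans (proj₂ (small-inv A (½ * ε) (*-pos (ℚ.positive⁻¹ ½) 0<ε)) n₁ (ℕ.n≤1+n n₁))
         (subst₂ _<_ (ℚ.+-identityʳ (½ * ε)) (lem ε) (ℚ.+-monoʳ-< (½ * ε) (*-pos (ℚ.positive⁻¹ ½) 0<ε)))
         where
         lem : ∀ ε → ½ * ε + ½ * ε ≡ ε
         lem = solve-∀ ringℚ
       n₂ = proj₁ (small-inv (ι k * ι k) ½ (ℚ.positive⁻¹ ½))

     half-simple : ∀ n → n₂ ℕ.≤ suc n → ½ ≤ simple {n} k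
     half-simple n le = ½≤simple {n} k (proj₂ (small-inv (ι k * ι k) ½ (ℚ.positive⁻¹ ½)) n le)

     -- Otherwise `oscillation-≤` bounds the oscillation of order k - g, and `supersaturation`
     -- refutes so small a value.
     biased-order : ∀ n → n₂ ℕ.≤ suc n → (G : Hypergraph (suc n) k) → γ < density G → density G < 1ℚ - γ →
       ∃[ s ] 2ℚ * κ ≤ bias (λ e → 𝟙 (edge G e)) (suc (order s)) (toℕ s)
     biased-order n le G γ<p p<1-γ = decide em
       where
       Found : Set
       Found = ∃[ s ] 2ℚ * κ ≤ bias (λ e → 𝟙 (edge G e)) (suc (order s)) (toℕ s)
       lem : ∀ T κ c → T * ((1ℚ + 1ℚ) * κ * c) ≡ T * ((1ℚ + 1ℚ) * c) * κ
       lem = solve-∀ ringℚ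
       μ = simple {n} k
       ½≤μ = half-simple n le
       0<μ : 0ℚ < μ
       0<μ = ℚ.<-≤-trans (ℚ.positive⁻¹ ½) ½≤μ
       p = density G
       0≤p : 0ℚ ≤ p
       0≤p = ℚ.<⇒≤ (ℚ.<-trans 0<γ γ<p)
       μ≤1 : μ ≤ 1ℚ
       μ≤1 = Probability.≤-const (power-prob (unif-prob n) k) 1ℚ (λ xs → 𝟙-≤1 (ofSize k (toSet xs)))
       dense : η ≤ mean {n} k G
       dense = subst (η ≤_) (sym (mean-density k 0<μ G)) (*-mono (ℚ.<⇒≤ (ℚ.positive⁻¹ ½)) 0≤p (ℚ.<⇒≤ γ<p) ½≤μ)
       sparse : η ≤ 1ℚ - mean {n} k G
       sparse = subst (λ z → η ≤ 1ℚ - z) (sym (mean-density k 0<μ G)) (≤-by {η} ((1ℚ - γ - p) + p * (1ℚ - μ) + γ * ½)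
         (+-nonneg (+-nonneg (0≤q-p (ℚ.<⇒≤ p<1-γ)) (*-nonneg 0≤p (0≤q-p μ≤1))) (ℚ.<⇒≤ 0<η)) (lem₂ γ p μ))
         where
         lem₂ : ∀ γ p μ → 1ℚ - p * μ ≡ γ * ½ + ((1ℚ - γ - p) + p * (1ℚ - μ) + γ * ½)
         lem₂ = solve-∀ ringℚ
       small : ¬ Found → ∀ r′ s′ → r′ ℕ.+ s′ ≡ r₀ ℕ.+ g → r₀ ℕ.≤ r′ → bias (λ e → 𝟙 (edge G e)) r′ s′ ≤ 2ℚ * κ
       small none r′ s′ eq r₀≤r′ = subst₂ (λ r s → bias (λ e → 𝟙 (edge G e)) r s ≤ 2ℚ * κ) r≡ s≡
         (ℚ.<⇒≤ (ℚ.≰⇒> (λ le → none (s , le))))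
         where
         s′≤g : s′ ℕ.≤ g
         s′≤g = ℕ.+-cancelˡ-≤ r₀ s′ g (ℕ.≤-trans (ℕ.+-monoˡ-≤ s′ r₀≤r′) (ℕ.≤-reflexive eq))
         s = fromℕ< (s≤s s′≤g)
         s≡ : toℕ s ≡ s′
         s≡ = Fin.toℕ-fromℕ< (s≤s s′≤g)
         r≡ : suc (order s) ≡ r′
         r≡ = ℕ.+-cancelʳ-≡ (toℕ s) (suc (order s)) r′ (trans (order+ s) (trans (sym (trans eq r₀+g)) (cong (r′ ℕ.+_) (sym s≡))))
       impossible : ¬ Found → ⊥
       impossible none = supersaturation em only r₀+g 0<r₀ ramseyM (edge G) η (ℚ.<⇒≤ 0<η) dense sparse
         (ℚ.≤-<-trans (ℚ.≤-trans (*-monoˡ T (ℚ.<⇒≤ (threshold-pos em only r₀+g 0<r₀ ramseyM))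
           (oscillation-≤ (λ e → 𝟙 (edge G e)) (2ℚ * κ) g (*-nonneg 0≤2 (inv-nonneg (suc n₁))) g r₀ ℕ.≤-refl (small none)))
           (ℚ.≤-reflexive (lem T κ ((1ℚ + 2ℚ * ι g) ^ g)))) Aκ<ε)
       decide : Dec Found → Found
       decide (yes found) = found
       decide (no none)   = ⊥-elim (impossible none)

     private
       Large : ℕ → ℕ → ℕ → ℚ → ℕ → Set
       Large l q s c n₀ = ∀ n → n₀ ℕ.≤ suc n → ∀ (G H : Hypergraph (suc n) l) →
         2ℚ * κ ≤ bias (λ e → 𝟙 (edge G e)) (suc q) s → 2ℚ * κ ≤ bias (λ e → 𝟙 (edge H e)) (suc q) s →
         ∀ d → 0ℚ ≤ d → IsDisc G H d → c * c * ι (suc n) ^ suc l ≤ d * d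

       -- The uniformity l is kept variable so that the equation can be matched with `refl`.
       large : ∀ {l} q s → suc q ℕ.+ s ≡ l → ∃[ c ] 0ℚ < c × ∃[ n₀ ] Large l q s c n₀
       large q s refl = largeDiscrepancy q s κ (inv-pos n₁)

       constants : ∀ s → ∃[ c ] 0ℚ < c × ∃[ n₀ ] Large k (order s) (toℕ s) c n₀
       constants s = large (order s) (toℕ s) (order+ s)

       least = positive-bound (λ s → proj₁ (constants s)) (λ s → proj₁ (proj₂ (constants s)))
       greatest = upper-bound (λ s → proj₁ (proj₂ (proj₂ (constants s))))

     discrepant-pair : ∃[ c ] 0ℚ < c × ∃[ n₀ ] ∀ n → n₀ ℕ.≤ n → (G : Fin (g ℕ.+ 2) → Hypergraph n k) →
       (∀ i → γ < density (G i) × density (G i) < 1ℚ - γ) →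
       ∃[ i ] ∃[ j ] i ≢ j × ∃[ d ] IsDisc (G i) (G j) d × c * c * ℕ→ℚ (n ℕ.^ (k ℕ.+ 1)) ≤ d * d
     discrepant-pair = proj₁ least , proj₁ (proj₂ least) , suc (n₂ ℕ.⊔ proj₁ greatest) , pair
       where
       c = proj₁ least
       pair : ∀ n → suc (n₂ ℕ.⊔ proj₁ greatest) ℕ.≤ n → (G : Fin (g ℕ.+ 2) → Hypergraph n k) →
         (∀ i → γ < density (G i) × density (G i) < 1ℚ - γ) →
         ∃[ i ] ∃[ j ] i ≢ j × ∃[ d ] IsDisc (G i) (G j) d × c * c * ℕ→ℚ (n ℕ.^ (k ℕ.+ 1)) ≤ d * d
       pair (suc n) le G inRange = i , j , Fin.<⇒≢ i<j , d , isDisc , (begin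
         c * c * ℕ→ℚ (suc n ℕ.^ (k ℕ.+ 1))
           ≡⟨ cong (c * c *_) (trans (sym (ι≡ (suc n ℕ.^ (k ℕ.+ 1)))) (trans (cong (λ l → ι (suc n ℕ.^ l)) (ℕ.+-comm k 1)) (ι-^ (suc n) (suc k)))) ⟩
         c * c * ι (suc n) ^ suc k
           ≤⟨ *-monoʳ _ (^-nonneg (suc k) (ι-nonneg (suc n))) (*-mono (ℚ.<⇒≤ (proj₁ (proj₂ least))) (ℚ.<⇒≤ (proj₁ (proj₂ (constants s)))) (proj₂ (proj₂ least) s) (proj₂ (proj₂ least) s)) ⟩
         cₛ * cₛ * ι (suc n) ^ suc k
           ≤⟨ proj₂ (proj₂ (proj₂ (constants s))) n (ℕ.≤-trans (proj₂ greatest s) (ℕ.≤-trans (ℕ.m≤n⊔m n₂ (proj₁ greatest)) big)) (G i) (G j)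
                (proj₂ (order-of i)) (subst (λ s → 2ℚ * κ ≤ bias (λ e → 𝟙 (edge (G j) e)) (suc (order s)) (toℕ s)) (sym same) (proj₂ (order-of j))) d 0≤d isDisc ⟩
         d * d ∎)
         where
         open ℚ.≤-Reasoning
         big : n₂ ℕ.⊔ proj₁ greatest ℕ.≤ suc n
         big = ℕ.≤-trans (ℕ.n≤1+n _) le
         order-of : ∀ i → ∃[ s ] 2ℚ * κ ≤ bias (λ e → 𝟙 (edge (G i) e)) (suc (order s)) (toℕ s)
         order-of i = biased-order n (ℕ.≤-trans (ℕ.m≤m⊔n n₂ (proj₁ greatest)) big) (G i) (proj₁ (inRange i)) (proj₂ (inRange i))
         collision = Fin.pigeonhole (subst (suc g ℕ.<_) (ℕ.+-comm 2 g) (ℕ.n<1+n (suc g))) (λ i → proj₁ (order-of i))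
         i = proj₁ collision
         j = proj₁ (proj₂ collision)
         i<j = proj₁ (proj₂ (proj₂ collision))
         same : proj₁ (order-of i) ≡ proj₁ (order-of j)
         same = proj₂ (proj₂ (proj₂ collision))
         s = proj₁ (order-of i)
         cₛ = proj₁ (constants s)
         disc = disc-exists em (G i) (G j)
         d = proj₁ disc
         0≤d = proj₁ (proj₂ disc)
         isDisc = proj₂ (proj₂ disc)

   upper : HasDiscrepantPair k (g ℕ.+ 2)
   upper γ 0<γ _ = discrepant-pair γ 0<γ

-- The sets meeting every colour, as a function of low degree.

module Colours where

 open Density using (ofSize-true)
 open Measures
 open Permutations using (Distinct; ∣toSet∣)
 open Rationals
 open Subsets
 open import Data.Bool using (_∧_)
 open import Data.Fin.Permutation using (inverseˡ; inverseʳ)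
 open import Data.Fin.Subset using (∣_∣)
 open import Data.Rational using (_*_; _≤_)
 open import Data.Vec using (lookup; tabulate)
 open import Relation.Nullary using (_×-dec_)

 ⊆⇒∣∣≤ : ∀ {n} (A B : Subset n) → (∀ v → lookup A v ≡ true → lookup B v ≡ true) → ∣ A ∣ ℕ.≤ ∣ B ∣
 ⊆⇒∣∣≤ A B h = ι-cancel-≤ (subst₂ _≤_ (sym (ι∣∣ A)) (sym (ι∣∣ B)) (sum-mono _ _ bound))
   where
   bound : ∀ v → 𝟙 (lookup A v) ≤ 𝟙 (lookup B v)
   bound v with lookup A v in eq
   ... | true  = ℚ.≤-reflexive (cong 𝟙 (sym (h v eq)))
   ... | false = 𝟙-nonneg (lookup B v)

 ∈-tabulate : ∀ {n l} (s : Fin l → Fin n) i → lookup (toSet (tabulate s)) (s i) ≡ true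
 ∈-tabulate s zero    = lookup-ins (s zero) _
 ∈-tabulate s (suc i) = lookup-ins-mono (s zero) _ (s (suc i)) (∈-tabulate (λ i → s (suc i)) i)

 tabulate-∈ : ∀ {n l} (s : Fin l → Fin n) v → lookup (toSet (tabulate s)) v ≡ true → ∃[ i ] s i ≡ v
 tabulate-∈ {l = zero}  s v h = ⊥-elim (true≢false h (lookup-∅ v))
 tabulate-∈ {l = suc l} s v h with s zero Fin.≟ v
 ... | yes e = zero , e
 ... | no ne with tabulate-∈ (λ i → s (suc i)) v (trans (sym (lookup-ins-≢ _ ne)) h)
 ...   | i , e = suc i , e

 distinct-tabulate : ∀ {n l} (s : Fin l → Fin n) → (∀ {i j} → s i ≡ s j → i ≡ j) → Distinct (tabulate s)
 distinct-tabulate {l = zero}  s inj = tt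
 distinct-tabulate {l = suc l} s inj = fresh , distinct-tabulate (λ i → s (suc i)) (λ e → Fin.suc-injective (inj e))
   where
   fresh : lookup (toSet (tabulate (λ i → s (suc i)))) (s zero) ≡ false
   fresh with lookup (toSet (tabulate (λ i → s (suc i)))) (s zero) in eq
   ... | false = refl
   ... | true with tabulate-∈ (λ i → s (suc i)) (s zero) eq
   ...   | i , e with inj e
   ...     | ()

 module _ {n q : ℕ} (κ : Fin n → Fin q) where

   Full : Subset n → Set
   Full e = ∀ j → ∃[ v ] lookup e v ≡ true × κ v ≡ j

   full? : ∀ e → Dec (Full e)
   full? e = Fin.all? (λ j → Fin.any? (λ v → (lookup e v Bool.≟ true) ×-dec (κ v Fin.≟ j)))

   full : Subset n → Bool
   full e = does (full? e)

   full⇒q≤∣∣ : ∀ e → Full e → q ℕ.≤ ∣ e ∣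
   full⇒q≤∣∣ e f = subst (ℕ._≤ ∣ e ∣) (∣toSet∣ (tabulate s) (distinct-tabulate s s-injective))
     (⊆⇒∣∣≤ (toSet (tabulate s)) e (λ v h → let i , eq = tabulate-∈ s v h in subst (λ v → lookup e v ≡ true) eq (proj₁ (proj₂ (f i)))))
     where
     s : Fin q → Fin n
     s j = proj₁ (f j)
     s-injective : ∀ {i j} → s i ≡ s j → i ≡ j
     s-injective {i} {j} eq = trans (sym (proj₂ (proj₂ (f i)))) (trans (cong κ eq) (proj₂ (proj₂ (f j))))

   -- One vertex of each colour accounts for q of the q + 1 vertices; the vertex left over shares
   -- its colour with a chosen one.
   repeated-colour : ∀ e → Full e → ∣ e ∣ ≡ suc q →
     ∃[ u ] ∃[ u′ ] ¬ u ≡ u′ × lookup e u ≡ true × lookup e u′ ≡ true × κ u ≡ κ u′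
   repeated-colour e f size with Fin.any? (λ v → (lookup e v Bool.≟ true) ×-dec (lookup (toSet (tabulate (λ j → proj₁ (f j)))) v Bool.≟ false))
   ... | yes (u′ , ∈e , ∉A) = s (κ u′) , u′ , (λ { eq → true≢false (subst (λ v → lookup A v ≡ true) eq (∈-tabulate s (κ u′))) ∉A }) ,
         proj₁ (proj₂ (f (κ u′))) , ∈e , proj₂ (proj₂ (f (κ u′)))
     where
     s = λ j → proj₁ (f j)
     A = toSet (tabulate s)
   ... | no none = ⊥-elim (ℕ.<-irrefl refl (ℕ.≤-trans (ℕ.≤-reflexive (sym size)) (ℕ.≤-trans (⊆⇒∣∣≤ e A inside) (∣toSet∣≤ (tabulate s)))))
     where
     s = λ j → proj₁ (f j)
     A = toSet (tabulate s)
     inside : ∀ v → lookup e v ≡ true → lookup A v ≡ true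
     inside v h with lookup A v in eq
     ... | true  = refl
     ... | false = ⊥-elim (none (v , h , eq))

   full-del : ∀ e u u′ → ¬ u ≡ u′ → lookup e u′ ≡ true → κ u ≡ κ u′ → Full e → Full (del u e)
   full-del e u u′ ne ∈e same f j with u Fin.≟ proj₁ (f j)
   ... | yes refl = u′ , trans (lookup-del-≢ e ne) ∈e , trans (sym same) (proj₂ (proj₂ (f j)))
   ... | no ne′   = proj₁ (f j) , trans (lookup-del-≢ e ne′) (proj₁ (proj₂ (f j))) , proj₂ (proj₂ (f j))

   del-full : ∀ e v → Full (del v e) → Full e
   del-full e v f j with f j
   ... | u , ∈del , c with v Fin.≟ u
   ...   | yes refl = ⊥-elim (true≢false ∈del (lookup-del v e))
   ...   | no ne    = u , trans (sym (lookup-del-≢ e ne)) ∈del , c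

   private
     rainbow : Subset n → Bool
     rainbow T = ofSize q T ∧ full T

     same-size : ∀ (e : Subset n) v → lookup e v ≡ true → ofSize q (del v e) ≡ ofSize (suc q) e
     same-size e v h = cong (ℕ._≡ᵇ suc q) (sym (∣del∣ v e h))

   -- In a full set of q+1 vertices exactly two share a colour, and removing
   -- either of these leaves a full set.
   full-degree : ∀ e → ι 2 * 𝟙 (ofSize {n} (suc q) e ∧ full e) ≡ sum {n} (λ v → 𝟙 (lookup e v) * 𝟙 (ofSize {n} q (del v e) ∧ full (del v e)))
   full-degree e with ∣ e ∣ ℕ.≟ suc q | full? e
   ... | no ne | f = trans (trans (cong (λ b → ι 2 * 𝟙 (b ∧ full e)) wrong) (ℚ.*-zeroʳ (ι 2))) (sym (trans (sum-cong none) (trans (sum-const n 0ℚ) (ℚ.*-zeroʳ (ι n)))))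
     where
     wrong : ofSize (suc q) e ≡ false
     wrong with ofSize (suc q) e in eq
     ... | false = refl
     ... | true  = ⊥-elim (ne (ℕ.≡ᵇ⇒≡ ∣ e ∣ (suc q) (subst Bool.T (sym eq) tt)))
     none : ∀ v → 𝟙 (lookup e v) * 𝟙 (rainbow (del v e)) ≡ 0ℚ
     none v with lookup e v in eq
     ... | false = ℚ.*-zeroˡ (𝟙 (rainbow (del v e)))
     ... | true  = trans (ℚ.*-identityˡ (𝟙 (rainbow (del v e)))) (cong (λ b → 𝟙 (b ∧ full (del v e))) (trans (same-size e v eq) wrong))
   ... | yes size | no nf = trans (trans (cong (λ b → ι 2 * 𝟙 b) (trans (cong (ofSize (suc q) e ∧_) (dec-false (full? e) nf)) (Bool.∧-zeroʳ (ofSize (suc q) e)))) (ℚ.*-zeroʳ (ι 2))) (sym (trans (sum-cong none) (trans (sum-const n 0ℚ) (ℚ.*-zeroʳ (ι n)))))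
     where
     none : ∀ v → 𝟙 (lookup e v) * 𝟙 (rainbow (del v e)) ≡ 0ℚ
     none v = trans (cong (λ b → 𝟙 (lookup e v) * 𝟙 (ofSize q (del v e) ∧ b)) (dec-false (full? (del v e)) (λ f → nf (del-full e v f))))
       (trans (cong (λ b → 𝟙 (lookup e v) * 𝟙 b) (Bool.∧-zeroʳ (ofSize q (del v e)))) (ℚ.*-zeroʳ (𝟙 (lookup e v))))
   ... | yes size | yes f with repeated-colour e f size
   ...   | u , u′ , ne , ∈u , ∈u′ , same = trans (trans (cong₂ (λ a b → ι 2 * 𝟙 (a ∧ b)) right (dec-true (full? e) f)) (ℚ.*-identityʳ (ι 2)))
         (sym (trans (sum-cong each) (trans (sym (ι∣∣ pair)) (cong ι ∣pair∣))))
     where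
     right : ofSize (suc q) e ≡ true
     right = ofSize-true e size
     pair : Subset n
     pair = ins u (ins u′ ∅)
     ∣pair∣ : ∣ pair ∣ ≡ 2
     ∣pair∣ = trans (∣ins∣ u (ins u′ ∅) (trans (lookup-ins-≢ ∅ (λ e → ne (sym e))) (lookup-∅ u))) (cong suc (trans (∣ins∣ u′ ∅ (lookup-∅ u′)) (cong suc (∣∅∣ n))))
     removable : ∀ v → lookup e v ≡ true → Full (del v e) → lookup pair v ≡ true → 𝟙 (lookup e v) * 𝟙 (rainbow (del v e)) ≡ 𝟙 (lookup pair v)
     removable v h f′ p = trans (cong₂ (λ a b → 𝟙 a * 𝟙 b) h (cong₂ _∧_ (trans (same-size e v h) right) (dec-true (full? (del v e)) f′))) (cong 𝟙 (sym p))
     each : ∀ v → 𝟙 (lookup e v) * 𝟙 (rainbow (del v e)) ≡ 𝟙 (lookup pair v)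
     each v with u Fin.≟ v | u′ Fin.≟ v
     ... | yes refl | _ = removable u ∈u (full-del e u u′ ne ∈u′ same f) (lookup-ins u (ins u′ ∅))
     ... | no _ | yes refl = removable u′ ∈u′ (full-del e u′ u (λ e → ne (sym e)) ∈u (sym same) f) (lookup-ins-mono u (ins u′ ∅) u′ (lookup-ins u′ ∅))
     ... | no n₁ | no n₂ with lookup e v in eq
     ...   | false = trans (ℚ.*-zeroˡ (𝟙 (rainbow (del v e)))) (cong 𝟙 (sym out))
       where
       out : lookup pair v ≡ false
       out = trans (lookup-ins-≢ (ins u′ ∅) n₁) (trans (lookup-ins-≢ ∅ n₂) (lookup-∅ v))
     ...   | true = trans (ℚ.*-identityˡ (𝟙 (rainbow (del v e)))) (trans (cong (λ b → 𝟙 (ofSize q (del v e) ∧ b)) (dec-false (full? (del v e)) absurd))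
               (trans (cong 𝟙 (Bool.∧-zeroʳ (ofSize q (del v e)))) (cong 𝟙 (sym out))))
       where
       out : lookup pair v ≡ false
       out = trans (lookup-ins-≢ (ins u′ ∅) n₁) (trans (lookup-ins-≢ ∅ n₂) (lookup-∅ v))
       -- If a third vertex v could be removed, u could be removed as well, and q - 1 vertices would
       -- meet q colours.
       absurd : ¬ Full (del v e)
       absurd f′ = ℕ.<-irrefl refl (ℕ.≤-trans (ℕ.s≤s (full⇒q≤∣∣ (del u (del v e)) (full-del (del v e) u u′ ne (trans (lookup-del-≢ e (λ e → n₂ (sym e))) ∈u′) same f′)))
         (ℕ.≤-reflexive (trans (sym (∣del∣ u (del v e) (trans (lookup-del-≢ e (λ e → n₁ (sym e))) ∈u))) (ℕ.suc-injective (trans (sym (∣del∣ v e eq)) size)))))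

 -- The counterpart of `full-degree` for all (q+1)-sets, in which every vertex can be removed; it
 -- serves to count the edges of the signed hypergraph.
 size-degree : ∀ {n} q (e : Subset n) → ι (suc q) * 𝟙 (ofSize (suc q) e) ≡ sum (λ v → 𝟙 (lookup e v) * 𝟙 (ofSize q (del v e)))
 size-degree {n} q e = sym (trans (sum-cong each) (trans (sum-*ˡ {n} (𝟙 (ofSize (suc q) e)) (λ v → 𝟙 (lookup e v))) (trans (cong (𝟙 (ofSize (suc q) e) *_) (sym (ι∣∣ e))) total-size)))
   where
   each : ∀ v → 𝟙 (lookup e v) * 𝟙 (ofSize q (del v e)) ≡ 𝟙 (ofSize (suc q) e) * 𝟙 (lookup e v)
   each v with lookup e v in eq
   ... | false = trans (ℚ.*-zeroˡ (𝟙 (ofSize q (del v e)))) (sym (ℚ.*-zeroʳ (𝟙 (ofSize (suc q) e))))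
   ... | true  = trans (ℚ.*-comm 1ℚ (𝟙 (ofSize q (del v e)))) (cong (λ s → 𝟙 (s ℕ.≡ᵇ suc q) * 1ℚ) (sym (∣del∣ v e eq)))
   total-size : 𝟙 (ofSize (suc q) e) * ι ∣ e ∣ ≡ ι (suc q) * 𝟙 (ofSize (suc q) e)
   total-size with ofSize (suc q) e in eq
   ... | false = trans (ℚ.*-zeroˡ (ι ∣ e ∣)) (sym (ℚ.*-zeroʳ (ι (suc q))))
   ... | true  = trans (ℚ.*-comm 1ℚ (ι ∣ e ∣)) (cong (λ s → ι s * 1ℚ) (ℕ.≡ᵇ⇒≡ ∣ e ∣ (suc q) (subst Bool.T (sym eq) tt)))

 full-image : ∀ {n q} (κ : Fin n → Fin q) (π : Permutation′ n) e → full κ (image π e) ≡ full (λ v → κ (π ⟨$⟩ʳ v)) e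
 full-image κ π e with full? (λ v → κ (π ⟨$⟩ʳ v)) e
 ... | yes f = trans (dec-true (full? κ (image π e)) (λ j → let v , h , c = f j in π ⟨$⟩ʳ v , trans (lookup-image π e (π ⟨$⟩ʳ v)) (trans (cong (lookup e) (inverseˡ π)) h) , c))
   (sym (dec-true (full? (λ v → κ (π ⟨$⟩ʳ v)) e) f))
 ... | no nf = trans (dec-false (full? κ (image π e)) (λ f → nf (λ j → let v , h , c = f j in π ⟨$⟩ˡ v , trans (sym (lookup-image π e v)) h , trans (cong κ (inverseʳ π)) c)))
   (sym (dec-false (full? (λ v → κ (π ⟨$⟩ʳ v)) e) nf))

 full-cong : ∀ {n q} {κ κ′ : Fin n → Fin q} → (∀ v → κ v ≡ κ′ v) → ∀ e → full κ e ≡ full κ′ e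
 full-cong {κ = κ} {κ′} h e with full? κ′ e
 ... | yes f = trans (dec-true (full? κ e) (λ j → let v , m , c = f j in v , m , trans (h v) c)) (sym (dec-true (full? κ′ e) f))
 ... | no nf = trans (dec-false (full? κ e) (λ f → nf (λ j → let v , m , c = f j in v , m , trans (sym (h v)) c))) (sym (dec-false (full? κ′ e) nf))

-- Signs nearly balanced against many tests.

module Signs where

 open Cubes using (sg)
 open Measures
 open Rationals
 open Subsets
 open Probability
 open import Data.Bool using (not; _∧_; _xor_; if_then_else_)
 open import Data.Rational using (_+_; _*_; _-_; -_; _≤_; _<_; ∣_∣)
 open Degrees using (2ℚ; 0≤2)

 count : ∀ n → (Subset n → Bool) → ℕ
 count zero    p = if p [] then 1 else 0
 count (suc n) p = count n (λ e → p (false ∷ e)) ℕ.+ count n (λ e → p (true ∷ e))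

 ι-count : ∀ n p → ι (count n p) ≡ ∫ (counting n) (λ e → 𝟙 (p e))
 ι-count zero p with p [] in eq
 ... | true  = trans ι-1 (sym (trans (∫-counting-[] (λ e → 𝟙 (p e))) (cong 𝟙 eq)))
 ... | false = trans ι-0 (sym (trans (∫-counting-[] (λ e → 𝟙 (p e))) (cong 𝟙 eq)))
 ι-count (suc n) p = trans (ι-+ (count n (λ e → p (false ∷ e))) _) (trans (cong₂ _+_ (ι-count n _) (ι-count n _)) (sym (∫-counting n (λ e → 𝟙 (p e)))))

 ∏ : ∀ n → (Subset n → ℚ) → ℚ
 ∏ zero    F = F []
 ∏ (suc n) F = ∏ n (λ e → F (false ∷ e)) * ∏ n (λ e → F (true ∷ e))

 ∏-cong : ∀ n {F G : Subset n → ℚ} → (∀ e → F e ≡ G e) → ∏ n F ≡ ∏ n G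
 ∏-cong zero    h = h []
 ∏-cong (suc n) h = cong₂ _*_ (∏-cong n (λ e → h (false ∷ e))) (∏-cong n (λ e → h (true ∷ e)))

 ∏-count : ∀ n x y (p r : Subset n → Bool) → ∏ n (λ e → (if p e then x else 1ℚ) * (if r e then y else 1ℚ)) ≡ x ^ count n p * y ^ count n r
 ∏-count zero x y p r = cong₂ _*_ (one x (p [])) (one y (r []))
   where
   one : ∀ x b → (if b then x else 1ℚ) ≡ x ^ (if b then 1 else 0)
   one x true  = sym (ℚ.*-identityʳ x)
   one x false = refl
 ∏-count (suc n) x y p r = trans (cong₂ _*_ (∏-count n x y (λ e → p (false ∷ e)) (λ e → r (false ∷ e))) (∏-count n x y (λ e → p (true ∷ e)) (λ e → r (true ∷ e))))
   (trans (lem (x ^ a) (y ^ b) (x ^ c) (y ^ d)) (cong₂ _*_ (sym (^-+ x a c)) (sym (^-+ y b d))))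
   where
   a = count n (λ e → p (false ∷ e))
   b = count n (λ e → r (false ∷ e))
   c = count n (λ e → p (true ∷ e))
   d = count n (λ e → r (true ∷ e))
   lem : ∀ x y z w → x * y * (z * w) ≡ x * z * (y * w)
   lem = solve-∀ ringℚ

 -- The method of conditional expectations.
 chooseSigns : ∀ {A : Set} (L : Measure A) n (f : A → Subset n → ℚ) (W : A → ℚ) →
   Σ[ h ∈ (Subset n → Bool) ] ∫ L (λ t → W t * ∏ n (λ e → 1ℚ + sg (h e) * f t e)) ≤ ∫ L W
 chooseSigns L zero f W with ℚ.≤-total (∫ L (λ t → W t * f t [])) 0ℚ
 ... | inj₁ le = (λ _ → false) , ℚ.≤-trans (ℚ.≤-reflexive (trans (∫-cong L (λ t → lem (W t) (f t []))) (∫-+ L W (λ t → W t * f t []))))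
       (ℚ.≤-trans (ℚ.+-monoʳ-≤ (∫ L W) le) (ℚ.≤-reflexive (ℚ.+-identityʳ (∫ L W))))
   where
   lem : ∀ w x → w * (1ℚ + 1ℚ * x) ≡ w + w * x
   lem = solve-∀ ringℚ
 ... | inj₂ ge = (λ _ → true) , ℚ.≤-trans (ℚ.≤-reflexive (trans (∫-cong L (λ t → lem (W t) (f t []))) (∫-- L W (λ t → W t * f t []))))
       (≤-by (∫ L (λ t → W t * f t [])) ge (lem₂ (∫ L W) (∫ L (λ t → W t * f t []))))
   where
   lem : ∀ w x → w * (1ℚ + (- 1ℚ) * x) ≡ w - w * x
   lem = solve-∀ ringℚ
   lem₂ : ∀ a b → a ≡ a - b + b
   lem₂ = solve-∀ ringℚ
 chooseSigns L (suc n) f W with chooseSigns L n (λ t e → f t (false ∷ e)) W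
 -- The factors of the half already treated become part of the weight for the other half.
 ... | h₀ , le₀ with chooseSigns L n (λ t e → f t (true ∷ e)) (λ t → W t * ∏ n (λ e → 1ℚ + sg (h₀ e) * f t (false ∷ e)))
 ...   | h₁ , le₁ = h , ℚ.≤-trans (ℚ.≤-reflexive (∫-cong L (λ t → sym (ℚ.*-assoc (W t) (∏ n (λ e → 1ℚ + sg (h₀ e) * f t (false ∷ e))) (∏ n (λ e → 1ℚ + sg (h₁ e) * f t (true ∷ e))))))) (ℚ.≤-trans le₁ le₀)
   where
   h : Subset (suc n) → Bool
   h (false ∷ e) = h₀ e
   h (true  ∷ e) = h₁ e

 bernoulli : ∀ x → 0ℚ ≤ 1ℚ + x → ∀ m → 1ℚ + ι m * x ≤ (1ℚ + x) ^ m
 bernoulli x h zero    = ℚ.≤-reflexive (trans (cong (λ z → 1ℚ + z * x) ι-0) (lem x))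
   where
   lem : ∀ x → 1ℚ + 0ℚ * x ≡ 1ℚ
   lem = solve-∀ ringℚ
 bernoulli x h (suc m) = ℚ.≤-trans (≤-by (ι m * (x * x)) (*-nonneg (ι-nonneg m) (square-nonneg x)) (trans (lem (ι m) x) (cong (λ z → 1ℚ + z * x + ι m * (x * x)) (sym (ι-suc m)))))
   (*-monoˡ (1ℚ + x) h (bernoulli x h m))
   where
   lem : ∀ m x → (1ℚ + x) * (1ℚ + m * x) ≡ 1ℚ + (1ℚ + m) * x + m * (x * x)
   lem = solve-∀ ringℚ

 m≤2^m : ∀ m → m ℕ.≤ 2 ℕ.^ m
 m≤2^m zero    = z≤n
 m≤2^m (suc m) = ℕ.≤-trans (ℕ.+-mono-≤ (ℕ.m^n>0 2 m) (m≤2^m m)) (ℕ.≤-reflexive (cong (2 ℕ.^ m ℕ.+_) (sym (ℕ.+-identityʳ (2 ℕ.^ m)))))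

 ^-≤-^ : ∀ {p m n} → 1ℚ ≤ p → m ℕ.≤ n → p ^ m ≤ p ^ n
 ^-≤-^ {p} {m} {n} 1≤p m≤n = subst₂ _≤_ (ℚ.*-identityʳ (p ^ m)) (trans (sym (^-+ p m (n ℕ.∸ m))) (cong (p ^_) (ℕ.m+[n∸m]≡n m≤n)))
   (*-monoˡ (p ^ m) (^-nonneg m (ℚ.≤-trans 0≤1 1≤p)) (^-≥1 (n ℕ.∸ m) 1≤p))

 ^-≥-^ : ∀ {p m n} → 0ℚ ≤ p → p ≤ 1ℚ → m ℕ.≤ n → p ^ n ≤ p ^ m
 ^-≥-^ {p} {m} {n} 0≤p p≤1 m≤n = subst₂ _≤_ (trans (sym (^-+ p m (n ℕ.∸ m))) (cong (p ^_) (ℕ.m+[n∸m]≡n m≤n))) (ℚ.*-identityʳ (p ^ m))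
   (*-monoˡ (p ^ m) (^-nonneg m 0≤p) (^-≤1 (n ℕ.∸ m) 0≤p p≤1))

 ι-2^ : ∀ n → ι (2 ℕ.^ n) ≡ 2ℚ ^ n
 ι-2^ n = trans (ι-^ 2 n) (cong (_^ n) (trans (ι-suc 1) (cong (1ℚ +_) ι-1)))

 module Drift (D′ : ℕ) where

   D : ℕ
   D = suc D′

   -- For δ = 1 / (2D), Bernoulli's inequality gives (1 + δ)^(2D) ≥ 2 and (1 - δ²)^(D²) ≥ 1/2. These
   -- two facts take the place of exponentials and logarithms.
   δ : ℚ
   δ = inv (2 ℕ.* D)

   private
     0≤δ : 0ℚ ≤ δ
     0≤δ = inv-nonneg (2 ℕ.* D)

     2Dδ : ι (2 ℕ.* D) * δ ≡ 1ℚ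
     2Dδ = ι*inv (D′ ℕ.+ suc (D′ ℕ.+ 0))

     ι2≡ : ι 2 ≡ 2ℚ
     ι2≡ = trans (ι-suc 1) (cong (1ℚ +_) ι-1)

     δ² : ι (D ℕ.* D) * (δ * δ) ≡ ½ * ½
     δ² = trans (cong (_* (δ * δ)) (ι-* D D)) (trans (lem (ι D) δ) (trans (cong (λ z → ½ * ½ * (z * z)) (trans (cong (_* δ) (trans (cong (_* ι D) (sym ι2≡)) (sym (ι-* 2 D)))) 2Dδ)) refl))
       where
       lem : ∀ d δ → d * d * (δ * δ) ≡ ½ * ½ * ((1ℚ + 1ℚ) * d * δ * ((1ℚ + 1ℚ) * d * δ))
       lem = solve-∀ ringℚ

     δ²≤ : δ * δ ≤ ½ * ½
     δ²≤ = subst (δ * δ ≤_) δ² (subst (_≤ ι (D ℕ.* D) * (δ * δ)) (ℚ.*-identityˡ (δ * δ))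
       (*-monoʳ (δ * δ) (square-nonneg δ) (subst (_≤ ι (D ℕ.* D)) ι-1 (ι-mono (s≤s z≤n)))))

     up : 2ℚ ≤ (1ℚ + δ) ^ (2 ℕ.* D)
     up = subst (λ z → 1ℚ + z ≤ (1ℚ + δ) ^ (2 ℕ.* D)) 2Dδ (bernoulli δ (+-nonneg 0≤1 0≤δ) (2 ℕ.* D))

     0≤1-δ² : 0ℚ ≤ 1ℚ - δ * δ
     0≤1-δ² = 0≤q-p (ℚ.≤-trans δ²≤ (≤-by {½ * ½} (½ + ½ * ½) (ℚ.nonNegative⁻¹ _) refl))

     down : ½ ≤ (1ℚ - δ * δ) ^ (D ℕ.* D)
     down = ℚ.≤-trans (≤-by {½} (½ * ½) (ℚ.nonNegative⁻¹ _) (trans (lem (ι (D ℕ.* D)) (δ * δ)) (cong (λ z → 1ℚ - z) δ²)))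
       (bernoulli (- (δ * δ)) 0≤1-δ² (D ℕ.* D))
       where
       lem : ∀ d x → 1ℚ + d * (- x) ≡ 1ℚ - d * x
       lem = solve-∀ ringℚ

   δ≤1 : δ ≤ 1ℚ
   δ≤1 = subst (δ ≤_) 2Dδ (subst (_≤ ι (2 ℕ.* D) * δ) (ℚ.*-identityˡ δ) (*-monoʳ δ 0≤δ (subst (_≤ ι (2 ℕ.* D)) ι-1 (ι-mono (s≤s z≤n)))))

   -- If P were larger, a surplus of 2D(E + 1 + t) factors 1 + δ would give 2^(E+1+t), while the M
   -- pairs of factors (1 + δ)(1 - δ) lose at most 2^t; the product would reach 2^(E+1).
   drift : ∀ P M E t → M ℕ.≤ D ℕ.* D ℕ.* t → (1ℚ + δ) ^ P * (1ℚ - δ) ^ M ≤ ι (2 ℕ.^ E) → P ℕ.≤ M ℕ.+ 2 ℕ.* D ℕ.* (suc E ℕ.+ t)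
   drift P M E t M≤ h with P ℕ.≤? M ℕ.+ 2 ℕ.* D ℕ.* (suc E ℕ.+ t)
   ... | yes le = le
   ... | no nle = ⊥-elim (ℚ.<-irrefl refl (ℚ.≤-<-trans (ℚ.≤-trans bound h) (subst₂ _<_ (sym (ι-2^ E)) refl power-<-suc)))
     where
     open ℚ.≤-Reasoning
     j = suc E ℕ.+ t
     0<2^E : 0ℚ < 2ℚ ^ E
     0<2^E = ^-pos E (ℚ.<-≤-trans 0<1 (≤-by 1ℚ 0≤1 refl))
     power-<-suc : 2ℚ ^ E < 2ℚ ^ suc E
     power-<-suc = subst₂ _<_ (ℚ.+-identityʳ (2ℚ ^ E)) (lem (2ℚ ^ E)) (ℚ.+-monoʳ-< (2ℚ ^ E) 0<2^E)
       where
       lem : ∀ x → x + x ≡ (1ℚ + 1ℚ) * x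
       lem = solve-∀ ringℚ
     1≤1+δ : 1ℚ ≤ 1ℚ + δ
     1≤1+δ = ≤-by {1ℚ} δ 0≤δ refl
     half : 2ℚ ^ t * ½ ^ t ≡ 1ℚ
     half = trans (sym (^-distrib-* 2ℚ ½ t)) (1^ t)
     lem₁ : ∀ δ → (1ℚ - δ * δ) ≡ (1ℚ + δ) * (1ℚ - δ)
     lem₁ = solve-∀ ringℚ
     lem₂ : ∀ a b c → a * b * c ≡ c * a * b
     lem₂ = solve-∀ ringℚ
     bound : 2ℚ ^ suc E ≤ (1ℚ + δ) ^ P * (1ℚ - δ) ^ M
     bound = begin
       2ℚ ^ suc E
         ≡⟨ trans (sym (ℚ.*-identityʳ (2ℚ ^ suc E))) (trans (cong (2ℚ ^ suc E *_) (sym half)) (trans (sym (ℚ.*-assoc (2ℚ ^ suc E) (2ℚ ^ t) (½ ^ t))) (cong (_* ½ ^ t) (sym (^-+ 2ℚ (suc E) t))))) ⟩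
       2ℚ ^ j * ½ ^ t
         ≤⟨ *-mono (^-nonneg t (ℚ.nonNegative⁻¹ ½)) (^-nonneg j (^-nonneg (2 ℕ.* D) (ℚ.≤-trans 0≤1 1≤1+δ))) (^-mono j 0≤2 up) (^-mono t (ℚ.nonNegative⁻¹ ½) down) ⟩
       ((1ℚ + δ) ^ (2 ℕ.* D)) ^ j * ((1ℚ - δ * δ) ^ (D ℕ.* D)) ^ t
         ≡⟨ cong₂ _*_ (trans (^-^ (1ℚ + δ) (2 ℕ.* D) j) (cong ((1ℚ + δ) ^_) (ℕ.*-comm j (2 ℕ.* D)))) (trans (^-^ (1ℚ - δ * δ) (D ℕ.* D) t) (cong ((1ℚ - δ * δ) ^_) (ℕ.*-comm t (D ℕ.* D)))) ⟩
       (1ℚ + δ) ^ (2 ℕ.* D ℕ.* j) * (1ℚ - δ * δ) ^ (D ℕ.* D ℕ.* t)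
         ≤⟨ *-monoˡ _ (^-nonneg (2 ℕ.* D ℕ.* j) (ℚ.≤-trans 0≤1 1≤1+δ)) (^-≥-^ 0≤1-δ² (≤-by {1ℚ - δ * δ} (δ * δ) (square-nonneg δ) (lem₃ (δ * δ))) M≤) ⟩
       (1ℚ + δ) ^ (2 ℕ.* D ℕ.* j) * (1ℚ - δ * δ) ^ M
         ≡⟨ trans (cong ((1ℚ + δ) ^ (2 ℕ.* D ℕ.* j) *_) (trans (cong (_^ M) (lem₁ δ)) (^-distrib-* (1ℚ + δ) (1ℚ - δ) M))) (lem₄ ((1ℚ + δ) ^ (2 ℕ.* D ℕ.* j)) ((1ℚ + δ) ^ M) ((1ℚ - δ) ^ M)) ⟩
       (1ℚ + δ) ^ M * (1ℚ + δ) ^ (2 ℕ.* D ℕ.* j) * (1ℚ - δ) ^ M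
         ≡⟨ cong (_* (1ℚ - δ) ^ M) (^-+ (1ℚ + δ) M (2 ℕ.* D ℕ.* j)) ⟨
       (1ℚ + δ) ^ (M ℕ.+ 2 ℕ.* D ℕ.* j) * (1ℚ - δ) ^ M
         ≤⟨ *-monoʳ _ (^-nonneg M (0≤q-p δ≤1)) (^-≤-^ 1≤1+δ (ℕ.<⇒≤ (ℕ.≰⇒> nle))) ⟩
       (1ℚ + δ) ^ P * (1ℚ - δ) ^ M ∎
       where
       lem₃ : ∀ x → 1ℚ ≡ 1ℚ - x + x
       lem₃ = solve-∀ ringℚ
       lem₄ : ∀ a b c → a * (b * c) ≡ b * a * c
       lem₄ = solve-∀ ringℚ

 imbalance : ∀ {n} → (Subset n → Bool) → (Subset n → Bool) → ℚ
 imbalance {n} h T = ∫ (counting n) (λ e → sg (h e) * 𝟙 (T e))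

 count-mono : ∀ n {p r : Subset n → Bool} → (∀ e → p e ≡ true → r e ≡ true) → count n p ℕ.≤ count n r
 count-mono n {p} {r} h = ι-cancel-≤ (subst₂ _≤_ (sym (ι-count n p)) (sym (ι-count n r)) (counting-mono n _ _ bound))
   where
   bound : ∀ e → 𝟙 (p e) ≤ 𝟙 (r e)
   bound e with p e in eq
   ... | true  = ℚ.≤-reflexive (cong 𝟙 (sym (h e eq)))
   ... | false = 𝟙-nonneg (r e)

 module _ (D′ q′ l E t : ℕ) where

   open Drift D′

   -- Each signed test has a potential, a product of factors 1 ± δ. Conditional expectations keep
   -- the mean of the potentials at most 1, so each is at most the number of codes of signed tests,
   -- hence at most 2^E; `drift` converts this into a bound on the imbalance.
   balancedSigns : ∀ n (T : Vec (Fin (2 ℕ.+ q′)) l → Subset n → Bool) →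
     (∀ κ → count n (T κ) ℕ.≤ D ℕ.* D ℕ.* t) → (2 ℕ.+ q′) ℕ.^ suc l ℕ.≤ 2 ℕ.^ E →
     Σ[ h ∈ (Subset n → Bool) ] ∀ κ → ∣ imbalance h (T κ) ∣ ≤ ι (2 ℕ.* D ℕ.* (suc E ℕ.+ t))
   balancedSigns n T small tests = h , bounded
     where
     q = 2 ℕ.+ q′
     -- The extra coordinate of a test is the sign of the imbalance.
     L = power (unif q) (suc l)
     side : Fin q → Bool
     side zero    = false
     side (suc _) = true
     f : Vec (Fin q) (suc l) → Subset n → ℚ
     f (a ∷ κ) e = δ * (sg (side a) * 𝟙 (T κ e))
     chosen = chooseSigns L n f (λ _ → 1ℚ)
     h = proj₁ chosen
     product : Vec (Fin q) (suc l) → ℚ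
     product τ = ∏ n (λ e → 1ℚ + sg (h e) * f τ e)
     like unlike : Fin q → Vec (Fin q) l → Subset n → Bool
     like   a κ e = T κ e ∧ not (h e xor side a)
     unlike a κ e = T κ e ∧ (h e xor side a)
     product≡ : ∀ a κ → product (a ∷ κ) ≡ (1ℚ + δ) ^ count n (like a κ) * (1ℚ - δ) ^ count n (unlike a κ)
     product≡ a κ = trans (∏-cong n (λ e → each (T κ e) (h e) (side a))) (∏-count n (1ℚ + δ) (1ℚ - δ) (like a κ) (unlike a κ))
       where
       each : ∀ t h s → 1ℚ + sg h * (δ * (sg s * 𝟙 t)) ≡ (if t ∧ not (h xor s) then 1ℚ + δ else 1ℚ) * (if t ∧ (h xor s) then 1ℚ - δ else 1ℚ)
       each false h s = trans (lem (sg h) δ (sg s)) refl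
         where
         lem : ∀ h δ s → 1ℚ + h * (δ * (s * 0ℚ)) ≡ 1ℚ
         lem = solve-∀ ringℚ
       each true false false = lem δ
         where
         lem : ∀ δ → 1ℚ + 1ℚ * (δ * (1ℚ * 1ℚ)) ≡ (1ℚ + δ) * 1ℚ
         lem = solve-∀ ringℚ
       each true false true = lem δ
         where
         lem : ∀ δ → 1ℚ + 1ℚ * (δ * ((- 1ℚ) * 1ℚ)) ≡ 1ℚ * (1ℚ - δ)
         lem = solve-∀ ringℚ
       each true true false = lem δ
         where
         lem : ∀ δ → 1ℚ + (- 1ℚ) * (δ * (1ℚ * 1ℚ)) ≡ 1ℚ * (1ℚ - δ)
         lem = solve-∀ ringℚ
       each true true true = lem δ
         where
         lem : ∀ δ → 1ℚ + (- 1ℚ) * (δ * ((- 1ℚ) * 1ℚ)) ≡ (1ℚ + δ) * 1ℚ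
         lem = solve-∀ ringℚ
     product-nonneg : ∀ τ → 0ℚ ≤ product τ
     product-nonneg (a ∷ κ) = subst (0ℚ ≤_) (sym (product≡ a κ)) (*-nonneg (^-nonneg (count n (like a κ)) (+-nonneg 0≤1 (inv-nonneg (2 ℕ.* D)))) (^-nonneg (count n (unlike a κ)) (0≤q-p δ≤1)))
     product-≤ : ∀ τ → product τ ≤ ι (2 ℕ.^ E)
     product-≤ τ = begin
       product τ
         ≡⟨ trans (sym (ℚ.*-identityˡ (product τ))) (cong (_* product τ) (sym unit)) ⟩
       ι q ^ suc l * inv q ^ suc l * product τ
         ≡⟨ ℚ.*-assoc (ι q ^ suc l) (inv q ^ suc l) (product τ) ⟩
       ι q ^ suc l * (inv q ^ suc l * product τ)
         ≤⟨ *-mono (*-nonneg (^-nonneg (suc l) (inv-nonneg q)) (product-nonneg τ)) (ι-nonneg (2 ℕ.^ E)) (subst (_≤ ι (2 ℕ.^ E)) (ι-^ q (suc l)) (ι-mono tests))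
              (ℚ.≤-trans (∫-power-point (unif-prob (suc q′)) (inv-nonneg q) (unif-point q) product product-nonneg τ)
                (ℚ.≤-trans (ℚ.≤-reflexive (∫-cong L (λ τ → sym (ℚ.*-identityˡ (product τ))))) (ℚ.≤-trans (proj₂ chosen) (ℚ.≤-reflexive (const (power-prob (unif-prob (suc q′)) (suc l)) 1ℚ))))) ⟩
       ι (2 ℕ.^ E) * 1ℚ
         ≡⟨ ℚ.*-identityʳ (ι (2 ℕ.^ E)) ⟩
       ι (2 ℕ.^ E) ∎
       where
       open ℚ.≤-Reasoning
       unit : ι q ^ suc l * inv q ^ suc l ≡ 1ℚ
       unit = trans (sym (^-distrib-* (ι q) (inv q) (suc l))) (trans (cong (_^ suc l) (ι*inv (suc q′))) (1^ (suc l)))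
     B = 2 ℕ.* D ℕ.* (suc E ℕ.+ t)
     balanced : ∀ a κ → ι (count n (like a κ)) ≤ ι (count n (unlike a κ)) + ι B
     balanced a κ = subst (ι (count n (like a κ)) ≤_) (ι-+ (count n (unlike a κ)) B) (ι-mono (drift (count n (like a κ)) (count n (unlike a κ)) E t
       (ℕ.≤-trans (count-mono n (λ e → ∧-left (T κ e))) (small κ)) (subst (_≤ ι (2 ℕ.^ E)) (product≡ a κ) (product-≤ (a ∷ κ)))))
       where
       ∧-left : ∀ b {c} → b ∧ c ≡ true → b ≡ true
       ∧-left true h = refl
     difference : ∀ a κ → ι (count n (like a κ)) - ι (count n (unlike a κ)) ≡ sg (side a) * imbalance h (T κ)
     difference a κ = trans (cong₂ _-_ (ι-count n (like a κ)) (ι-count n (unlike a κ))) (trans (sym (∫-- (counting n) _ _))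
       (trans (∫-cong (counting n) (λ e → each (T κ e) (h e) (side a))) (∫-*ˡ (counting n) (sg (side a)) (λ e → sg (h e) * 𝟙 (T κ e)))))
       where
       each : ∀ t h s → 𝟙 (t ∧ not (h xor s)) - 𝟙 (t ∧ (h xor s)) ≡ sg s * (sg h * 𝟙 t)
       each false h s = sym (trans (cong (sg s *_) (ℚ.*-zeroʳ (sg h))) (ℚ.*-zeroʳ (sg s)))
       each true false false = refl
       each true false true  = refl
       each true true  false = refl
       each true true  true  = refl
     one-sided : ∀ a κ → sg (side a) * imbalance h (T κ) ≤ ι B
     one-sided a κ = subst (_≤ ι B) (difference a κ) (≤-by (ι M + ι B - ι P) (0≤q-p (balanced a κ)) (lem (ι M) (ι B) (ι P)))
       where
       P = count n (like a κ)
       M = count n (unlike a κ)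
       lem : ∀ m b p → b ≡ p - m + (m + b - p)
       lem = solve-∀ ringℚ
     bounded : ∀ κ → ∣ imbalance h (T κ) ∣ ≤ ι B
     bounded κ = ∣p∣≤ (subst (_≤ ι B) (ℚ.*-identityˡ (imbalance h (T κ))) (one-sided zero κ)) (subst (_≤ ι B) (lem (imbalance h (T κ))) (one-sided (suc zero) κ))
       where
       lem : ∀ x → (- 1ℚ) * x ≡ - x
       lem = solve-∀ ringℚ

-- A product of signs orthogonal to functions of lower degree.

module Pairs where

 open Measures
 open Rationals
 open Subsets
 open Cubes using (sg)
 open import Data.Bool using (not; _∧_; _∨_; _xor_; if_then_else_)
 open import Data.Bool.Properties using (∧-identityʳ)
 open import Data.Fin.Subset using (∣_∣)
 open import Data.Rational using (_+_; _*_; _-_; -_; _≤_; _<_)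
 open Signs using (count)
 open import Data.Vec using (lookup)
 open import Data.Nat.Tactic.RingSolver renaming (solve-∀ to ℕ-solve-∀)

 -- The vertices 2i and 2i+1 form a pair.
 hasPair : ∀ m → Subset (m ℕ.* 2) → Bool
 hasPair zero    e           = false
 hasPair (suc m) (a ∷ b ∷ e) = (a ∧ b) ∨ hasPair m e

 -- If a set misses a pair, its two extensions within the pair contribute 1 and -1; if it has one
 -- vertex there, the only extension contributes 0. So the one-vertex extensions of any set cancel
 -- (`balance-cancels`).
 factor : Bool → Bool → ℚ
 factor false false = 1ℚ
 factor true  false = 1ℚ
 factor false true  = - 1ℚ
 factor true  true  = 0ℚ

 balance : ∀ m → Subset (m ℕ.* 2) → ℚ
 balance zero    e           = 1ℚ
 balance (suc m) (a ∷ b ∷ e) = factor a b * balance m e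

 balance-cancels : ∀ m T → sum (λ v → 𝟙 (not (lookup T v)) * balance m (ins v T)) ≡ 0ℚ
 balance-cancels zero    T           = refl
 balance-cancels (suc m) (a ∷ b ∷ T) = begin
   𝟙 (not a) * (factor true b * B) + (𝟙 (not b) * (factor a true * B) + sum (λ v → 𝟙 (not (lookup T v)) * (factor a b * balance m (ins v T))))
     ≡⟨ cong (λ z → 𝟙 (not a) * (factor true b * B) + (𝟙 (not b) * (factor a true * B) + z))
          (trans (sum-cong (λ v → lem₁ (𝟙 (not (lookup T v))) (factor a b) (balance m (ins v T)))) (trans (sum-*ˡ {m ℕ.* 2} (factor a b) (λ v → 𝟙 (not (lookup T v)) * balance m (ins v T))) (cong (factor a b *_) (balance-cancels m T)))) ⟩
   𝟙 (not a) * (factor true b * B) + (𝟙 (not b) * (factor a true * B) + factor a b * 0ℚ)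
     ≡⟨ heads a b B ⟩
   0ℚ ∎
   where
   open ≡-Reasoning
   B = balance m T
   lem₁ : ∀ x f b → x * (f * b) ≡ f * (x * b)
   lem₁ = solve-∀ ringℚ
   heads : ∀ a b B → 𝟙 (not a) * (factor true b * B) + (𝟙 (not b) * (factor a true * B) + factor a b * 0ℚ) ≡ 0ℚ
   heads false false = solve-∀ ringℚ
   heads false true  = solve-∀ ringℚ
   heads true  false = solve-∀ ringℚ
   heads true  true  = solve-∀ ringℚ

 -- After double counting, `Q T` is multiplied by the sum of `balance` over the one-vertex
 -- extensions of T, which is 0.
 balance-orthogonal : ∀ m {c} {F : Subset (m ℕ.* 2) → ℚ} (Q : Subset (m ℕ.* 2) → ℚ) → 0ℚ < c →
   (∀ e → c * F e ≡ sum {m ℕ.* 2} (λ v → 𝟙 (lookup e v) * Q (del v e))) → ∫ (counting (m ℕ.* 2)) (λ e → balance m e * F e) ≡ 0ℚ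
 balance-orthogonal m {c} {F} Q 0<c h = ℚ.≤-antisym (*-cancelˡ c 0<c (ℚ.≤-reflexive zero≡)) (*-cancelˡ c 0<c (ℚ.≤-reflexive (sym zero≡)))
   where
   M = counting (m ℕ.* 2)
   lem₁ : ∀ c b f → c * (b * f) ≡ b * (c * f)
   lem₁ = solve-∀ ringℚ
   lem₂ : ∀ b x q → b * (x * q) ≡ x * (b * q)
   lem₂ = solve-∀ ringℚ
   lem₃ : ∀ x b q → x * (b * q) ≡ q * (x * b)
   lem₃ = solve-∀ ringℚ
   zero≡ : c * ∫ M (λ e → balance m e * F e) ≡ c * 0ℚ
   zero≡ = begin
     c * ∫ M (λ e → balance m e * F e)
       ≡⟨ ∫-*ˡ M c (λ e → balance m e * F e) ⟨
     ∫ M (λ e → c * (balance m e * F e))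
       ≡⟨ ∫-cong M (λ e → trans (lem₁ c (balance m e) (F e)) (trans (cong (balance m e *_) (h e))
            (trans (sym (sum-*ˡ {m ℕ.* 2} (balance m e) (λ v → 𝟙 (lookup e v) * Q (del v e)))) (sum-cong (λ v → lem₂ (balance m e) (𝟙 (lookup e v)) (Q (del v e))))))) ⟩
     ∫ M (λ e → sum (λ v → 𝟙 (lookup e v) * (balance m e * Q (del v e))))
       ≡⟨ double-count (m ℕ.* 2) (λ e T → balance m e * Q T) ⟩
     ∫ M (λ T → sum (λ v → 𝟙 (not (lookup T v)) * (balance m (ins v T) * Q T)))
       ≡⟨ ∫-≡0 M (λ T → trans (sum-cong (λ v → lem₃ (𝟙 (not (lookup T v))) (balance m (ins v T)) (Q T)))
            (trans (sum-*ˡ {m ℕ.* 2} (Q T) (λ v → 𝟙 (not (lookup T v)) * balance m (ins v T))) (trans (cong (Q T *_) (balance-cancels m T)) (ℚ.*-zeroʳ (Q T))))) ⟩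
     0ℚ
       ≡⟨ ℚ.*-zeroʳ c ⟨
     c * 0ℚ ∎
     where open ≡-Reasoning

 balance-hasPair : ∀ m e → hasPair m e ≡ true → balance m e ≡ 0ℚ
 balance-hasPair (suc m) (true  ∷ true  ∷ e) h = ℚ.*-zeroˡ (balance m e)
 balance-hasPair (suc m) (false ∷ false ∷ e) h = trans (cong (1ℚ *_) (balance-hasPair m e h)) (ℚ.*-zeroʳ 1ℚ)
 balance-hasPair (suc m) (false ∷ true  ∷ e) h = trans (cong ((- 1ℚ) *_) (balance-hasPair m e h)) (ℚ.*-zeroʳ (- 1ℚ))
 balance-hasPair (suc m) (true  ∷ false ∷ e) h = trans (cong (1ℚ *_) (balance-hasPair m e h)) (ℚ.*-zeroʳ 1ℚ)

 odds : ∀ m → Subset (m ℕ.* 2) → Bool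
 odds zero    e           = false
 odds (suc m) (a ∷ b ∷ e) = b xor odds m e

 balance-sign : ∀ m e → hasPair m e ≡ false → balance m e ≡ sg (odds m e)
 balance-sign zero    []                  h = refl
 balance-sign (suc m) (false ∷ false ∷ e) h = trans (ℚ.*-identityˡ (balance m e)) (balance-sign m e h)
 balance-sign (suc m) (true  ∷ false ∷ e) h = trans (ℚ.*-identityˡ (balance m e)) (balance-sign m e h)
 balance-sign (suc m) (false ∷ true  ∷ e) h = trans (cong ((- 1ℚ) *_) (balance-sign m e h)) (flip (odds m e))
   where
   flip : ∀ b → (- 1ℚ) * sg b ≡ sg (not b)
   flip true  = refl
   flip false = refl

 sets paired : ℕ → ℕ → ℕ
 sets   m k = count (m ℕ.* 2) (ofSize k)
 paired m k = count (m ℕ.* 2) (λ e → ofSize k e ∧ hasPair m e)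

 private
   growth : ∀ x j → x ℕ.^ suc j ℕ.+ 3 ℕ.* x ℕ.^ j ℕ.≤ (x ℕ.+ 3) ℕ.^ suc j
   growth x j = ℕ.≤-trans (ℕ.≤-reflexive (sym (ℕ.*-distribʳ-+ (x ℕ.^ j) x 3))) (ℕ.*-monoʳ-≤ (x ℕ.+ 3) (ℕ.^-monoˡ-≤ j (ℕ.m≤m+n x 3)))

   base : ℕ → ℕ
   base m = suc (m ℕ.* 3)

   base-suc : ∀ m → base m ℕ.+ 3 ≡ base (suc m)
   base-suc m = cong suc (ℕ.+-comm (m ℕ.* 3) 3)

 count-false : ∀ n → count n (λ _ → false) ≡ 0
 count-false zero    = refl
 count-false (suc n) = cong₂ ℕ._+_ (count-false n) (count-false n)

 count-cong : ∀ n {p r : Subset n → Bool} → (∀ e → p e ≡ r e) → count n p ≡ count n r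
 count-cong zero    h = cong (λ b → if b then 1 else 0) (h [])
 count-cong (suc n) h = cong₂ ℕ._+_ (count-cong n (λ e → h (false ∷ e))) (count-cong n (λ e → h (true ∷ e)))

 -- Of the four cases for a new pair, three use at least one of its vertices and contribute at most
 -- x^k each, so it suffices that x^(k+1) + 3x^k ≤ (x + 3)^(k+1) for x = 3m + 1.
 sets-≤ : ∀ m k → sets m k ℕ.≤ base m ℕ.^ k
 sets-≤ zero    zero    = ℕ.≤-refl
 sets-≤ zero    (suc k) = ℕ.z≤n
 sets-≤ (suc m) zero    = ℕ.≤-trans (ℕ.≤-reflexive (cong₂ ℕ._+_ (cong (sets m 0 ℕ.+_) (count-false (m ℕ.* 2))) (cong₂ ℕ._+_ (count-false (m ℕ.* 2)) (count-false (m ℕ.* 2)))))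
   (ℕ.≤-trans (ℕ.≤-reflexive (trans (ℕ.+-identityʳ _) (ℕ.+-identityʳ _))) (sets-≤ m zero))
 sets-≤ (suc m) (suc k) = ℕ.≤-trans (ℕ.+-mono-≤ (ℕ.+-mono-≤ (sets-≤ m (suc k)) (sets-≤ m k)) (ℕ.+-mono-≤ (sets-≤ m k) (last k)))
   (ℕ.≤-trans (ℕ.≤-reflexive (lem (base m ℕ.^ suc k) (base m ℕ.^ k))) (ℕ.≤-trans (growth (base m) k) (ℕ.≤-reflexive (cong (ℕ._^ suc k) (base-suc m)))))
   where
   lem : ∀ a b → (a ℕ.+ b) ℕ.+ (b ℕ.+ b) ≡ a ℕ.+ 3 ℕ.* b
   lem = ℕ-solve-∀
   last : ∀ k → count (m ℕ.* 2) (λ e → suc (suc ∣ e ∣) ℕ.≡ᵇ suc k) ℕ.≤ base m ℕ.^ k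
   last zero    = ℕ.≤-trans (ℕ.≤-reflexive (count-false (m ℕ.* 2))) ℕ.z≤n
   last (suc k) = ℕ.≤-trans (sets-≤ m k) (ℕ.^-monoʳ-≤ (base m) (ℕ.n≤1+n k))

 -- A pair inside the set occupies two vertices but has only m positions, which saves one factor. In
 -- the induction this is the case where the new pair lies in the set and the rest is arbitrary.
 paired-≤ : ∀ m k → paired m (suc k) ℕ.≤ base m ℕ.^ k
 paired-≤ zero    k = ℕ.z≤n
 paired-≤ (suc m) zero = ℕ.≤-trans (ℕ.+-mono-≤ (ℕ.+-mono-≤ (paired-≤ m 0) (ℕ.≤-reflexive (empty m))) (ℕ.+-mono-≤ (ℕ.≤-reflexive (empty m)) (ℕ.≤-reflexive (count-false (m ℕ.* 2)))))
   ℕ.≤-refl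
   where
   empty : ∀ m → paired m 0 ≡ 0
   empty zero    = refl
   empty (suc m) = cong₂ ℕ._+_ (cong₂ ℕ._+_ (empty m) (count-false (m ℕ.* 2))) (cong₂ ℕ._+_ (count-false (m ℕ.* 2)) (count-false (m ℕ.* 2)))
 paired-≤ (suc m) (suc k) = ℕ.≤-trans (ℕ.+-mono-≤ (ℕ.+-mono-≤ (paired-≤ m (suc k)) (paired-≤ m k)) (ℕ.+-mono-≤ (paired-≤ m k) last))
   (ℕ.≤-trans (ℕ.≤-reflexive (lem (base m ℕ.^ suc k) (base m ℕ.^ k))) (ℕ.≤-trans (growth (base m) k) (ℕ.≤-reflexive (cong (ℕ._^ suc k) (base-suc m)))))
   where
   lem : ∀ a b → (a ℕ.+ b) ℕ.+ (b ℕ.+ b) ≡ a ℕ.+ 3 ℕ.* b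
   lem = ℕ-solve-∀
   last : count (m ℕ.* 2) (λ e → ofSize k e ∧ true) ℕ.≤ base m ℕ.^ k
   last = ℕ.≤-trans (ℕ.≤-reflexive (count-cong (m ℕ.* 2) (λ e → ∧-identityʳ (ofSize k e)))) (sets-≤ m k)

-- Colourings with density bounded away from 0 and 1.

module Colouring where

 open import Defs using (Hypergraph; edge; uniform; density)
 open Blowup using (marginal)
 open Colours
 open Correlation using (distinct-++ˡ; distinct-++ʳ)
 open Density
 open Measures
 open Permutations using (Distinct; distinct?; repeated; ∣toSet∣; ∫-repeated)
 open Rationals
 open Subsets
 open Supersaturation using (positive-point)
 open Probability
 open import Data.Bool using (_∧_)
 open import Data.Fin.Subset using (∣_∣)
 open import Data.Rational using (_+_; _*_; _-_; -_; _≤_; _<_)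
 open import Data.Vec using (lookup; tabulate; map; _++_)

 ∈-toSet : ∀ {n l} (xs : Vec (Fin n) l) i → lookup (toSet xs) (lookup xs i) ≡ true
 ∈-toSet xs i = subst (λ z → lookup (toSet z) (lookup xs i) ≡ true) (Vec.tabulate∘lookup xs) (∈-tabulate (lookup xs) i)

 toSet-lookup : ∀ {n l} (xs : Vec (Fin n) l) v → lookup (toSet xs) v ≡ true → ∃[ i ] lookup xs i ≡ v
 toSet-lookup xs v h = tabulate-∈ (lookup xs) v (subst (λ z → lookup (toSet z) v ≡ true) (sym (Vec.tabulate∘lookup xs)) h)

 coloured : ∀ {n q} → (Fin n → Fin q) → Hypergraph n (suc q)
 coloured {n} {q} κ = record { edge = λ e → ofSize (suc q) e ∧ full κ e ; uniform = λ e h → ℕ.≡ᵇ⇒≡ ∣ e ∣ (suc q) (∧-T (ofSize (suc q) e) h) }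
   where
   ∧-T : ∀ b {c} → b ∧ c ≡ true → Bool.T b
   ∧-T true h = tt

 module _ (q′ : ℕ) where

   private
     q k : ℕ
     q = 2 ℕ.+ q′
     k = suc q
     -- The probability that two disjoint k-tuples receive the colour patterns `all-colours` and
     -- `one-colour`.
     λ₀ : ℚ
     λ₀ = inv q ^ k * inv q ^ k
     0<λ₀ : 0ℚ < λ₀
     0<λ₀ = *-pos (^-pos k (inv-pos (suc q′))) (^-pos k (inv-pos (suc q′)))
     inv≤1 : inv q ≤ 1ℚ
     inv≤1 = subst (inv q ≤_) (ι*inv (suc q′)) (subst (_≤ ι q * inv q) (ℚ.*-identityˡ (inv q)) (*-monoʳ (inv q) (inv-nonneg q) (subst (_≤ ι q) ι-1 (ι-mono (s≤s z≤n)))))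
     λ₀≤1 : λ₀ ≤ 1ℚ
     λ₀≤1 = *-mono (^-nonneg k (inv-nonneg q)) 0≤1 (^-≤1 k (inv-nonneg q) inv≤1) (^-≤1 k (inv-nonneg q) inv≤1)

     all-colours one-colour : Vec (Fin q) k
     all-colours = zero ∷ tabulate (λ j → j)
     one-colour  = Vec.replicate k zero

     _≟_ : ∀ (c d : Vec (Fin q) k) → Dec (c ≡ d)
     _≟_ = Vec.≡-dec Fin._≟_

     is : Vec (Fin q) k → Vec (Fin q) k → ℚ
     is c d = 𝟙 (does (d ≟ c))

     is-refl : ∀ c → is c c ≡ 1ℚ
     is-refl c with c ≟ c
     ... | yes _ = refl
     ... | no ne = ⊥-elim (ne refl)

   module _ {n : ℕ} where

     U = power (unif (suc n)) k
     U-prob = power-prob (unif-prob n) k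
     K = power (unif q) (suc n)
     K-prob = power-prob (unif-prob (suc q′)) (suc n)
     C = power (unif q) k

     F : Vec (Fin q) (suc n) → Vec (Fin (suc n)) k → ℚ
     F y xs = 𝟙 (ofSize k (toSet xs) ∧ full (lookup y) (toSet xs))

     F′ : Vec (Fin q) (suc n) → Vec (Fin (suc n)) k → ℚ
     F′ y xs = 𝟙 (ofSize k (toSet xs)) - F y xs

     F-nonneg : ∀ y xs → 0ℚ ≤ F y xs
     F-nonneg y xs = 𝟙-nonneg (ofSize k (toSet xs) ∧ full (lookup y) (toSet xs))

     F′-nonneg : ∀ y xs → 0ℚ ≤ F′ y xs
     F′-nonneg y xs = 0≤q-p (∧-≤ (ofSize k (toSet xs)) (full (lookup y) (toSet xs)))
       where
       ∧-≤ : ∀ a b → 𝟙 (a ∧ b) ≤ 𝟙 a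
       ∧-≤ true  b = 𝟙-≤1 b
       ∧-≤ false b = ℚ.≤-refl

     is≤F : ∀ y xs → Distinct xs → is all-colours (map (lookup y) xs) ≤ F y xs
     is≤F y xs d with map (lookup y) xs ≟ all-colours
     ... | no _   = F-nonneg y xs
     ... | yes eq = ℚ.≤-reflexive (sym (cong₂ (λ a b → 𝟙 (a ∧ b)) (ofSize-true {k = k} (toSet xs) (∣toSet∣ xs d)) (dec-true (full? (lookup y) (toSet xs)) (λ j →
         lookup xs (suc j) , ∈-toSet xs (suc j) , trans (sym (Vec.lookup-map (suc j) (lookup y) xs)) (trans (cong (λ c → lookup c (suc j)) eq) (Vec.lookup∘tabulate (λ j → j) j))))))

     is≤F′ : ∀ y xs → Distinct xs → is one-colour (map (lookup y) xs) ≤ F′ y xs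
     is≤F′ y xs d with map (lookup y) xs ≟ one-colour
     ... | no _   = F′-nonneg y xs
     ... | yes eq = ℚ.≤-reflexive (sym (cong₂ (λ a b → 𝟙 a - 𝟙 (a ∧ b)) (ofSize-true {k = k} (toSet xs) (∣toSet∣ xs d)) (dec-false (full? (lookup y) (toSet xs)) not-full)))
       where
       not-full : ¬ Full (lookup y) (toSet xs)
       not-full f with f (suc zero)
       ... | v , h , c with toSet-lookup xs v h
       ...   | i , refl with trans (sym c) (trans (sym (Vec.lookup-map i (lookup y) xs)) (trans (cong (λ c → lookup c i) eq) (Vec.lookup-replicate i zero)))
       ...     | ()

     pairwise : ∀ xs ys → λ₀ * (1ℚ - 𝟙 (repeated (xs ++ ys))) ≤ ∫ K (λ y → F y xs * F′ y ys)
     pairwise xs ys with distinct? (xs ++ ys)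
     ... | no _  = ℚ.≤-trans (ℚ.≤-reflexive (ℚ.*-zeroʳ λ₀)) (nonneg K-prob _ (λ y → *-nonneg (F-nonneg y xs) (F′-nonneg y ys)))
     ... | yes d = begin
       λ₀ * 1ℚ
         ≡⟨ trans (ℚ.*-identityʳ λ₀) (cong₂ _*_ (sym (trans (cong (inv q ^ k *_) (is-refl all-colours)) (ℚ.*-identityʳ (inv q ^ k)))) (sym (trans (cong (inv q ^ k *_) (is-refl one-colour)) (ℚ.*-identityʳ (inv q ^ k))))) ⟩
       inv q ^ k * is all-colours all-colours * (inv q ^ k * is one-colour one-colour)
         ≤⟨ *-mono (*-nonneg (^-nonneg k (inv-nonneg q)) (𝟙-nonneg (does (one-colour ≟ one-colour)))) (nonneg (power-prob (unif-prob (suc q′)) k) (is all-colours) (λ c → 𝟙-nonneg (does (c ≟ all-colours)))) (point all-colours) (point one-colour) ⟩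
       ∫ C (is all-colours) * ∫ C (is one-colour)
         ≡⟨ trans (sym (∫-*ʳ C (∫ C (is one-colour)) (is all-colours))) (∫-cong C (λ c → sym (∫-*ˡ C (is all-colours c) (is one-colour)))) ⟩
       ∫ C (λ c → ∫ C (λ d → is all-colours c * is one-colour d))
         ≡⟨ marginal (unif-prob (suc q′)) xs ys d (λ c d → is all-colours c * is one-colour d) ⟨
       ∫ K (λ y → is all-colours (map (lookup y) xs) * is one-colour (map (lookup y) ys))
         ≤⟨ mono K-prob _ _ (λ y → *-mono (𝟙-nonneg (does (map (lookup y) ys ≟ one-colour))) (F-nonneg y xs) (is≤F y xs (distinct-++ˡ xs ys d)) (is≤F′ y ys (distinct-++ʳ xs ys d))) ⟩
       ∫ K (λ y → F y xs * F′ y ys) ∎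
       where
       open ℚ.≤-Reasoning
       point : ∀ c → inv q ^ k * is c c ≤ ∫ C (is c)
       point c = ∫-power-point (unif-prob (suc q′)) (inv-nonneg q) (unif-point q) (is c) (λ d → 𝟙-nonneg (does (d ≟ c))) c

     M : Vec (Fin q) (suc n) → ℚ
     M y = mean {n} k (coloured (lookup y))

     -- Two disjoint tuples are coloured independently, so with positive probability the first gives
     -- an edge and the second does not. A single colouring for which the product is large is
     -- bounded away from both ends at once.
     spread : λ₀ * (1ℚ - ι (k ℕ.+ k) * ι (k ℕ.+ k) * inv (suc n)) ≤ ∫ K (λ y → M y * (simple {n} k - M y))
     spread = begin
       λ₀ * (1ℚ - ι (k ℕ.+ k) * ι (k ℕ.+ k) * inv (suc n))
         ≤⟨ *-monoˡ λ₀ (ℚ.<⇒≤ 0<λ₀) (ℚ.+-monoʳ-≤ 1ℚ (neg-mono (∫-repeated n (k ℕ.+ k)))) ⟩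
       λ₀ * (1ℚ - ∫ (power (unif (suc n)) (k ℕ.+ k)) (λ zs → 𝟙 (repeated zs)))
         ≡⟨ cong (λ z → λ₀ * (1ℚ - z)) (∫-power-++ (unif (suc n)) k k (λ zs → 𝟙 (repeated zs))) ⟩
       λ₀ * (1ℚ - ∫ U (λ xs → ∫ U (λ ys → 𝟙 (repeated (xs ++ ys)))))
         ≡⟨ cong (λ₀ *_) (sym (trans (∫-cong U (λ xs → trans (∫-- U (λ _ → 1ℚ) (λ ys → 𝟙 (repeated (xs ++ ys)))) (cong (_- ∫ U (λ ys → 𝟙 (repeated (xs ++ ys)))) (const U-prob 1ℚ))))
              (trans (∫-- U (λ _ → 1ℚ) (λ xs → ∫ U (λ ys → 𝟙 (repeated (xs ++ ys))))) (cong (_- ∫ U (λ xs → ∫ U (λ ys → 𝟙 (repeated (xs ++ ys))))) (const U-prob 1ℚ))))) ⟩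
       λ₀ * ∫ U (λ xs → ∫ U (λ ys → 1ℚ - 𝟙 (repeated (xs ++ ys))))
         ≡⟨ trans (sym (∫-*ˡ U λ₀ _)) (∫-cong U (λ xs → sym (∫-*ˡ U λ₀ (λ ys → 1ℚ - 𝟙 (repeated (xs ++ ys)))))) ⟩
       ∫ U (λ xs → ∫ U (λ ys → λ₀ * (1ℚ - 𝟙 (repeated (xs ++ ys)))))
         ≤⟨ mono U-prob _ _ (λ xs → mono U-prob _ _ (λ ys → pairwise xs ys)) ⟩
       ∫ U (λ xs → ∫ U (λ ys → ∫ K (λ y → F y xs * F′ y ys)))
         ≡⟨ trans (∫-cong U (λ xs → ∫-swap U K (λ ys y → F y xs * F′ y ys))) (∫-swap U K (λ xs y → ∫ U (λ ys → F y xs * F′ y ys))) ⟩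
       ∫ K (λ y → ∫ U (λ xs → ∫ U (λ ys → F y xs * F′ y ys)))
         ≡⟨ ∫-cong K (λ y → trans (∫-cong U (λ xs → ∫-*ˡ U (F y xs) (F′ y))) (trans (∫-*ʳ U (∫ U (F′ y)) (F y)) (cong (M y *_) (∫-- U (λ ys → 𝟙 (ofSize k (toSet ys))) (F y))))) ⟩
       ∫ K (λ y → M y * (simple {n} k - M y)) ∎
       where open ℚ.≤-Reasoning

   opaque
     -- The factor 1/8 serves two purposes: γ₀ < λ₀ / 2 for the colouring, and γ₀ ≤ 1/8 < 1/4, the
     -- lower bound for the density of the signed hypergraph.
     γ₀ : ℚ
     γ₀ = ½ * ½ * ½ * λ₀

     γ₀-pos : 0ℚ < γ₀
     γ₀-pos = *-pos (ℚ.positive⁻¹ (½ * ½ * ½)) 0<λ₀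

     γ₀≤⅛ : γ₀ ≤ ½ * ½ * ½
     γ₀≤⅛ = subst (γ₀ ≤_) (ℚ.*-identityʳ (½ * ½ * ½)) (*-monoˡ (½ * ½ * ½) (ℚ.nonNegative⁻¹ _) λ₀≤1)

     γ₀<½λ₀ : γ₀ < λ₀ * ½
     γ₀<½λ₀ = subst₂ _<_ (ℚ.+-identityʳ γ₀) (lem₂ λ₀) (ℚ.+-monoʳ-< γ₀ (*-pos (ℚ.positive⁻¹ (½ * ½ + ½ * ½ * ½)) 0<λ₀))
       where
       lem₂ : ∀ l → ½ * ½ * ½ * l + (½ * ½ + ½ * ½ * ½) * l ≡ l * ½
       lem₂ = solve-∀ ringℚ

   balancedColouring : ExcludedMiddle 0ℓ → ∀ n → ι (k ℕ.+ k) * ι (k ℕ.+ k) * inv (suc n) ≤ ½ →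
     Σ[ κ ∈ (Fin (suc n) → Fin q) ] γ₀ < density (coloured κ) × density (coloured κ) < 1ℚ - γ₀
   balancedColouring em n few = lookup (proj₁ found) , conclude (proj₁ found) (proj₂ found)
     where
     ε = ι (k ℕ.+ k) * ι (k ℕ.+ k) * inv (suc n)
     lem₁ : ∀ ε → 1ℚ - ε ≡ ½ + (½ - ε)
     lem₁ = solve-∀ ringℚ
     L = power (unif q) (suc n)
     L-prob = power-prob (unif-prob (suc q′)) (suc n)
     G : Vec (Fin q) (suc n) → ℚ
     G y = M {n} y * (simple {n} k - M y)
     mean-excess : 0ℚ < ∫ L (λ y → G y - γ₀)
     mean-excess = subst (0ℚ <_) (sym (trans (∫-- L G (λ _ → γ₀)) (cong (λ z → ∫ L G - z) (const L-prob γ₀))))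
       (0<q-p (ℚ.<-≤-trans γ₀<½λ₀ (ℚ.≤-trans (*-monoˡ λ₀ (ℚ.<⇒≤ 0<λ₀) (≤-by {½} (½ - ε) (0≤q-p few) (lem₁ ε))) (spread {n}))))
     found : ∃[ y ] 0ℚ < G y - γ₀
     found = positive-point em {L = L} L-prob (λ y → G y - γ₀) mean-excess
     conclude : ∀ y → 0ℚ < G y - γ₀ → γ₀ < density (coloured (lookup y)) × density (coloured (lookup y)) < 1ℚ - γ₀
     conclude y pos = ℚ.<-≤-trans γ₀<X X≤p , subst (_< 1ℚ - γ₀) (lem₅ p) (ℚ.+-monoʳ-< 1ℚ (ℚ.neg-antimono-< (ℚ.<-≤-trans γ₀<X X≤1-p)))
       where
       p μ X : ℚ
       p = density (coloured (lookup y))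
       μ = simple {n} k
       -- Equal to p(1 - p)μ², hence at most p and at most 1 - p.
       X = M y * (μ - M y)
       γ₀<X : γ₀ < X
       γ₀<X = subst₂ _<_ (ℚ.+-identityˡ γ₀) (lem X γ₀) (ℚ.+-monoˡ-< γ₀ pos)
         where
         lem : ∀ a b → a - b + b ≡ a
         lem = solve-∀ ringℚ
       μ≤1 : μ ≤ 1ℚ
       μ≤1 = ≤-const (power-prob (unif-prob n) k) 1ℚ (λ xs → 𝟙-≤1 (ofSize k (toSet xs)))
       few′ : ι k * ι k * inv (suc n) ≤ ½
       few′ = ℚ.≤-trans (*-monoʳ (inv (suc n)) (inv-nonneg (suc n)) (*-mono (ι-nonneg k) (ι-nonneg (k ℕ.+ k)) (ι-mono (ℕ.m≤m+n k k)) (ι-mono (ℕ.m≤m+n k k)))) few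
       0<μ : 0ℚ < μ
       0<μ = ℚ.<-≤-trans (ℚ.positive⁻¹ ½) (½≤simple {n} k few′)
       0≤M : 0ℚ ≤ M y
       0≤M = nonneg (power-prob (unif-prob n) k) _ (F-nonneg y)
       0≤μ-M : 0ℚ ≤ μ - M y
       0≤μ-M = subst (0ℚ ≤_) (∫-- (power (unif (suc n)) k) (λ xs → 𝟙 (ofSize k (toSet xs))) (F y)) (nonneg (power-prob (unif-prob n) k) _ (F′-nonneg y))
       M≡ : M y ≡ p * μ
       M≡ = mean-density k 0<μ (coloured (lookup y))
       0≤p : 0ℚ ≤ p
       0≤p = *-cancelˡ μ 0<μ (ℚ.≤-trans (ℚ.≤-reflexive (ℚ.*-zeroʳ μ)) (ℚ.≤-trans 0≤M (ℚ.≤-reflexive (trans M≡ (ℚ.*-comm p μ)))))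
       p≤1 : p ≤ 1ℚ
       p≤1 = *-cancelˡ μ 0<μ (≤-by {μ * p} (μ - M y) 0≤μ-M (trans (lem μ p) (cong (λ z → μ * p + (μ - z)) (sym M≡))))
         where
         lem : ∀ μ p → μ * 1ℚ ≡ μ * p + (μ - p * μ)
         lem = solve-∀ ringℚ
       X≡ : X ≡ p * (1ℚ - p) * (μ * μ)
       X≡ = trans (cong (λ z → z * (μ - z)) M≡) (lem p μ)
         where
         lem : ∀ p μ → p * μ * (μ - p * μ) ≡ p * (1ℚ - p) * (μ * μ)
         lem = solve-∀ ringℚ
       X≤ : X ≤ p * (1ℚ - p)
       X≤ = ℚ.≤-trans (ℚ.≤-reflexive X≡) (ℚ.≤-trans (*-monoˡ (p * (1ℚ - p)) (*-nonneg 0≤p (0≤q-p p≤1)) (*-mono (ℚ.<⇒≤ 0<μ) 0≤1 μ≤1 μ≤1)) (ℚ.≤-reflexive (ℚ.*-identityʳ (p * (1ℚ - p)))))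
       X≤p : X ≤ p
       X≤p = ℚ.≤-trans X≤ (≤-by {p * (1ℚ - p)} (p * p) (square-nonneg p) (lem p))
         where
         lem : ∀ p → p ≡ p * (1ℚ - p) + p * p
         lem = solve-∀ ringℚ
       X≤1-p : X ≤ 1ℚ - p
       X≤1-p = ℚ.≤-trans X≤ (≤-by {p * (1ℚ - p)} ((1ℚ - p) * (1ℚ - p)) (square-nonneg (1ℚ - p)) (lem p))
         where
         lem : ∀ p → 1ℚ - p ≡ p * (1ℚ - p) + (1ℚ - p) * (1ℚ - p)
         lem = solve-∀ ringℚ
       lem₅ : ∀ p → 1ℚ - (1ℚ - p) ≡ p
       lem₅ = solve-∀ ringℚ

-- The signed hypergraph and its intersections with coloured ones.

module Construction where

 open import Defs using (Hypergraph; edge; uniform; edgeCount; commonEdges; _≅_)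
 open Colouring using (coloured)
 open Colours
 open Correlation using (image-cong; image-∘)
 open Cubes using (sg)
 open Density
 open Measures
 open Pairs
 open Rationals
 open Signs
 open Subsets
 open import Data.Bool using (not; _∧_; _∨_; if_then_else_)
 open import Data.Fin.Permutation using (flip; inverseˡ)
 open import Data.Fin.Subset using (∣_∣)
 open import Data.Nat.Combinatorics using (_C_)
 open import Data.Nat.Tactic.RingSolver renaming (solve-∀ to ℕ-solve-∀)
 open import Data.Vec using (lookup; tabulate)

 *-^ : ∀ a b n → (a ℕ.* b) ℕ.^ n ≡ a ℕ.^ n ℕ.* b ℕ.^ n
 *-^ a b zero    = refl
 *-^ a b (suc n) = trans (cong (a ℕ.* b ℕ.*_) (*-^ a b n)) (lem a b (a ℕ.^ n) (b ℕ.^ n))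
   where
   lem : ∀ a b c d → a ℕ.* b ℕ.* (c ℕ.* d) ≡ a ℕ.* c ℕ.* (b ℕ.* d)
   lem = ℕ-solve-∀

 module Signed (q′ v′ : ℕ) where

   open import Data.Nat using (_+_; _*_; _≤_) renaming (_^_ to _^ⁿ_)

   -- The parameters are balanced for `drift`. At most (4m)^q sets of size k contain a pair, which
   -- is D²t for D = v^(q-1) and t = 4^q m; the q^(n+2) codes of signed tests are at most 2^E
   -- because q ≤ 2^q. Then B is at most K m D = K v^k, and v^k has order n^(k/2).
   q k v m n′ n D′ D E t B K : ℕ
   q  = 2 + q′
   k  = suc q
   v  = suc v′
   m  = v * v
   -- Written so that `n` is `suc n′` by computation.
   n′ = suc ((v′ + v′ * v) * 2)
   n  = m * 2
   D′ = ℕ.pred (v ^ⁿ suc q′)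
   D  = suc D′
   E  = q * (2 + n)
   t  = 4 ^ⁿ q * m
   B  = 2 * D * (suc E + t)
   K  = 2 * (1 + q * 4 + 4 ^ⁿ q)

   private
     D≡ : D ≡ v ^ⁿ suc q′
     D≡ = ℕ.suc-pred (v ^ⁿ suc q′) {{ℕ.m^n≢0 v (suc q′)}}

     B≡ : ∀ D q f m → 2 * D * ((m + q * (4 * m)) + f * m) ≡ 2 * (1 + q * 4 + f) * (m * D)
     B≡ = ℕ-solve-∀

     power≡ : v * v * v ^ⁿ suc q′ ≡ v ^ⁿ k
     power≡ = ℕ.*-assoc v v (v ^ⁿ suc q′)

   B≤ : B ≤ K * v ^ⁿ k
   B≤ = ℕ.≤-trans (ℕ.*-monoʳ-≤ (2 * D) (ℕ.+-monoˡ-≤ t (ℕ.+-mono-≤ {1} {m} (s≤s z≤n) (ℕ.*-monoʳ-≤ q (ℕ.≤-trans (ℕ.+-monoˡ-≤ n (ℕ.*-monoʳ-≤ 2 {1} {m} (s≤s z≤n))) (ℕ.≤-reflexive (lem m)))))))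
     (ℕ.≤-reflexive (trans (B≡ D q (4 ^ⁿ q) m) (cong (K *_) (trans (cong (m *_) D≡) power≡))))
     where
     lem : ∀ m → 2 * m + m * 2 ≡ 4 * m
     lem = ℕ-solve-∀

   -- The leading coordinate is a switch: at `zero` the test contains all k-sets with a pair, which
   -- controls the number of edges, and otherwise only those that meet every colour.
   T : Vec (Fin q) (suc n) → Subset n → Bool
   T (b ∷ κ) e = (ofSize k e ∧ hasPair m e) ∧ (constant b ∨ full (lookup κ) e)
     where
     constant : Fin q → Bool
     constant zero    = true
     constant (suc _) = false

   private
     few : paired m k ≤ D * D * t
     few = ℕ.≤-trans (paired-≤ m q) (ℕ.≤-trans (ℕ.^-monoˡ-≤ q (ℕ.≤-trans (ℕ.+-monoˡ-≤ (m * 3) {1} {m} (s≤s z≤n)) (ℕ.≤-reflexive (lem₁ m))))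
       (ℕ.≤-reflexive (trans (*-^ 4 m q) (trans (cong (4 ^ⁿ q *_) (trans (*-^ v v q) (trans (cong (λ z → v * z * (v * z)) (sym D≡)) (lem₂ v D)))) (lem₃ (4 ^ⁿ q) D m)))))
       where
       lem₁ : ∀ m → m + m * 3 ≡ 4 * m
       lem₁ = ℕ-solve-∀
       lem₂ : ∀ v D → v * D * (v * D) ≡ D * D * (v * v)
       lem₂ = ℕ-solve-∀
       lem₃ : ∀ f D m → f * (D * D * m) ≡ D * D * (f * m)
       lem₃ = ℕ-solve-∀

     few-tests : q ^ⁿ (2 + n) ≤ 2 ^ⁿ E
     few-tests = ℕ.≤-trans (ℕ.^-monoˡ-≤ (2 + n) (m≤2^m q)) (ℕ.≤-reflexive (ℕ.^-*-assoc 2 q (2 + n)))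

   opaque
     choice : Σ[ h ∈ (Subset n → Bool) ] ∀ κ → ℚ.∣ imbalance h (T κ) ∣ ℚ.≤ ι B
     choice = balancedSigns D′ q′ (suc n) E t n T (λ κ → ℕ.≤-trans (count-mono n (λ e → part κ e)) few) few-tests
       where
       ∧-left : ∀ b {c} → b ∧ c ≡ true → b ≡ true
       ∧-left true h = refl
       part : ∀ κ e → T κ e ≡ true → ofSize k e ∧ hasPair m e ≡ true
       part (b ∷ κ) e = ∧-left (ofSize k e ∧ hasPair m e)

   h : Subset n → Bool
   h = proj₁ choice

   h-balanced : ∀ κ → ℚ.∣ imbalance h (T κ) ∣ ℚ.≤ ι B
   h-balanced = proj₂ choice

   -- The negation is there because `sg true` is -1: edges are the sets of sign +1. On sets with a
   -- pair the sign is free, as `balance` vanishes there.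
   member : Subset n → Bool
   member e = ofSize k e ∧ not (if hasPair m e then h e else odds m e)

   signed : Hypergraph n k
   signed = record { edge = member ; uniform = λ e h → ℕ.≡ᵇ⇒≡ ∣ e ∣ k (∧-T (ofSize k e) h) }
     where
     ∧-T : ∀ b {c} → b ∧ c ≡ true → Bool.T b
     ∧-T true h = tt

 module Counts (q′ v′ : ℕ) where

   open Signed q′ v′
   open import Data.Rational using (_+_; _*_; _-_; -_; _≤_)

   private
     M : Measure (Subset n)
     M = counting n

     -- On k-sets, twice the indicator of an edge is 1 plus its sign, and the sign is `balance` plus
     -- a correction by `h` supported on the sets with a pair.
     each : ∀ (c : Subset n → Bool) e → (1ℚ + 1ℚ) * 𝟙 ((ofSize k e ∧ c e) ∧ member e) ≡
       𝟙 (ofSize k e ∧ c e) + balance m e * 𝟙 (ofSize k e ∧ c e) + sg (h e) * 𝟙 ((ofSize k e ∧ hasPair m e) ∧ c e)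
     each c e = go (ofSize k e) (c e) (hasPair m e) (h e) refl
       where
       zeros : ∀ b s → (1ℚ + 1ℚ) * 0ℚ ≡ 0ℚ + b * 0ℚ + s * 0ℚ
       zeros = solve-∀ ringℚ
       two : ∀ b → (1ℚ + 1ℚ) * 𝟙 (not b) ≡ 1ℚ + 0ℚ * 1ℚ + sg b * 1ℚ
       two true  = refl
       two false = refl
       two′ : ∀ b s → (1ℚ + 1ℚ) * 𝟙 (not b) ≡ 1ℚ + sg b * 1ℚ + s * 0ℚ
       two′ true  = solve-∀ ringℚ
       two′ false = solve-∀ ringℚ
       go : ∀ s c p x → hasPair m e ≡ p → (1ℚ + 1ℚ) * 𝟙 ((s ∧ c) ∧ (s ∧ not (if p then x else odds m e))) ≡
         𝟙 (s ∧ c) + balance m e * 𝟙 (s ∧ c) + sg x * 𝟙 ((s ∧ p) ∧ c)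
       go false c     p     x eq = zeros (balance m e) (sg x)
       go true  false p     x eq = trans (zeros (balance m e) (sg x)) (cong (λ z → 0ℚ + balance m e * 0ℚ + sg x * 𝟙 z) (sym (Bool.∧-zeroʳ p)))
       go true  true  true  x eq = trans (two x) (cong (λ z → 1ℚ + z * 1ℚ + sg x * 1ℚ) (sym (balance-hasPair m e eq)))
       go true  true  false x eq = trans (two′ (odds m e) (sg x)) (cong (λ z → 1ℚ + z * 1ℚ + sg x * 0ℚ) (sym (balance-sign m e eq)))

     total : ∀ (c : Subset n → Bool) → ∫ M (λ e → balance m e * 𝟙 (ofSize k e ∧ c e)) ≡ 0ℚ →
       (1ℚ + 1ℚ) * ∫ M (λ e → 𝟙 ((ofSize k e ∧ c e) ∧ member e)) ≡ ∫ M (λ e → 𝟙 (ofSize k e ∧ c e)) + imbalance h (λ e → (ofSize k e ∧ hasPair m e) ∧ c e)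
     total c orthogonal = trans (sym (∫-*ˡ M (1ℚ + 1ℚ) (λ e → 𝟙 ((ofSize k e ∧ c e) ∧ member e)))) (trans (∫-cong M (each c))
       (trans (∫-+ M (λ e → 𝟙 (ofSize k e ∧ c e) + balance m e * 𝟙 (ofSize k e ∧ c e)) (λ e → sg (h e) * 𝟙 ((ofSize k e ∧ hasPair m e) ∧ c e)))
       (cong (_+ imbalance h (λ e → (ofSize k e ∧ hasPair m e) ∧ c e)) (trans (∫-+ M (λ e → 𝟙 (ofSize k e ∧ c e)) (λ e → balance m e * 𝟙 (ofSize k e ∧ c e)))
         (trans (cong (λ z → ∫ M (λ e → 𝟙 (ofSize k e ∧ c e)) + z) orthogonal) (ℚ.+-identityʳ (∫ M (λ e → 𝟙 (ofSize k e ∧ c e)))))))))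

   edges : ∃[ I ] ℚ.∣ I ∣ ≤ ι B × (1ℚ + 1ℚ) * ι (edgeCount signed) ≡ ι (n C k) + I
   edges = imbalance h (λ e → (ofSize k e ∧ hasPair m e) ∧ true) , h-balanced (zero ∷ Vec.replicate n zero) ,
     trans (cong ((1ℚ + 1ℚ) *_) (trans (length-filterᵇ n member) (∫-cong M (λ e → cong 𝟙 (absorb (ofSize k e))))))
       (trans (total (λ _ → true) orthogonal) (cong (_+ imbalance h (λ e → (ofSize k e ∧ hasPair m e) ∧ true))
         (trans (∫-cong M (λ e → cong 𝟙 (Bool.∧-identityʳ (ofSize k e)))) (∫-ofSize n k))))
     where
     absorb : ∀ a {b} → a ∧ b ≡ (a ∧ true) ∧ (a ∧ b)
     absorb true  = refl
     absorb false = refl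
     orthogonal : ∫ M (λ e → balance m e * 𝟙 (ofSize k e ∧ true)) ≡ 0ℚ
     orthogonal = balance-orthogonal m {ι k} {λ e → 𝟙 (ofSize k e ∧ true)} (λ T → 𝟙 (ofSize q T)) (ι-pos q)
       (λ e → trans (cong (λ b → ι k * 𝟙 b) (Bool.∧-identityʳ (ofSize k e))) (size-degree q e))

   common : ∀ (κ : Fin n → Fin q) → ∃[ I ] ℚ.∣ I ∣ ≤ ι B ×
     (1ℚ + 1ℚ) * ∫ M (λ e → 𝟙 ((ofSize k e ∧ full κ e) ∧ member e)) ≡ ∫ M (λ e → 𝟙 (ofSize k e ∧ full κ e)) + I
   common κ = imbalance h (λ e → (ofSize k e ∧ hasPair m e) ∧ full κ e) ,
     subst (λ z → ℚ.∣ z ∣ ≤ ι B) (∫-cong M (λ e → cong (λ b → sg (h e) * 𝟙 ((ofSize k e ∧ hasPair m e) ∧ b)) (full-cong (Vec.lookup∘tabulate κ) e))) (h-balanced (suc zero ∷ tabulate κ)) ,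
     total (full κ) (balance-orthogonal m {ι 2} {λ e → 𝟙 (ofSize k e ∧ full κ e)} (λ T → 𝟙 (ofSize q T ∧ full κ T)) (ι-pos 1) (full-degree κ))

   -- Both copies are moved by the permutation that turns the second into `signed`; the first is
   -- then the hypergraph of a recolouring `κ′`, and every colouring is among the tests.
   copies : ∀ (κ : Fin n → Fin q) (G H : Hypergraph n k) → G ≅ coloured κ → H ≅ signed →
     ∃[ I ] ℚ.∣ I ∣ ≤ ι B × (1ℚ + 1ℚ) * ι (commonEdges G H) ≡ ι (edgeCount (coloured κ)) + I
   copies κ G H (π , isoG) (ρ , isoH) = proj₁ found , proj₁ (proj₂ found) ,
     trans (cong ((1ℚ + 1ℚ) *_) count≡) (trans (proj₂ (proj₂ found)) (cong (_+ proj₁ found) size≡))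
     where
     θ = flip ρ ∘ₚ π
     κ′ : Fin n → Fin q
     κ′ v = κ (θ ⟨$⟩ʳ v)
     found = common κ′
     G₀ : Hypergraph n k
     G₀ = coloured κ
     pulled : ∀ e → edge G₀ (image θ e) ≡ ofSize k e ∧ full κ′ e
     pulled e = cong₂ _∧_ (cong (ℕ._≡ᵇ k) (∣image∣ θ e)) (full-image κ θ e)
     size≡ : ∫ M (λ e → 𝟙 (ofSize k e ∧ full κ′ e)) ≡ ι (edgeCount G₀)
     size≡ = trans (∫-cong M (λ e → cong 𝟙 (sym (pulled e)))) (trans (∫-image n′ k (λ e → 𝟙 (edge G₀ e)) (indicator-uniform G₀) θ) (sym (length-filterᵇ n (edge G₀))))
     Φ : Subset n → ℚ
     Φ e = 𝟙 ((ofSize k e ∧ full κ′ e) ∧ member e)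
     Φ-uniform : Uniform k Φ
     Φ-uniform e ne = trans (𝟙-∧ (ofSize k e ∧ full κ′ e) (member e)) (trans (cong (𝟙 (ofSize k e ∧ full κ′ e) *_) (indicator-uniform signed e ne)) (ℚ.*-zeroʳ (𝟙 (ofSize k e ∧ full κ′ e))))
     back : ∀ e → image θ (image ρ e) ≡ image π e
     back e = trans (image-∘ ρ θ e) (image-cong {π = ρ ∘ₚ θ} {π} (λ i → cong (π ⟨$⟩ʳ_) (inverseˡ ρ)) e)
     count≡ : ι (commonEdges G H) ≡ ∫ M Φ
     count≡ = trans (length-filterᵇ n (λ e → edge G e ∧ edge H e)) (trans (∫-cong M (λ e → cong 𝟙 (cong₂ _∧_
       (trans (sym (isoG e)) (trans (cong (edge G₀) (sym (back e))) (pulled (image ρ e)))) (sym (isoH e))))) (∫-image n′ k Φ Φ-uniform ρ))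

-- Two hypergraphs of small discrepancy when k ≥ 3.

module Counterexample where

 open import Defs
 open Colouring using (coloured; γ₀; γ₀-pos; γ₀≤⅛; balancedColouring)
 open Construction
 open Density
 open Rationals
 open Signs using (^-≤-^)
 open Subsets using (_!ℚ; !ℚ-pos; length-filterᵇ; 𝟙)
 open import Data.Bool using (_∧_)
 open import Data.Nat.Combinatorics using (_C_)
 open import Data.Rational using (_+_; _*_; _-_; -_; _≤_; _<_; ∣_∣)
 open Measures using (∫-cong)

 commonEdges-comm : ∀ {n k} (G H : Hypergraph n k) → ι (commonEdges G H) ≡ ι (commonEdges H G)
 commonEdges-comm {n} G H = trans (length-filterᵇ n (λ e → edge G e ∧ edge H e))
   (trans (∫-cong (Subsets.counting n) (λ e → cong 𝟙 (Bool.∧-comm (edge G e) (edge H e)))) (sym (length-filterᵇ n (λ e → edge H e ∧ edge G e))))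

 module Close {q n′ v′ : ℕ} (B K : ℕ) (signed : Hypergraph (suc n′) (suc q))
   (edges : ∃[ I ] ∣ I ∣ ≤ ι B × (1ℚ + 1ℚ) * ι (edgeCount signed) ≡ ι (suc n′ C suc q) + I)
   (copies : ∀ (κ : Fin (suc n′) → Fin q) (G H : Hypergraph (suc n′) (suc q)) → G ≅ coloured κ → H ≅ signed →
     ∃[ I ] ∣ I ∣ ≤ ι B × (1ℚ + 1ℚ) * ι (commonEdges G H) ≡ ι (edgeCount (coloured κ)) + I)
   (B≤ : B ℕ.≤ K ℕ.* suc v′ ℕ.^ suc q) (v²≤ : suc v′ ℕ.* suc v′ ℕ.≤ suc n′) where

   private
     k n v : ℕ
     k = suc q
     n = suc n′
     v = suc v′
     N₀ : ℚ
     N₀ = ι (n C k)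

   module _ (few : ι k * ι k * inv n ≤ ½) (large : ι 4 * ι K * (k !ℚ) ≤ ι v) where

     0<simple : 0ℚ < simple {n′} k
     0<simple = ℚ.<-≤-trans (ℚ.positive⁻¹ ½) (½≤simple {n′} k few)

     V : ℚ
     V = ι v ^ k

     0≤V : 0ℚ ≤ V
     0≤V = ^-nonneg k (ι-nonneg v)

     ιB≤ : ι B ≤ ι K * V
     ιB≤ = ℚ.≤-trans (ι-mono B≤) (ℚ.≤-reflexive (trans (ι-* K (v ℕ.^ k)) (cong (ι K *_) (ι-^ v k))))

     1≤v : 1ℚ ≤ ι v
     1≤v = subst (_≤ ι v) ι-1 (ι-mono (s≤s z≤n))

     v²≤n : ι v * ι v ≤ ι n
     v²≤n = subst (_≤ ι n) (ι-* v v) (ι-mono v²≤)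

     -- The binomial coefficient has order at least v^(2k) and B only v^k; the hypothesis `large`
     -- absorbs the constants. This puts the density of `signed` between 1/4 and 3/4.
     2B≤N₀ : ι B + ι B ≤ N₀
     2B≤N₀ = *-cancelˡ (k !ℚ) (!ℚ-pos k) (begin
       (k !ℚ) * (ι B + ι B)
         ≤⟨ *-monoˡ (k !ℚ) (ℚ.<⇒≤ (!ℚ-pos k)) (ℚ.+-mono-≤ ιB≤ ιB≤) ⟩
       (k !ℚ) * (ι K * V + ι K * V)
         ≡⟨ trans (lem₁ (k !ℚ) (ι K) V) (cong (λ z → ½ * (z * ι K * (k !ℚ)) * V) (sym ι4)) ⟩
       ½ * (ι 4 * ι K * (k !ℚ)) * V
         ≤⟨ *-monoʳ V 0≤V (*-monoˡ ½ (ℚ.nonNegative⁻¹ ½) (ℚ.≤-trans large (ℚ.≤-trans (ℚ.≤-reflexive (sym (ℚ.*-identityʳ (ι v)))) (^-≤-^ {m = 1} {k} 1≤v (s≤s z≤n))))) ⟩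
       ½ * V * V
         ≡⟨ trans (ℚ.*-assoc ½ V V) (trans (cong (½ *_) (sym (^-distrib-* (ι v) (ι v) k))) (ℚ.*-comm ½ ((ι v * ι v) ^ k))) ⟩
       (ι v * ι v) ^ k * ½
         ≤⟨ *-mono (ℚ.nonNegative⁻¹ ½) (^-nonneg k (ι-nonneg n)) (^-mono k (*-nonneg (ι-nonneg v) (ι-nonneg v)) v²≤n) (½≤simple {n′} k few) ⟩
       ι n ^ k * simple {n′} k
         ≡⟨ simple-count {n′} k ⟩
       (k !ℚ) * N₀ ∎)
       where
       open ℚ.≤-Reasoning
       ι4 : ι 4 ≡ (1ℚ + 1ℚ) * (1ℚ + 1ℚ)
       ι4 = trans (ι-* 2 2) (cong₂ _*_ ι2 ι2)
         where
         ι2 : ι 2 ≡ 1ℚ + 1ℚ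
         ι2 = trans (ι-suc 1) (cong (1ℚ +_) ι-1)
       lem₁ : ∀ f K V → f * (K * V + K * V) ≡ ½ * ((1ℚ + 1ℚ) * (1ℚ + 1ℚ) * K * f) * V
       lem₁ = solve-∀ ringℚ

     0<N₀ : 0ℚ < N₀
     0<N₀ = ℚ.≰⇒> (λ le → ℚ.<-irrefl refl (ℚ.<-≤-trans (*-pos (^-pos k (ι-pos n′)) 0<simple)
       (ℚ.≤-trans (ℚ.≤-reflexive (simple-count {n′} k)) (ℚ.≤-trans (*-monoˡ (k !ℚ) (ℚ.<⇒≤ (!ℚ-pos k)) le) (ℚ.≤-reflexive (ℚ.*-zeroʳ (k !ℚ)))))))

     private
       s I₁ : ℚ
       s = density signed
       I₁ = proj₁ edges

       s≡ : (1ℚ + 1ℚ) * (s * N₀) ≡ N₀ + I₁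
       s≡ = trans (cong ((1ℚ + 1ℚ) *_) (density-count {n′} k 0<simple signed)) (proj₂ (proj₂ edges))

       ∣I₁∣ : ∣ I₁ ∣ ≤ ι B
       ∣I₁∣ = proj₁ (proj₂ edges)

     quarter≤s : ½ * ½ ≤ s
     quarter≤s = *-cancelˡ N₀ 0<N₀ (≤-by {N₀ * (½ * ½)} (½ * ½ * (N₀ - (ι B + ι B)) + ½ * (ι B - ∣ I₁ ∣) + ½ * (∣ I₁ ∣ - - I₁))
       (+-nonneg (+-nonneg (*-nonneg (ℚ.nonNegative⁻¹ (½ * ½)) (0≤q-p 2B≤N₀)) (*-nonneg (ℚ.nonNegative⁻¹ ½) (0≤q-p ∣I₁∣))) (*-nonneg (ℚ.nonNegative⁻¹ ½) (0≤q-p (-p≤∣p∣ I₁))))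
       (trans (lem₁ N₀ s) (trans (cong (½ *_) s≡) (lem₂ N₀ (ι B) I₁ ∣ I₁ ∣))))
       where
       lem₁ : ∀ N s → N * s ≡ ½ * ((1ℚ + 1ℚ) * (s * N))
       lem₁ = solve-∀ ringℚ
       lem₂ : ∀ N B I A → ½ * (N + I) ≡ N * (½ * ½) + (½ * ½ * (N - (B + B)) + ½ * (B - A) + ½ * (A - - I))
       lem₂ = solve-∀ ringℚ

     s≤three-quarters : s ≤ 1ℚ - ½ * ½
     s≤three-quarters = *-cancelˡ N₀ 0<N₀ (≤-by {N₀ * s} (½ * ½ * (N₀ - (ι B + ι B)) + ½ * (ι B - ∣ I₁ ∣) + ½ * (∣ I₁ ∣ - I₁))
       (+-nonneg (+-nonneg (*-nonneg (ℚ.nonNegative⁻¹ (½ * ½)) (0≤q-p 2B≤N₀)) (*-nonneg (ℚ.nonNegative⁻¹ ½) (0≤q-p ∣I₁∣))) (*-nonneg (ℚ.nonNegative⁻¹ ½) (0≤q-p (p≤∣p∣ I₁))))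
       (sym (trans (cong (_+ rest) (trans (lem₁ N₀ s) (cong (½ *_) s≡))) (lem₂ N₀ (ι B) I₁ ∣ I₁ ∣))))
       where
       rest = ½ * ½ * (N₀ - (ι B + ι B)) + ½ * (ι B - ∣ I₁ ∣) + ½ * (∣ I₁ ∣ - I₁)
       lem₁ : ∀ N s → N * s ≡ ½ * ((1ℚ + 1ℚ) * (s * N))
       lem₁ = solve-∀ ringℚ
       lem₂ : ∀ N B I A → ½ * (N + I) + (½ * ½ * (N - (B + B)) + ½ * (B - A) + ½ * (A - I)) ≡ N * (1ℚ - ½ * ½)
       lem₂ = solve-∀ ringℚ

     module _ (κ : Fin n → Fin q) (0≤p : 0ℚ ≤ density (coloured κ)) (p≤1 : density (coloured κ) ≤ 1ℚ) where

       private
         p : ℚ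
         p = density (coloured κ)

       -- Twice the number of common edges is p N₀ + I, and twice the number of edges of `signed` is
       -- N₀ + I₁; the main terms cancel, and twice the deviation is I - p I₁.
       deviation-≤ : ∀ G H → G ≅ coloured κ → H ≅ signed → ∣ ι (commonEdges G H) - p * s * N₀ ∣ ≤ ι B
       deviation-≤ G H isoG isoH = begin
         ∣ c - p * s * N₀ ∣
           ≡⟨ cong ∣_∣ (trans (lem₁ c p s N₀) (trans (cong₂ (λ x y → ½ * (x - p * y)) (trans (proj₂ (proj₂ copy)) (cong (_+ I) (sym (density-count {n′} k 0<simple (coloured κ))))) s≡) (lem₂ p N₀ I I₁))) ⟩
         ∣ ½ * (I - p * I₁) ∣
           ≡⟨ ℚ.∣p*q∣≡∣p∣*∣q∣ ½ (I - p * I₁) ⟩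
         ½ * ∣ I - p * I₁ ∣
           ≤⟨ *-monoˡ ½ (ℚ.nonNegative⁻¹ ½) (ℚ.≤-trans (ℚ.∣p-q∣≤∣p∣+∣q∣ I (p * I₁)) (ℚ.+-mono-≤ (proj₁ (proj₂ copy))
                (ℚ.≤-trans (ℚ.≤-reflexive (trans (ℚ.∣p*q∣≡∣p∣*∣q∣ p I₁) (cong (_* ∣ I₁ ∣) (ℚ.0≤p⇒∣p∣≡p 0≤p)))) (*-mono (ℚ.0≤∣p∣ I₁) 0≤1 p≤1 ∣I₁∣)))) ⟩
         ½ * (ι B + 1ℚ * ι B)
           ≡⟨ lem₃ (ι B) ⟩
         ι B ∎
         where
         open ℚ.≤-Reasoning
         copy = copies κ G H isoG isoH
         c = ι (commonEdges G H)
         I = proj₁ copy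
         lem₁ : ∀ c p s N → c - p * s * N ≡ ½ * ((1ℚ + 1ℚ) * c - p * ((1ℚ + 1ℚ) * (s * N)))
         lem₁ = solve-∀ ringℚ
         lem₂ : ∀ p N I J → ½ * (p * N + I - p * (N + J)) ≡ ½ * (I - p * J)
         lem₂ = solve-∀ ringℚ
         lem₃ : ∀ b → ½ * (b + 1ℚ * b) ≡ b
         lem₃ = solve-∀ ringℚ

       disc-≤ : ∀ d → IsDisc (coloured κ) signed d → 0ℚ ≤ d × d ≤ ι B
       disc-≤ d ((G , H , isoG , isoH , eq) , _) = subst (λ z → 0ℚ ≤ z × z ≤ ι B) (sym eq) (ℚ.0≤∣p∣ X , bound)
         where
         X : ℚ
         X = ℕ→ℚ (commonEdges G H) - p * s * ℕ→ℚ (n C k)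
         X≡ : ι (commonEdges G H) - p * s * N₀ ≡ X
         X≡ = cong₂ (λ x y → x - p * s * y) (ι≡ (commonEdges G H)) (ι≡ (n C k))
         bound : ∣ X ∣ ≤ ι B
         bound = subst (λ z → ∣ z ∣ ≤ ι B) X≡ (deviation-≤ G H isoG isoH)

       disc-≤′ : ∀ d → IsDisc signed (coloured κ) d → 0ℚ ≤ d × d ≤ ι B
       disc-≤′ d ((H , G , isoH , isoG , eq) , _) = subst (λ z → 0ℚ ≤ z × z ≤ ι B) (sym eq) (ℚ.0≤∣p∣ X , bound)
         where
         X : ℚ
         X = ℕ→ℚ (commonEdges H G) - s * p * ℕ→ℚ (n C k)
         X≡ : ι (commonEdges G H) - p * s * N₀ ≡ X
         X≡ = trans (cong₂ (λ x y → x - y * N₀) (commonEdges-comm G H) (ℚ.*-comm p s)) (cong₂ (λ x y → x - s * p * y) (ι≡ (commonEdges H G)) (ι≡ (n C k)))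
         bound : ∣ X ∣ ≤ ι B
         bound = subst (λ z → ∣ z ∣ ≤ ι B) X≡ (deviation-≤ G H isoG isoH)

       -- As n ≥ v², the claimed discrepancy would be at least c v · v^k, whereas it is at most K
       -- v^k; the extra factor v wins once c v > K.
       not-discrepant : ∀ c d → 0ℚ ≤ d → d ≤ ι B → 0ℚ < c → ι K < c * ι v → ¬ (c * c * ι n ^ suc k ≤ d * d)
       not-discrepant c d 0≤d d≤B 0<c K<cv h = ℚ.<-irrefl refl (ℚ.<-≤-trans gap (≤-by {y * y - x * x} (x * x - y * y) (0≤q-p le) (lem x y)))
         where
         x y : ℚ
         x = ι K * V
         y = c * ι v * V
         lem : ∀ x y → 0ℚ ≡ y * y - x * x + (x * x - y * y)
         lem = solve-∀ ringℚ
         0<V : 0ℚ < V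
         0<V = ^-pos k (ι-pos v′)
         lem₂ : ∀ K c v V → (c * v - K) * V * ((c * v - K) * V + K * V + K * V) ≡ c * v * V * (c * v * V) - K * V * (K * V)
         lem₂ = solve-∀ ringℚ
         gap : 0ℚ < y * y - x * x
         gap = subst (0ℚ <_) (lem₂ (ι K) c (ι v) V) (*-pos pos (ℚ.<-≤-trans pos (≤-by {(c * ι v - ι K) * V} (x + x) (+-nonneg 0≤x 0≤x) (ℚ.+-assoc ((c * ι v - ι K) * V) x x))))
           where
           pos : 0ℚ < (c * ι v - ι K) * V
           pos = *-pos (0<q-p K<cv) 0<V
           0≤x : 0ℚ ≤ x
           0≤x = *-nonneg (ι-nonneg K) 0≤V
         lem₃ : ∀ c v V → c * v * V * (c * v * V) ≡ c * c * (v * V * (v * V))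
         lem₃ = solve-∀ ringℚ
         le : y * y ≤ x * x
         le = begin
           y * y                             ≡⟨ trans (lem₃ c (ι v) V) (cong (c * c *_) (sym (^-distrib-* (ι v) (ι v) (suc k)))) ⟩
           c * c * (ι v * ι v) ^ suc k       ≤⟨ *-monoˡ (c * c) (square-nonneg c) (^-mono (suc k) (*-nonneg (ι-nonneg v) (ι-nonneg v)) v²≤n) ⟩
           c * c * ι n ^ suc k               ≤⟨ h ⟩
           d * d                             ≤⟨ *-mono 0≤d (ℚ.≤-trans 0≤d d≤x) d≤x d≤x ⟩
           x * x                             ∎
           where
           open ℚ.≤-Reasoning
           d≤x : d ≤ x
           d≤x = ℚ.≤-trans d≤B ιB≤

 module _ (em : ExcludedMiddle 0ℓ) (q′ : ℕ) where

   private
     k : ℕ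
     k = 3 ℕ.+ q′
     γ : ℚ
     γ = γ₀ q′
     γ<¼ : γ < ½ * ½
     γ<¼ = ℚ.≤-<-trans (γ₀≤⅛ q′) (subst₂ _<_ (ℚ.+-identityʳ (½ * ½ * ½)) refl (ℚ.+-monoʳ-< (½ * ½ * ½) (ℚ.positive⁻¹ (½ * ½ * ½))))
     γ<½ : γ < ½
     γ<½ = ℚ.<-trans γ<¼ (subst₂ _<_ (ℚ.+-identityʳ (½ * ½)) refl (ℚ.+-monoʳ-< (½ * ½) (ℚ.positive⁻¹ (½ * ½))))

   module At (v′ : ℕ) (few : ι (k ℕ.+ k) * ι (k ℕ.+ k) * inv (suc (Signed.n′ q′ v′)) ≤ ½)
     (large : ι 4 * ι (Signed.K q′ v′) * (k !ℚ) ≤ ι (suc v′)) (c : ℚ) (0<c : 0ℚ < c) (K<cv : ι (Signed.K q′ v′) < c * ι (suc v′)) where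

     open Signed q′ v′ using (n; n′; v; m; K; B; q; signed; B≤)

     private
       few′ : ι k * ι k * inv (suc n′) ≤ ½
       few′ = ℚ.≤-trans (*-monoʳ (inv (suc n′)) (inv-nonneg (suc n′)) (*-mono (ι-nonneg k) (ι-nonneg (k ℕ.+ k)) (ι-mono (ℕ.m≤m+n k k)) (ι-mono (ℕ.m≤m+n k k)))) few
       module Near = Close {q} {n′} {v′} B K signed (Counts.edges q′ v′) (Counts.copies q′ v′) B≤ (ℕ.m≤m*n m 2)
       colouring : Σ[ κ ∈ (Fin (suc n′) → Fin q) ] γ < density (coloured κ) × density (coloured κ) < 1ℚ - γ
       colouring = balancedColouring q′ em n′ few
       κ : Fin (suc n′) → Fin q
       κ = proj₁ colouring
       p : ℚ
       p = density (coloured κ)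
       γ<p : γ < p
       γ<p = proj₁ (proj₂ colouring)
       p<1-γ : p < 1ℚ - γ
       p<1-γ = proj₂ (proj₂ colouring)
       0≤p : 0ℚ ≤ p
       0≤p = ℚ.<⇒≤ (ℚ.<-trans (γ₀-pos q′) γ<p)
       p≤1 : p ≤ 1ℚ
       p≤1 = ℚ.≤-trans (ℚ.<⇒≤ p<1-γ) (≤-by {1ℚ - γ} γ (ℚ.<⇒≤ (γ₀-pos q′)) (lem γ))
         where
         lem : ∀ γ → 1ℚ ≡ 1ℚ - γ + γ
         lem = solve-∀ ringℚ

     family : Fin 2 → Hypergraph (suc n′) k
     family zero    = coloured κ
     family (suc _) = signed

     inRange : ∀ i → γ < density (family i) × density (family i) < 1ℚ - γ
     inRange zero    = γ<p , p<1-γ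
     inRange (suc _) = ℚ.<-≤-trans γ<¼ (Near.quarter≤s few′ large) , ℚ.≤-<-trans (Near.s≤three-quarters few′ large) (ℚ.+-monoʳ-< 1ℚ (ℚ.neg-antimono-< γ<¼))

     private
       small-disc : ∀ d → 0ℚ ≤ d × d ≤ ι B → ¬ (c * c * ℕ→ℚ (suc n′ ℕ.^ (k ℕ.+ 1)) ≤ d * d)
       small-disc d (0≤d , d≤B) h = Near.not-discrepant few′ large κ 0≤p p≤1 c d 0≤d d≤B 0<c K<cv
         (subst (λ z → c * c * z ≤ d * d) (trans (sym (ι≡ (suc n′ ℕ.^ (k ℕ.+ 1)))) (trans (cong (λ l → ι (suc n′ ℕ.^ l)) (ℕ.+-comm k 1)) (ι-^ (suc n′) (suc k)))) h)

     not-discrepant-pair : ¬ (∃[ i ] ∃[ j ] i ≢ j × ∃[ d ] IsDisc (family i) (family j) d × c * c * ℕ→ℚ (suc n′ ℕ.^ (k ℕ.+ 1)) ≤ d * d)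
     not-discrepant-pair (zero     , zero     , ne , d , isDisc , h) = ne refl
     not-discrepant-pair (zero     , suc zero , ne , d , isDisc , h) = small-disc d (Near.disc-≤ few′ large κ 0≤p p≤1 d isDisc) h
     not-discrepant-pair (suc zero , zero     , ne , d , isDisc , h) = small-disc d (Near.disc-≤′ few′ large κ 0≤p p≤1 d isDisc) h
     not-discrepant-pair (suc zero , suc zero , ne , d , isDisc , h) = ne refl

   noDiscrepantPair : ¬ HasDiscrepantPair k 2
   noDiscrepantPair holds = refute (n₀ ℕ.+ (n₁ ℕ.+ (f ℕ.+ K ℕ.* suc y)))
       (ℕ.m≤m+n n₀ (n₁ ℕ.+ (f ℕ.+ K ℕ.* suc y)))
       (ℕ.≤-trans (ℕ.m≤m+n n₁ (f ℕ.+ K ℕ.* suc y)) (ℕ.m≤n+m (n₁ ℕ.+ (f ℕ.+ K ℕ.* suc y)) n₀))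
       (ℕ.≤-trans (ℕ.m≤m+n f (K ℕ.* suc y)) (ℕ.≤-trans (ℕ.m≤n+m (f ℕ.+ K ℕ.* suc y) n₁) (ℕ.m≤n+m (n₁ ℕ.+ (f ℕ.+ K ℕ.* suc y)) n₀)))
       (ℕ.≤-trans (ℕ.m≤n+m (K ℕ.* suc y) f) (ℕ.≤-trans (ℕ.m≤n+m (f ℕ.+ K ℕ.* suc y) n₁) (ℕ.m≤n+m (n₁ ℕ.+ (f ℕ.+ K ℕ.* suc y)) n₀)))
     where
     claim = holds γ (γ₀-pos q′) γ<½
     c : ℚ
     c = proj₁ claim
     0<c : 0ℚ < c
     0<c = proj₁ (proj₂ claim)
     n₀ : ℕ
     n₀ = proj₁ (proj₂ (proj₂ claim))
     pair = proj₂ (proj₂ (proj₂ claim))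
     K n₁ f y : ℕ
     -- This constant does not depend on `v′`, so it may be read off at 0 before `v′` is chosen.
     K  = Signed.K q′ 0
     n₁ = proj₁ (small-inv (ι (k ℕ.+ k) * ι (k ℕ.+ k)) ½ (ℚ.positive⁻¹ ½))
     f  = proj₁ (archimedean (ι 4 * ι K * (k !ℚ)))
     y  = proj₁ (archimedean-inv 0<c)
     refute : ∀ v′ → n₀ ℕ.≤ v′ → n₁ ℕ.≤ v′ → f ℕ.≤ v′ → K ℕ.* suc y ℕ.≤ v′ → ⊥
     refute v′ n₀≤ n₁≤ f≤ Ky≤ = Refuted.not-discrepant-pair (pair (suc (Signed.n′ q′ v′)) (ℕ.≤-trans n₀≤ v′≤n) Refuted.family Refuted.inRange)
       where
       v : ℕ
       v = suc v′
       v′≤n : v′ ℕ.≤ v ℕ.* v ℕ.* 2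
       v′≤n = ℕ.≤-trans (ℕ.n≤1+n v′) (ℕ.≤-trans (ℕ.m≤m*n v v) (ℕ.m≤m*n (v ℕ.* v) 2))
       big : 1ℚ + ι (K ℕ.* suc y) ≤ ι v
       big = ℚ.≤-trans (ℚ.≤-reflexive (sym (ι-suc (K ℕ.* suc y)))) (ι-mono (s≤s Ky≤))
       lem : ∀ i z K → i * (1ℚ + K * z) ≡ i + K * (z * i)
       lem = solve-∀ ringℚ
       K<cv : ι K < c * ι v
       K<cv = ℚ.<-≤-trans (subst₂ _<_ (ℚ.+-identityˡ (ι K)) eq (ℚ.+-monoˡ-< (ι K) (inv-pos y)))
         (ℚ.≤-trans (*-monoˡ (inv (suc y)) (inv-nonneg (suc y)) big) (*-monoʳ (ι v) (ι-nonneg v) (proj₂ (archimedean-inv 0<c))))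
         where
         eq : inv (suc y) + ι K ≡ inv (suc y) * (1ℚ + ι (K ℕ.* suc y))
         eq = sym (trans (cong (λ z → inv (suc y) * (1ℚ + z)) (ι-* K (suc y))) (trans (lem (inv (suc y)) (ι (suc y)) (ι K))
           (cong (inv (suc y) +_) (trans (cong (ι K *_) (ι*inv y)) (ℚ.*-identityʳ (ι K))))))
       module Refuted = At v′ (proj₂ (small-inv (ι (k ℕ.+ k) * ι (k ℕ.+ k)) ½ (ℚ.positive⁻¹ ½)) (Signed.n′ q′ v′) (ℕ.≤-trans n₁≤ v′≤n))
         (ℚ.≤-trans (proj₂ (archimedean (ι 4 * ι K * (k !ℚ)))) (ι-mono (ℕ.m≤n⇒m≤1+n f≤))) c 0<c K<cv

-- Existence of bs(k) and g(k), and both inequalities.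

module Main where

 open import Defs using (IsLeast; IsBs; IsG; HasDiscrepantPair; OnlyConstantSolutions)
 open Counterexample using (noDiscrepantPair)
 open Types using (onlyConstant-pred)
 open Upper using (upper)
 open import Data.Nat using (_+_; _≤_; _<_; _⊓_)
 open import Data.Nat.Induction using (<-rec)

 module _ (em : ExcludedMiddle 0ℓ) where

   least : (P : ℕ → Set) → ∀ n → P n → ∃[ m ] IsLeast P m
   least P = <-rec (λ n → P n → ∃[ m ] IsLeast P m) step
     where
     step : ∀ n → (∀ {m} → m < n → P m → ∃[ m ] IsLeast P m) → P n → ∃[ m ] IsLeast P m
     step n below p with em {∃[ m ] (m < n × P m)}
     ... | yes (m , m<n , pm) = below m<n pm
     ... | no none = n , p , λ m pm → ℕ.≮⇒≥ (λ m<n → none (m , m<n , pm))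

   bounds : ∀ (k : ℕ) → 2 ≤ k → ∃[ b ] ∃[ g ] IsBs k b × IsG k g × k ⊓ 3 ≤ b × b ≤ g + 2
   bounds (suc k′) 2≤k = b , g , isBs , isG , lower k′ b isBs , proj₂ isBs (g + 2) (ℕ.m≤n+m 2 g , pair)
     where
     leastG = least (OnlyConstantSolutions (suc k′)) k′ (onlyConstant-pred k′)
     g = proj₁ leastG
     isG = proj₂ leastG
     pair : HasDiscrepantPair (suc k′) (g + 2)
     -- Minimality of g against the witness `k′` gives g ≤ k - 1.
     pair = upper em (proj₁ isG) (proj₂ isG k′ (onlyConstant-pred k′))
     leastB = least (λ m → 2 ≤ m × HasDiscrepantPair (suc k′) m) (g + 2) (ℕ.m≤n+m 2 g , pair)
     b = proj₁ leastB
     isBs : IsBs (suc k′) b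
     isBs = proj₂ leastB
     lower : ∀ k′ b → IsBs (suc k′) b → suc k′ ⊓ 3 ≤ b
     lower zero           b ((2≤b , _) , _) = ℕ.≤-trans (ℕ.n≤1+n 1) 2≤b
     lower (suc zero)     b ((2≤b , _) , _) = 2≤b
     -- b ≥ 2 holds by definition, and the counterexample rules out b = 2.
     lower (suc (suc q′)) b ((2≤b , p) , _) = ℕ.≤-trans (ℕ.≤-reflexive (cong (λ z → suc (suc (suc z))) (ℕ.⊓-zeroʳ q′)))
       (ℕ.≤∧≢⇒< 2≤b (λ e → noDiscrepantPair em q′ (subst (HasDiscrepantPair (3 + q′)) (sym e) p)))

open import Defs
open import Axiom.ExcludedMiddle using (ExcludedMiddle)
open import Data.Nat using (ℕ; _+_; _≤_; _⊓_)
open import Data.Product using (∃-syntax; _×_)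
open import Level using (0ℓ)

theorem1p2 : ExcludedMiddle 0ℓ →
    ∀ (k : ℕ) → 2 ≤ k →
    ∃[ b ] ∃[ g ] IsBs k b × IsG k g × k ⊓ 3 ≤ b × b ≤ g + 2
theorem1p2 = Main.bounds
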